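{- Let $r\ge 1$ be an integer and let $G$ be a graph with $n$ vertices and at most $r$ cycles. (I) If $n\ge 3r-1$, then $$m(G)\le g(n,r),$$ with equality if and only if $G\cong G(n,r)$. (II) If $n\ge 3r$ and $G$ is connected, then $$m(G)\le c(n,r),$$ with equality if and only if $G\cong C(n,r)$ or one of the following exceptional cases holds: - $(n,r)=(4,1)$ and $G\cong P_4$; - $(n,r)=(5,1)$ and $G\cong C_5$; - $(n,r)=(7,2)$ and $G\cong C(7,1)$ or $G\cong E$.
   Context: All graphs are finite and simple. For a graph $G=(V,E)$, a set $I\subseteq V$ is independent if no edge of $G$ joins two vertices of $I$; it is maximal if it is not properly contained in another independent set. $m(G)$ denotes the number of maximal independent sets of $G$. The number of cycles of a graph is the number of its subgraphs that are cycles. $K_m$, $P_m$, $C_m$ denote the complete graph, path and cycle on $m$ vertices. $G\uplus H$ denotes the disjoint union of graphs, and $tG$ the disjoint union of $t\ge 0$ copies of $G$. For positive integers $n,r$ with $n\ge 3r-1$ define $$G(n,r)=\begin{cases} rK_3\uplus\frac{n-3r}{2}K_2 & \text{if } n\equiv r \pmod 2,\\ (r-1)K_3\uplus\frac{n-3r+3}{2}K_2 & \text{if } n\not\equiv r\pmod 2,\end{cases}$$ and $$g(n,r)=m(G(n,r))=\begin{cases} 3^r\cdot 2^{\frac{n-3r}{2}} & \text{if } n\equiv r\pmod 2,\\ 3^{r-1}\cdot 2^{\frac{n-3r+3}{2}} & \text{if } n\not\equiv r\pmod 2.\end{cases}$$ If $G$ is a graph all of whose components are complete and $K_m$ is a complete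 graph disjoint from $G$, then $K_m * G$ denotes the graph obtained from $K_m\uplus G$ by picking a vertex $v_0$ of $K_m$ and connecting it by an edge to a single vertex in each component of $G$ (well defined up to isomorphism). For positive integers $n,r$ with $n\ge 3r$ define $$C(n,r)=\begin{cases} K_3 * \left((r-1)K_3\uplus\frac{n-3r}{2}K_2\right) & \text{if } n\equiv r\pmod 2,\\ K_1 * \left(rK_3\uplus\frac{n-3r-1}{2}K_2\right) & \text{if } n\not\equiv r\pmod 2,\end{cases}$$ and $$c(n,r)=m(C(n,r))=\begin{cases} 3^{r-1}\cdot 2^{\frac{n-3r+2}{2}}+2^{r-1} & \text{if } n\equiv r\pmod 2,\\ 3^r\cdot 2^{\frac{n-3r-1}{2}} & \text{if } n\not\equiv r\pmod 2.\end{cases}$$ In particular $C(7,1)=K_3*(2K_2)$. $E$ is the graph on $7$ vertices $c,a_1,a_2,b_1,b_2,p,q$ with edges $ca_1,\,ca_2,\,a_1a_2,\,cb_1,\,cb_2,\,b_1b_2,\,cp,\,pq$ (two triangles sharing the vertex $c$, together with a path of length $2$ attached at $c$). -}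

module Defs where

open import Data.Empty using (⊥)
open import Data.Fin using (Fin; zero; suc; toℕ; fromℕ<)
open import Data.Fin.Patterns
open import Data.Fin.Properties as Fin using (any?; all?; toℕ<n; toℕ-fromℕ<; injective⇒≤)
open import Data.Fin.Subset using (Subset; inside; outside; _∈_; _⊂_)
open import Data.Fin.Subset.Properties using (_∈?_; _⊂?_; anySubset?)
open import Data.List using (List; []; _∷_; [_]; length; filter; cartesianProductWith)
import Data.List.Membership.DecPropositional as DecMembership
open import Data.Nat using (ℕ; zero; suc; _+_; _*_; _∸_; _^_; _≤_; _<_; _≤?_; s≤s)
open import Data.Nat.DivMod using (_/_; _%_)
open import Data.Nat.Properties as ℕ using (_≟_)
open import Data.Product using (Σ; ∃; _×_; _,_; proj₁; proj₂)
open import Data.Product.Properties using (≡-dec)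
open import Data.Sum using (_⊎_; inj₁; inj₂; swap)
open import Data.Unit using (⊤; tt)
open import Data.Vec using (Vec; []; _∷_; lookup; tabulate)
open import Data.Vec.Properties using (lookup∘tabulate)
open import Data.Vec.Properties.WithK using ([]=-irrelevant)
open import Function using (_∘_; _↔_; _⇔_; mk⇔; mk↔ₛ′; Inverse; Equivalence)
open import Function.Definitions using (Injective)
open import Level using (0ℓ)
open import Relation.Binary using (Rel; Decidable; DecidableEquality; Symmetric; Irreflexive)
open import Relation.Binary.Construct.Closure.ReflexiveTransitive using (Star)
open import Relation.Binary.PropositionalEquality
  using (_≡_; _≢_; refl; sym; trans; cong; subst; subst₂)
open import Relation.Nullary using (¬_; Dec; yes; no; ¬?; contradiction)
open import Relation.Nullary.Decidable using (map′; _×-dec_; _⊎-dec_; _→-dec_)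
import Relation.Unary as U

infix  4 _≅_
infixr 5 _⊎ᴳ_
infixr 6 _∙_

record Graph (V : Set) : Set₁ where
  infix 4 _~_ _~?_
  field
    _~_      : Rel V 0ℓ
    ~-sym    : Symmetric _~_
    ~-irrefl : Irreflexive _≡_ _~_
    _~?_     : Decidable _~_

_≅_ : {V W : Set} → Graph V → Graph W → Set
_≅_ {V} {W} G H =
  Σ (V ↔ W) λ φ → ∀ u v → (u G.~ v) ⇔ (Inverse.to φ u H.~ Inverse.to φ v)
  where module G = Graph G
        module H = Graph H

Connected : {V : Set} → Graph V → Set
Connected G = ∀ u v → Star (Graph._~_ G) u v

-- All vectors of length k with entries from xs; duplicate-free if xs is.
vecs : {A : Set} → List A → (k : ℕ) → List (Vec A k)
vecs xs zero    = [ [] ]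
vecs xs (suc k) = cartesianProductWith _∷_ xs (vecs xs k)

subsets : (n : ℕ) → List (Subset n)
subsets = vecs (inside ∷ outside ∷ [])

module _ {n : ℕ} (G : Graph (Fin n)) where
  open Graph G

  Independent : Subset n → Set
  Independent I = ∀ u v → u ∈ I → v ∈ I → ¬ (u ~ v)

  independent? : U.Decidable Independent
  independent? I = all? λ u → all? λ v →
    (u ∈? I) →-dec ((v ∈? I) →-dec ¬? (u ~? v))

  MaximalIndependent : Subset n → Set
  MaximalIndependent I =
    Independent I × ¬ (∃ λ J → I ⊂ J × Independent J)

  maximalIndependent? : U.Decidable MaximalIndependent
  maximalIndependent? I = independent? I
    ×-dec ¬? (anySubset? λ J → (I ⊂? J) ×-dec independent? J)

  m : ℕ
  m = length (filter maximalIndependent? (subsets n))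

-- The simple graph underlying a relation: symmetrised, loops discarded.
simple : {V : Set} {R : Rel V 0ℓ} →
         DecidableEquality V → Decidable R → Graph V
simple {R = R} _≟ⱽ_ R? = record
  { _~_      = λ u v → u ≢ v × (R u v ⊎ R v u)
  ; ~-sym    = λ (u≢v , e) → u≢v ∘ sym , swap e
  ; ~-irrefl = λ u≡v (u≢v , _) → u≢v u≡v
  ; _~?_     = λ u v → ¬? (u ≟ⱽ v) ×-dec (R? u v ⊎-dec R? v u)
  }

K : (k : ℕ) → Graph (Fin k)
K k = simple {R = λ _ _ → ⊤} Fin._≟_ (λ _ _ → yes tt)

P : (k : ℕ) → Graph (Fin k)
P k = simple Fin._≟_ λ i j → suc (toℕ i) ≟ toℕ j

-- The cycle on k vertices when 3 ≤ k, the only range in which it is used.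
C : (k : ℕ) → Graph (Fin k)
C k = simple Fin._≟_ λ i j →
  (suc (toℕ i) ≟ toℕ j) ⊎-dec ((suc (toℕ i) ≟ k) ×-dec (toℕ j ≟ 0))

_⊎ᴳ_ : {V W : Set} → Graph V → Graph W → Graph (V ⊎ W)
_⊎ᴳ_ {V} {W} G H = record
  { _~_      = _~_
  ; ~-sym    = λ {x} {y} → ~-sym {x} {y}
  ; ~-irrefl = λ {x} {y} → ~-irrefl {x} {y}
  ; _~?_     = _~?_
  }
  where
  module G = Graph G
  module H = Graph H

  _~_ : Rel (V ⊎ W) 0ℓ
  inj₁ u ~ inj₁ v = u G.~ v
  inj₂ u ~ inj₂ v = u H.~ v
  inj₁ _ ~ inj₂ _ = ⊥
  inj₂ _ ~ inj₁ _ = ⊥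

  ~-sym : Symmetric _~_
  ~-sym {inj₁ _} {inj₁ _} = G.~-sym
  ~-sym {inj₂ _} {inj₂ _} = H.~-sym

  ~-irrefl : Irreflexive _≡_ _~_
  ~-irrefl {inj₁ _} refl = G.~-irrefl refl
  ~-irrefl {inj₂ _} refl = H.~-irrefl refl

  _~?_ : Decidable _~_
  inj₁ u ~? inj₁ v = u G.~? v
  inj₂ u ~? inj₂ v = u H.~? v
  inj₁ _ ~? inj₂ _ = no λ ()
  inj₂ _ ~? inj₁ _ = no λ ()

_∙_ : {V : Set} (t : ℕ) → Graph V → Graph (Fin t × V)
t ∙ G = record
  { _~_      = λ (i , u) (j , v) → i ≡ j × u ~ v
  ; ~-sym    = λ (i≡j , e) → sym i≡j , ~-sym e
  ; ~-irrefl = λ u≡v (_ , e) → ~-irrefl (cong proj₂ u≡v) e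
  ; _~?_     = λ (i , u) (j , v) → (i Fin.≟ j) ×-dec (u ~? v)
  }
  where open Graph G

-- Candidate subgraphs: uv is an edge iff v ∈ lookup edges u.
record RawSubgraph (n : ℕ) : Set where
  constructor raw
  field
    vertices : Subset n
    edges    : Vec (Subset n) n

  Edge : Rel (Fin n) 0ℓ
  Edge u v = v ∈ lookup edges u

  edge? : Decidable Edge
  edge? u v = v ∈? lookup edges u

  Vertex : Set
  Vertex = ∃ λ v → v ∈ vertices

rawSubgraphs : (n : ℕ) → List (RawSubgraph n)
rawSubgraphs n = cartesianProductWith raw (subsets n) (vecs (subsets n) n)

module _ {n : ℕ} (G : Graph (Fin n)) where
  open Graph G
  open RawSubgraph

  IsSubgraph : RawSubgraph n → Set
  IsSubgraph H = ∀ u v → Edge H u v →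
    Edge H v u × (u ∈ vertices H × v ∈ vertices H) × u ~ v

  isSubgraph? : U.Decidable IsSubgraph
  isSubgraph? H = all? λ u → all? λ v → edge? H u v →-dec
    (edge? H v u ×-dec (((u ∈? vertices H) ×-dec (v ∈? vertices H)) ×-dec (u ~? v)))

  toGraph : (H : RawSubgraph n) → IsSubgraph H → Graph (Vertex H)
  toGraph H H⊆G = record
    { _~_      = λ (u , _) (v , _) → Edge H u v
    ; ~-sym    = λ {(u , _)} {(v , _)} e → proj₁ (H⊆G u v e)
    ; ~-irrefl = λ {(u , _)} {(v , _)} u≡v e →
                   ~-irrefl (cong proj₁ u≡v) (proj₂ (proj₂ (H⊆G u v e)))
    ; _~?_     = λ (u , _) (v , _) → edge? H u v
    }

  IsCycle : RawSubgraph n → Set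
  IsCycle H = Σ (IsSubgraph H) λ H⊆G →
    ∃ λ k → 3 ≤ k × toGraph H H⊆G ≅ C k

  -- Decidability of IsCycle: an isomorphism with C k amounts to a vector
  -- listing the vertices in cyclic order, and there are finitely many of those.
  Listing : (H : RawSubgraph n) (k : ℕ) → Vec (Fin n) k → Set
  Listing H k vs =
    (∀ i → lookup vs i ∈ vertices H) ×
    (∀ i j → lookup vs i ≡ lookup vs j → i ≡ j) ×
    (∀ v → v ∈ vertices H → ∃ λ i → lookup vs i ≡ v) ×
    (∀ i j → (Edge H (lookup vs i) (lookup vs j) → Graph._~_ (C k) i j) ×
             (Graph._~_ (C k) i j → Edge H (lookup vs i) (lookup vs j)))

  listing? : ∀ H k → U.Decidable (Listing H k)
  listing? H k vs =
    (all? λ i → lookup vs i ∈? vertices H) ×-dec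
    (all? λ i → all? λ j → (lookup vs i Fin.≟ lookup vs j) →-dec (i Fin.≟ j)) ×-dec
    (all? λ v → (v ∈? vertices H) →-dec any? λ i → lookup vs i Fin.≟ v) ×-dec
    (all? λ i → all? λ j →
      (edge? H _ _ →-dec Graph._~?_ (C k) i j) ×-dec
      (Graph._~?_ (C k) i j →-dec edge? H _ _))

  anyVec? : ∀ k {Q : Vec (Fin n) k → Set} → U.Decidable Q → Dec (∃ Q)
  anyVec? zero    Q? = map′ ([] ,_) (λ { ([] , q) → q }) (Q? [])
  anyVec? (suc k) Q? =
    map′ (λ (v , vs , q) → v ∷ vs , q) (λ { (v ∷ vs , q) → v , vs , q })
         (any? λ v → anyVec? k λ vs → Q? (v ∷ vs))

  vertex-≡ : ∀ (H : RawSubgraph n) {x y : Vertex H} → proj₁ x ≡ proj₁ y → x ≡ y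
  vertex-≡ H {_ , p} {_ , q} refl = cong (_ ,_) ([]=-irrelevant p q)

  listing⇒≅ : ∀ H H⊆G k → ∃ (Listing H k) → toGraph H H⊆G ≅ C k
  listing⇒≅ H H⊆G k (vs , mem , inj , surj , adj) =
    mk↔ₛ′ to from to∘from from∘to , λ (u , p) (v , q) → mk⇔
      (λ e → proj₁ (adj _ _)
        (subst₂ (Edge H) (sym (at u p)) (sym (at v q)) e))
      (λ e → subst₂ (Edge H) (at u p) (at v q) (proj₂ (adj _ _) e))
    where
    to : Vertex H → Fin k
    to (v , p) = proj₁ (surj v p)

    from : Fin k → Vertex H
    from i = lookup vs i , mem i

    at : ∀ v p → lookup vs (to (v , p)) ≡ v
    at v p = proj₂ (surj v p)

    to∘from : ∀ i → to (from i) ≡ i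
    to∘from i = inj _ _ (at _ (mem i))

    from∘to : ∀ x → from (to x) ≡ x
    from∘to (v , p) = vertex-≡ H (at v p)

  ≅⇒listing : ∀ H H⊆G k → toGraph H H⊆G ≅ C k → ∃ (Listing H k)
  ≅⇒listing H H⊆G k (φ , adj) =
    tabulate f , mem , inj , surj , λ i j →
      (λ e → subst₂ (Graph._~_ (C k)) (to∘from i) (to∘from j)
        (Equivalence.to (adj _ _) (subst₂ (Edge H) (at i) (at j) e))) ,
      (λ e → subst₂ (Edge H) (sym (at i)) (sym (at j))
        (Equivalence.from (adj _ _)
          (subst₂ (Graph._~_ (C k)) (sym (to∘from i)) (sym (to∘from j)) e)))
    where
    open Inverse φ using (to; from; strictlyInverseˡ; strictlyInverseʳ)
    f : Fin k → Fin n
    f = proj₁ ∘ from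

    to∘from : ∀ i → to (from i) ≡ i
    to∘from = strictlyInverseˡ

    at : ∀ i → lookup (tabulate f) i ≡ f i
    at = lookup∘tabulate f

    mem : ∀ i → lookup (tabulate f) i ∈ vertices H
    mem i = subst (_∈ vertices H) (sym (at i)) (proj₂ (from i))

    inj : ∀ i j → lookup (tabulate f) i ≡ lookup (tabulate f) j → i ≡ j
    inj i j eq = trans (sym (to∘from i)) (trans
      (cong to (vertex-≡ H (trans (sym (at i)) (trans eq (at j))))) (to∘from j))

    surj : ∀ v → v ∈ vertices H → ∃ λ i → lookup (tabulate f) i ≡ v
    surj v p = to (v , p) , trans (at _) (cong proj₁ (strictlyInverseʳ (v , p)))

  listing-bound : ∀ H k → ∃ (Listing H k) → k < suc n
  listing-bound H k (vs , _ , inj , _) =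
    s≤s (injective⇒≤ {f = lookup vs} λ {i} {j} → inj i j)

  isCycle? : U.Decidable IsCycle
  isCycle? H with isSubgraph? H
  ... | no H⊈G  = no (H⊈G ∘ proj₁)
  ... | yes H⊆G = map′
    (λ (k , 3≤k , l) → H⊆G , toℕ k , 3≤k , listing⇒≅ H H⊆G _ l)
    (λ (H⊆G′ , k , 3≤k , iso) →
      let l    = ≅⇒listing H H⊆G′ k iso
          k<1+n = listing-bound H k l
      in fromℕ< k<1+n ,
         subst (λ k → 3 ≤ k × ∃ (Listing H k)) (sym (toℕ-fromℕ< k<1+n)) (3≤k , l))
    (any? λ (k : Fin (suc n)) → (3 ≤? toℕ k) ×-dec anyVec? _ (listing? H (toℕ k)))

  numCycles : ℕ
  numCycles = length (filter isCycle? (rawSubgraphs n))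

-- K (suc k) * (a ∙ K 3 ⊎ᴳ b ∙ K 2): vertex 0 of K (suc k) is joined to
-- vertex 0 of every copy of K 3 and of K 2.
K[1+_]*⟨_∙K₃⊎_∙K₂⟩ : (k a b : ℕ) →
  Graph (Fin (suc k) ⊎ (Fin a × Fin 3 ⊎ Fin b × Fin 2))
K[1+ k ]*⟨ a ∙K₃⊎ b ∙K₂⟩ = record
  { _~_      = _~_
  ; ~-sym    = λ {x} {y} → ~-sym {x} {y}
  ; ~-irrefl = λ {x} {y} → ~-irrefl {x} {y}
  ; _~?_     = _~?_
  }
  where
  W = Fin a × Fin 3 ⊎ Fin b × Fin 2

  base : Graph (Fin (suc k) ⊎ W)
  base = K (suc k) ⊎ᴳ a ∙ K 3 ⊎ᴳ b ∙ K 2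
  module B = Graph base

  Chosen : W → Set
  Chosen (inj₁ (_ , v)) = v ≡ 0F
  Chosen (inj₂ (_ , v)) = v ≡ 0F

  chosen? : U.Decidable Chosen
  chosen? (inj₁ (_ , v)) = v Fin.≟ 0F
  chosen? (inj₂ (_ , v)) = v Fin.≟ 0F

  _~_ : Rel (Fin (suc k) ⊎ W) 0ℓ
  inj₁ u ~ inj₂ w = u ≡ 0F × Chosen w
  inj₂ w ~ inj₁ u = u ≡ 0F × Chosen w
  inj₁ u ~ inj₁ v = inj₁ u B.~ inj₁ v
  inj₂ u ~ inj₂ v = inj₂ u B.~ inj₂ v

  ~-sym : Symmetric _~_
  ~-sym {inj₁ _} {inj₂ _} e = e
  ~-sym {inj₂ _} {inj₁ _} e = e
  ~-sym {inj₁ u} {inj₁ v} = B.~-sym {inj₁ u} {inj₁ v}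
  ~-sym {inj₂ u} {inj₂ v} = B.~-sym {inj₂ u} {inj₂ v}

  ~-irrefl : Irreflexive _≡_ _~_
  ~-irrefl {inj₁ u} refl = B.~-irrefl {inj₁ u} refl
  ~-irrefl {inj₂ u} refl = B.~-irrefl {inj₂ u} refl

  _~?_ : Decidable _~_
  inj₁ u ~? inj₂ w = (u Fin.≟ 0F) ×-dec chosen? w
  inj₂ w ~? inj₁ u = (u Fin.≟ 0F) ×-dec chosen? w
  inj₁ u ~? inj₁ v = inj₁ u B.~? inj₁ v
  inj₂ u ~? inj₂ v = inj₂ u B.~? inj₂ v

-- For 3 * r ∸ 1 ≤ n (resp. 3 * r ≤ n, for C⟨_,_⟩ and c) and 1 ≤ r, the
-- subtractions below never truncate and the halvings are exact.  Indeed
-- n = 3 * r ∸ 1 has the parity opposite to r, and n = 3 * r that of r.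

G⟨_,_⟩ : (n r : ℕ) → ∃ Graph
G⟨ n , r ⟩ with n % 2 ≟ r % 2
... | yes _ = _ , r ∙ K 3       ⊎ᴳ ((n ∸ 3 * r) / 2) ∙ K 2
... | no  _ = _ , (r ∸ 1) ∙ K 3 ⊎ᴳ ((n + 3 ∸ 3 * r) / 2) ∙ K 2

g : ℕ → ℕ → ℕ
g n r with n % 2 ≟ r % 2
... | yes _ = 3 ^ r       * 2 ^ ((n ∸ 3 * r) / 2)
... | no  _ = 3 ^ (r ∸ 1) * 2 ^ ((n + 3 ∸ 3 * r) / 2)

C⟨_,_⟩ : (n r : ℕ) → ∃ Graph
C⟨ n , r ⟩ with n % 2 ≟ r % 2
... | yes _ = _ , K[1+ 2 ]*⟨ r ∸ 1 ∙K₃⊎ (n ∸ 3 * r) / 2 ∙K₂⟩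
... | no  _ = _ , K[1+ 0 ]*⟨ r ∙K₃⊎ (n ∸ 3 * r ∸ 1) / 2 ∙K₂⟩

c : ℕ → ℕ → ℕ
c n r with n % 2 ≟ r % 2
... | yes _ = 3 ^ (r ∸ 1) * 2 ^ ((n + 2 ∸ 3 * r) / 2) + 2 ^ (r ∸ 1)
... | no  _ = 3 ^ r       * 2 ^ ((n ∸ 3 * r ∸ 1) / 2)

-- Vertices in the order c, a₁, a₂, b₁, b₂, p, q.
E : Graph (Fin 7)
E = simple Fin._≟_ λ u v → (u , v) ∈ᴸ?
  ( (0F , 1F) ∷ (0F , 2F) ∷ (1F , 2F)
  ∷ (0F , 3F) ∷ (0F , 4F) ∷ (3F , 4F)
  ∷ (0F , 5F) ∷ (5F , 6F) ∷ [])
  where open DecMembership (≡-dec (Fin._≟_ {7}) (Fin._≟_ {7})) renaming (_∈?_ to _∈ᴸ?_)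

{-# OPTIONS --safe #-}

-- The proof is an induction over the induced subgraphs S of G.  Branching at a vertex v gives
-- m(S) ≤ m(S - v) + m(S - N[v]), and every pair of neighbours of v that are joined in S - v
-- contributes a cycle through v, so that deleting v also loses cycles.
--
-- (I) Branching at a vertex that does not separate its neighbours shows that a graph is a disjoint
-- union of copies of K₃ and K₂ or falls short of g by a constant factor.
--
-- (II) If a connected S has no non-separating vertex with three neighbours, consider the vertices
-- separated from a fixed non-separating root x by deleting a vertex u, and take a vertex w for which
-- this set is minimal among the vertices that separate more than a pendant path.  All vertices cut
-- off by w have degree at most two, hence what hangs at w are leaves, paths of length two, triangles
-- and longer ears.  In each configuration branching near w beats c, unless S is P₄ or C₅, or all
-- components of S - h are K₃ or K₂ for some vertex h.  In the last case m is computed directly.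
--
-- All bounds are combinations of 3^r 2^h / 4^r and 2^r with finitely many rational coefficients, so
-- that the numerical comparisons are decided by evaluation.

module Submission where

open import Defs
open import Data.Bool using (Bool; true; false; T; _∧_)
open import Data.Empty using (⊥; ⊥-elim)
open import Data.Fin using (Fin; zero; suc; toℕ)
open import Data.Fin.Patterns
open import Data.Fin.Properties as Fin using (any?; all?; toℕ-injective)
open import Data.Fin.Subset using (Subset; _∈_; _∉_; _⊆_; _∪_; _-_; ⁅_⁆; ∣_∣)
  renaming (⊤ to full; ⊥ to ∅)
open import Data.Fin.Subset.Properties
  using (_∈?_; _⊆?_; ⊆-antisym; ∈⊤; ∣⊤∣≡n; ∉⊥; ∣⊥∣≡0; x∈p∪q⁺; x∈p∪q⁻; x∈⁅y⁆⇒x≡y; x∈⁅x⁆;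
         x∈p∧x≢y⇒x∈p-y; p─q⊆p; p⊆q⇒∣p∣≤∣q∣; p─⊥≡p)
open import Data.List using (List; []; _∷_; [_]; _++_; length; reverse; filter; map; allFin)
open import Data.List.Membership.Propositional using (lose) renaming (_∈_ to _∈ₗ_; _∉_ to _∉ₗ_)
open import Data.List.Membership.Propositional.Properties
  using (∈-∃++; ∈-++⁺ˡ; ∈-++⁺ʳ; ∈-++⁻; ∈-filter⁺; ∈-filter⁻; ∈-map⁻; ∈-map⁺; ∈-allFin; ∈-lookup; ∈-cartesianProductWith⁺)
open import Data.List.Properties using (length-map; length-++; length-tabulate; filter-none)
open import Data.List.Relation.Unary.All as All using (All; []; _∷_)
open import Data.List.Relation.Unary.AllPairs using (AllPairs; []; _∷_)
open import Data.List.Relation.Unary.All.Properties using (All¬⇒¬Any; all-filter)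
open import Data.List.Relation.Unary.Any as Any using (Any; here; there)
open import Data.List.Relation.Unary.Any.Properties using (reverse⁺)
open import Data.List.Relation.Unary.Unique.Propositional using (Unique)
import Data.List.Relation.Unary.Unique.Propositional.Properties as Uniqueₚ
open import Data.Nat using (ℕ; zero; suc; _+_; _*_; _∸_; _^_; _≤_; _<_; _≥_; _≤ᵇ_; _<ᵇ_; z≤n; s≤s; >-nonZero)
open import Data.Nat.DivMod using (_/_; _%_; m≡m%n+[m/n]*n; [m+kn]%n≡m%n; m*n/n≡m)
open import Data.Nat.Solver using (module +-*-Solver)
open import Data.Nat.ListAction using (sum)
open import Data.Nat.Properties as ℕ using (≤-trans; ≤-refl; ≤-reflexive; +-mono-≤; module ≤-Reasoning)
open import Data.Product using (∃; ∃₂; _×_; _,_; proj₁; proj₂)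
open import Data.Sum using (_⊎_; inj₁; inj₂; [_,_]′)
open import Data.Unit using (⊤; tt)
open import Data.Vec as Vec using (Vec; []; _∷_; lookup; tabulate)
open import Data.Vec.Properties using (lookup∘tabulate; ∷-injective; []=⇒lookup; lookup⇒[]=)
open import Function using (_∘_; id; case_of_; _⇔_; mk⇔; mk↔ₛ′; Inverse; Equivalence)
open import Relation.Binary.PropositionalEquality
  using (_≡_; _≢_; refl; sym; trans; cong; cong₂; subst; subst₂; module ≡-Reasoning)
open import Relation.Nullary using (¬_; Dec; yes; no; ¬?; does; contradiction)
open import Relation.Nullary.Decidable using (map′; _×-dec_; _⊎-dec_; _→-dec_; decidable-stable; toWitness)
import Relation.Unary as U
import Data.List.Membership.DecPropositional as DecMembership
open import Relation.Binary.Definitions using (tri<; tri≈; tri>)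
open import Relation.Binary.Construct.Closure.ReflexiveTransitive using (Star; ε; _◅_)

-- Counting in lists and subsets

-- Deletions lead to subgraphs with fewer than 3r vertices, where g and c are not defined. `Bound`
-- therefore carries a factor 4^r and measures size through n + r = val p + 2h, so that losing k
-- vertices and s cycles merely shifts parity and exponents. The odd connected bound needs an extra
-- 2^(r-1) there, controlled by a flag; in the odd case the induction hypothesis is used only after
-- deletions that lose at most three vertices per cycle.
--
-- Equality is not followed through the branching. Strict inequality is proved outside a short list
-- of special graphs. The delicate point is the exact identity c(n,r) = c(n-1,r-1) + c(n-3,r-1):
-- branching on a long cycle or ear gains nothing and only passes strictness on, so the smaller
-- graph must be shown not to be special. Elsewhere the gap mostly comes from (I): a rest that is
-- not a union of K₃ and K₂ falls short of g by a factor 8/9 or 11/12, and if it is such a union, a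
-- hub has been found.
--
-- The exceptions at (7,2) reflect 3^2 = 2^3 + 1: three edges at a hub that is fully joined to one
-- of them match two triangles at a hub.

private
  variable
    A B : Set

unique-⊆⇒length≤ : {xs ys : List A} → Unique xs → (∀ {x} → x ∈ₗ xs → x ∈ₗ ys) →
                   length xs ≤ length ys
unique-⊆⇒length≤ [] _ = z≤n
unique-⊆⇒length≤ {xs = x ∷ xs} (x∉ ∷ u) sub with ∈-∃++ (sub (here refl))
... | as , bs , refl = ≤-trans
    (s≤s (unique-⊆⇒length≤ {ys = as ++ bs} u sub′))
    (≤-reflexive (trans (cong suc (length-++ as))
      (trans (sym (ℕ.+-suc (length as) _)) (sym (length-++ as)))))
  where
  sub′ : ∀ {y} → y ∈ₗ xs → y ∈ₗ as ++ bs
  sub′ {y} y∈ with ∈-++⁻ as (sub (there y∈))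
  ... | inj₁ p = ∈-++⁺ˡ p
  ... | inj₂ (here refl) = contradiction refl (All.lookup x∉ y∈)
  ... | inj₂ (there p) = ∈-++⁺ʳ as p

count : {P : A → Set} → U.Decidable P → List A → ℕ
count P? xs = length (filter P? xs)

map-unique : {P : A → Set} (f : A → B) (xs : List A) → Unique xs → All P xs →
             (∀ {x y} → P x → P y → f x ≡ f y → x ≡ y) → Unique (map f xs)
map-unique f [] _ _ _ = []
map-unique {P = P} f (x ∷ xs) (x∉ ∷ u) (px ∷ ps) inj =
  go xs x∉ ps ∷ map-unique f xs u ps inj
  where
  go : ∀ ys → All (x ≢_) ys → All P ys → All (f x ≢_) (map f ys)
  go [] _ _ = []
  go (y ∷ ys) (x≢y ∷ a) (py ∷ b) = (λ e → x≢y (inj px py e)) ∷ go ys a b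

count-injection : {P : A → Set} {Q : B → Set} (P? : U.Decidable P) (Q? : U.Decidable Q)
  (xs : List A) (ys : List B) → Unique xs → (∀ y → y ∈ₗ ys) → (f : A → B) →
  (∀ {x} → P x → Q (f x)) → (∀ {x y} → P x → P y → f x ≡ f y → x ≡ y) →
  count P? xs ≤ count Q? ys
count-injection P? Q? xs ys u all∈ f pq inj = begin
  length (filter P? xs)         ≡⟨ sym (length-map f (filter P? xs)) ⟩
  length (map f (filter P? xs)) ≤⟨ unique-⊆⇒length≤
      (map-unique f _ (Uniqueₚ.filter⁺ P? u) (all-filter P? xs) inj) sub ⟩
  length (filter Q? ys)         ∎
  where
  open ≤-Reasoning
  sub : ∀ {y} → y ∈ₗ map f (filter P? xs) → y ∈ₗ filter Q? ys
  sub y∈ with ∈-map⁻ f y∈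
  ... | x , x∈ , refl = ∈-filter⁺ Q? (all∈ _) (pq (proj₂ (∈-filter⁻ P? {xs = xs} x∈)))

count-cover : {P Q R : A → Set} (P? : U.Decidable P) (Q? : U.Decidable Q) (R? : U.Decidable R)
  (xs : List A) → (∀ {x} → P x → Q x ⊎ R x) → count P? xs ≤ count Q? xs + count R? xs
count-cover P? Q? R? [] f = z≤n
count-cover P? Q? R? (x ∷ xs) f with P? x | Q? x | R? x
... | no _  | no _  | no _  = count-cover P? Q? R? xs f
... | no _  | no _  | yes _ = ≤-trans (count-cover P? Q? R? xs f) (ℕ.+-monoʳ-≤ (count Q? xs) (ℕ.n≤1+n _))
... | no _  | yes _ | no _  = ℕ.m≤n⇒m≤1+n (count-cover P? Q? R? xs f)
... | no _  | yes _ | yes _ = ℕ.m≤n⇒m≤1+n (≤-trans (count-cover P? Q? R? xs f) (ℕ.+-monoʳ-≤ (count Q? xs) (ℕ.n≤1+n _)))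
... | yes _ | yes _ | no _  = s≤s (count-cover P? Q? R? xs f)
... | yes _ | yes _ | yes _ = s≤s (≤-trans (count-cover P? Q? R? xs f) (ℕ.+-monoʳ-≤ (count Q? xs) (ℕ.n≤1+n _)))
... | yes _ | no _  | yes _ = ≤-trans (s≤s (count-cover P? Q? R? xs f)) (≤-reflexive (sym (ℕ.+-suc (count Q? xs) _)))
... | yes p | no ¬q | no ¬r = ⊥-elim ([ ¬q , ¬r ]′ (f p))

count-++ : {P Q R : A → Set} (P? : U.Decidable P) (Q? : U.Decidable Q) (R? : U.Decidable R)
  (xs : List A) → Unique xs → (∀ {x} → Q x → P x) → (∀ {x} → R x → P x) →
  (∀ {x} → Q x → ¬ R x) → count Q? xs + count R? xs ≤ count P? xs
count-++ P? Q? R? xs u qp rp dis = begin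
  count Q? xs + count R? xs                  ≡⟨ sym (length-++ (filter Q? xs)) ⟩
  length (filter Q? xs ++ filter R? xs)      ≤⟨ unique-⊆⇒length≤
    (Uniqueₚ.++⁺ (Uniqueₚ.filter⁺ Q? u) (Uniqueₚ.filter⁺ R? u)
      λ (a , b) → dis (proj₂ (∈-filter⁻ Q? {xs = xs} a)) (proj₂ (∈-filter⁻ R? {xs = xs} b))) sub ⟩
  count P? xs                                ∎
  where
  open ≤-Reasoning
  sub : ∀ {y} → y ∈ₗ filter Q? xs ++ filter R? xs → y ∈ₗ filter P? xs
  sub y∈ with ∈-++⁻ (filter Q? xs) y∈
  ... | inj₁ a = let (p , q) = ∈-filter⁻ Q? {xs = xs} a in ∈-filter⁺ P? p (qp q)
  ... | inj₂ a = let (p , q) = ∈-filter⁻ R? {xs = xs} a in ∈-filter⁺ P? p (rp q)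

-- Turns explicit witnesses into a numerical gain: cycles destroyed by a deletion, or an independent
-- set that ceases to be maximal.
count-extra : {P Q : A → Set} (P? : U.Decidable P) (Q? : U.Decidable Q) (xs ys : List A) →
  Unique xs → Unique ys → (∀ x → x ∈ₗ xs) → (∀ {x} → P x → Q x) →
  All (λ y → Q y × ¬ P y) ys → length ys + count P? xs ≤ count Q? xs
count-extra P? Q? xs ys ux uy all∈ pq ys-ok = begin
  length ys + count P? xs     ≡⟨ sym (length-++ ys) ⟩
  length (ys ++ filter P? xs) ≤⟨ unique-⊆⇒length≤
    (Uniqueₚ.++⁺ uy (Uniqueₚ.filter⁺ P? ux)
      λ (a , b) → proj₂ (All.lookup ys-ok a) (proj₂ (∈-filter⁻ P? {xs = xs} b))) sub ⟩
  count Q? xs                 ∎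
  where
  open ≤-Reasoning
  sub : ∀ {y} → y ∈ₗ ys ++ filter P? xs → y ∈ₗ filter Q? xs
  sub y∈ with ∈-++⁻ ys y∈
  ... | inj₁ a = ∈-filter⁺ Q? (all∈ _) (proj₁ (All.lookup ys-ok a))
  ... | inj₂ a = ∈-filter⁺ Q? (all∈ _) (pq (proj₂ (∈-filter⁻ P? {xs = xs} a)))

vecs-unique : {xs : List A} → Unique xs → ∀ k → Unique (vecs xs k)
vecs-unique u zero    = [] ∷ []
vecs-unique u (suc k) = Uniqueₚ.cartesianProductWith⁺ _∷_ ∷-injective u (vecs-unique u k)

vecs-complete : {xs : List A} → (∀ x → x ∈ₗ xs) → ∀ k v → v ∈ₗ vecs xs k
vecs-complete all∈ zero    []      = here refl
vecs-complete all∈ (suc k) (x ∷ v) = ∈-cartesianProductWith⁺ _∷_ (all∈ x) (vecs-complete all∈ k v)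

subsets-unique : ∀ n → Unique (subsets n)
subsets-unique = vecs-unique (((λ ()) ∷ []) ∷ [] ∷ [])

subsets-complete : ∀ n (I : Subset n) → I ∈ₗ subsets n
subsets-complete = vecs-complete λ { true → here refl ; false → there (here refl) }

rawSubgraphs-unique : ∀ n → Unique (rawSubgraphs n)
rawSubgraphs-unique n = Uniqueₚ.cartesianProductWith⁺ raw (λ { refl → refl , refl })
  (subsets-unique n) (vecs-unique (subsets-unique n) n)

rawSubgraphs-complete : ∀ n (H : RawSubgraph n) → H ∈ₗ rawSubgraphs n
rawSubgraphs-complete n (raw V F) = ∈-cartesianProductWith⁺ raw (subsets-complete n V)
  (vecs-complete (subsets-complete n) n F)

-- Subsets of vertices and their sizes

comprehension : ∀ {n} {P : Fin n → Set} → U.Decidable P → Subset n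
comprehension P? = tabulate λ v → does (P? v)

∈-comprehension⁺ : ∀ {n} {P : Fin n → Set} (P? : U.Decidable P) {v} → P v → v ∈ comprehension P?
∈-comprehension⁺ P? {v} p = lookup⇒[]= v _ (trans (lookup∘tabulate _ v) eq)
  where
  eq : does (P? v) ≡ true
  eq with P? v
  ... | yes _ = refl
  ... | no ¬p = contradiction p ¬p

∈-comprehension⁻ : ∀ {n} {P : Fin n → Set} (P? : U.Decidable P) {v} → v ∈ comprehension P? → P v
∈-comprehension⁻ P? {v} v∈ with P? v | trans (sym (lookup∘tabulate (λ v → does (P? v)) v)) ([]=⇒lookup v∈)
... | yes p | _ = p
... | no _  | ()

∈-remove⁺ : ∀ {n} {S : Subset n} {u v} → u ∈ S → u ≢ v → u ∈ S - v
∈-remove⁺ = x∈p∧x≢y⇒x∈p-y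

∈-remove⁻ : ∀ {n} {S : Subset n} {u v} → u ∈ S - v → u ∈ S
∈-remove⁻ {S = S} {v = v} = p─q⊆p S ⁅ v ⁆

∉-remove : ∀ {n} {S : Subset n} {v} → v ∉ S - v
∉-remove {S = _ ∷ _} {zero}  ()
∉-remove {S = _ ∷ S} {suc v} (Vec.there p) = ∉-remove {S = S} {v} p

remove-≢ : ∀ {n} {S : Subset n} {u v} → u ∈ S - v → u ≢ v
remove-≢ {S = S} u∈ refl = ∉-remove {S = S} u∈

⊆-remove : ∀ {n} {S T : Subset n} {v} → T ⊆ S → v ∉ T → T ⊆ S - v
⊆-remove {T = T} sub v∉ {u} u∈ = ∈-remove⁺ (sub u∈) λ e → v∉ (subst (_∈ T) e u∈)

size-remove : ∀ {n} {S : Subset n} {v} → v ∈ S → suc ∣ S - v ∣ ≡ ∣ S ∣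
size-remove {S = true ∷ S} {zero} _ = cong suc (cong ∣_∣ (p─⊥≡p S))
size-remove {S = true ∷ S}  {suc v} (Vec.there p) = cong suc (size-remove p)
size-remove {S = false ∷ S} {suc v} (Vec.there p) = size-remove p

independent-insert : ∀ {n} (G : Graph (Fin n)) {I v} → Independent G I → (∀ u → u ∈ I → ¬ Graph._~_ G u v) →
                     Independent G (I ∪ ⁅ v ⁆)
independent-insert G {I} {v} ind free a b a∈ b∈ e with x∈p∪q⁻ I ⁅ v ⁆ a∈ | x∈p∪q⁻ I ⁅ v ⁆ b∈
... | inj₁ p | inj₁ q = ind a b p q e
... | inj₁ p | inj₂ q = free a p (subst (Graph._~_ G a) (x∈⁅y⁆⇒x≡y v q) e)
... | inj₂ p | inj₁ q = free b q (subst (Graph._~_ G b) (x∈⁅y⁆⇒x≡y v p) (Graph.~-sym G e))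
... | inj₂ p | inj₂ q = Graph.~-irrefl G (trans (x∈⁅y⁆⇒x≡y v p) (sym (x∈⁅y⁆⇒x≡y v q))) e

insert-⊆ : ∀ {n} {S I : Subset n} {v} → I ⊆ S → v ∈ S → I ∪ ⁅ v ⁆ ⊆ S
insert-⊆ {S = S} {I} {v} I⊆S v∈S x∈ with x∈p∪q⁻ I ⁅ v ⁆ x∈
... | inj₁ p = I⊆S p
... | inj₂ p = subst (_∈ S) (sym (x∈⁅y⁆⇒x≡y v p)) v∈S

v∈I∪⁅v⁆ : ∀ {n} {I : Subset n} {v} → v ∈ I ∪ ⁅ v ⁆
v∈I∪⁅v⁆ {v = v} = x∈p∪q⁺ (inj₂ (x∈⁅x⁆ v))

-- The list names vertices known to be lost, not necessarily all of them; peeling them off one at a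
-- time keeps `T` inside what remains.
size-drop : ∀ {n} {S T : Subset n} (xs : List (Fin n)) → T ⊆ S → Unique xs →
            All (λ x → x ∈ S × x ∉ T) xs → length xs + ∣ T ∣ ≤ ∣ S ∣
size-drop [] sub _ _ = p⊆q⇒∣p∣≤∣q∣ sub
size-drop {S = S} {T} (x ∷ xs) sub (x∉ ∷ u) ((x∈S , x∉T) ∷ a) =
  ≤-trans (s≤s (size-drop xs (⊆-remove sub x∉T) u (go xs x∉ a))) (≤-reflexive (size-remove x∈S))
  where
  go : ∀ ys → All (x ≢_) ys → All (λ y → y ∈ S × y ∉ T) ys → All (λ y → y ∈ S - x × y ∉ T) ys
  go [] _ _ = []
  go (y ∷ ys) (x≢y ∷ b) ((p , q) ∷ c) = (∈-remove⁺ p (x≢y ∘ sym) , q) ∷ go ys b c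

search : ∀ {k} {P Q : Fin k → Set} → (∀ i → P i ⊎ Q i) → ∃ P ⊎ (∀ i → Q i)
search {zero} f = inj₂ λ ()
search {suc k} f with f 0F | search (f ∘ suc)
... | inj₁ p | _ = inj₁ (0F , p)
... | inj₂ _ | inj₁ (i , p) = inj₁ (suc i , p)
... | inj₂ q | inj₂ qs = inj₂ λ { 0F → q ; (suc i) → qs i }

Cells : ℕ → ℕ → Set
Cells a b = Fin a × Fin 3 ⊎ Fin b × Fin 2

cells : ∀ a b → Graph (Cells a b)
cells a b = a ∙ K 3 ⊎ᴳ b ∙ K 2

∈-toList⁻ : ∀ {k} (xs : Vec A k) {x} → x ∈ₗ Vec.toList xs → ∃ λ i → lookup xs i ≡ x
∈-toList⁻ (x ∷ xs) (here eq)  = zero , sym eq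
∈-toList⁻ (x ∷ xs) (there x∈) = let (i , eq) = ∈-toList⁻ xs x∈ in suc i , eq

all-lookup : ∀ {P : A → Set} {k} (xs : Vec A k) → All P (Vec.toList xs) → ∀ i → P (lookup xs i)
all-lookup (x ∷ xs) (p ∷ ps) zero    = p
all-lookup (x ∷ xs) (p ∷ ps) (suc i) = all-lookup xs ps i

-- Rates

data Parity : Set where
  ev od : Parity

val : Parity → ℕ
val ev = 0
val od = 1

-- Two nonnegative rational coefficients over a common denominator, kept as naturals so that
-- comparisons of concrete rates are Boolean tests on literals.
record Rate : Set where
  constructor rate
  field
    lead corr den : ℕ
open Rate public

-- M ≤ (lead · 3^r 2^h / 4^r + corr · 2^r) / den.
-- With n + r = val p + 2 h, the unit 3^r 2^h / 4^r is g(n,r) if p = ev and 3/4 of it if p = od.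
record Bound (x : Rate) (M r h : ℕ) : Set where
  constructor isBound
  field
    unbound : den x * (4 ^ r * M) ≤ lead x * (3 ^ r * 2 ^ h) + corr x * 8 ^ r
open Bound public

record Bound< (x : Rate) (M r h : ℕ) : Set where
  constructor isBound<
  field
    unbound< : den x * (4 ^ r * M) < lead x * (3 ^ r * 2 ^ h) + corr x * 8 ^ r
open Bound< public

-- The rate for r + s and h + t with the same right-hand side as the given one for r and h.
scale : ℕ → ℕ → Rate → Rate
scale s t (rate c e d) = rate (c * 8 ^ s) (e * (3 ^ s * 2 ^ t)) (d * (3 ^ s * 2 ^ t * 2 ^ s))

_⊕_ : Rate → Rate → Rate
rate c e d ⊕ rate c′ e′ d′ = rate (c * d′ + c′ * d) (e * d′ + e′ * d) (d * d′)

infixl 6 _⊕_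

-- The comparison is coefficient by coefficient, which is sufficient but not necessary. Where one
-- coefficient fails, `Bound-trade` or `Bound-trade′` first moves weight from one term to the other.
_≼ᵇ_ _≺ᵇ_ : Rate → Rate → Bool
rate c e d ≼ᵇ rate c′ e′ d′ = (0 <ᵇ d) ∧ (c * d′ ≤ᵇ c′ * d) ∧ (e * d′ ≤ᵇ e′ * d)
x ≺ᵇ y = (x ≼ᵇ y) ∧ (lead x * den y + corr x * den y <ᵇ lead y * den x + corr y * den x)

2^*4^ : ∀ s → 2 ^ s * 4 ^ s ≡ 8 ^ s
2^*4^ zero    = refl
2^*4^ (suc s) = trans (solve 2 (λ a b → (con 2 :* a) :* (con 4 :* b) := con 8 :* (a :* b)) refl (2 ^ s) (4 ^ s))
  (cong (8 *_) (2^*4^ s))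
  where open +-*-Solver

private
  rhs : Rate → ℕ → ℕ → ℕ
  rhs x r h = lead x * (3 ^ r * 2 ^ h) + corr x * 8 ^ r

  factor : ℕ → ℕ → ℕ
  factor s t = 3 ^ s * 2 ^ t * 8 ^ s

  scaleˡ : ∀ d M r s t → d * (3 ^ s * 2 ^ t * 2 ^ s) * (4 ^ (s + r) * M) ≡ factor s t * (d * (4 ^ r * M))
  scaleˡ d M r s t = begin
    d * (3 ^ s * 2 ^ t * 2 ^ s) * (4 ^ (s + r) * M)
      ≡⟨ cong (λ z → d * (3 ^ s * 2 ^ t * 2 ^ s) * (z * M)) (ℕ.^-distribˡ-+-* 4 s r) ⟩
    d * (3 ^ s * 2 ^ t * 2 ^ s) * (4 ^ s * 4 ^ r * M)
      ≡⟨ solve 7 (λ d a b w f g M → d :* (a :* b :* w) :* (f :* g :* M) := a :* b :* (w :* f) :* (d :* (g :* M)))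
           refl d (3 ^ s) (2 ^ t) (2 ^ s) (4 ^ s) (4 ^ r) M ⟩
    3 ^ s * 2 ^ t * (2 ^ s * 4 ^ s) * (d * (4 ^ r * M))
      ≡⟨ cong (λ z → 3 ^ s * 2 ^ t * z * (d * (4 ^ r * M))) (2^*4^ s) ⟩
    factor s t * (d * (4 ^ r * M)) ∎
    where
    open ≡-Reasoning
    open +-*-Solver

  scaleʳ : ∀ x r h s t → factor s t * rhs x r h ≡ rhs (scale s t x) (s + r) (t + h)
  scaleʳ (rate c e d) r h s t = begin
    factor s t * (c * (3 ^ r * 2 ^ h) + e * 8 ^ r)
      ≡⟨ solve 8 (λ c e a b w f g v → a :* b :* w :* (c :* (f :* g) :+ e :* v)
           := c :* w :* (a :* f :* (b :* g)) :+ e :* (a :* b) :* (w :* v))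
           refl c e (3 ^ s) (2 ^ t) (8 ^ s) (3 ^ r) (2 ^ h) (8 ^ r) ⟩
    c * 8 ^ s * (3 ^ s * 3 ^ r * (2 ^ t * 2 ^ h)) + e * (3 ^ s * 2 ^ t) * (8 ^ s * 8 ^ r)
      ≡⟨ sym (cong₂ (λ y z → c * 8 ^ s * y + e * (3 ^ s * 2 ^ t) * z)
           (cong₂ _*_ (ℕ.^-distribˡ-+-* 3 s r) (ℕ.^-distribˡ-+-* 2 t h)) (ℕ.^-distribˡ-+-* 8 s r)) ⟩
    rhs (scale s t (rate c e d)) (s + r) (t + h) ∎
    where
    open ≡-Reasoning
    open +-*-Solver

  +ˡ : ∀ d d′ f M N → d * d′ * (f * (M + N)) ≡ d′ * (d * (f * M)) + d * (d′ * (f * N))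
  +ˡ = solve 5 (λ d d′ f M N → d :* d′ :* (f :* (M :+ N)) := d′ :* (d :* (f :* M)) :+ d :* (d′ :* (f :* N))) refl
    where open +-*-Solver

  +ʳ : ∀ c e d c′ e′ d′ U V → d′ * (c * U + e * V) + d * (c′ * U + e′ * V) ≡
         (c * d′ + c′ * d) * U + (e * d′ + e′ * d) * V
  +ʳ = solve 8 (λ c e d c′ e′ d′ U V → d′ :* (c :* U :+ e :* V) :+ d :* (c′ :* U :+ e′ :* V)
         := (c :* d′ :+ c′ :* d) :* U :+ (e :* d′ :+ e′ :* d) :* V) refl
    where open +-*-Solver

1≤^ : ∀ b r → 1 ≤ suc b ^ r
1≤^ b r = ℕ.m^n>0 (suc b) r

Bound-scale : ∀ x {M r h} s t → Bound x M r h → Bound (scale s t x) M (s + r) (t + h)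
Bound-scale x@(rate _ _ d) {M} {r} {h} s t (isBound b) = isBound
  (subst₂ _≤_ (sym (scaleˡ d M r s t)) (scaleʳ x r h s t) (ℕ.*-monoʳ-≤ (factor s t) b))

Bound<-scale : ∀ x {M r h} s t → Bound< x M r h → Bound< (scale s t x) M (s + r) (t + h)
Bound<-scale x@(rate _ _ d) {M} {r} {h} s t (isBound< b) = isBound<
  (subst₂ _<_ (sym (scaleˡ d M r s t)) (scaleʳ x r h s t)
    (ℕ.*-monoʳ-< (factor s t) {{>-nonZero (ℕ.*-mono-≤ (ℕ.*-mono-≤ (1≤^ 2 s) (1≤^ 1 t)) (1≤^ 7 s))}} b))

Bound-≤ : ∀ x {M M′ r h} → M′ ≤ M → Bound x M r h → Bound x M′ r h
Bound-≤ (rate c e d) {r = r} M′≤M (isBound b) = isBound (≤-trans (ℕ.*-monoʳ-≤ d (ℕ.*-monoʳ-≤ (4 ^ r) M′≤M)) b)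

Bound<-≤ : ∀ x {M M′ r h} → M′ ≤ M → Bound< x M r h → Bound< x M′ r h
Bound<-≤ (rate c e d) {r = r} M′≤M (isBound< b) = isBound< (ℕ.≤-<-trans (ℕ.*-monoʳ-≤ d (ℕ.*-monoʳ-≤ (4 ^ r) M′≤M)) b)

Bound-+ : ∀ x y {M N r h} → Bound x M r h → Bound y N r h → Bound (x ⊕ y) (M + N) r h
Bound-+ (rate c e d) (rate c′ e′ d′) {M} {N} {r} {h} (isBound a) (isBound b) = isBound
  (subst₂ _≤_ (sym (+ˡ d d′ (4 ^ r) M N)) (+ʳ c e d c′ e′ d′ (3 ^ r * 2 ^ h) (8 ^ r))
    (+-mono-≤ (ℕ.*-monoʳ-≤ d′ a) (ℕ.*-monoʳ-≤ d b)))

Bound<-+ : ∀ x y {M N r h} → T (0 <ᵇ den y) → Bound< x M r h → Bound y N r h → Bound< (x ⊕ y) (M + N) r h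
Bound<-+ (rate c e d) (rate c′ e′ d′@(suc _)) {M} {N} {r} {h} _ (isBound< a) (isBound b) = isBound<
  (subst₂ _<_ (sym (+ˡ d d′ (4 ^ r) M N)) (+ʳ c e d c′ e′ d′ (3 ^ r * 2 ^ h) (8 ^ r))
    (ℕ.+-mono-<-≤ (ℕ.*-monoʳ-< d′ a) (ℕ.*-monoʳ-≤ d b)))

∧-elim : ∀ {a b} → T (a ∧ b) → T a × T b
∧-elim {true} {true} _ = tt , tt

private
  cross : ∀ c e d U V d′ X → d * X ≤ c * U + e * V → d * (d′ * X) ≤ c * d′ * U + e * d′ * V
  cross c e d U V d′ X b = begin
    d * (d′ * X)             ≡⟨ solve 3 (λ d d′ X → d :* (d′ :* X) := d′ :* (d :* X)) refl d d′ X ⟩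
    d′ * (d * X)             ≤⟨ ℕ.*-monoʳ-≤ d′ b ⟩
    d′ * (c * U + e * V)     ≡⟨ solve 5 (λ c e d′ U V → d′ :* (c :* U :+ e :* V)
                                  := c :* d′ :* U :+ e :* d′ :* V) refl c e d′ U V ⟩
    c * d′ * U + e * d′ * V  ∎
    where
    open ≤-Reasoning
    open +-*-Solver

  regroup : ∀ c′ e′ d U V → c′ * d * U + e′ * d * V ≡ d * (c′ * U + e′ * V)
  regroup = solve 5 (λ c′ e′ d U V → c′ :* d :* U :+ e′ :* d :* V := d :* (c′ :* U :+ e′ :* V)) refl
    where open +-*-Solver

Bound-weaken : ∀ x y {M r h} → T (x ≼ᵇ y) → Bound x M r h → Bound y M r h
Bound-weaken (rate c e d) (rate c′ e′ d′) {M} {r} {h} le (isBound b) with ∧-elim {0 <ᵇ d} le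
... | d>0 , les with ∧-elim {c * d′ ≤ᵇ c′ * d} les
... | c≤ , e≤ = isBound (ℕ.*-cancelˡ-≤ d {{>-nonZero (ℕ.<ᵇ⇒< 0 d d>0)}} (≤-trans
  (cross c e d U V d′ _ b)
  (≤-trans (+-mono-≤ (ℕ.*-monoˡ-≤ U (ℕ.≤ᵇ⇒≤ (c * d′) (c′ * d) c≤)) (ℕ.*-monoˡ-≤ V (ℕ.≤ᵇ⇒≤ (e * d′) (e′ * d) e≤)))
    (≤-reflexive (regroup c′ e′ d U V)))))
  where
  U = 3 ^ r * 2 ^ h
  V = 8 ^ r

-- Since both units are at least 1, one copy of each coefficient can be split off. There the strict
-- inequality of the sums applies; the remainder is compared term by term.
strict-mix : ∀ {a b a′ b′ U V} → a ≤ a′ → b ≤ b′ → a + b < a′ + b′ → 1 ≤ U → 1 ≤ V →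
  a * U + b * V < a′ * U + b′ * V
strict-mix {a} {b} {a′} {b′} {suc U} {suc V} a≤ b≤ lt _ _ = begin-strict
  a * suc U + b * suc V             ≡⟨ cong₂ _+_ (ℕ.*-suc a U) (ℕ.*-suc b V) ⟩
  (a + a * U) + (b + b * V)         ≡⟨ swap a (a * U) b (b * V) ⟩
  (a + b) + (a * U + b * V)         <⟨ ℕ.+-mono-<-≤ lt (+-mono-≤ (ℕ.*-monoˡ-≤ U a≤) (ℕ.*-monoˡ-≤ V b≤)) ⟩
  (a′ + b′) + (a′ * U + b′ * V)     ≡⟨ sym (swap a′ (a′ * U) b′ (b′ * V)) ⟩
  (a′ + a′ * U) + (b′ + b′ * V)     ≡⟨ sym (cong₂ _+_ (ℕ.*-suc a′ U) (ℕ.*-suc b′ V)) ⟩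
  a′ * suc U + b′ * suc V           ∎
  where
  open ≤-Reasoning
  open +-*-Solver
  swap : ∀ a x b y → (a + x) + (b + y) ≡ (a + b) + (x + y)
  swap = solve 4 (λ a x b y → (a :+ x) :+ (b :+ y) := (a :+ b) :+ (x :+ y)) refl

Bound-strict : ∀ x y {M r h} → T (x ≺ᵇ y) → Bound x M r h → Bound< y M r h
Bound-strict x@(rate c e d) y@(rate c′ e′ d′) {M} {r} {h} lt (isBound b) with ∧-elim {x ≼ᵇ y} lt
... | le , lt′ with ∧-elim {0 <ᵇ d} le
... | d>0 , les with ∧-elim {c * d′ ≤ᵇ c′ * d} les
... | c≤ , e≤ = isBound< (ℕ.*-cancelˡ-< d _ _ (ℕ.≤-<-trans
  (cross c e d U V d′ _ b)
  (ℕ.<-≤-trans (strict-mix (ℕ.≤ᵇ⇒≤ (c * d′) (c′ * d) c≤) (ℕ.≤ᵇ⇒≤ (e * d′) (e′ * d) e≤)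
        (ℕ.<ᵇ⇒< (c * d′ + e * d′) (c′ * d + e′ * d) lt′)
      (ℕ.*-mono-≤ (1≤^ 2 r) (1≤^ 1 h)) (1≤^ 7 r))
    (≤-reflexive (regroup c′ e′ d U V)))))
  where
  U = 3 ^ r * 2 ^ h
  V = 8 ^ r

Bound<-weaken : ∀ x y {M r h} → T (0 <ᵇ den y) → T (x ≼ᵇ y) → Bound< x M r h → Bound< y M r h
Bound<-weaken (rate c e d) (rate c′ e′ d′@(suc _)) {M} {r} {h} _ le (isBound< b) with ∧-elim {0 <ᵇ d} le
... | d>0 , les with ∧-elim {c * d′ ≤ᵇ c′ * d} les
... | c≤ , e≤ = isBound< (ℕ.*-cancelˡ-< d _ _ (begin-strict
  d * (d′ * X)                 ≡⟨ solve 3 (λ d d′ X → d :* (d′ :* X) := d′ :* (d :* X)) refl d d′ X ⟩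
  d′ * (d * X)                 <⟨ ℕ.*-monoʳ-< d′ b ⟩
  d′ * (c * U + e * V)         ≡⟨ solve 5 (λ c e d′ U V → d′ :* (c :* U :+ e :* V)
                                    := c :* d′ :* U :+ e :* d′ :* V) refl c e d′ U V ⟩
  c * d′ * U + e * d′ * V      ≤⟨ +-mono-≤ (ℕ.*-monoˡ-≤ U (ℕ.≤ᵇ⇒≤ (c * d′) (c′ * d) c≤))
                                    (ℕ.*-monoˡ-≤ V (ℕ.≤ᵇ⇒≤ (e * d′) (e′ * d) e≤)) ⟩
  c′ * d * U + e′ * d * V      ≡⟨ regroup c′ e′ d U V ⟩
  d * (c′ * U + e′ * V)        ∎))
  where
  open ≤-Reasoning
  open +-*-Solver
  X = 4 ^ r * M
  U = 3 ^ r * 2 ^ h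
  V = 8 ^ r

Bound<⇒Bound : ∀ x {M r h} → Bound< x M r h → Bound x M r h
Bound<⇒Bound _ (isBound< lt) = isBound (ℕ.<⇒≤ lt)

-- Subtracting j from val p + 2 h leaves val (shift p j) + 2 (h - halves p j).
halves : Parity → ℕ → ℕ
halves p  zero    = 0
halves od (suc j) = halves ev j
halves ev (suc j) = suc (halves od j)

shift : Parity → ℕ → Parity
shift p  zero    = p
shift od (suc j) = shift ev j
shift ev (suc j) = shift od j

borrow-≤ : ∀ p j {X h} → j + X ≤ val p + 2 * h →
           ∃ λ h′ → halves p j + h′ ≡ h × X ≤ val (shift p j) + 2 * h′
borrow-≤ p zero {h = h} le = h , refl , le
borrow-≤ od (suc j) (s≤s le) = borrow-≤ ev j le
borrow-≤ ev (suc j) {h = suc h} le =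
  let (h′ , eq , le′) = borrow-≤ od j {h = h} (ℕ.≤-pred (≤-trans le (≤-reflexive (ℕ.*-suc 2 h))))
  in h′ , cong suc eq , le′

borrow-≡ : ∀ p j {X h} → j + X ≡ val p + 2 * h →
           ∃ λ h′ → halves p j + h′ ≡ h × X ≡ val (shift p j) + 2 * h′
borrow-≡ p zero {h = h} eq = h , refl , eq
borrow-≡ od (suc j) eq = borrow-≡ ev j (ℕ.suc-injective eq)
borrow-≡ ev (suc j) {h = suc h} eq =
  let (h′ , eq₁ , eq₂) = borrow-≡ od j {h = h} (ℕ.suc-injective (trans eq (ℕ.*-suc 2 h)))
  in h′ , cong suc eq₁ , eq₂

-- The rate contributed by a subgraph with k fewer vertices and s fewer cycles.
drop : ℕ → ℕ → (Parity → Rate) → Parity → Rate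
drop k s x p = scale s (halves p (k + s)) (x (shift p (k + s)))

_⊞_ : (Parity → Rate) → (Parity → Rate) → Parity → Rate
(x ⊞ y) p = x p ⊕ y p

infixl 6 _⊞_

-- `general` is g itself: for odd n - r it is 4/3 of the unit. `bad` is what branching gives at a
-- vertex with three neighbours, two of which close a cycle: 2/3 + 2/9 and 8/9 + 1/3. It is the
-- worst case apart from components K₃ and K₂. `leafy` belongs to a leaf whose neighbour has a
-- second neighbour: 1/2 + 1/3 and 2/3 + 1/2.
general bad leafy : Parity → Rate
general ev = rate 1 0 1
general od = rate 4 0 3
bad ev = rate 8 0 9
bad od = rate 11 0 9
leafy ev = rate 5 0 6
leafy od = rate 7 0 6

-- The connected bound c(n,r); for odd n - r the flag adds 2^(r-1), needed when n < 3r.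
connected : Bool → Parity → Rate
connected _     ev = rate 4 3 6
connected false od = rate 1 0 1
connected true  od = rate 2 1 2

every : (Parity → Bool) → Bool
every f = f ev ∧ f od

every-elim : ∀ f → T (every f) → ∀ p → T (f p)
every-elim f t ev = proj₁ (∧-elim {f ev} t)
every-elim f t od = proj₂ (∧-elim {f ev} t)

everyᵇ : (Bool → Parity → Bool) → Bool
everyᵇ f = every (f false) ∧ every (f true)

everyᵇ-elim : ∀ f → T (everyᵇ f) → ∀ b p → T (f b p)
everyᵇ-elim f t false = every-elim (f false) (proj₁ (∧-elim {every (f false)} t))
everyᵇ-elim f t true  = every-elim (f true) (proj₂ (∧-elim {every (f false)} t))

-- Exchange of the two terms of a bound when one of them dominates the other.
Bound-trade : ∀ c k e d q {M r h} → 3 ^ r * 2 ^ h ≤ q * 8 ^ r →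
  Bound (rate (c + k) e d) M r h → Bound (rate c (e + k * q) d) M r h
Bound-trade c k e d q {M} {r} {h} le (isBound b) = isBound (begin
  d * (4 ^ r * M)                ≤⟨ b ⟩
  (c + k) * U + e * V            ≡⟨ solve 5 (λ c k e U V → (c :+ k) :* U :+ e :* V := c :* U :+ (e :* V :+ k :* U)) refl c k e U V ⟩
  c * U + (e * V + k * U)        ≤⟨ ℕ.+-monoʳ-≤ (c * U) (ℕ.+-monoʳ-≤ (e * V) (ℕ.*-monoʳ-≤ k le)) ⟩
  c * U + (e * V + k * (q * V))  ≡⟨ cong (c * U +_) (solve 4 (λ e k q V → e :* V :+ k :* (q :* V) := (e :+ k :* q) :* V) refl e k q V) ⟩
  c * U + (e + k * q) * V        ∎)
  where
  open ≤-Reasoning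
  open +-*-Solver
  U = 3 ^ r * 2 ^ h
  V = 8 ^ r

Bound-trade′ : ∀ c e d q q′ {M r h} → q * 8 ^ r ≤ q′ * (3 ^ r * 2 ^ h) →
  Bound (rate c e d) M r h → Bound (rate (q * c + q′ * e) 0 (q * d)) M r h
Bound-trade′ c e d q q′ {M} {r} {h} le (isBound b) = isBound (begin
  q * d * (4 ^ r * M)            ≡⟨ ℕ.*-assoc q d _ ⟩
  q * (d * (4 ^ r * M))          ≤⟨ ℕ.*-monoʳ-≤ q b ⟩
  q * (c * U + e * V)            ≡⟨ solve 5 (λ q c e U V → q :* (c :* U :+ e :* V) := q :* c :* U :+ e :* (q :* V)) refl q c e U V ⟩
  q * c * U + e * (q * V)        ≤⟨ ℕ.+-monoʳ-≤ (q * c * U) (ℕ.*-monoʳ-≤ e le) ⟩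
  q * c * U + e * (q′ * U)       ≡⟨ solve 5 (λ q q′ c e U → q :* c :* U :+ e :* (q′ :* U) := (q :* c :+ q′ :* e) :* U :+ con 0) refl q q′ c e U ⟩
  (q * c + q′ * e) * U + 0       ∎)
  where
  open ≤-Reasoning
  open +-*-Solver
  U = 3 ^ r * 2 ^ h
  V = 8 ^ r

-- For r = s + r′ the ratio of the unit to 2^r is at most 3^s 2^t / 8^s times (6/8)^r′. A single
-- numerical test at s and t therefore covers all larger r.
small-unit : ∀ s t q r′ h → h ≤ t + r′ → T (3 ^ s * 2 ^ t ≤ᵇ q * 8 ^ s) → 3 ^ (s + r′) * 2 ^ h ≤ q * 8 ^ (s + r′)
small-unit s t q r′ h h≤ le = begin
  3 ^ (s + r′) * 2 ^ h                 ≤⟨ ℕ.*-monoʳ-≤ (3 ^ (s + r′)) (ℕ.^-monoʳ-≤ 2 h≤) ⟩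
  3 ^ (s + r′) * 2 ^ (t + r′)          ≡⟨ cong₂ _*_ (ℕ.^-distribˡ-+-* 3 s r′) (ℕ.^-distribˡ-+-* 2 t r′) ⟩
  3 ^ s * 3 ^ r′ * (2 ^ t * 2 ^ r′)    ≡⟨ solve 4 (λ a b c d → a :* b :* (c :* d) := a :* c :* (b :* d)) refl (3 ^ s) (3 ^ r′) (2 ^ t) (2 ^ r′) ⟩
  3 ^ s * 2 ^ t * (3 ^ r′ * 2 ^ r′)    ≤⟨ ℕ.*-mono-≤ (ℕ.≤ᵇ⇒≤ (3 ^ s * 2 ^ t) (q * 8 ^ s) le) (ℕ.*-monoˡ-≤ (2 ^ r′) (ℕ.^-monoˡ-≤ r′ (ℕ.n≤1+n 3))) ⟩
  q * 8 ^ s * (4 ^ r′ * 2 ^ r′)        ≡⟨ cong (q * 8 ^ s *_) (trans (ℕ.*-comm (4 ^ r′) _) (2^*4^ r′)) ⟩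
  q * 8 ^ s * 8 ^ r′                   ≡⟨ trans (ℕ.*-assoc q _ _) (cong (q *_) (sym (ℕ.^-distribˡ-+-* 8 s r′))) ⟩
  q * 8 ^ (s + r′)                     ∎
  where
  open ≤-Reasoning
  open +-*-Solver

Bound-suc : ∀ x {M r h} → T (0 <ᵇ den x) → Bound x (suc M) r h → Bound< x M r h
Bound-suc (rate c e d@(suc _)) {M} {r} _ (isBound b) = isBound< (ℕ.<-≤-trans
  (ℕ.*-monoʳ-< d (ℕ.*-monoʳ-< (4 ^ r) {{>-nonZero (1≤^ 3 r)}} (ℕ.n<1+n M))) b)

-- Exchanging triangles for edges on the same number of vertices

halve : ∀ k → (∃ λ i → k ≡ 2 * i) ⊎ (∃ λ i → k ≡ 1 + 2 * i)
halve zero = inj₁ (0 , refl)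
halve (suc k) with halve k
... | inj₁ (i , eq) = inj₂ (i , cong suc eq)
... | inj₂ (i , eq) = inj₁ (suc i , trans (cong suc eq) (sym (ℕ.*-suc 2 i)))

even≢odd : ∀ i j → 2 * i ≢ 1 + 2 * j
even≢odd (suc i) zero eq = contradiction (trans (sym (ℕ.*-suc 2 i)) eq) λ ()
even≢odd (suc i) (suc j) eq = even≢odd i j (ℕ.suc-injective (ℕ.suc-injective
  (trans (sym (ℕ.*-suc 2 i)) (trans eq (cong suc (ℕ.*-suc 2 j))))))

-- Two triangles have as many vertices as three edges.
exchange : ∀ {a b r i} → a ≤ r → 3 * a + 2 * b ≡ 3 * r + 2 * i → ∃ λ d → r ≡ a + 2 * d × b ≡ i + 3 * d
exchange {a} {b} {r} {i} a≤r eq with r ∸ a | ℕ.m+[n∸m]≡n a≤r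
... | j | refl = go (halve j)
  where
  open +-*-Solver
  2b : 2 * b ≡ 3 * j + 2 * i
  2b = ℕ.+-cancelˡ-≡ (3 * a) _ _ (trans eq (solve 3 (λ a j i → con 3 :* (a :+ j) :+ con 2 :* i := con 3 :* a :+ (con 3 :* j :+ con 2 :* i)) refl a j i))
  go : (∃ λ d → j ≡ 2 * d) ⊎ (∃ λ d → j ≡ 1 + 2 * d) → ∃ λ d → a + j ≡ a + 2 * d × b ≡ i + 3 * d
  go (inj₁ (d , refl)) = d , refl , ℕ.*-cancelˡ-≡ b (i + 3 * d) 2 (trans 2b
    (solve 2 (λ d i → con 3 :* (con 2 :* d) :+ con 2 :* i := con 2 :* (i :+ con 3 :* d)) refl d i))
  go (inj₂ (d , refl)) = ⊥-elim (even≢odd b (1 + 3 * d + i) (trans 2b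
    (solve 2 (λ d i → con 3 :* (con 1 :+ con 2 :* d) :+ con 2 :* i := con 1 :+ con 2 :* (con 1 :+ con 3 :* d :+ i)) refl d i)))

power-exchange : ∀ a i d → 3 ^ (a + 2 * d) * 2 ^ i ≡ 3 ^ a * 2 ^ i * 9 ^ d × 3 ^ a * 2 ^ (i + 3 * d) ≡ 3 ^ a * 2 ^ i * 8 ^ d
power-exchange a i d =
  trans (cong (_* 2 ^ i) (trans (ℕ.^-distribˡ-+-* 3 a (2 * d)) (cong (3 ^ a *_) (sym (ℕ.^-*-assoc 3 2 d)))))
    (solve 3 (λ x y z → x :* z :* y := x :* y :* z) refl (3 ^ a) (2 ^ i) (9 ^ d)) ,
  trans (cong (3 ^ a *_) (trans (ℕ.^-distribˡ-+-* 2 i (3 * d)) (cong (2 ^ i *_) (sym (ℕ.^-*-assoc 2 3 d)))))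
    (sym (ℕ.*-assoc (3 ^ a) (2 ^ i) (8 ^ d)))
  where open +-*-Solver

8^<9^ : ∀ d → 8 ^ suc d < 9 ^ suc d
8^<9^ d = ℕ.^-monoˡ-< (suc d) (ℕ.n<1+n 8)

-- Replacing 3d edges by 2d triangles multiplies the product by (9/8)^d, so equality forces d = 0.
exchange-≤ : ∀ {a b r i} → a ≤ r → 3 * a + 2 * b ≡ 3 * r + 2 * i →
  3 ^ a * 2 ^ b ≤ 3 ^ r * 2 ^ i × (3 ^ r * 2 ^ i ≤ 3 ^ a * 2 ^ b → a ≡ r × b ≡ i)
exchange-≤ {a} {b} {r} {i} a≤r eq with exchange {a} {b} {r} {i} a≤r eq
... | zero , refl , refl = ≤-reflexive (cong₂ (λ x y → 3 ^ x * 2 ^ y) (sym (ℕ.+-identityʳ a)) (ℕ.+-identityʳ i)) , λ _ → sym (ℕ.+-identityʳ a) , ℕ.+-identityʳ i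
... | suc d , refl , refl = ℕ.<⇒≤ lt , λ le → contradiction le (ℕ.<⇒≱ lt)
  where
  lt : 3 ^ a * 2 ^ (i + 3 * suc d) < 3 ^ (a + 2 * suc d) * 2 ^ i
  lt = subst₂ _<_ (sym (proj₂ (power-exchange a i (suc d)))) (sym (proj₁ (power-exchange a i (suc d))))
    (ℕ.*-monoʳ-< (3 ^ a * 2 ^ i) {{>-nonZero (ℕ.*-mono-≤ (1≤^ 2 a) (1≤^ 1 i))}} (8^<9^ d))

2^<3^ : ∀ a → 2 ^ suc a < 3 ^ suc a
2^<3^ a = ℕ.^-monoˡ-< (suc a) (ℕ.n<1+n 2)

-- 9^d - 8^d exceeds 1 unless d = 1.
tight-exchange : ∀ a i d → 3 ^ (a + 2 * suc d) * 2 ^ i ≤ 3 ^ a * 2 ^ (i + 3 * suc d) + 2 ^ a → a ≡ 0 × i ≡ 0 × d ≡ 0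
tight-exchange a i d le = a≡0 a i small , i≡0 , d≡0 d le′
  where
  unit = 3 ^ a * 2 ^ i
  le′ : unit * 9 ^ suc d ≤ unit * 8 ^ suc d + 2 ^ a
  le′ = subst₂ (λ x y → x ≤ y + 2 ^ a) (proj₁ (power-exchange a i (suc d))) (proj₂ (power-exchange a i (suc d))) le
  excess : ∀ e → 8 ^ suc d + e ≤ 9 ^ suc d → unit * e ≤ 2 ^ a
  excess e ex = ℕ.+-cancelˡ-≤ (unit * 8 ^ suc d) _ _ (≤-trans (≤-reflexive (sym (ℕ.*-distribˡ-+ unit (8 ^ suc d) e)))
    (≤-trans (ℕ.*-monoʳ-≤ unit ex) le′))
  small : unit * 1 ≤ 2 ^ a
  small = excess 1 (≤-trans (≤-reflexive (ℕ.+-comm _ 1)) (8^<9^ d))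
  a≡0 : ∀ a i → 3 ^ a * 2 ^ i * 1 ≤ 2 ^ a → a ≡ 0
  a≡0 zero i _ = refl
  a≡0 (suc a) i le = contradiction (≤-trans (≤-trans (≤-reflexive (sym (trans (ℕ.*-identityʳ _) (ℕ.*-identityʳ _))))
    (ℕ.*-monoˡ-≤ 1 (ℕ.*-monoʳ-≤ (3 ^ suc a) (1≤^ 1 i)))) le) (ℕ.<⇒≱ (2^<3^ a))
  a=0 = a≡0 a i small
  no-power : ∀ i → 3 ^ 0 * 2 ^ i * 1 ≤ 2 ^ 0 → i ≡ 0
  no-power zero _ = refl
  no-power (suc i) le = contradiction (≤-trans (ℕ.*-monoʳ-≤ 2 (1≤^ 1 i)) (≤-trans (≤-reflexive (sym (trans (ℕ.*-identityʳ _) (ℕ.+-identityʳ _)))) le)) λ { (s≤s ()) }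
  i≡0 : i ≡ 0
  i≡0 = no-power i (subst (λ a → 3 ^ a * 2 ^ i * 1 ≤ 2 ^ a) a=0 small)
  d≡0 : ∀ d → 3 ^ a * 2 ^ i * 9 ^ suc d ≤ 3 ^ a * 2 ^ i * 8 ^ suc d + 2 ^ a → d ≡ 0
  d≡0 zero _ = refl
  d≡0 (suc d) le = contradiction (subst₂ (λ a i → 3 ^ a * 2 ^ i * 9 ^ suc (suc d) ≤ 3 ^ a * 2 ^ i * 8 ^ suc (suc d) + 2 ^ a) a=0 i≡0 le)
    (ℕ.<⇒≱ (begin-strict
      1 * 8 ^ suc (suc d) + 1      ≡⟨ cong (_+ 1) (ℕ.+-identityʳ (8 ^ suc (suc d))) ⟩
      8 * 8 ^ suc d + 1            <⟨ ℕ.+-mono-≤-< (ℕ.≤-refl {8 * 8 ^ suc d}) (≤-trans (s≤s (s≤s z≤n)) (ℕ.*-mono-≤ {8} {8} ≤-refl (1≤^ 7 d))) ⟩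
      8 * 8 ^ suc d + 8 ^ suc d    ≡⟨ ℕ.+-comm (8 * 8 ^ suc d) _ ⟩
      9 * 8 ^ suc d                ≤⟨ ℕ.*-monoʳ-≤ 9 (ℕ.<⇒≤ (8^<9^ d)) ⟩
      9 ^ suc (suc d)              ≡⟨ sym (ℕ.+-identityʳ _) ⟩
      1 * 9 ^ suc (suc d)          ∎))
    where open ≤-Reasoning

private
  unscale-rhs : ∀ c e r i → c * (3 ^ r * 2 ^ (2 * r + i)) + e * 8 ^ r ≡ 4 ^ r * (c * (3 ^ r * 2 ^ i) + e * 2 ^ r)
  unscale-rhs c e r i = begin
    c * (3 ^ r * 2 ^ (2 * r + i)) + e * 8 ^ r
      ≡⟨ cong₂ (λ x y → c * (3 ^ r * x) + e * y)
           (trans (ℕ.^-distribˡ-+-* 2 (2 * r) i) (cong (_* 2 ^ i) (sym (ℕ.^-*-assoc 2 2 r)))) (sym (2^*4^ r)) ⟩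
    c * (3 ^ r * (4 ^ r * 2 ^ i)) + e * (2 ^ r * 4 ^ r)
      ≡⟨ solve 6 (λ c e f t p q → c :* (t :* (f :* p)) :+ e :* (q :* f) := f :* (c :* (t :* p) :+ e :* q))
           refl c e (4 ^ r) (3 ^ r) (2 ^ i) (2 ^ r) ⟩
    4 ^ r * (c * (3 ^ r * 2 ^ i) + e * 2 ^ r) ∎
    where
    open ≡-Reasoning
    open +-*-Solver

  unscale-lhs : ∀ d r M → d * (4 ^ r * M) ≡ 4 ^ r * (d * M)
  unscale-lhs d r M = solve 3 (λ d f M → d :* (f :* M) := f :* (d :* M)) refl d (4 ^ r) M
    where open +-*-Solver

-- With h = 2r + i the factor 4^r cancels, which returns a bound to the powers 3^r 2^i and 2^r in
-- which g and c are written.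
unscale : ∀ x {M} r i → Bound x M r (2 * r + i) → den x * M ≤ lead x * (3 ^ r * 2 ^ i) + corr x * 2 ^ r
unscale (rate c e d) {M} r i (isBound b) = ℕ.*-cancelˡ-≤ (4 ^ r) {{>-nonZero (1≤^ 3 r)}}
  (subst₂ _≤_ (unscale-lhs d r M) (unscale-rhs c e r i) b)

unscale< : ∀ x {M} r i → Bound< x M r (2 * r + i) → den x * M < lead x * (3 ^ r * 2 ^ i) + corr x * 2 ^ r
unscale< (rate c e d) {M} r i (isBound< b) = ℕ.*-cancelˡ-< (4 ^ r) _ _
  (subst₂ _<_ (unscale-lhs d r M) (unscale-rhs c e r i) b)

module _ {n : ℕ} (G : Graph (Fin n)) where

  -- Maximal independent sets of induced subgraphs

  open Graph G
  open DecMembership (Fin._≟_ {n}) using () renaming (_∈?_ to _∈ₗ?_) public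

  Dominating : Subset n → Subset n → Set
  Dominating S I = ∀ v → v ∈ S → v ∉ I → ∃ λ u → u ∈ I × u ~ v

  -- Maximality inside S is expressed by domination. This speaks about single vertices only, so it
  -- behaves well under restriction to induced subgraphs and is decided without a search through all
  -- supersets.
  MIS : Subset n → Subset n → Set
  MIS S I = I ⊆ S × Independent G I × Dominating S I

  MIS? : ∀ S → U.Decidable (MIS S)
  MIS? S I = (I ⊆? S) ×-dec independent? G I ×-dec
    all? λ v → (v ∈? S) →-dec ((¬? (v ∈? I)) →-dec any? λ u → (u ∈? I) ×-dec (u ~? v))

  mis : Subset n → ℕ
  mis S = count (MIS? S) (subsets n)

  far? : ∀ S v → U.Decidable (λ u → u ∈ S × u ≢ v × ¬ v ~ u)
  far? S v u = (u ∈? S) ×-dec (¬? (u Fin.≟ v) ×-dec ¬? (v ~? u))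

  _⊖_ : Subset n → Fin n → Subset n
  S ⊖ v = comprehension (far? S v)

  infixl 5 _⊖_

  ∈-⊖⁺ : ∀ {S u v} → u ∈ S → u ≢ v → ¬ v ~ u → u ∈ S ⊖ v
  ∈-⊖⁺ p q r = ∈-comprehension⁺ (far? _ _) (p , q , r)

  ∈-⊖⁻ : ∀ {S u v} → u ∈ S ⊖ v → u ∈ S × u ≢ v × ¬ v ~ u
  ∈-⊖⁻ = ∈-comprehension⁻ (far? _ _)

  ~⇒≢ : ∀ {u v} → u ~ v → u ≢ v
  ~⇒≢ e refl = ~-irrefl refl e

  ∪⁅⁆-injective : ∀ {v} {I J : Subset n} → v ∉ I → v ∉ J → I ∪ ⁅ v ⁆ ≡ J ∪ ⁅ v ⁆ → I ≡ J
  ∪⁅⁆-injective {v} v∉I v∉J eq = ⊆-antisym (half v∉I eq) (half v∉J (sym eq))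
    where
    half : ∀ {I J} → v ∉ I → I ∪ ⁅ v ⁆ ≡ J ∪ ⁅ v ⁆ → I ⊆ J
    half {I} {J} v∉ eq {x} x∈ with x∈p∪q⁻ J ⁅ v ⁆ (subst (x ∈_) eq (x∈p∪q⁺ (inj₁ x∈)))
    ... | inj₁ p = p
    ... | inj₂ p = contradiction (subst (_∈ I) (x∈⁅y⁆⇒x≡y v p) x∈) v∉

  remove-injective : ∀ {v} {I J : Subset n} → v ∈ I → v ∈ J → I - v ≡ J - v → I ≡ J
  remove-injective {v} v∈I v∈J eq = ⊆-antisym (half v∈J eq) (half v∈I (sym eq))
    where
    half : ∀ {I J} → v ∈ J → I - v ≡ J - v → I ⊆ J
    half v∈J eq {x} x∈ with x Fin.≟ v
    ... | yes refl = v∈J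
    ... | no x≢v = ∈-remove⁻ (subst (x ∈_) eq (∈-remove⁺ x∈ x≢v))

  maximum : ∀ {S I J} → MIS S I → MIS S J → I ⊆ J → J ⊆ I
  maximum {I = I} (_ , _ , dom) (J⊆S , ind , _) I⊆J {x} x∈J with x ∈? I
  ... | yes x∈I = x∈I
  ... | no x∉I = let (u , u∈I , u~x) = dom x (J⊆S x∈J) x∉I
                 in contradiction u~x (ind u x (I⊆J u∈I) x∈J)

  containing : ∀ S v → count (λ I → MIS? S I ×-dec (v ∈? I)) (subsets n) ≤ mis (S ⊖ v)
  containing S v = count-injection _ (MIS? (S ⊖ v)) (subsets n) (subsets n)
    (subsets-unique n) (subsets-complete n) (_- v) ok
    λ (_ , v∈I) (_ , v∈J) → remove-injective v∈I v∈J
    where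
    ok : ∀ {I} → MIS S I × v ∈ I → MIS (S ⊖ v) (I - v)
    ok {I} ((I⊆S , ind , dom) , v∈I) =
      (λ {x} x∈ → let x∈I = ∈-remove⁻ x∈ in
        ∈-⊖⁺ (I⊆S x∈I) (remove-≢ x∈) (ind v x v∈I x∈I)) ,
      (λ a b p q → ind a b (∈-remove⁻ p) (∈-remove⁻ q)) ,
      λ x x∈ x∉ → let (x∈S , x≢v , v≁x) = ∈-⊖⁻ x∈
                      (u , u∈I , u~x) = dom x x∈S (λ x∈I → x∉ (∈-remove⁺ x∈I x≢v))
                  in u , ∈-remove⁺ u∈I (λ u≡v → v≁x (subst (_~ x) u≡v u~x)) , u~x

  containing-≥ : ∀ {S v} → v ∈ S →
    mis (S ⊖ v) ≤ count (λ I → MIS? S I ×-dec (v ∈? I)) (subsets n)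
  containing-≥ {S} {v} v∈S = count-injection (MIS? (S ⊖ v)) _ (subsets n) (subsets n)
    (subsets-unique n) (subsets-complete n) (_∪ ⁅ v ⁆) ok
    λ (I⊆ , _) (J⊆ , _) → ∪⁅⁆-injective (v∉ I⊆) (v∉ J⊆)
    where
    v∉ : ∀ {I} → I ⊆ S ⊖ v → v ∉ I
    v∉ I⊆ v∈ = proj₁ (proj₂ (∈-⊖⁻ (I⊆ v∈))) refl
    ok : ∀ {I} → MIS (S ⊖ v) I → MIS S (I ∪ ⁅ v ⁆) × v ∈ I ∪ ⁅ v ⁆
    ok {I} (I⊆ , ind , dom) = (insert-⊆ (proj₁ ∘ ∈-⊖⁻ ∘ I⊆) v∈S ,
      independent-insert G ind (λ u u∈ e → proj₂ (proj₂ (∈-⊖⁻ (I⊆ u∈))) (~-sym e)) , dom′) , v∈I∪⁅v⁆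
      where
      dom′ : Dominating S (I ∪ ⁅ v ⁆)
      dom′ x x∈S x∉ with x Fin.≟ v | v ~? x
      ... | yes refl | _ = contradiction (v∈I∪⁅v⁆) x∉
      ... | no _ | yes e = v , v∈I∪⁅v⁆ , e
      ... | no x≢v | no v≁x = let (u , u∈I , e) = dom x (∈-⊖⁺ x∈S x≢v v≁x) (x∉ ∘ x∈p∪q⁺ ∘ inj₁)
                              in u , x∈p∪q⁺ (inj₁ u∈I) , e

  avoiding-MIS : ∀ {S v I} → MIS S I → v ∉ I → MIS (S - v) I
  avoiding-MIS (I⊆S , ind , dom) v∉ =
    ⊆-remove I⊆S v∉ , ind , λ x x∈ → dom x (∈-remove⁻ x∈)

  avoiding : ∀ S v → count (λ I → MIS? S I ×-dec ¬? (v ∈? I)) (subsets n) ≤ mis (S - v)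
  avoiding S v = count-injection _ (MIS? (S - v)) (subsets n) (subsets n)
    (subsets-unique n) (subsets-complete n) id (λ (p , q) → avoiding-MIS p q) λ _ _ → id

  mis-branch : ∀ S v → mis S ≤ mis (S - v) + mis (S ⊖ v)
  mis-branch S v = ≤-trans
    (count-cover (MIS? S) (λ I → MIS? S I ×-dec ¬? (v ∈? I)) (λ I → MIS? S I ×-dec (v ∈? I))
      (subsets n) (λ {I} p → case v ∈? I of λ { (yes q) → inj₂ (p , q) ; (no q) → inj₁ (p , q) }))
    (+-mono-≤ (avoiding S v) (containing S v))

  -- A maximal independent set J of S - v without neighbours of v is not maximal in S,
  -- so the bound mis-branch is not attained.
  mis-branch-strict : ∀ S v {J} → v ∈ S → MIS (S - v) J → (∀ u → u ∈ J → ¬ u ~ v) →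
    suc (mis S) ≤ mis (S - v) + mis (S ⊖ v)
  mis-branch-strict S v {J} v∈S J-mis J≁v = ≤-trans
    (s≤s (count-cover (MIS? S) (λ I → MIS? S I ×-dec ¬? (v ∈? I)) (λ I → MIS? S I ×-dec (v ∈? I))
      (subsets n) (λ {I} p → case v ∈? I of λ { (yes q) → inj₂ (p , q) ; (no q) → inj₁ (p , q) })))
    (+-mono-≤ (count-extra _ (MIS? (S - v)) (subsets n) (J ∷ []) (subsets-unique n)
      ([] ∷ []) (subsets-complete n) (λ (p , q) → avoiding-MIS p q)
      ((J-mis , λ ((_ , _ , dom) , v∉J) → let (u , u∈J , u~v) = dom v v∈S v∉J in J≁v u u∈J u~v) ∷ []))
      (containing S v))

  any-cover : ∀ S (Q : Subset n → Set) (Q? : U.Decidable Q) ys →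
    (∀ I → MIS S I → Q I → Any (_∈ I) ys) →
    count (λ I → MIS? S I ×-dec Q? I) (subsets n) ≤ sum (map (λ y → mis (S ⊖ y)) ys)
  any-cover S Q Q? [] f = ≤-reflexive (cong length (filter-none (λ I → MIS? S I ×-dec Q? I) {xs = subsets n}
    (All.tabulate λ {I} _ (p , q) → case f I p q of λ ())))
  any-cover S Q Q? (y ∷ ys) f = ≤-trans
    (count-cover _ (λ I → MIS? S I ×-dec (y ∈? I)) (λ I → MIS? S I ×-dec (Q? I ×-dec ¬? (y ∈? I)))
      (subsets n) (λ {I} (p , q) → case y ∈? I of λ { (yes y∈) → inj₁ (p , y∈) ; (no y∉) → inj₂ (p , q , y∉) }))
    (+-mono-≤ (containing S y) (any-cover S _ (λ I → Q? I ×-dec ¬? (y ∈? I)) ys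
      λ I p (q , y∉) → rest y∉ (f I p q)))
    where
    rest : ∀ {I} → y ∉ I → Any (_∈ I) (y ∷ ys) → Any (_∈ I) ys
    rest y∉ (here y∈) = contradiction y∈ y∉
    rest y∉ (there a) = a

  -- Every maximal independent set meets the closed neighbourhood of u.
  mis-closedNbhd : ∀ {S u} ys → u ∈ S → u ∈ₗ ys → (∀ v → v ∈ S → u ~ v → v ∈ₗ ys) →
    mis S ≤ sum (map (λ y → mis (S ⊖ y)) ys)
  mis-closedNbhd {S} {u} ys u∈S u∈ys nb = ≤-trans
    (count-injection (MIS? S) (λ I → MIS? S I ×-dec yes tt) (subsets n) (subsets n) (subsets-unique n)
      (subsets-complete n) id (_, tt) λ _ _ → id)
    (any-cover S (λ _ → ⊤) (λ _ → yes tt) ys meets)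
    where
    meets : ∀ I → MIS S I → ⊤ → Any (_∈ I) ys
    meets I (I⊆S , ind , dom) _ with u ∈? I
    ... | yes u∈I = lose u∈ys u∈I
    ... | no u∉I = let (v , v∈I , v~u) = dom u u∈S u∉I
                   in lose (nb v (I⊆S v∈I) (~-sym v~u)) v∈I

  -- If v is never the only vertex of I next to a neighbour of v, then I - v still dominates S - v.
  -- No two sets have the same image: if they differed only by v, one would properly contain the
  -- other.
  mis-delete : ∀ S v →
    (∀ I → MIS S I → v ∈ I → ∀ y → y ∈ S → v ~ y → ∃ λ z → z ∈ I × z ≢ v × z ~ y) →
    mis S ≤ mis (S - v)
  mis-delete S v red = count-injection (MIS? S) (MIS? (S - v)) (subsets n) (subsets n)
    (subsets-unique n) (subsets-complete n) (_- v) ok inj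
    where
    ok : ∀ {I} → MIS S I → MIS (S - v) (I - v)
    ok {I} p@(I⊆S , ind , dom) =
      (λ x∈ → ∈-remove⁺ (I⊆S (∈-remove⁻ x∈)) (remove-≢ x∈)) ,
      (λ a b p q → ind a b (∈-remove⁻ p) (∈-remove⁻ q)) , dom′
      where
      dom′ : Dominating (S - v) (I - v)
      dom′ x x∈ x∉ with dom x (∈-remove⁻ x∈) (λ x∈I → x∉ (∈-remove⁺ x∈I (remove-≢ x∈)))
      ... | u , u∈I , u~x with u Fin.≟ v
      ... | no u≢v = u , ∈-remove⁺ u∈I u≢v , u~x
      ... | yes refl = let (z , z∈I , z≢v , z~x) = red I p u∈I x (∈-remove⁻ x∈) u~x
                       in z , ∈-remove⁺ z∈I z≢v , z~x
    mixed : ∀ {I J} → MIS S I → MIS S J → v ∈ I → v ∉ J → I - v ≡ J - v → ⊥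
    mixed {I} {J} p q v∈I v∉J eq = v∉J (maximum q p J⊆I v∈I)
      where
      J⊆I : J ⊆ I
      J⊆I {x} x∈ = ∈-remove⁻ (subst (x ∈_) (sym eq) (∈-remove⁺ x∈ λ { refl → v∉J x∈ }))
    same : ∀ {I J} → v ∉ I → v ∉ J → I - v ≡ J - v → I ⊆ J
    same v∉I v∉J eq {x} x∈ = ∈-remove⁻ (subst (x ∈_) eq (∈-remove⁺ x∈ λ { refl → v∉I x∈ }))
    inj : ∀ {I J} → MIS S I → MIS S J → I - v ≡ J - v → I ≡ J
    inj {I} {J} p q eq with v ∈? I | v ∈? J
    ... | yes a | yes b = remove-injective a b eq
    ... | yes a | no b  = ⊥-elim (mixed p q a b eq)
    ... | no a  | yes b = ⊥-elim (mixed q p b a (sym eq))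
    ... | no a  | no b  = ⊆-antisym (same a b eq) (same b a (sym eq))

  -- A maximal independent set of S - v either dominates v already or can be extended by v, and v
  -- records which of the two happened.
  mis-remove-≤ : ∀ S v → v ∈ S → mis (S - v) ≤ mis S
  mis-remove-≤ S v v∈S = count-injection (MIS? (S - v)) (MIS? S) (subsets n) (subsets n)
    (subsets-unique n) (subsets-complete n) extend ok inj
    where
    free? : ∀ I → Dec (∃ λ u → u ∈ I × u ~ v)
    free? I = any? λ u → (u ∈? I) ×-dec (u ~? v)
    extend : Subset n → Subset n
    extend I with free? I
    ... | yes _ = I
    ... | no _  = I ∪ ⁅ v ⁆
    ok : ∀ {I} → MIS (S - v) I → MIS S (extend I)
    ok {I} (I⊆ , ind , dom) with free? I
    ... | yes (u , u∈I , u~v) = (∈-remove⁻ ∘ I⊆) , ind , dom′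
      where
      dom′ : Dominating S I
      dom′ x x∈S x∉ with x Fin.≟ v
      ... | yes refl = u , u∈I , u~v
      ... | no x≢v = dom x (∈-remove⁺ x∈S x≢v) x∉
    ... | no ¬u = insert-⊆ (∈-remove⁻ ∘ I⊆) v∈S , independent-insert G ind (λ u u∈ e → ¬u (u , u∈ , e)) , dom′
      where
      dom′ : Dominating S (I ∪ ⁅ v ⁆)
      dom′ x x∈S x∉ with x Fin.≟ v
      ... | yes refl = contradiction (v∈I∪⁅v⁆) x∉
      ... | no x≢v = let (u , u∈I , e) = dom x (∈-remove⁺ x∈S x≢v) (x∉ ∘ x∈p∪q⁺ ∘ inj₁)
                     in u , x∈p∪q⁺ (inj₁ u∈I) , e
    v∉ : ∀ {I} → MIS (S - v) I → v ∉ I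
    v∉ (I⊆ , _) v∈ = ∉-remove {S = S} (I⊆ v∈)
    inj : ∀ {I J} → MIS (S - v) I → MIS (S - v) J → extend I ≡ extend J → I ≡ J
    inj {I} {J} p q eq with free? I | free? J
    ... | yes _ | yes _ = eq
    ... | yes _ | no _  = contradiction (subst (v ∈_) (sym eq) (v∈I∪⁅v⁆)) (v∉ p)
    ... | no _  | yes _ = contradiction (subst (v ∈_) eq (v∈I∪⁅v⁆)) (v∉ q)
    ... | no _  | no _  = ∪⁅⁆-injective (v∉ p) (v∉ q) eq

  mis-mono : ∀ {S T} → T ⊆ S → mis T ≤ mis S
  mis-mono {S} {T} = go ∣ S ∣ ≤-refl
    where
    go : ∀ k {S} → ∣ S ∣ ≤ k → T ⊆ S → mis T ≤ mis S
    go k {S} b sub with any? (λ v → (v ∈? S) ×-dec ¬? (v ∈? T))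
    ... | no ¬v = ≤-reflexive (cong mis (⊆-antisym sub λ {x} x∈ →
                    decidable-stable (x ∈? T) λ x∉ → ¬v (x , x∈ , x∉)))
    go zero b sub | yes (v , v∈S , v∉T) =
      contradiction (≤-trans (≤-reflexive (size-remove v∈S)) b) λ ()
    go (suc k) {S} b sub | yes (v , v∈S , v∉T) = ≤-trans
      (go k (ℕ.≤-pred (≤-trans (≤-reflexive (size-remove v∈S)) b)) (⊆-remove sub v∉T))
      (mis-remove-≤ S v v∈S)

  -- If every maximal independent set of S - v contains a neighbour of v, it stays maximal in S.
  mis-branch-≥ : ∀ S v → v ∈ S → (∀ I → MIS (S - v) I → ∃ λ u → u ∈ I × u ~ v) →
    mis (S - v) + mis (S ⊖ v) ≤ mis S
  mis-branch-≥ S v v∈S hit = ≤-trans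
    (+-mono-≤ (count-injection (MIS? (S - v)) (λ I → MIS? S I ×-dec ¬? (v ∈? I)) (subsets n) (subsets n)
      (subsets-unique n) (subsets-complete n) id (λ p → ok p , v∉ p) (λ _ _ → id)) (containing-≥ v∈S))
    (count-++ (MIS? S) (λ I → MIS? S I ×-dec ¬? (v ∈? I)) (λ I → MIS? S I ×-dec (v ∈? I)) (subsets n) (subsets-unique n) proj₁ proj₁
      λ (_ , v∉) (_ , v∈) → v∉ v∈)
    where
    v∉ : ∀ {I} → MIS (S - v) I → v ∉ I
    v∉ (I⊆ , _) v∈ = ∉-remove {S = S} (I⊆ v∈)
    ok : ∀ {I} → MIS (S - v) I → MIS S I
    ok {I} p@(I⊆ , ind , dom) = (∈-remove⁻ ∘ I⊆) , ind , dom′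
      where
      dom′ : Dominating S I
      dom′ x x∈S x∉ with x Fin.≟ v
      ... | yes refl = hit I p
      ... | no x≢v = dom x (∈-remove⁺ x∈S x≢v) x∉

  -- An independent set meets a clique at most once, so the families of sets containing the various
  -- y are disjoint.
  mis-clique-≥ : ∀ {S} ys → All (_∈ S) ys → AllPairs _~_ ys →
    sum (map (λ y → mis (S ⊖ y)) ys) ≤ mis S
  mis-clique-≥ {S} ys ys⊆S clique = ≤-trans (go ys ys⊆S clique)
    (count-injection _ (MIS? S) (subsets n) (subsets n) (subsets-unique n) (subsets-complete n)
      id proj₁ λ _ _ → id)
    where
    meet? : ∀ ys I → Dec (Any (_∈ I) ys)
    meet? ys I = Any.any? (_∈? I) ys
    go : ∀ ys → All (_∈ S) ys → AllPairs _~_ ys →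
         sum (map (λ y → mis (S ⊖ y)) ys) ≤ count (λ I → MIS? S I ×-dec meet? ys I) (subsets n)
    go [] _ _ = z≤n
    go (y ∷ ys) (y∈ ∷ a) (e ∷ es) = ≤-trans (+-mono-≤ (containing-≥ y∈) (go ys a es))
      (count-++ _ (λ I → MIS? S I ×-dec (y ∈? I)) (λ I → MIS? S I ×-dec meet? ys I) (subsets n) (subsets-unique n) (λ (p , q) → p , here q) (λ (p , q) → p , there q)
        λ ((_ , ind , _) , y∈I) (_ , any) → apart ind y∈I e any)
      where
      apart : ∀ {I zs} → Independent G I → y ∈ I → All (y ~_) zs → Any (_∈ I) zs → ⊥
      apart ind y∈I (e ∷ _) (here z∈) = ind _ _ y∈I z∈ e
      apart ind y∈I (_ ∷ es) (there any) = apart ind y∈I es any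

  mis-empty : ∀ {S} → (∀ v → v ∉ S) → mis S ≡ 1
  mis-empty {S} none = ℕ.≤-antisym upper lower
    where
    upper : mis S ≤ 1
    upper = count-injection (MIS? S) (λ (_ : ⊤) → yes tt) (subsets n) (tt ∷ []) (subsets-unique n)
      (λ _ → here refl) _ (λ _ → tt)
      λ (I⊆ , _) (J⊆ , _) _ → ⊆-antisym (λ x∈ → contradiction (I⊆ x∈) (none _)) (λ x∈ → contradiction (J⊆ x∈) (none _))
    lower : 1 ≤ mis S
    lower = count-injection (λ (_ : ⊤) → yes tt) (MIS? S) (tt ∷ []) (subsets n) ([] ∷ [])
      (subsets-complete n) (λ _ → ∅)
      (λ _ → (λ x∈ → contradiction x∈ ∉⊥) , (λ _ _ x∈ _ _ → ∉⊥ x∈) , λ v v∈ → contradiction v∈ (none v))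
      λ _ _ _ → refl

  mis≡m : mis full ≡ m G
  mis≡m = ℕ.≤-antisym
    (count-injection (MIS? full) (maximalIndependent? G) (subsets n) (subsets n) (subsets-unique n)
      (subsets-complete n) id to (λ _ _ → id))
    (count-injection (maximalIndependent? G) (MIS? full) (subsets n) (subsets n) (subsets-unique n)
      (subsets-complete n) id from (λ _ _ → id))
    where
    to : ∀ {I} → MIS full I → MaximalIndependent G I
    to {I} (_ , ind , dom) = ind , λ (J , (I⊆J , x , x∈J , x∉I) , indJ) →
      let (u , u∈I , u~x) = dom x ∈⊤ x∉I in indJ u x (I⊆J u∈I) x∈J u~x
    from : ∀ {I} → MaximalIndependent G I → MIS full I
    from {I} (ind , max) = (λ _ → ∈⊤) , ind , dom
      where
      dom : Dominating full I
      dom v _ v∉ with any? (λ u → (u ∈? I) ×-dec (u ~? v))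
      ... | yes p = p
      ... | no ¬p = ⊥-elim (max (I ∪ ⁅ v ⁆ , (x∈p∪q⁺ ∘ inj₁ , v , v∈I∪⁅v⁆ , v∉) , independent-insert G ind (λ u u∈ e → ¬p (u , u∈ , e))))

  -- Paths and cycles

  data Reach (T : Subset n) : Fin n → Fin n → Set where
    stop : ∀ {a} → a ∈ T → Reach T a a
    step : ∀ {a b c} → a ∈ T → a ~ c → Reach T c b → Reach T a b

  reach-source : ∀ {T a b} → Reach T a b → a ∈ T
  reach-source (stop p)     = p
  reach-source (step p _ _) = p

  reach-target : ∀ {T a b} → Reach T a b → b ∈ T
  reach-target (stop p)     = p
  reach-target (step _ _ r) = reach-target r

  reach-trans : ∀ {T a b c} → Reach T a b → Reach T b c → Reach T a c
  reach-trans (stop _)     s = s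
  reach-trans (step p e r) s = step p e (reach-trans r s)

  reach-edge : ∀ {T a b} → a ∈ T → b ∈ T → a ~ b → Reach T a b
  reach-edge p q e = step p e (stop q)

  reach-sym : ∀ {T a b} → Reach T a b → Reach T b a
  reach-sym (stop p)     = stop p
  reach-sym (step p e r) = reach-trans (reach-sym r) (reach-edge (reach-source r) p (~-sym e))

  reach-mono : ∀ {S T a b} → T ⊆ S → Reach T a b → Reach S a b
  reach-mono sub (stop p)     = stop (sub p)
  reach-mono sub (step p e r) = step (sub p) e (reach-mono sub r)

  reach-avoid : ∀ {T a b u} → Reach T a b → (∀ c → Reach T a c → c ≢ u) → Reach (T - u) a b
  reach-avoid (stop p)     f = stop (∈-remove⁺ p (f _ (stop p)))
  reach-avoid (step p e r) f = step (∈-remove⁺ p (f _ (stop p))) e (reach-avoid r λ c s → f c (step p e s))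

  reach-exit : ∀ {S} T {a b} → Reach S a b → a ∈ T →
    Reach T a b ⊎ ∃₂ λ c d → Reach T a c × c ~ d × d ∈ S × d ∉ T
  reach-exit T (stop _) a∈ = inj₁ (stop a∈)
  reach-exit T (step {c = c} _ e r) a∈ with c ∈? T
  ... | no c∉ = inj₂ (_ , c , stop a∈ , e , reach-source r , c∉)
  ... | yes c∈ with reach-exit T r c∈
  ... | inj₁ s = inj₁ (step a∈ e s)
  ... | inj₂ (x , y , s , rest) = inj₂ (x , y , step a∈ e s , rest)

  -- In contrast to `Reach` every visited vertex is deleted, so a path repeats no vertex. `Reach` is
  -- convenient for composition; `Path` serves for deciding reachability and for building cycles.
  data Path : Subset n → Fin n → Fin n → Set where
    stop : ∀ {T a} → a ∈ T → Path T a a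
    step : ∀ {T a b c} → a ∈ T → a ~ c → Path (T - a) c b → Path T a b

  remove-mono : ∀ {S T : Subset n} {v} → T ⊆ S → T - v ⊆ S - v
  remove-mono sub x∈ = ∈-remove⁺ (sub (∈-remove⁻ x∈)) (remove-≢ x∈)

  path-mono : ∀ {S T a b} → T ⊆ S → Path T a b → Path S a b
  path-mono sub (stop p)     = stop (sub p)
  path-mono sub (step p e r) = step (sub p) e (path-mono (remove-mono sub) r)

  path⇒reach : ∀ {T a b} → Path T a b → Reach T a b
  path⇒reach (stop p)     = stop p
  path⇒reach (step p e r) = step p e (reach-mono ∈-remove⁻ (path⇒reach r))

  remove-comm : ∀ {S : Subset n} {u v} → S - u - v ⊆ S - v - u
  remove-comm x∈ = let y∈ = ∈-remove⁻ x∈ in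
    ∈-remove⁺ (∈-remove⁺ (∈-remove⁻ y∈) (remove-≢ x∈)) (remove-≢ y∈)

  -- Loop erasure for `reach⇒path`: a path that meets a is cut down to its part from a onward.
  path-split : ∀ {T c b} a → Path T c b → Path (T - a) c b ⊎ Path T a b
  path-split {c = c} a (stop p) with c Fin.≟ a
  ... | yes refl = inj₂ (stop p)
  ... | no c≢a   = inj₁ (stop (∈-remove⁺ p c≢a))
  path-split {c = c} a (step p e r) with c Fin.≟ a
  ... | yes refl = inj₂ (step p e r)
  ... | no c≢a with path-split a r
  ... | inj₁ s = inj₁ (step (∈-remove⁺ p c≢a) e (path-mono remove-comm s))
  ... | inj₂ s = inj₂ (path-mono ∈-remove⁻ s)

  reach⇒path : ∀ {T a b} → Reach T a b → Path T a b
  reach⇒path (stop p) = stop p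
  reach⇒path {a = a} (step p e r) with path-split a (reach⇒path r)
  ... | inj₁ s = step p e s
  ... | inj₂ s = s

  path? : ∀ k {T} → ∣ T ∣ ≤ k → ∀ a b → Dec (Path T a b)
  path? k {T} bound a b with a ∈? T | a Fin.≟ b
  ... | no a∉  | _        = no λ { (stop p) → a∉ p ; (step p _ _) → a∉ p }
  ... | yes a∈ | yes refl = yes (stop a∈)
  path? zero bound a b | yes a∈ | no _ = contradiction (≤-trans (≤-reflexive (size-remove a∈)) bound) λ ()
  path? (suc k) {T} bound a b | yes a∈ | no a≢b = map′
    (λ (c , e , r) → step a∈ e r)
    (λ { (stop _) → contradiction refl a≢b ; (step _ e r) → _ , e , r })
    (any? λ c → (a ~? c) ×-dec path? k (ℕ.≤-pred (≤-trans (≤-reflexive (size-remove a∈)) bound)) c b)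

  reach? : ∀ T a b → Dec (Reach T a b)
  reach? T a b = map′ path⇒reach reach⇒path (path? ∣ T ∣ ≤-refl a b)

  len : ∀ {T a b} → Path T a b → ℕ
  len (stop _)     = 0
  len (step _ _ r) = suc (len r)

  verts : ∀ {T a b} (p : Path T a b) → Vec (Fin n) (suc (len p))
  verts {a = a} (stop _)     = a ∷ []
  verts {a = a} (step _ _ r) = a ∷ verts r

  verts-head : ∀ {T a b} (p : Path T a b) → lookup (verts p) 0F ≡ a
  verts-head (stop _)     = refl
  verts-head (step _ _ _) = refl

  verts-last : ∀ {T a b} (p : Path T a b) i → toℕ i ≡ len p → lookup (verts p) i ≡ b
  verts-last (stop _)     0F      _  = refl
  verts-last (step _ _ r) (suc i) eq = verts-last r i (ℕ.suc-injective eq)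

  verts-∈ : ∀ {T a b} (p : Path T a b) i → lookup (verts p) i ∈ T
  verts-∈ (stop x)     0F      = x
  verts-∈ (step x _ _) 0F      = x
  verts-∈ (step _ _ r) (suc i) = ∈-remove⁻ (verts-∈ r i)

  verts-injective : ∀ {T a b} (p : Path T a b) i j → lookup (verts p) i ≡ lookup (verts p) j → i ≡ j
  verts-injective (stop _)     0F      0F      _  = refl
  verts-injective (step _ _ _) 0F      0F      _  = refl
  verts-injective (step _ _ r) 0F      (suc j) eq = contradiction (sym eq) (remove-≢ (verts-∈ r j))
  verts-injective (step _ _ r) (suc i) 0F      eq = contradiction eq (remove-≢ (verts-∈ r i))
  verts-injective (step _ _ r) (suc i) (suc j) eq = cong suc (verts-injective r i j eq)

  verts-adjacent : ∀ {T a b} (p : Path T a b) i j → suc (toℕ i) ≡ toℕ j →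
                   lookup (verts p) i ~ lookup (verts p) j
  verts-adjacent (stop _)     0F      0F      ()
  verts-adjacent (step _ e r) 0F      (suc 0F) eq = subst (_ ~_) (sym (verts-head r)) e
  verts-adjacent (step _ _ r) (suc i) (suc j) eq = verts-adjacent r i j (ℕ.suc-injective eq)

  module _ {T v a b} (v∉T : v ∉ T) (p : Path T a b) (a≢b : a ≢ b) (v~a : v ~ a) (v~b : v ~ b) where
    open RawSubgraph

    private
      k : ℕ
      k = suc (suc (len p))

      vs : Vec (Fin n) k
      vs = v ∷ verts p

      _≈_ = Graph._~_ (C k)
      _≈?_ = Graph._~?_ (C k)

      vertex? : U.Decidable (λ u → ∃ λ i → lookup vs i ≡ u)
      vertex? u = any? λ i → lookup vs i Fin.≟ u

      ends? : ∀ u → U.Decidable (λ w → ∃₂ λ i j → lookup vs i ≡ u × lookup vs j ≡ w × i ≈ j)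
      ends? u w = any? λ i → any? λ j → (lookup vs i Fin.≟ u) ×-dec (lookup vs j Fin.≟ w) ×-dec (i ≈? j)

      H : RawSubgraph n
      H = raw (comprehension vertex?) (tabulate λ u → comprehension (ends? u))

      edge⁺ : ∀ {u w} → (∃₂ λ i j → lookup vs i ≡ u × lookup vs j ≡ w × i ≈ j) → Edge H u w
      edge⁺ {u} {w} q = subst (w ∈_) (sym (lookup∘tabulate _ u)) (∈-comprehension⁺ (ends? u) q)

      edge⁻ : ∀ {u w} → Edge H u w → ∃₂ λ i j → lookup vs i ≡ u × lookup vs j ≡ w × i ≈ j
      edge⁻ {u} {w} e = ∈-comprehension⁻ (ends? u) (subst (w ∈_) (lookup∘tabulate _ u) e)

      vs-injective : ∀ i j → lookup vs i ≡ lookup vs j → i ≡ j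
      vs-injective 0F      0F      _  = refl
      vs-injective 0F      (suc j) eq = contradiction (subst (_∈ T) (sym eq) (verts-∈ p j)) v∉T
      vs-injective (suc i) 0F      eq = contradiction (subst (_∈ T) eq (verts-∈ p i)) v∉T
      vs-injective (suc i) (suc j) eq = cong suc (verts-injective p i j eq)

      successor : ∀ i j → suc (toℕ i) ≡ toℕ j ⊎ (suc (toℕ i) ≡ k × toℕ j ≡ 0) → lookup vs i ~ lookup vs j
      successor 0F      (suc 0F) (inj₁ _)        = subst (v ~_) (sym (verts-head p)) v~a
      successor (suc i) (suc j)  (inj₁ eq)       = verts-adjacent p i j (ℕ.suc-injective eq)
      successor (suc i) 0F       (inj₂ (eq , _)) = subst (_~ v)
        (sym (verts-last p i (ℕ.suc-injective (ℕ.suc-injective eq)))) (~-sym v~b)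
      successor 0F      0F       (inj₂ (() , _))

      adjacent : ∀ i j → i ≈ j → lookup vs i ~ lookup vs j
      adjacent i j (_ , inj₁ q) = successor i j q
      adjacent i j (_ , inj₂ q) = ~-sym (successor j i q)

      sub : IsSubgraph G H
      sub u w e = let (i , j , p , q , i≈j) = edge⁻ e in
        edge⁺ (j , i , q , p , Graph.~-sym (C k) i≈j) ,
        (∈-comprehension⁺ vertex? (i , p) , ∈-comprehension⁺ vertex? (j , q)) ,
        subst₂ _~_ p q (adjacent i j i≈j)

      listing : Listing G H k vs
      listing = (λ i → ∈-comprehension⁺ vertex? (i , refl)) , vs-injective ,
        (λ w w∈ → ∈-comprehension⁻ vertex? w∈) ,
        λ i j → (λ e → let (i′ , j′ , p , q , r) = edge⁻ e in
                  subst₂ _≈_ (vs-injective i′ i p) (vs-injective j′ j q) r) ,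
                λ r → edge⁺ (i , j , refl , refl , r)

      1≤len : ∀ {T a b} (p : Path T a b) → a ≢ b → 1 ≤ len p
      1≤len (stop _)     a≢b = contradiction refl a≢b
      1≤len (step _ _ _) _   = s≤s z≤n

      last : Fin (suc (len p))
      last = Data.Fin.fromℕ (len p)
        where import Data.Fin

      toℕ-last : toℕ last ≡ len p
      toℕ-last = Fin.toℕ-fromℕ (len p)

      index : ∀ u w → u ≡ v → Edge H u w → ∃ λ j → lookup vs j ≡ w × 0F ≈ j
      index u w u≡v e = let (i , j , p , q , r) = edge⁻ e in
        j , q , subst (_≈ j) (vs-injective i 0F (trans p u≡v)) r

      only : ∀ j → 0F ≈ j → lookup vs j ≡ a ⊎ lookup vs j ≡ b
      only 0F       (0≢0 , _)                = contradiction refl 0≢0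
      only (suc 0F) _                        = inj₁ (verts-head p)
      only (suc (suc j)) (_ , inj₁ (inj₁ ()))
      only (suc (suc j)) (_ , inj₁ (inj₂ (() , _)))
      only (suc (suc j)) (_ , inj₂ (inj₂ (eq , _))) =
        inj₂ (verts-last p (suc j) (ℕ.suc-injective (ℕ.suc-injective eq)))
      only (suc (suc j)) (_ , inj₂ (inj₁ ()))

    -- The path is closed through v. The exact description of the edges at v is what later tells
    -- cycles for different pairs of neighbours apart.
    cycle-through : ∃ λ H → IsCycle G H × (∀ u → u ∈ vertices H → u ≡ v ⊎ u ∈ T) ×
      v ∈ vertices H × Edge H v a × Edge H v b × (∀ u → Edge H v u → u ≡ a ⊎ u ≡ b)
    -- Distinct ends make the path have at least one edge, so the cycle has at least three vertices.
    cycle-through = H , (sub , k , s≤s (s≤s (1≤len p a≢b)) , listing⇒≅ G H sub k (vs , listing)) ,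
      (λ u u∈ → inside-T (∈-comprehension⁻ vertex? u∈)) , ∈-comprehension⁺ vertex? (0F , refl) ,
      edge⁺ (0F , 1F , refl , verts-head p , (λ ()) , inj₁ (inj₁ refl)) ,
      edge⁺ (0F , suc last , refl , verts-last p last toℕ-last ,
        (λ ()) , inj₂ (inj₂ (cong (λ l → suc (suc l)) toℕ-last , refl))) ,
      λ u e → let (j , q , r) = index v u refl e in
        [ (λ x → inj₁ (trans (sym q) x)) , (λ x → inj₂ (trans (sym q) x)) ]′ (only j r)
      where
      inside-T : ∀ {u} → (∃ λ i → lookup vs i ≡ u) → u ≡ v ⊎ u ∈ T
      inside-T (0F    , refl) = inj₁ refl
      inside-T (suc i , refl) = inj₂ (verts-∈ p i)

  -- Cycles lost by deleting a vertex

  CycleIn : Subset n → RawSubgraph n → Set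
  CycleIn S H = IsCycle G H × RawSubgraph.vertices H ⊆ S

  CycleIn? : ∀ S → U.Decidable (CycleIn S)
  CycleIn? S H = isCycle? G H ×-dec (RawSubgraph.vertices H ⊆? S)

  cyc : Subset n → ℕ
  cyc S = count (CycleIn? S) (rawSubgraphs n)

  cyc-full : cyc full ≤ numCycles G
  cyc-full = count-injection (CycleIn? full) (isCycle? G) (rawSubgraphs n) (rawSubgraphs n)
    (rawSubgraphs-unique n) (rawSubgraphs-complete n) id proj₁ λ _ _ → id

  cyc-mono : ∀ {S T} → T ⊆ S → cyc T ≤ cyc S
  cyc-mono {S} {T} sub = count-injection (CycleIn? T) (CycleIn? S) (rawSubgraphs n) (rawSubgraphs n)
    (rawSubgraphs-unique n) (rawSubgraphs-complete n) id (λ (c , p) → c , λ x∈ → sub (p x∈)) λ _ _ → id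

  -- Such a pair closes up to a cycle through v.
  Closes : Subset n → Fin n → Fin n × Fin n → Set
  Closes S v (a , b) = a ≢ b × v ~ a × v ~ b × Reach (S - v) a b

  -- Positive form of the inequality of the sets {a, b} and {c, d}: some vertex of the first lies
  -- outside the second. It excludes that one cycle has both pairs as its neighbours at v.
  Apart : Fin n × Fin n → Fin n × Fin n → Set
  Apart (a , b) (c , d) = (a ≢ c × a ≢ d) ⊎ (b ≢ c × b ≢ d)

  -- Each pair yields a cycle through v. Its two edges at v recover the pair, so different pairs
  -- give different cycles, and none of them lies in `T` since v does not.
  cyc-pairs : ∀ {S T v} ps → T ⊆ S - v → v ∈ S → All (Closes S v) ps → AllPairs Apart ps →
    length ps + cyc T ≤ cyc S
  cyc-pairs {S} {T} {v} ps T⊆ v∈S closes apart =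
    let (Hs , eq , unique , ok) = cycles ps closes apart in
    subst (λ k → k + cyc T ≤ cyc S) eq
      (count-extra (CycleIn? T) (CycleIn? S) (rawSubgraphs n) Hs (rawSubgraphs-unique n) unique
        (rawSubgraphs-complete n) (λ (c , p) → c , λ x∈ → ∈-remove⁻ (T⊆ (p x∈))) (to-All ok))
    where
    open RawSubgraph
    record Traces (q : Fin n × Fin n) (H : RawSubgraph n) : Set where
      constructor traces
      field
        inside-S : CycleIn S H
        not-in-T : ¬ CycleIn T H
        edge₁ : Edge H v (proj₁ q)
        edge₂ : Edge H v (proj₂ q)
        no-more : ∀ u → Edge H v u → u ≡ proj₁ q ⊎ u ≡ proj₂ q
    open Traces

    data Tracing : List (Fin n × Fin n) → List (RawSubgraph n) → Set where
      []  : Tracing [] []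
      _∷_ : ∀ {q H qs Hs} → Traces q H → Tracing qs Hs → Tracing (q ∷ qs) (H ∷ Hs)

    to-All : ∀ {qs Hs} → Tracing qs Hs → All (λ H → CycleIn S H × ¬ CycleIn T H) Hs
    to-All []       = []
    to-All (t ∷ ts) = (inside-S t , not-in-T t) ∷ to-All ts

    distinct : ∀ {q r H} → Apart q r → Traces q H → ¬ Traces r H
    distinct (inj₁ (x , y)) t s = [ x , y ]′ (no-more s _ (edge₁ t))
    distinct (inj₂ (x , y)) t s = [ x , y ]′ (no-more s _ (edge₂ t))

    fresh : ∀ {q H qs Hs} → All (Apart q) qs → Traces q H → Tracing qs Hs → All (H ≢_) Hs
    fresh [] t []             = []
    fresh (a ∷ as) t (s ∷ ss) = (λ { refl → distinct a t s }) ∷ fresh as t ss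

    trace : ∀ {q} → Closes S v q → ∃ (Traces q)
    trace {a , b} (a≢b , v~a , v~b , r) =
      pack (cycle-through {v = v} (∉-remove {S = S}) (reach⇒path r) a≢b v~a v~b)
      where
      pack : (∃ λ H → IsCycle G H × (∀ u → u ∈ vertices H → u ≡ v ⊎ u ∈ S - v) ×
        v ∈ vertices H × Edge H v a × Edge H v b × (∀ u → Edge H v u → u ≡ a ⊎ u ≡ b)) →
        ∃ (Traces (a , b))
      pack (H , isC , V⊆ , v∈H , ea , eb , only) = H , record
        { inside-S = isC , λ {x} x∈ → [ (λ x≡v → subst (_∈ S) (sym x≡v) v∈S) , ∈-remove⁻ ]′ (V⊆ x x∈)
        ; not-in-T = λ (_ , p) → ∉-remove {S = S} (T⊆ (p v∈H))
        ; edge₁    = ea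
        ; edge₂    = eb
        ; no-more  = only
        }

    cycles : ∀ qs → All (Closes S v) qs → AllPairs Apart qs →
      ∃ λ Hs → length Hs ≡ length qs × Unique Hs × Tracing qs Hs
    cycles [] [] [] = [] , refl , [] , []
    cycles (q ∷ qs) (c ∷ cs) (x ∷ xs) =
      let (Hs , eq , u , ok) = cycles qs cs xs
          (H , t) = trace c
      in H ∷ Hs , cong suc eq , fresh x t ok ∷ u , t ∷ ok

  -- The bound for arbitrary graphs

  -- Quantifying over all r and h above the true values makes a bound insensitive to losses of
  -- vertices and cycles beyond those that have been counted.
  record Bounded (x : Parity → Rate) (S : Subset n) (M : ℕ) : Set where
    constructor bounded
    field
      at : ∀ p r h → cyc S ≤ r → ∣ S ∣ + r ≤ val p + 2 * h → Bound (x p) M r h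

  record Loses (k s : ℕ) (T S : Subset n) : Set where
    constructor loses
    field
      fewer-vertices : k + ∣ T ∣ ≤ ∣ S ∣
      fewer-cycles   : s + cyc T ≤ cyc S

  rearrange : ∀ k s t r → (k + s) + (t + r) ≡ (k + t) + (s + r)
  rearrange = solve 4 (λ k s t r → (k :+ s) :+ (t :+ r) := (k :+ t) :+ (s :+ r)) refl
    where open +-*-Solver

  bounded-lose : ∀ {k s T S M} x → Loses k s T S → Bounded x T M → Bounded (drop k s x) S M
  bounded-lose {k} {s} {T} {S} {M} x (loses kT sT) (bounded b) = bounded bound-at
    where
    bound-at : ∀ p r h → cyc S ≤ r → ∣ S ∣ + r ≤ val p + 2 * h → Bound (drop k s x p) M r h
    bound-at p r h cyc≤ size≤ = subst₂ (Bound (drop k s x p) M) s+r′≡r h-eq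
        (Bound-scale (x (shift p (k + s))) s (halves p (k + s)) (b _ r′ h′ cycT≤ size′))
      where
      s≤r : s ≤ r
      s≤r = ≤-trans (ℕ.m≤m+n s _) (≤-trans sT cyc≤)
      r′ = r ∸ s
      s+r′≡r : s + r′ ≡ r
      s+r′≡r = ℕ.m+[n∸m]≡n s≤r
      cycT≤ : cyc T ≤ r′
      cycT≤ = ℕ.+-cancelˡ-≤ s _ _ (≤-trans sT (≤-trans cyc≤ (≤-reflexive (sym s+r′≡r))))
      split = borrow-≤ p (k + s) {∣ T ∣ + r′} {h} (begin
        (k + s) + (∣ T ∣ + r′) ≡⟨ rearrange k s ∣ T ∣ r′ ⟩
        (k + ∣ T ∣) + (s + r′) ≤⟨ +-mono-≤ kT (≤-reflexive s+r′≡r) ⟩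
        ∣ S ∣ + r              ≤⟨ size≤ ⟩
        val p + 2 * h          ∎)
        where open ≤-Reasoning
      h′ = proj₁ split
      h-eq = proj₁ (proj₂ split)
      size′ = proj₂ (proj₂ split)

  bounded-+ : ∀ {S M N} x y → Bounded x S M → Bounded y S N → Bounded (x ⊞ y) S (M + N)
  bounded-+ x y (bounded a) (bounded b) =
    bounded λ p r h c≤ s≤ → Bound-+ (x p) (y p) (a p r h c≤ s≤) (b p r h c≤ s≤)

  bounded-≤ : ∀ {S M M′} x → M′ ≤ M → Bounded x S M → Bounded x S M′
  bounded-≤ x le (bounded b) = bounded λ p r h c≤ s≤ → Bound-≤ (x p) le (b p r h c≤ s≤)

  bounded-weaken : ∀ {S M} x y → (∀ p → T (x p ≼ᵇ y p)) → Bounded x S M → Bounded y S M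
  bounded-weaken x y le (bounded b) = bounded λ p r h c≤ s≤ → Bound-weaken (x p) (y p) (le p) (b p r h c≤ s≤)

  HasRate : (Parity → Rate) → Subset n → Set
  HasRate x S = Bounded x S (mis S)

  Nbhd⊆ : Subset n → Fin n → List (Fin n) → Set
  Nbhd⊆ S v xs = ∀ u → u ∈ S → v ~ u → u ∈ₗ xs

  neighbour? : ∀ S v xs → (∃ λ u → u ∈ S × v ~ u × u ∉ₗ xs) ⊎ Nbhd⊆ S v xs
  neighbour? S v xs with any? (λ u → (u ∈? S) ×-dec ((v ~? u) ×-dec ¬? (u ∈ₗ? xs)))
  ... | yes p = inj₁ p
  ... | no ¬p = inj₂ λ u u∈ e → decidable-stable (u ∈ₗ? xs) λ u∉ → ¬p (u , u∈ , e , u∉)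

  nbhd₁ : ∀ {S v x u} → Nbhd⊆ S v (x ∷ []) → u ∈ S → v ~ u → u ≡ x
  nbhd₁ nb u∈ e with nb _ u∈ e
  ... | here eq = eq

  nbhd₂ : ∀ {S v x y u} → Nbhd⊆ S v (x ∷ y ∷ []) → u ∈ S → v ~ u → u ≡ x ⊎ u ≡ y
  nbhd₂ nb u∈ e with nb _ u∈ e
  ... | here eq         = inj₁ eq
  ... | there (here eq) = inj₂ eq

  nbhd₃ : ∀ {S v x y z u} → Nbhd⊆ S v (x ∷ y ∷ z ∷ []) → u ∈ S → v ~ u → u ≡ x ⊎ u ≡ y ⊎ u ≡ z
  nbhd₃ nb u∈ e with nb _ u∈ e
  ... | here eq                 = inj₁ eq
  ... | there (here eq)         = inj₂ (inj₁ eq)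
  ... | there (there (here eq)) = inj₂ (inj₂ eq)

  nbhd-reverse : ∀ {S v xs} → Nbhd⊆ S v xs → Nbhd⊆ S v (reverse xs)
  nbhd-reverse nb u u∈ e = reverse⁺ (nb u u∈ e)

  nbhd-within : ∀ {S v xs ys} → All (_∈ₗ ys) xs → Nbhd⊆ S v xs → Nbhd⊆ S v ys
  nbhd-within sub nb u u∈ e = All.lookup sub (nb u u∈ e)

  nbhd-mono : ∀ {S T v xs} → T ⊆ S → Nbhd⊆ S v xs → Nbhd⊆ T v xs
  nbhd-mono sub nb u u∈ = nb u (sub u∈)

  nbhd-remove : ∀ {S v x xs} → Nbhd⊆ S v (x ∷ xs) → Nbhd⊆ (S - x) v xs
  nbhd-remove nb u u∈ e with nb u (∈-remove⁻ u∈) e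
  ... | here eq = contradiction eq (remove-≢ u∈)
  ... | there m = m

  closed-reach : ∀ {S xs a b} → All (λ v → Nbhd⊆ S v xs) xs → a ∈ₗ xs → Reach S a b → b ∈ₗ xs
  closed-reach closed a∈ (stop _)     = a∈
  closed-reach closed a∈ (step _ e r) = closed-reach closed (All.lookup closed a∈ _ (reach-source r) e) r

  fresh-∷ : ∀ {x : Fin n} {xs} → x ∉ₗ xs → Unique xs → Unique (x ∷ xs)
  fresh-∷ {x} {xs} x∉ u = All.tabulate (λ y∈ x≡y → x∉ (subst (_∈ₗ xs) (sym x≡y) y∈)) ∷ u

  Nbrs : Subset n → Fin n → List (Fin n) → Set
  Nbrs S v us = Unique us × All (λ u → u ∈ S × v ~ u) us

  ∉-⊖ : ∀ {S u v} → v ~ u → u ∉ S ⊖ v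
  ∉-⊖ e u∈ = proj₂ (proj₂ (∈-⊖⁻ u∈)) e

  ⊖⊆remove : ∀ {S v} → S ⊖ v ⊆ S - v
  ⊖⊆remove x∈ = let (a , b , _) = ∈-⊖⁻ x∈ in ∈-remove⁺ a b

  size-⊖ : ∀ {S v} us → v ∈ S → Nbrs S v us → suc (length us) + ∣ S ⊖ v ∣ ≤ ∣ S ∣
  size-⊖ {S} {v} us v∈S (u , a) = size-drop (v ∷ us) (λ x∈ → proj₁ (∈-⊖⁻ x∈))
    (All.map (λ (_ , e) → ~⇒≢ e) a ∷ u)
    ((v∈S , λ v∈ → proj₁ (proj₂ (∈-⊖⁻ v∈)) refl) ∷ All.map (λ (u∈ , e) → u∈ , ∉-⊖ e) a)

  Connects : Subset n → Fin n → List (Fin n × Fin n) → Set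
  Connects S v ps = All (Closes S v) ps × AllPairs Apart ps

  loses-remove : ∀ {S v ps} → v ∈ S → Connects S v ps → Loses 1 (length ps) (S - v) S
  loses-remove {ps = ps} v∈S (cl , ap) = loses (≤-reflexive (size-remove v∈S)) (cyc-pairs ps id v∈S cl ap)

  loses-⊖ : ∀ {S v us ps} → v ∈ S → Nbrs S v us → Connects S v ps →
            Loses (suc (length us)) (length ps) (S ⊖ v) S
  loses-⊖ {us = us} {ps} v∈S nb (cl , ap) = loses (size-⊖ us v∈S nb) (cyc-pairs ps ⊖⊆remove v∈S cl ap)

  loses-trans : ∀ {S T U k s k′ s′} → Loses k s T S → Loses k′ s′ U T → Loses (k + k′) (s + s′) U S
  loses-trans {S} {T} {U} {k} {s} {k′} {s′} (loses a b) (loses c d) = loses (glue a c) (glue b d)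
    where
    glue : ∀ {k k′ x y z} → k + x ≤ z → k′ + y ≤ x → k + k′ + y ≤ z
    glue {k} {k′} {x} {y} p q = ≤-trans (≤-reflexive (ℕ.+-assoc k k′ y)) (≤-trans (ℕ.+-monoʳ-≤ k q) p)

  branch-rate : ∀ {S v us ps} x y → v ∈ S → Nbrs S v us → Connects S v ps →
    HasRate x (S - v) → HasRate y (S ⊖ v) →
    HasRate (drop 1 (length ps) x ⊞ drop (suc (length us)) (length ps) y) S
  branch-rate {S} {v} x y v∈S nb cn a b = bounded-≤ _ (mis-branch S v)
    (bounded-+ _ _ (bounded-lose x (loses-remove v∈S cn) a) (bounded-lose y (loses-⊖ v∈S nb cn) b))

  mis-leaf : ∀ {S v y} → v ∈ S → Nbhd⊆ S v (y ∷ []) → mis S ≤ mis (S ⊖ v) + mis (S ⊖ y)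
  mis-leaf {S} {v} {y} v∈ nb = subst (λ z → mis S ≤ mis (S ⊖ v) + z) (ℕ.+-identityʳ _)
    (mis-closedNbhd (v ∷ y ∷ []) v∈ (here refl) λ u u∈ e → there (nb u u∈ e))

  mis-triangle : ∀ {S v y z} → v ∈ S → Nbhd⊆ S v (y ∷ z ∷ []) →
    mis S ≤ mis (S ⊖ v) + (mis (S ⊖ y) + mis (S ⊖ z))
  mis-triangle {S} {v} {y} {z} v∈ nb = subst (λ t → mis S ≤ mis (S ⊖ v) + (mis (S ⊖ y) + t)) (ℕ.+-identityʳ _)
    (mis-closedNbhd (v ∷ y ∷ z ∷ []) v∈ (here refl) λ u u∈ e → there (nb u u∈ e))

  mis-isolated : ∀ {S v} → v ∈ S → Nbhd⊆ S v [] → mis S ≤ mis (S - v)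
  mis-isolated {S} {v} v∈ nb = ≤-trans (subst (mis S ≤_) (ℕ.+-identityʳ _)
    (mis-closedNbhd (v ∷ []) v∈ (here refl) λ u u∈ e → there (nb u u∈ e))) (mis-mono ⊖⊆remove)

  no-pairs : ∀ {S v} → Connects S v []
  no-pairs = [] , []

  one-pair : ∀ {S v q} → Closes S v q → Connects S v (q ∷ [])
  one-pair c = c ∷ [] , [] ∷ []

  leaf-rate : ∀ {S v y z} → v ∈ S → y ∈ S → z ∈ S → v ~ y → y ~ z → z ≢ v → Nbhd⊆ S v (y ∷ []) →
    HasRate general (S ⊖ v) → HasRate general (S ⊖ y) → HasRate leafy S
  leaf-rate {S} {v} {y} {z} v∈ y∈ z∈ v~y y~z z≢v nb a b =
    bounded-weaken (drop 2 0 general ⊞ drop 3 0 general) leafy (λ { ev → tt ; od → tt })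
      (bounded-≤ _ (mis-leaf v∈ nb) (bounded-+ _ _
        (bounded-lose general (loses-⊖ {us = y ∷ []} v∈ (([] ∷ []) , (y∈ , v~y) ∷ []) no-pairs) a)
        (bounded-lose general (loses-⊖ {us = z ∷ v ∷ []} y∈
          (((z≢v ∷ []) ∷ [] ∷ []) , (z∈ , y~z) ∷ (v∈ , ~-sym v~y) ∷ []) no-pairs) b)))

  -- Local form of not being a cut vertex: S may be disconnected, and only the neighbours of v have
  -- to stay linked.
  Noncut : Subset n → Fin n → Set
  Noncut S v = ∀ a b → a ∈ S → b ∈ S → v ~ a → v ~ b → Reach (S - v) a b

  -- A connected set U next to a vertex v is enlarged by v until it contains all neighbours of v.
  noncut-exists : ∀ {S v} → v ∈ S → ∃ λ w → w ∈ S × Noncut S w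
  noncut-exists {S} {v} v∈S = grow ∣ S ∣ ∅ v (ℕ.m≤m+n _ _) (λ p → contradiction p ∉⊥) v∈S ∉⊥
    (λ _ _ p → contradiction p ∉⊥) λ _ p → contradiction p ∉⊥
    where
    grow : ∀ k U v → ∣ S ∣ ≤ k + ∣ U ∣ → U ⊆ S → v ∈ S → v ∉ U → (∀ a b → a ∈ U → b ∈ U → Reach U a b) →
           (∀ a → a ∈ U → ∃ λ u → u ∈ U × u ~ v) → ∃ λ w → w ∈ S × Noncut S w
    grow k U v bound U⊆S v∈S v∉U conn adj
      with any? (λ y → (y ∈? S) ×-dec ((v ~? y) ×-dec ¬? (y ∈? U)))
    ... | no ¬y = v , v∈S , λ a b a∈ b∈ v~a v~b →
      reach-mono (⊆-remove U⊆S v∉U) (conn a b (inU a a∈ v~a) (inU b b∈ v~b))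
      where
      inU : ∀ a → a ∈ S → v ~ a → a ∈ U
      inU a a∈ v~a = decidable-stable (a ∈? U) λ a∉ → ¬y (a , a∈ , v~a , a∉)
    grow zero U v bound U⊆S v∈S v∉U conn adj | yes _ =
      contradiction (≤-trans (size-drop (v ∷ []) U⊆S ([] ∷ []) ((v∈S , v∉U) ∷ [])) bound) (ℕ.n≮n _)
    grow (suc k) U v bound U⊆S v∈S v∉U conn adj | yes (y , y∈S , v~y , y∉U) =
      grow k U′ y bound′ U′⊆S y∈S y∉U′ conn′ λ _ _ → v , v∈U′ , v~y
      where
      U′ = U ∪ ⁅ v ⁆
      v∈U′ : v ∈ U′
      v∈U′ = x∈p∪q⁺ (inj₂ (x∈⁅x⁆ v))
      old : U ⊆ U′
      old x∈ = x∈p∪q⁺ (inj₁ x∈)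
      cases : ∀ {x} → x ∈ U′ → x ∈ U ⊎ x ≡ v
      cases x∈ = [ inj₁ , inj₂ ∘ x∈⁅y⁆⇒x≡y v ]′ (x∈p∪q⁻ U ⁅ v ⁆ x∈)
      bound′ : ∣ S ∣ ≤ k + ∣ U′ ∣
      bound′ = ≤-trans bound (≤-trans (≤-reflexive (sym (ℕ.+-suc k _)))
        (ℕ.+-monoʳ-≤ k (size-drop (v ∷ []) old ([] ∷ []) ((v∈U′ , v∉U) ∷ []))))
      U′⊆S : U′ ⊆ S
      U′⊆S x∈ = [ U⊆S , (λ e → subst (_∈ S) (sym e) v∈S) ]′ (cases x∈)
      y∉U′ : y ∉ U′
      y∉U′ y∈ = [ y∉U , (λ e → ~⇒≢ v~y (sym e)) ]′ (cases y∈)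
      toV : ∀ {x} → x ∈ U′ → Reach U′ x v
      toV x∈ with cases x∈
      ... | inj₂ refl = stop v∈U′
      ... | inj₁ x∈U = let (u , u∈ , u~v) = adj _ x∈U in
        reach-trans (reach-mono old (conn _ u x∈U u∈)) (reach-edge (old u∈) v∈U′ u~v)
      conn′ : ∀ a b → a ∈ U′ → b ∈ U′ → Reach U′ a b
      conn′ a b a∈ b∈ = reach-trans (toV a∈) (reach-sym (toV b∈))

  record TriangleComponent (S : Subset n) (x y z : Fin n) : Set where
    field
      x∈ : x ∈ S
      y∈ : y ∈ S
      z∈ : z ∈ S
      x~y : x ~ y
      x~z : x ~ z
      y~z : y ~ z
      x-nbhd : Nbhd⊆ S x (y ∷ z ∷ [])
      y-nbhd : Nbhd⊆ S y (x ∷ z ∷ [])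
      z-nbhd : Nbhd⊆ S z (x ∷ y ∷ [])

  record EdgeComponent (S : Subset n) (x y : Fin n) : Set where
    field
      x∈ : x ∈ S
      y∈ : y ∈ S
      x~y : x ~ y
      x-nbhd : Nbhd⊆ S x (y ∷ [])
      y-nbhd : Nbhd⊆ S y (x ∷ [])

  -- Components are peeled off one by one, a of them K₃ and b of them K₂. The labels Q₃ and Q₂ are
  -- trivial in `Clustered`; later they record which vertices of a component a hub is joined to.
  data Clusters (Q₃ : Fin n → Fin n → Fin n → Set) (Q₂ : Fin n → Fin n → Set) : Subset n → ℕ → ℕ → Set where
    empty : ∀ {S} → (∀ v → v ∉ S) → Clusters Q₃ Q₂ S 0 0
    triangle : ∀ {S x y z a b} → TriangleComponent S x y z → Q₃ x y z →
      Clusters Q₃ Q₂ (S - x - y - z) a b → Clusters Q₃ Q₂ S (suc a) b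
    edge : ∀ {S x y a b} → EdgeComponent S x y → Q₂ x y →
      Clusters Q₃ Q₂ (S - x - y) a b → Clusters Q₃ Q₂ S a (suc b)

  Clustered : Subset n → ℕ → ℕ → Set
  Clustered = Clusters (λ _ _ _ → ⊤) (λ _ _ → ⊤)

  IsClustered : Subset n → Set
  IsClustered S = ∃₂ λ a b → Clustered S a b

  loses-edge : ∀ {S x y} → EdgeComponent S x y → Loses 2 0 (S - x - y) S
  loses-edge {S} {x} {y} c = loses
    (≤-reflexive (trans (cong suc (size-remove (∈-remove⁺ y∈ (~⇒≢ x~y ∘ sym)))) (size-remove x∈)))
    (cyc-mono (∈-remove⁻ ∘ ∈-remove⁻))
    where open EdgeComponent c

  triangle-closes : ∀ {S x y z} → TriangleComponent S x y z → Closes S x (y , z)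
  triangle-closes c = ~⇒≢ y~z , x~y , x~z ,
    reach-edge (∈-remove⁺ y∈ (~⇒≢ x~y ∘ sym)) (∈-remove⁺ z∈ (~⇒≢ x~z ∘ sym)) y~z
    where open TriangleComponent c

  size-triangle : ∀ {S x y z} → TriangleComponent S x y z → 3 + ∣ S - x - y - z ∣ ≡ ∣ S ∣
  size-triangle c = trans (cong (λ k → suc (suc k))
    (size-remove (∈-remove⁺ (∈-remove⁺ z∈ (~⇒≢ x~z ∘ sym)) (~⇒≢ y~z ∘ sym))))
    (trans (cong suc (size-remove (∈-remove⁺ y∈ (~⇒≢ x~y ∘ sym)))) (size-remove x∈))
    where open TriangleComponent c

  loses-triangle : ∀ {S x y z} → TriangleComponent S x y z → Loses 3 1 (S - x - y - z) S
  loses-triangle {S} {x} {y} {z} c = loses (≤-reflexive (size-triangle c))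
    (cyc-pairs ((y , z) ∷ []) (∈-remove⁻ ∘ ∈-remove⁻) x∈ (triangle-closes c ∷ []) ([] ∷ []))
    where open TriangleComponent c

  edge-⊖ : ∀ {S x y} → EdgeComponent S x y → S ⊖ x ⊆ S - x - y × S ⊖ y ⊆ S - x - y
  edge-⊖ c =
    (λ v∈ → let (p , q , r) = ∈-⊖⁻ v∈ in ∈-remove⁺ (∈-remove⁺ p q) λ { refl → r x~y }) ,
    (λ v∈ → let (p , q , r) = ∈-⊖⁻ v∈ in ∈-remove⁺ (∈-remove⁺ p λ { refl → r (~-sym x~y) }) q)
    where open EdgeComponent c

  triangle-⊖ : ∀ {S x y z} → TriangleComponent S x y z →
    S ⊖ x ⊆ S - x - y - z × S ⊖ y ⊆ S - x - y - z × S ⊖ z ⊆ S - x - y - z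
  triangle-⊖ c =
    (λ v∈ → let (p , q , r) = ∈-⊖⁻ v∈ in
      ∈-remove⁺ (∈-remove⁺ (∈-remove⁺ p q) λ { refl → r x~y }) λ { refl → r x~z }) ,
    (λ v∈ → let (p , q , r) = ∈-⊖⁻ v∈ in
      ∈-remove⁺ (∈-remove⁺ (∈-remove⁺ p λ { refl → r (~-sym x~y) }) q) λ { refl → r y~z }) ,
    (λ v∈ → let (p , q , r) = ∈-⊖⁻ v∈ in
      ∈-remove⁺ (∈-remove⁺ (∈-remove⁺ p λ { refl → r (~-sym x~z) }) λ { refl → r (~-sym y~z) }) q)
    where open TriangleComponent c

  edge-mis : ∀ {S x y} → EdgeComponent S x y → mis S ≤ mis (S - x - y) + mis (S - x - y)
  edge-mis c = let (p , q) = edge-⊖ c in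
    ≤-trans (mis-leaf x∈ x-nbhd) (+-mono-≤ (mis-mono p) (mis-mono q))
    where open EdgeComponent c

  triangle-mis : ∀ {S x y z} → TriangleComponent S x y z →
    mis S ≤ mis (S - x - y - z) + (mis (S - x - y - z) + mis (S - x - y - z))
  triangle-mis c = let (p , q , r) = triangle-⊖ c in
    ≤-trans (mis-triangle x∈ x-nbhd) (+-mono-≤ (mis-mono p) (+-mono-≤ (mis-mono q) (mis-mono r)))
    where open TriangleComponent c

  -- A component K₂ doubles the count while two vertices less halve the unit. The rate is left open
  -- so that both `general` and `bad` pass through; in this way a gap in one component survives in
  -- the whole graph.
  edge-rate : ∀ {S x y} r → (∀ p → T ((drop 2 0 r ⊞ drop 2 0 r) p ≼ᵇ r p)) → EdgeComponent S x y →
    HasRate r (S - x - y) → HasRate r S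
  edge-rate r le c b = bounded-weaken _ r le (bounded-≤ _ (edge-mis c) (bounded-+ _ _ b′ b′))
    where b′ = bounded-lose r (loses-edge c) b

  triangle-rate : ∀ {S x y z} r → (∀ p → T ((drop 3 1 r ⊞ (drop 3 1 r ⊞ drop 3 1 r)) p ≼ᵇ r p)) →
    TriangleComponent S x y z → HasRate r (S - x - y - z) → HasRate r S
  triangle-rate r le c b = bounded-weaken _ r le
    (bounded-≤ _ (triangle-mis c) (bounded-+ _ _ b′ (bounded-+ _ _ b′ b′)))
    where b′ = bounded-lose r (loses-triangle c) b

  cyclic-rate : ∀ {S v us q} → v ∈ S → Nbrs S v us → length us ≡ 3 → Closes S v q →
    HasRate general (S - v) → HasRate general (S ⊖ v) → HasRate bad S
  cyclic-rate {us = _ ∷ _ ∷ _ ∷ []} v∈ nb refl c a b =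
    bounded-weaken (drop 1 1 general ⊞ drop 4 1 general) bad (λ { ev → tt ; od → tt })
      (branch-rate general general v∈ nb (one-pair c) a b)

  Classified : Subset n → Set
  Classified S = HasRate general S × (IsClustered S ⊎ HasRate bad S)

  classify-bad : ∀ {S} → HasRate bad S → Classified S
  classify-bad b = bounded-weaken bad general (λ { ev → tt ; od → tt }) b , inj₂ b

  -- Induction by the degree of a non-separating vertex v. Degree 0 and degree at least 3 give a gap
  -- at once. For degrees 1 and 2 the neighbours of v either complete a component K₂ or K₃, or some
  -- vertex near v provides a third neighbour on a cycle or a leaf with a longer path behind it.
  classify : ∀ S → Classified S
  classify S = go ∣ S ∣ S ≤-refl
    where
    go : ∀ k S → ∣ S ∣ ≤ k → Classified S
    go k S bound with any? (_∈? S)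
    ... | no none = empty-rate , inj₁ (0 , 0 , empty λ v v∈ → none (v , v∈))
      where
      empty-rate : HasRate general S
      empty-rate = bounded λ p r h _ size≤ → subst (λ M → Bound (general p) M r h)
        (sym (mis-empty λ v v∈ → none (v , v∈))) (one p r h (≤-trans (ℕ.m≤n+m r ∣ S ∣) size≤))
        where
        lift : ∀ x s t {r h} → T (scale s t (rate 1 0 1) ≼ᵇ x) → Bound (rate 1 0 1) 1 r h → Bound x 1 (s + r) (t + h)
        lift x s t le b = Bound-weaken _ x le (Bound-scale (rate 1 0 1) s t b)
        ev-case : ∀ r h → r ≤ 2 * h → Bound (general ev) 1 r h
        ev-case zero h _ = isBound (subst (1 ≤_) (sym (trans (ℕ.+-identityʳ _) (trans (ℕ.+-identityʳ _) (ℕ.+-identityʳ _)))) (1≤^ 1 h))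
        ev-case (suc zero) (suc h) _ = lift (general ev) 1 1 tt (ev-case 0 h z≤n)
        ev-case (suc (suc r)) (suc h) le = lift (general ev) 2 1 tt
          (ev-case r h (ℕ.≤-pred (ℕ.≤-pred (≤-trans le (≤-reflexive (ℕ.*-suc 2 h))))))
        od-case : ∀ r h → r ≤ 1 + 2 * h → Bound (general od) 1 r h
        od-case zero h _ = Bound-weaken _ (general od) {r = 0} {h = h} tt (ev-case 0 h z≤n)
        od-case (suc r) h (s≤s le) = lift (general od) 1 0 tt (ev-case r h le)
        one : ∀ p r h → r ≤ val p + 2 * h → Bound (general p) 1 r h
        one ev = ev-case
        one od = od-case
    go zero S bound | yes (v , v∈) = contradiction (≤-trans (≤-reflexive (size-remove v∈)) bound) λ ()
    go (suc k) S bound | yes (v₀ , v₀∈) = main (noncut-exists v₀∈)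
      where
      IH : ∀ {T v} → v ∈ S → T ⊆ S - v → Classified T
      IH v∈ sub = go k _ (ℕ.≤-pred (≤-trans (s≤s (p⊆q⇒∣p∣≤∣q∣ sub)) (≤-trans (≤-reflexive (size-remove v∈)) bound)))
      gen : ∀ {T v} → v ∈ S → T ⊆ S - v → HasRate general T
      gen v∈ sub = proj₁ (IH v∈ sub)
      main : (∃ λ w → w ∈ S × Noncut S w) → Classified S
      main (v , v∈ , nc) with neighbour? S v []
      ... | inj₂ nb = classify-bad (bounded-weaken (drop 1 0 general) bad (λ { ev → tt ; od → tt })
            (bounded-≤ _ (mis-isolated v∈ nb) (bounded-lose general (loses-remove v∈ no-pairs) (gen v∈ id))))
      ... | inj₁ (a , a∈ , v~a , _) with neighbour? S v (a ∷ [])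
      ... | inj₂ nbv with neighbour? S a (v ∷ [])
      ...   | inj₁ (b , b∈ , a~b , b∉) = classify-bad (bounded-weaken leafy bad (λ { ev → tt ; od → tt })
              (leaf-rate v∈ a∈ b∈ v~a a~b (b∉ ∘ here) nbv (gen v∈ ⊖⊆remove) (gen a∈ ⊖⊆remove)))
      ...   | inj₂ nba = edge-rate general (λ { ev → tt ; od → tt }) comp (proj₁ rest) , pack (proj₂ rest)
        where
        comp : EdgeComponent S v a
        comp = record { x∈ = v∈ ; y∈ = a∈ ; x~y = v~a ; x-nbhd = nbv ; y-nbhd = nba }
        rest : Classified (S - v - a)
        rest = IH v∈ ∈-remove⁻
        pack : IsClustered (S - v - a) ⊎ HasRate bad (S - v - a) → IsClustered S ⊎ HasRate bad S
        pack (inj₁ (_ , _ , cl)) = inj₁ (_ , _ , edge comp tt cl)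
        pack (inj₂ b) = inj₂ (edge-rate bad (λ { ev → tt ; od → tt }) comp b)
      main (v , v∈ , nc) | inj₁ (a , a∈ , v~a , _) | inj₁ (b , b∈ , v~b , b∉) with neighbour? S v (b ∷ a ∷ [])
      ... | inj₁ (c , c∈ , v~c , c∉) = classify-bad (cyclic-rate v∈
              (fresh-∷ c∉ (fresh-∷ b∉ ([] ∷ [])) , (c∈ , v~c) ∷ (b∈ , v~b) ∷ (a∈ , v~a) ∷ []) refl
              (b∉ ∘ here ∘ sym , v~a , v~b , nc a b a∈ b∈ v~a v~b) (gen v∈ id) (gen v∈ ⊖⊆remove))
      ... | inj₂ nbv with neighbour? S a (b ∷ v ∷ [])
      -- Apart from v the vertex a has no neighbour but b, so the path from a to b that avoids v
      -- must begin with the edge ab.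
      ...   | inj₂ nba = ab-adjacent (reach⇒path (nc a b a∈ b∈ v~a v~b))
        where
        ab-adjacent : Path (S - v) a b → Classified S
        ab-adjacent (stop _) = contradiction (here refl) b∉
        ab-adjacent (step {c = c} _ a~c r) with nba c (∈-remove⁻ (∈-remove⁻ (reach-source (path⇒reach r)))) a~c
        ... | there (here refl) = contradiction refl (remove-≢ (∈-remove⁻ (reach-source (path⇒reach r))))
        ... | here refl with neighbour? S b (a ∷ v ∷ [])
        ...   | inj₁ (d , d∈ , b~d , d∉) = classify-bad (cyclic-rate b∈
                  (fresh-∷ d∉ ((~⇒≢ (~-sym v~a) ∷ []) ∷ [] ∷ []) , (d∈ , b~d) ∷ (a∈ , ~-sym a~c) ∷ (v∈ , ~-sym v~b) ∷ []) refl
                  (~⇒≢ v~a , ~-sym v~b , ~-sym a~c , reach-edge (∈-remove⁺ v∈ (~⇒≢ v~b)) (∈-remove⁺ a∈ (~⇒≢ a~c)) v~a)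
                  (gen b∈ id) (gen b∈ ⊖⊆remove))
        ...   | inj₂ nbb = triangle-rate general (λ { ev → tt ; od → tt }) comp (proj₁ rest) , pack (proj₂ rest)
          where
          flip : ∀ {u x y : Fin n} → u ∈ₗ x ∷ y ∷ [] → u ∈ₗ y ∷ x ∷ []
          flip (here e) = there (here e)
          flip (there (here e)) = here e
          comp : TriangleComponent S v a b
          comp = record { x∈ = v∈ ; y∈ = a∈ ; z∈ = b∈ ; x~y = v~a ; x~z = v~b ; y~z = a~c
            ; x-nbhd = λ u u∈ e → flip (nbv u u∈ e) ; y-nbhd = λ u u∈ e → flip (nba u u∈ e)
            ; z-nbhd = λ u u∈ e → flip (nbb u u∈ e) }
          rest : Classified (S - v - a - b)
          rest = IH v∈ (∈-remove⁻ ∘ ∈-remove⁻)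
          pack : IsClustered (S - v - a - b) ⊎ HasRate bad (S - v - a - b) → IsClustered S ⊎ HasRate bad S
          pack (inj₁ (_ , _ , cl)) = inj₁ (_ , _ , triangle comp tt cl)
          pack (inj₂ x) = inj₂ (triangle-rate bad (λ { ev → tt ; od → tt }) comp x)
      ...   | inj₁ (d , d∈ , a~d , d∉) with neighbour? S a (d ∷ v ∷ [])
      -- The path from a to b closes up through v, so a lies on a cycle, and v, d, e are three
      -- neighbours of a.
      ...     | inj₁ (e , e∈ , a~e , e∉) = classify-bad (via (reach⇒path (nc a b a∈ b∈ v~a v~b)))
        where
        via : Path (S - v) a b → HasRate bad S
        via (stop _) = contradiction (here refl) b∉
        via (step {c = c} _ a~c r) = cyclic-rate a∈
          (fresh-∷ e∉ (fresh-∷ (d∉ ∘ there) ([] ∷ [])) , (e∈ , a~e) ∷ (d∈ , a~d) ∷ (v∈ , ~-sym v~a) ∷ []) refl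
          (remove-≢ (∈-remove⁻ c∈) ∘ sym , ~-sym v~a , a~c ,
            step (∈-remove⁺ v∈ (~⇒≢ v~a)) v~b (reach-sym (reach-mono (λ x∈ → remove-mono ∈-remove⁻ x∈) (path⇒reach r))))
          (gen a∈ id) (gen a∈ ⊖⊆remove)
          where
          c∈ : c ∈ S - v - a
          c∈ = reach-source (path⇒reach r)
      -- Deleting v opens the cycle and makes a a leaf of S - v attached to d, which has a further
      -- neighbour. The leaf bound for S - v makes up for v having only two neighbours.
      ...     | inj₂ nba = classify-bad (via (reach⇒path (nc a b a∈ b∈ v~a v~b)))
        where
        finish : ∀ {c} → c ∈ S - v - a → d ~ c → HasRate bad S
        finish {c} c∈ d~c = bounded-weaken (drop 1 1 leafy ⊞ drop 3 1 general) bad (λ { ev → tt ; od → tt })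
          (branch-rate leafy general v∈ ((((b∉ ∘ here ∘ sym) ∷ []) ∷ [] ∷ []) , (a∈ , v~a) ∷ (b∈ , v~b) ∷ [])
            (one-pair (b∉ ∘ here ∘ sym , v~a , v~b , nc a b a∈ b∈ v~a v~b))
            (leaf-rate a∈′ (∈-remove⁺ d∈ (d∉ ∘ there ∘ here)) (∈-remove⁻ c∈) a~d d~c (remove-≢ c∈)
              nba′ (gen v∈ (∈-remove⁻ ∘ ⊖⊆remove)) (gen v∈ (∈-remove⁻ ∘ ⊖⊆remove)))
            (gen v∈ ⊖⊆remove))
          where
          a∈′ : a ∈ S - v
          a∈′ = ∈-remove⁺ a∈ (~⇒≢ v~a ∘ sym)
          nba′ : Nbhd⊆ (S - v) a (d ∷ [])
          nba′ = nbhd-remove (nbhd-reverse nba)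
        via : Path (S - v) a b → HasRate bad S
        via (stop _) = contradiction (here refl) b∉
        via (step {c = c} _ a~c r) with nba c (∈-remove⁻ (∈-remove⁻ (reach-source (path⇒reach r)))) a~c
        ... | there (here refl) = contradiction refl (remove-≢ (∈-remove⁻ (reach-source (path⇒reach r))))
        via (step _ a~c (stop _)) | here refl = contradiction (here refl) d∉
        via (step _ a~c (step _ d~e r)) | here refl =
          finish (∈-remove⁻ (reach-source (path⇒reach r))) d~e

  general-rate : ∀ S → HasRate general S
  general-rate S = proj₁ (classify S)

  -- Graphs with complete components

  two-of : ∀ {p q a b} → p ~ q → a ∈ₗ p ∷ q ∷ [] → b ∈ₗ p ∷ q ∷ [] → a ≡ b ⊎ a ~ b
  two-of e (here refl) (here refl) = inj₁ refl
  two-of e (here refl) (there (here refl)) = inj₂ e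
  two-of e (there (here refl)) (here refl) = inj₂ (~-sym e)
  two-of e (there (here refl)) (there (here refl)) = inj₁ refl

  triangle-away : ∀ {S x y z v a} → TriangleComponent S x y z → v ∈ S → v ≢ x → v ≢ y → v ≢ z → a ∈ S → v ~ a →
    a ∈ S - x - y - z
  triangle-away {v = v} c v∈ p q r a∈ e = ∈-remove⁺ (∈-remove⁺ (∈-remove⁺ a∈ ax) ay) az
    where
    open TriangleComponent c
    ax : _ ≢ _
    ax refl = [ q , r ]′ (nbhd₂ x-nbhd v∈ (~-sym e))
    ay : _ ≢ _
    ay refl = [ p , r ]′ (nbhd₂ y-nbhd v∈ (~-sym e))
    az : _ ≢ _
    az refl = [ p , q ]′ (nbhd₂ z-nbhd v∈ (~-sym e))

  edge-away : ∀ {S x y v a} → EdgeComponent S x y → v ∈ S → v ≢ x → v ≢ y → a ∈ S → v ~ a → a ∈ S - x - y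
  edge-away {v = v} c v∈ p q a∈ e = ∈-remove⁺ (∈-remove⁺ a∈ ax) ay
    where
    open EdgeComponent c
    ax : _ ≢ _
    ax refl = q (nbhd₁ x-nbhd v∈ (~-sym e))
    ay : _ ≢ _
    ay refl = p (nbhd₁ y-nbhd v∈ (~-sym e))

  module _ {Q₃ : Fin n → Fin n → Fin n → Set} {Q₂ : Fin n → Fin n → Set} where

    clusters-size : ∀ {S a b} → Clusters Q₃ Q₂ S a b → ∣ S ∣ ≡ 3 * a + 2 * b
    clusters-size {S} (empty none) = ℕ.n≤0⇒n≡0 (≤-trans (p⊆q⇒∣p∣≤∣q∣ {q = ∅} (λ {x} x∈ → contradiction x∈ (none x)))
                                   (≤-reflexive (∣⊥∣≡0 n)))
    clusters-size (triangle {a = a} {b} c _ cs) = trans (sym (size-triangle c))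
      (trans (cong (3 +_) (clusters-size cs)) (sym (cong (_+ 2 * b) (ℕ.*-suc 3 a))))
    clusters-size (edge {S} {x} {y} {a = a} {b} c _ cs) =
      trans (sym (trans (cong suc (size-remove (∈-remove⁺ y∈ (~⇒≢ x~y ∘ sym)))) (size-remove x∈)))
      (trans (cong (2 +_) (clusters-size cs))
        (trans (solve 2 (λ a b → con 2 :+ (a :+ b) := a :+ (con 2 :+ b)) refl (3 * a) (2 * b))
          (sym (cong (3 * a +_) (ℕ.*-suc 2 b)))))
      where
      open EdgeComponent c
      open +-*-Solver

    clusters-cyc : ∀ {S a b} → Clusters Q₃ Q₂ S a b → a ≤ cyc S
    clusters-cyc (empty _) = z≤n
    clusters-cyc (triangle c _ cs) = ≤-trans (s≤s (clusters-cyc cs)) (Loses.fewer-cycles (loses-triangle c))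
    clusters-cyc (edge c _ cs) = ≤-trans (clusters-cyc cs) (Loses.fewer-cycles (loses-edge c))

    clusters-mis : ∀ {S a b} → Clusters Q₃ Q₂ S a b → mis S ≤ 3 ^ a * 2 ^ b
    clusters-mis (empty none) = ≤-reflexive (mis-empty none)
    clusters-mis (triangle {a = a} {b} c _ cs) = ≤-trans (triangle-mis c)
      (≤-trans (+-mono-≤ ih (+-mono-≤ ih ih)) (≤-reflexive (solve 2 (λ p q →
        p :* q :+ (p :* q :+ p :* q) := con 3 :* p :* q) refl (3 ^ a) (2 ^ b))))
      where
      ih = clusters-mis cs
      open +-*-Solver
    clusters-mis (edge {a = a} {b} c _ cs) = ≤-trans (edge-mis c)
      (≤-trans (+-mono-≤ ih ih) (≤-reflexive (solve 2 (λ p q →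
        p :* q :+ p :* q := p :* (con 2 :* q)) refl (3 ^ a) (2 ^ b))))
      where
      ih = clusters-mis cs
      open +-*-Solver

    clusters-neighbour : ∀ {S a b} → Clusters Q₃ Q₂ S a b → ∀ v → v ∈ S → ∃ λ u → u ∈ S × v ~ u
    clusters-neighbour (empty none) v v∈ = contradiction v∈ (none v)
    clusters-neighbour (triangle {x = x} {y} {z} c _ cs) v v∈ with v Fin.≟ x | v Fin.≟ y | v Fin.≟ z
    ... | yes refl | _ | _ = y , TriangleComponent.y∈ c , TriangleComponent.x~y c
    ... | no _ | yes refl | _ = x , TriangleComponent.x∈ c , ~-sym (TriangleComponent.x~y c)
    ... | no _ | no _ | yes refl = x , TriangleComponent.x∈ c , ~-sym (TriangleComponent.x~z c)
    ... | no p | no q | no r = let (u , u∈ , e) = clusters-neighbour cs v (∈-remove⁺ (∈-remove⁺ (∈-remove⁺ v∈ p) q) r)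
                               in u , ∈-remove⁻ (∈-remove⁻ (∈-remove⁻ u∈)) , e
    clusters-neighbour (edge {x = x} {y} c _ cs) v v∈ with v Fin.≟ x | v Fin.≟ y
    ... | yes refl | _ = y , EdgeComponent.y∈ c , EdgeComponent.x~y c
    ... | no _ | yes refl = x , EdgeComponent.x∈ c , ~-sym (EdgeComponent.x~y c)
    ... | no p | no q = let (u , u∈ , e) = clusters-neighbour cs v (∈-remove⁺ (∈-remove⁺ v∈ p) q)
                        in u , ∈-remove⁻ (∈-remove⁻ u∈) , e

    clusters-clique : ∀ {S a b} → Clusters Q₃ Q₂ S a b → ∀ {v u w} → v ∈ S → u ∈ S → w ∈ S →
      v ~ u → v ~ w → u ≡ w ⊎ u ~ w
    clusters-clique (empty none) v∈ _ _ _ _ = contradiction v∈ (none _)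
    clusters-clique (triangle {x = x} {y} {z} c _ cs) {v} v∈ u∈ w∈ e f with v Fin.≟ x | v Fin.≟ y | v Fin.≟ z
    ... | yes refl | _ | _ = two-of y~z (x-nbhd _ u∈ e) (x-nbhd _ w∈ f)
      where open TriangleComponent c
    ... | no _ | yes refl | _ = two-of x~z (y-nbhd _ u∈ e) (y-nbhd _ w∈ f)
      where open TriangleComponent c
    ... | no _ | no _ | yes refl = two-of x~y (z-nbhd _ u∈ e) (z-nbhd _ w∈ f)
      where open TriangleComponent c
    ... | no p | no q | no r = clusters-clique cs (∈-remove⁺ (∈-remove⁺ (∈-remove⁺ v∈ p) q) r)
      (triangle-away c v∈ p q r u∈ e) (triangle-away c v∈ p q r w∈ f) e f
    clusters-clique (edge {x = x} {y} c _ cs) {v} v∈ u∈ w∈ e f with v Fin.≟ x | v Fin.≟ y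
    ... | no p | no q = clusters-clique cs (∈-remove⁺ (∈-remove⁺ v∈ p) q)
      (edge-away c v∈ p q u∈ e) (edge-away c v∈ p q w∈ f) e f
    ... | no _ | yes refl with EdgeComponent.y-nbhd c _ u∈ e | EdgeComponent.y-nbhd c _ w∈ f
    ...   | here refl | here refl = inj₁ refl
    clusters-clique (edge {x = x} {y} c _ cs) {v} v∈ u∈ w∈ e f | yes refl | _
      with EdgeComponent.x-nbhd c _ u∈ e | EdgeComponent.x-nbhd c _ w∈ f
    ...   | here refl | here refl = inj₁ refl

    clusters-nbhd : ∀ {S a b} → Clusters Q₃ Q₂ S a b → ∀ v → v ∈ S → ∃₂ λ k l → Nbhd⊆ S v (k ∷ l ∷ [])
    clusters-nbhd (empty none) v v∈ = contradiction v∈ (none v)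
    clusters-nbhd (triangle {x = x} {y} {z} c _ cs) v v∈ with v Fin.≟ x | v Fin.≟ y | v Fin.≟ z
    ... | yes refl | _ | _ = _ , _ , TriangleComponent.x-nbhd c
    ... | no _ | yes refl | _ = _ , _ , TriangleComponent.y-nbhd c
    ... | no _ | no _ | yes refl = _ , _ , TriangleComponent.z-nbhd c
    ... | no p | no q | no r = let (k , l , nb) = clusters-nbhd cs v (∈-remove⁺ (∈-remove⁺ (∈-remove⁺ v∈ p) q) r)
                               in k , l , λ u u∈ e → nb u (triangle-away c v∈ p q r u∈ e) e
    clusters-nbhd (edge {x = x} {y} c _ cs) v v∈ with v Fin.≟ x | v Fin.≟ y
    ... | yes refl | _ = y , y , λ u u∈ e → there (EdgeComponent.x-nbhd c u u∈ e)
    ... | no _ | yes refl = x , x , λ u u∈ e → there (EdgeComponent.y-nbhd c u u∈ e)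
    ... | no p | no q = let (k , l , nb) = clusters-nbhd cs v (∈-remove⁺ (∈-remove⁺ v∈ p) q)
                        in k , l , λ u u∈ e → nb u (edge-away c v∈ p q u∈ e) e

    clusters-reach : ∀ {S a b} → Clusters Q₃ Q₂ S a b → ∀ {v u} → Reach S v u → v ≡ u ⊎ v ~ u
    clusters-reach cs (stop _) = inj₁ refl
    clusters-reach cs (step v∈ e r) with clusters-reach cs r
    ... | inj₁ refl = inj₂ e
    ... | inj₂ f = clusters-clique cs (reach-source r) v∈ (reach-target r) (~-sym e) f

    -- Each component loses a vertex, so it has at most two maximal independent sets if it was
    -- a triangle and at most one if it was an edge.
    clusters-hit : ∀ {S a b} → Clusters Q₃ Q₂ S a b → ∀ {U} → U ⊆ S →
      (∀ y → y ∈ S → ∃ λ z → z ∈ S × z ∉ U × (y ≡ z ⊎ y ~ z)) → mis U ≤ 2 ^ a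
    clusters-hit (empty none) sub _ = ≤-reflexive (mis-empty λ v v∈ → none v (sub v∈))
    clusters-hit (triangle {S} {x} {y} {z} {a} c _ cs) {U} sub hit = begin
      mis U                                           ≤⟨ cases (hit x x∈) ⟩
      mis (U - x - y - z) + mis (U - x - y - z)       ≤⟨ +-mono-≤ ih ih ⟩
      2 ^ a + 2 ^ a                                   ≡⟨ sym (cong (2 ^ a +_) (ℕ.+-identityʳ _)) ⟩
      2 ^ suc a                                       ∎
      where
      open ≤-Reasoning
      open TriangleComponent c
      ih : mis (U - x - y - z) ≤ 2 ^ a
      ih = clusters-hit cs (remove-mono (remove-mono (remove-mono sub))) λ v v∈ →
        let v∈₂ = ∈-remove⁻ v∈ ; v∈₁ = ∈-remove⁻ v∈₂
            (w , w∈ , w∉ , e) = hit v (∈-remove⁻ v∈₁)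
        in w , [ (λ eq → subst (_∈ S - x - y - z) eq v∈) ,
                 triangle-away c (∈-remove⁻ v∈₁) (remove-≢ v∈₁) (remove-≢ v∈₂) (remove-≢ v∈) w∈ ]′ e ,
           (λ p → w∉ (∈-remove⁻ (∈-remove⁻ (∈-remove⁻ p)))) , e
      pair : ∀ {p q o} → p ~ q → o ∉ U → Nbhd⊆ S p (q ∷ o ∷ []) → Nbhd⊆ S q (p ∷ o ∷ []) →
        U - p - q ⊆ U - x - y - z → mis U ≤ mis (U - x - y - z) + mis (U - x - y - z)
      pair {p} {q} {o} e o∉ np nq into with p ∈? U | q ∈? U
      ... | yes p∈ | _ = ≤-trans (mis-leaf p∈ λ u u∈ f → only (np u (sub u∈) f) u∈)
        (+-mono-≤ (mis-mono λ v∈ → let (k , l , f) = ∈-⊖⁻ v∈ in into (∈-remove⁺ (∈-remove⁺ k l) λ { refl → f e }))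
                  (mis-mono λ v∈ → let (k , l , f) = ∈-⊖⁻ v∈ in into (∈-remove⁺ (∈-remove⁺ k λ { refl → f (~-sym e) }) l)))
        where
        only : ∀ {u} → u ∈ₗ q ∷ o ∷ [] → u ∈ U → u ∈ₗ q ∷ []
        only (here eq) _ = here eq
        only (there (here refl)) u∈ = contradiction u∈ o∉
      ... | no p∉ | yes q∈ = ≤-trans (mis-leaf q∈ λ u u∈ f → only (nq u (sub u∈) f) u∈)
        (+-mono-≤ (mis-mono λ v∈ → let (k , l , f) = ∈-⊖⁻ v∈ in into (∈-remove⁺ (∈-remove⁺ k λ { refl → p∉ k }) l))
                  (mis-mono λ v∈ → let (k , l , f) = ∈-⊖⁻ v∈ in into (∈-remove⁺ (∈-remove⁺ k l) λ { refl → f e })))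
        where
        only : ∀ {u} → u ∈ₗ p ∷ o ∷ [] → u ∈ U → u ∈ₗ p ∷ []
        only (here eq) _ = here eq
        only (there (here refl)) u∈ = contradiction u∈ o∉
      ... | no p∉ | no q∉ = ≤-trans (mis-mono λ v∈ → into (∈-remove⁺ (∈-remove⁺ v∈ λ { refl → p∉ v∈ }) λ { refl → q∉ v∈ }))
                              (ℕ.m≤m+n _ _)
      swap : ∀ {s t u : Fin n} → u ∈ₗ s ∷ t ∷ [] → u ∈ₗ t ∷ s ∷ []
      swap (here e) = there (here e)
      swap (there (here e)) = here e
      missing : ∀ w → w ∉ U → w ≡ x ⊎ w ≡ y ⊎ w ≡ z → mis U ≤ mis (U - x - y - z) + mis (U - x - y - z)
      missing _ x∉ (inj₁ refl) = pair y~z x∉ (λ u p e → swap (y-nbhd u p e)) (λ u p e → swap (z-nbhd u p e))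
        λ v∈ → ∈-remove⁺ (∈-remove⁺ (∈-remove⁺ (∈-remove⁻ (∈-remove⁻ v∈)) λ { refl → x∉ (∈-remove⁻ (∈-remove⁻ v∈)) })
          (remove-≢ (∈-remove⁻ v∈))) (remove-≢ v∈)
      missing _ y∉ (inj₂ (inj₁ refl)) = pair x~z y∉ (λ u p e → swap (x-nbhd u p e)) z-nbhd
        λ v∈ → ∈-remove⁺ (∈-remove⁺ (∈-remove⁻ v∈) λ { refl → y∉ (∈-remove⁻ (∈-remove⁻ v∈)) }) (remove-≢ v∈)
      missing _ z∉ (inj₂ (inj₂ refl)) = pair x~y z∉ x-nbhd y-nbhd
        λ v∈ → ∈-remove⁺ v∈ λ { refl → z∉ (∈-remove⁻ (∈-remove⁻ v∈)) }
      cases : (∃ λ w → w ∈ S × w ∉ U × (x ≡ w ⊎ x ~ w)) → mis U ≤ mis (U - x - y - z) + mis (U - x - y - z)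
      cases (w , w∈ , w∉ , inj₁ eq) = missing w w∉ (inj₁ (sym eq))
      cases (w , w∈ , w∉ , inj₂ e) = [ (λ eq → missing w w∉ (inj₂ (inj₁ eq))) , (λ eq → missing w w∉ (inj₂ (inj₂ eq))) ]′ (nbhd₂ x-nbhd w∈ e)
    clusters-hit (edge {S} {x} {y} {a} c _ cs) {U} sub hit = ≤-trans (cases (hit x x∈)) ih
      where
      open EdgeComponent c
      ih : mis (U - x - y) ≤ 2 ^ a
      ih = clusters-hit cs (remove-mono (remove-mono sub)) λ v v∈ →
        let v∈₁ = ∈-remove⁻ v∈
            (w , w∈ , w∉ , e) = hit v (∈-remove⁻ v∈₁)
        in w , [ (λ eq → subst (_∈ S - x - y) eq v∈) ,
                 edge-away c (∈-remove⁻ v∈₁) (remove-≢ v∈₁) (remove-≢ v∈) w∈ ]′ e ,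
           (λ p → w∉ (∈-remove⁻ (∈-remove⁻ p))) , e
      single : ∀ {p o} → o ∉ U → Nbhd⊆ S p (o ∷ []) → U - p ⊆ U - x - y → mis U ≤ mis (U - x - y)
      single {p} {o} o∉ np into with p ∈? U
      ... | no p∉ = mis-mono λ v∈ → into (∈-remove⁺ v∈ λ { refl → p∉ v∈ })
      ... | yes p∈ = ≤-trans (mis-isolated p∈ λ u u∈ f → none (np u (sub u∈) f) u∈) (mis-mono into)
        where
        none : ∀ {u} → u ∈ₗ o ∷ [] → u ∈ U → u ∈ₗ []
        none (here refl) u∈ = contradiction u∈ o∉
      missing : ∀ w → w ∉ U → w ≡ x ⊎ w ≡ y → mis U ≤ mis (U - x - y)
      missing _ x∉ (inj₁ refl) = single x∉ y-nbhd
        λ v∈ → ∈-remove⁺ (∈-remove⁺ (∈-remove⁻ v∈) λ { refl → x∉ (∈-remove⁻ v∈) }) (remove-≢ v∈)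
      missing _ y∉ (inj₂ refl) = single y∉ x-nbhd λ v∈ → ∈-remove⁺ v∈ λ { refl → y∉ (∈-remove⁻ v∈) }
      cases : (∃ λ w → w ∈ S × w ∉ U × (x ≡ w ⊎ x ~ w)) → mis U ≤ mis (U - x - y)
      cases (w , w∈ , w∉ , inj₁ eq) = missing w w∉ (inj₁ (sym eq))
      cases (w , w∈ , w∉ , inj₂ e) = missing w w∉ (inj₂ (nbhd₁ x-nbhd w∈ e))

  -- Budgets for connected sets, and hubs

  ConnectedIn : Subset n → Set
  ConnectedIn S = ∀ a b → a ∈ S → b ∈ S → Reach S a b

  -- Unlike in `Bounded` the size is exact, because the odd case argues with the parity of n + r,
  -- for instance in `odd-gap`.
  record Budget (δ : Bool) (p : Parity) (r h : ℕ) (S : Subset n) : Set where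
    field
      cyc≤ : cyc S ≤ r
      size≡ : ∣ S ∣ + r ≡ val p + 2 * h
      regime : δ ≡ true ⊎ 3 * r ≤ ∣ S ∣
  open Budget

  at-budget : ∀ {δ p r h S M x} → Bounded x S M → Budget δ p r h S → Bound (x p) M r h
  at-budget b B = Bounded.at b _ _ _ (cyc≤ B) (≤-reflexive (size≡ B))

  record ExactlyLoses (k s : ℕ) (T S : Subset n) : Set where
    constructor loses!
    field
      fewer-vertices : k + ∣ T ∣ ≡ ∣ S ∣
      fewer-cycles   : s + cyc T ≤ cyc S

  -- If k ≤ 3s, losing k vertices and s cycles preserves 3r ≤ n, and the flag can be kept. Otherwise
  -- the smaller set has to be content with the weaker odd bound.
  Inherits : ℕ → ℕ → Bool → Bool → Set
  Inherits k s δ δ′ = δ′ ≡ true ⊎ (δ ≡ δ′ × k ≤ 3 * s)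

  ConnectedRate : Subset n → Set
  ConnectedRate T = ∀ δ p r h → Budget δ p r h T → Bound (connected δ p) (mis T) r h

  inherit : ∀ {k s T S δ p r h} δ′ → ExactlyLoses k s T S → Inherits k s δ δ′ → Budget δ p r h S →
    ∃₂ λ r′ h′ → s + r′ ≡ r × halves p (k + s) + h′ ≡ h × Budget δ′ (shift p (k + s)) r′ h′ T
  inherit {k} {s} {T} {S} {δ} {p} {r} {h} δ′ (loses! kT sT) inh B = r′ , h′ , s+r′≡r , h-eq ,
    record { cyc≤ = cycT≤ ; size≡ = size′ ; regime = reg inh (regime B) }
    where
    s≤r : s ≤ r
    s≤r = ≤-trans (ℕ.m≤m+n s _) (≤-trans sT (cyc≤ B))
    r′ = r ∸ s
    s+r′≡r : s + r′ ≡ r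
    s+r′≡r = ℕ.m+[n∸m]≡n s≤r
    cycT≤ : cyc T ≤ r′
    cycT≤ = ℕ.+-cancelˡ-≤ s _ _ (≤-trans sT (≤-trans (cyc≤ B) (≤-reflexive (sym s+r′≡r))))
    split = borrow-≡ p (k + s) {∣ T ∣ + r′} {h} (trans (rearrange k s ∣ T ∣ r′) (trans (cong₂ _+_ kT s+r′≡r) (size≡ B)))
    h′ = proj₁ split
    h-eq = proj₁ (proj₂ split)
    size′ = proj₂ (proj₂ split)
    reg : Inherits k s δ δ′ → δ ≡ true ⊎ 3 * r ≤ ∣ S ∣ → δ′ ≡ true ⊎ 3 * r′ ≤ ∣ T ∣
    reg (inj₁ t) _ = inj₁ t
    reg (inj₂ (refl , _)) (inj₁ t) = inj₁ t
    reg (inj₂ (refl , k≤)) (inj₂ le) = inj₂ (ℕ.+-cancelˡ-≤ k _ _ (begin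
      k + 3 * r′       ≤⟨ ℕ.+-monoˡ-≤ (3 * r′) k≤ ⟩
      3 * s + 3 * r′   ≡⟨ sym (ℕ.*-distribˡ-+ 3 s r′) ⟩
      3 * (s + r′)     ≡⟨ cong (3 *_) s+r′≡r ⟩
      3 * r            ≤⟨ le ⟩
      ∣ S ∣            ≡⟨ sym kT ⟩
      k + ∣ T ∣        ∎))
      where open ≤-Reasoning

  connected-lose : ∀ {k s T S δ p r h} δ′ → ConnectedRate T → ExactlyLoses k s T S → Inherits k s δ δ′ →
    Budget δ p r h S → Bound (drop k s (connected δ′) p) (mis T) r h
  connected-lose {k} {s} {T} {p = p} δ′ rt ls inh B =
    let (r′ , h′ , r-eq , h-eq , B′) = inherit δ′ ls inh B
    in subst₂ (Bound (drop k s (connected δ′) p) (mis T)) r-eq h-eq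
         (Bound-scale (connected δ′ (shift p (k + s))) s (halves p (k + s)) (rt _ _ _ _ B′))

  -- In this regime 3^r 2^h / 4^r is at least 3^r.
  regime-od : ∀ {r h S} → Budget false od r h S → 4 ^ r ≤ 2 ^ h
  regime-od {r} {h} {S} B with regime B
  ... | inj₂ 3r≤ = ≤-trans (≤-reflexive (ℕ.^-*-assoc 2 2 r)) (ℕ.^-monoʳ-≤ 2 (half {2 * r} {h} (begin
      2 * (2 * r)        ≡⟨ solve 1 (λ r → con 2 :* (con 2 :* r) := con 3 :* r :+ r) refl r ⟩
      3 * r + r          ≤⟨ ℕ.+-monoˡ-≤ r 3r≤ ⟩
      ∣ S ∣ + r          ≡⟨ size≡ B ⟩
      1 + 2 * h          ∎)))
    where
    open ≤-Reasoning
    open +-*-Solver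
    half : ∀ {a b} → 2 * a ≤ 1 + 2 * b → a ≤ b
    half {zero} _ = z≤n
    half {suc a} {b} le with subst (_≤ 1 + 2 * b) (ℕ.*-suc 2 a) le
    half {suc a} {zero} le | s≤s ()
    half {suc a} {suc b} le | le′ = s≤s (half (ℕ.≤-pred (ℕ.≤-pred (≤-trans le′ (≤-reflexive (cong suc (ℕ.*-suc 2 b)))))))

  Bound-power : ∀ {a r h} → suc a ≤ r → Bound (rate 0 1 2) (2 ^ a) r h
  Bound-power {a} {r} a<r = isBound (begin
    2 * (4 ^ r * 2 ^ a)   ≡⟨ solve 2 (λ f p → con 2 :* (f :* p) := (con 2 :* p) :* f) refl (4 ^ r) (2 ^ a) ⟩
    2 ^ suc a * 4 ^ r     ≤⟨ ℕ.*-monoˡ-≤ (4 ^ r) (ℕ.^-monoʳ-≤ 2 a<r) ⟩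
    2 ^ r * 4 ^ r         ≡⟨ 2^*4^ r ⟩
    8 ^ r                 ≡⟨ sym (ℕ.+-identityʳ _) ⟩
    1 * 8 ^ r             ∎)
    where
    open ≤-Reasoning
    open +-*-Solver

  -- When 4^r ≤ 2^h the unit is at least 3^r, hence at least 9 times 3^a and so 9 times 2^a. This
  -- ninth is the gap between 8/9 and 1 that `rate-saturated` has to fill.
  Bound-power-od : ∀ {a r h} → 2 + a ≤ r → 4 ^ r ≤ 2 ^ h → Bound (rate 1 0 9) (2 ^ a) r h
  Bound-power-od {a} {r} {h} le 4≤2 = isBound (begin
    9 * (4 ^ r * 2 ^ a)   ≤⟨ ℕ.*-monoʳ-≤ 9 (ℕ.*-mono-≤ 4≤2 (ℕ.^-monoˡ-≤ a (s≤s (s≤s z≤n)))) ⟩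
    9 * (2 ^ h * 3 ^ a)   ≡⟨ solve 2 (λ f p → con 9 :* (f :* p) := (con 3 :* (con 3 :* p)) :* f) refl (2 ^ h) (3 ^ a) ⟩
    3 ^ (2 + a) * 2 ^ h   ≤⟨ ℕ.*-monoˡ-≤ (2 ^ h) (ℕ.^-monoʳ-≤ 3 le) ⟩
    3 ^ r * 2 ^ h         ≡⟨ sym (trans (ℕ.+-identityʳ _) (ℕ.+-identityʳ _)) ⟩
    1 * (3 ^ r * 2 ^ h) + 0 ∎)
    where
    open ≤-Reasoning
    open +-*-Solver

  -- If S - h consists of complete components, then h is joined to the whole component of y.
  Saturated : Subset n → Fin n → Fin n → Set
  Saturated S h y = y ∈ S - h × h ~ y × (∀ z → z ∈ S - h → y ~ z → h ~ z)

  saturated? : ∀ S h → Dec (∃ (Saturated S h))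
  saturated? S h = any? λ y → (y ∈? S - h) ×-dec ((h ~? y) ×-dec
    all? λ z → (z ∈? S - h) →-dec ((y ~? z) →-dec (h ~? z)))

  module Hub {S h a b} (conn : ConnectedIn S) (h∈ : h ∈ S) (cl : Clustered (S - h) a b) where

    attached : ∀ y → y ∈ S - h → ∃ λ z → z ∈ S - h × h ~ z × (y ≡ z ⊎ y ~ z)
    attached y y∈ with reach-exit (S - h) (conn y h (∈-remove⁻ y∈) h∈) y∈
    ... | inj₁ r = contradiction (reach-target r) (∉-remove {S = S})
    ... | inj₂ (c , d , r , c~d , d∈ , d∉) = c , reach-target r , subst (_~ c) d≡h (~-sym c~d) , clusters-reach cl r
      where
      d≡h : d ≡ h
      d≡h = decidable-stable (d Fin.≟ h) λ d≢h → d∉ (∈-remove⁺ d∈ d≢h)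

    mis-⊖ : mis (S ⊖ h) ≤ 2 ^ a
    mis-⊖ = clusters-hit cl ⊖⊆remove λ y y∈ →
      let (z , z∈ , e , f) = attached y y∈ in z , z∈ , ∉-⊖ e , f

    unsaturated : ¬ ∃ (Saturated S h) → mis S ≤ mis (S - h)
    unsaturated ¬sat = mis-delete S h λ I mi h∈I y y∈S h~y →
      let y∈ = ∈-remove⁺ y∈S (~⇒≢ h~y ∘ sym) in
      witness I mi h∈I y y∈ h~y (partner y y∈ h~y)
      where
      partner : ∀ y → y ∈ S - h → h ~ y → ∃ λ z → z ∈ S - h × y ~ z × ¬ h ~ z
      partner y y∈ h~y with any? (λ z → (z ∈? S - h) ×-dec ((y ~? z) ×-dec ¬? (h ~? z)))
      ... | yes p = p
      ... | no ¬p = contradiction (y , y∈ , h~y , λ z z∈ e →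
              decidable-stable (h ~? z) λ h≁z → ¬p (z , z∈ , e , h≁z)) ¬sat
      witness : ∀ I → MIS S I → h ∈ I → ∀ y → y ∈ S - h → h ~ y → (∃ λ z → z ∈ S - h × y ~ z × ¬ h ~ z) →
        ∃ λ z → z ∈ I × z ≢ h × z ~ y
      witness I (I⊆ , ind , dom) h∈I y y∈ h~y (z , z∈ , y~z , h≁z) with z ∈? I
      ... | yes z∈I = z , z∈I , remove-≢ z∈ , ~-sym y~z
      ... | no z∉I = let (u , u∈I , u~z) = dom z (∈-remove⁻ z∈) z∉I
                         u≢h = λ u≡h → h≁z (subst (_~ z) u≡h u~z)
                     in u , u∈I , u≢h , [ (λ u≡y → contradiction h~y (ind h y h∈I (subst (_∈ I) u≡y u∈I))) , id ]′
                       (clusters-clique cl z∈ (∈-remove⁺ (I⊆ u∈I) u≢h) y∈ (~-sym u~z) (~-sym y~z))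

    -- K₃ and K₂ have no isolated vertex, so a component fully joined to h contains an edge that
    -- forms a triangle with h.
    saturated-pair : ∃ (Saturated S h) → ∃ λ q → Closes S h q
    saturated-pair (y , y∈ , h~y , all) =
      let (z , z∈ , y~z) = clusters-neighbour cl y y∈
      in (y , z) , ~⇒≢ y~z , h~y , all z z∈ y~z , reach-edge y∈ z∈ y~z

    saturated-cyc : ∃ (Saturated S h) → suc a ≤ cyc S
    saturated-cyc sat = ≤-trans (s≤s (clusters-cyc cl))
      (Loses.fewer-cycles (loses-remove h∈ (one-pair (proj₂ (saturated-pair sat)))))

    size : ∣ S ∣ ≡ 1 + (3 * a + 2 * b)
    size = trans (sym (size-remove h∈)) (cong suc (clusters-size cl))

    -- In the odd case r and a have the same parity.
    odd-gap : ∀ {δ r k} → Budget δ od r k S → suc a ≤ r → 2 + a ≤ r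
    odd-gap {r = r} {k} B a<r = ℕ.≤∧≢⇒< a<r λ eq → even≢odd (2 * a + b + 1) k (begin
      2 * (2 * a + b + 1)           ≡⟨ solve 2 (λ a b → con 2 :* (con 2 :* a :+ b :+ con 1) := con 1 :+ (con 3 :* a :+ con 2 :* b) :+ (con 1 :+ a)) refl a b ⟩
      1 + (3 * a + 2 * b) + suc a   ≡⟨ cong₂ _+_ (sym size) eq ⟩
      ∣ S ∣ + r                     ≡⟨ size≡ B ⟩
      1 + 2 * k                     ∎)
      where
      open ≡-Reasoning
      open +-*-Solver

    -- The triangle at h costs a cycle, so S - h contributes 2/3 of the unit in the even and 8/9 in
    -- the odd case; the sets through h number at most 2^a with a < r. In the even case this is c
    -- exactly. In the odd case without the flag, parity improves a < r to a + 2 ≤ r.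
    rate-saturated : ∀ δ p r k → Budget δ p r k S → ∃ (Saturated S h) → Bound (connected δ p) (mis S) r k
    rate-saturated δ p r k B sat = go δ p B
      where
      parts : ∀ {δ p} x → Budget δ p r k S → Bound x (2 ^ a) r k → Bound (drop 1 1 general p ⊕ x) (mis S) r k
      parts {p = p} x B b = Bound-≤ _ (≤-trans (mis-branch S h) (ℕ.+-monoʳ-≤ _ mis-⊖))
        (Bound-+ (drop 1 1 general p) x (at-budget (bounded-lose general
          (loses-remove h∈ (one-pair (proj₂ (saturated-pair sat)))) (general-rate (S - h))) B) b)
      a<r : ∀ {δ p} → Budget δ p r k S → suc a ≤ r
      a<r B = ≤-trans (saturated-cyc sat) (cyc≤ B)
      go : ∀ δ p → Budget δ p r k S → Bound (connected δ p) (mis S) r k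
      go false ev B = Bound-weaken _ _ tt (parts (rate 0 1 2) B (Bound-power (a<r B)))
      go true  ev B = Bound-weaken _ _ tt (parts (rate 0 1 2) B (Bound-power (a<r B)))
      go true  od B = Bound-weaken _ _ tt (parts (rate 0 1 2) B (Bound-power (a<r B)))
      go false od B = Bound-weaken _ _ tt (parts (rate 1 0 9) B (Bound-power-od (odd-gap B (a<r B)) (regime-od B)))

    hub-rate : ConnectedRate S
    hub-rate δ p r k B with saturated? S h
    ... | yes sat = rate-saturated δ p r k B sat
    ... | no ¬sat = Bound-weaken (drop 1 0 general p) (connected δ p)
      (everyᵇ-elim (λ δ p → drop 1 0 general p ≼ᵇ connected δ p) tt δ p)
      (at-budget (bounded-≤ _ (unsaturated ¬sat)
        (bounded-lose general (loses-remove h∈ no-pairs) (general-rate (S - h)))) B)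

  -- The bound for connected graphs

  AllFin : ∀ k → (Fin k → Set) → Set
  AllFin zero    Q = ⊤
  AllFin (suc k) Q = Q 0F × AllFin k (λ j → Q (suc j))

  -- The pairs i < j, row by row.
  Upper : ∀ k → (Fin k → Fin k → Set) → Set
  Upper zero    Q = ⊤
  Upper (suc k) Q = AllFin k (λ j → Q 0F (suc j)) × Upper k (λ i j → Q (suc i) (suc j))

  allFin-elim : ∀ k {Q : Fin k → Set} → AllFin k Q → ∀ j → Q j
  allFin-elim (suc k) (q , _)  0F      = q
  allFin-elim (suc k) (_ , qs) (suc j) = allFin-elim k qs j

  upper-elim : ∀ k {Q : Fin k → Fin k → Set} → Upper k Q → ∀ i j → toℕ i < toℕ j → Q i j
  upper-elim (suc k) (row , _)  0F      (suc j) _        = allFin-elim k row j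
  upper-elim (suc k) (_ , rows) (suc i) (suc j) (s≤s lt) = upper-elim k rows i j lt

  Related : Fin n → Fin n → Bool → Set
  Related u v true  = u ~ v
  Related u v false = u ≢ v × ¬ u ~ v

  record Fits {V : Set} (S : Subset n) (H : Graph V) (f : V → Fin n) : Set where
    private module H = Graph H
    field
      inside-S  : ∀ i → f i ∈ S
      onto      : ∀ v → v ∈ S → ∃ λ i → f i ≡ v
      injective : ∀ i j → f i ≡ f j → i ≡ j
      preserves : ∀ i j → i H.~ j → f i ~ f j
      reflects  : ∀ i j → f i ~ f j → i H.~ j

  module _ {k} {S : Subset n} (H : Graph (Fin k)) (f : Fin k → Fin n) where
    private module H = Graph H

    -- The table covers only i < j, and each of its entries also separates f i from f j, so
    -- injectivity comes with the adjacency data.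
    fits : (∀ i → f i ∈ S) → (∀ v → v ∈ S → ∃ λ i → f i ≡ v) →
      Upper k (λ i j → Related (f i) (f j) (does (i H.~? j))) → Fits S H f
    fits ins sur table = record { inside-S = ins ; onto = sur ; injective = inj
      ; preserves = λ i j e → proj₂ (proj₁ (both i j) e) ; reflects = λ i j e → proj₂ (both i j) e }
      where
      below : ∀ i j → toℕ i < toℕ j → f i ≢ f j × (i H.~ j → f i ~ f j) × (f i ~ f j → i H.~ j)
      below i j lt with i H.~? j | upper-elim k table i j lt
      ... | yes e | u~v = ~⇒≢ u~v , (λ _ → u~v) , λ _ → e
      ... | no ¬e | u≢v , u≁v = u≢v , (λ e → contradiction e ¬e) , λ e → contradiction e u≁v
      inj : ∀ i j → f i ≡ f j → i ≡ j
      inj i j eq with ℕ.<-cmp (toℕ i) (toℕ j)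
      ... | tri< lt _ _ = contradiction eq (proj₁ (below i j lt))
      ... | tri≈ _ e _  = toℕ-injective e
      ... | tri> _ _ gt = contradiction (sym eq) (proj₁ (below j i gt))
      both : ∀ i j → (i H.~ j → i ≢ j × f i ~ f j) × (f i ~ f j → i H.~ j)
      both i j with ℕ.<-cmp (toℕ i) (toℕ j)
      ... | tri< lt _ _ = (λ e → (λ { refl → ℕ.<-irrefl refl lt }) , proj₁ (proj₂ (below i j lt)) e) , proj₂ (proj₂ (below i j lt))
      ... | tri≈ _ e _  = (λ a → contradiction a (H.~-irrefl (toℕ-injective e))) , λ a → contradiction a (~-irrefl (cong f (toℕ-injective e)))
      ... | tri> _ _ gt = (λ e → (λ { refl → ℕ.<-irrefl refl gt }) , ~-sym (proj₁ (proj₂ (below j i gt)) (H.~-sym e))) ,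
                          λ e → H.~-sym (proj₂ (proj₂ (below j i gt)) (~-sym e))

  fits-nbhd : ∀ {k S} {H : Graph (Fin k)} {f} → Fits S H f → ∀ i js →
    (∀ j → Graph._~_ H i j → j ∈ₗ js) → Nbhd⊆ S (f i) (map f js)
  fits-nbhd {f = f} F i js nb u u∈ e with Fits.onto F u u∈
  ... | j , refl = ∈-map⁺ f (nb j (Fits.reflects F i j e))

  -- Every connected graph that attains c has to appear here; all others satisfy a strict
  -- inequality. `special-rate` bounds the members directly.
  data Special (S : Subset n) : Set where
    hub    : ∀ {h} → h ∈ S → IsClustered (S - h) → Special S
    path₄  : ∀ {f} → Fits S (P 4) f → Special S
    cycle₅ : ∀ {f} → Fits S (C 5) f → Special S

  data Outcome (δ : Bool) (p : Parity) (r h : ℕ) (S : Subset n) : Set where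
    strict  : Bound< (connected δ p) (mis S) r h → Outcome δ p r h S
    special : Special S → Outcome δ p r h S

  -- K₂ is excluded because for n = 2 and r = 0 the bound is 11/6, less than its 2 maximal
  -- independent sets. This is why smaller connected sets of two vertices are singled out before
  -- each use of the induction hypothesis.
  Claim : Subset n → Set
  Claim S = ConnectedIn S → 1 ≤ ∣ S ∣ → ∣ S ∣ ≢ 2 → ∀ {δ p r h} → Budget δ p r h S → Outcome δ p r h S

  loses-list : ∀ {S T w ps} xs → w ∈ S → T ⊆ S - w → Connects S w ps → Unique xs →
    All (λ x → x ∈ S × x ∉ T) xs → Loses (length xs) (length ps) T S
  loses-list xs w∈ sub (cl , ap) u all = loses (size-drop xs (∈-remove⁻ ∘ sub) u all) (cyc-pairs _ sub w∈ cl ap)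

  fin5? : ∀ {k} (H : Graph (Fin k)) i js → Dec (∀ j → Graph._~_ H i j → j ∈ₗ js)
  fin5? H i js = all? λ j → Graph._~?_ H i j →-dec DecMembership._∈?_ Fin._≟_ j js

  fits-size : ∀ {k S} {H : Graph (Fin k)} {f} → Fits S H f → ∣ S ∣ ≡ k
  fits-size {k} {S} {f = f} F = ℕ.≤-antisym upper lower
    where
    open Fits F
    image : List (Fin n)
    image = map f (allFin k)
    image-unique : Unique image
    image-unique = Uniqueₚ.map⁺ (λ {i} {j} → injective i j) (Uniqueₚ.allFin⁺ k)
    length-image : length image ≡ k
    length-image = trans (length-map f (allFin k)) (length-tabulate id)
    lower : k ≤ ∣ S ∣
    lower = ≤-trans (≤-reflexive (sym length-image)) (≤-trans (ℕ.m≤m+n _ _)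
      (size-drop {T = ∅} image (λ x∈ → contradiction x∈ ∉⊥) image-unique
        (All.tabulate λ {x} x∈ → (let (i , _ , eq) = ∈-map⁻ f x∈ in subst (_∈ S) (sym eq) (inside-S i)) , ∉⊥)))
    size-≤ : ∀ xs {T : Subset n} → (∀ v → v ∈ T → v ∈ₗ xs) → ∣ T ∣ ≤ length xs
    size-≤ [] {T} cover = ≤-trans (p⊆q⇒∣p∣≤∣q∣ {p = T} {q = ∅} (λ {x} x∈ → case cover x x∈ of λ ())) (≤-reflexive (∣⊥∣≡0 n))
    size-≤ (x ∷ xs) {T} cover with x ∈? T
    ... | yes x∈ = ≤-trans (≤-reflexive (sym (size-remove x∈))) (s≤s (size-≤ xs {T - x} λ v v∈ → Any.tail (remove-≢ v∈) (cover v (∈-remove⁻ v∈))))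
    ... | no x∉ = ℕ.m≤n⇒m≤1+n (size-≤ xs λ v v∈ → Any.tail (λ { refl → x∉ v∈ }) (cover v v∈))
    upper : ∣ S ∣ ≤ k
    upper = ≤-trans (size-≤ image λ v v∈ → let (i , eq) = onto v v∈ in subst (_∈ₗ image) eq (∈-map⁺ f (∈-allFin i))) (≤-reflexive length-image)

  drop-isolated : ∀ {S T v k s} x → v ∈ T → Nbhd⊆ T v [] → Loses k s (T - v) S →
    HasRate x (T - v) → Bounded (drop k s x) S (mis T)
  drop-isolated x v∈ nb ls b = bounded-≤ _ (mis-isolated v∈ nb) (bounded-lose x ls b)

  private
    halved : ∀ k r {h} → k + k + r ≡ 0 + 2 * h → h ≤ k + r
    halved k r {h} eq = ℕ.*-cancelˡ-≤ 2 (begin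
      2 * h          ≡⟨ sym eq ⟩
      k + k + r      ≤⟨ ℕ.+-monoʳ-≤ (k + k) (ℕ.m≤m+n r r) ⟩
      k + k + (r + r) ≡⟨ solve 2 (λ k r → k :+ k :+ (r :+ r) := con 2 :* (k :+ r)) refl k r ⟩
      2 * (k + r)    ∎)
      where
      open ≤-Reasoning
      open +-*-Solver

  module _ {S : Subset n} {f : Fin 4 → Fin n} (F : Fits S (P 4) f) where
    open Fits F

    private
      from-P : ∀ i j → Graph._~_ (P 4) i j → f i ~ f j
      from-P = preserves

      distinct : ∀ {i j} → i ≢ j → f i ≢ f j
      distinct i≢j eq = i≢j (injective _ _ eq)

      a~b : f 0F ~ f 1F
      a~b = from-P 0F 1F ((λ ()) , inj₁ refl)
      b~c : f 1F ~ f 2F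
      b~c = from-P 1F 2F ((λ ()) , inj₁ refl)

      a-nbhd : Nbhd⊆ S (f 0F) (f 1F ∷ [])
      a-nbhd = fits-nbhd F 0F (1F ∷ []) (toWitness {a? = fin5? (P 4) 0F (1F ∷ [])} tt)

      d-nbhd : Nbhd⊆ S (f 3F) (f 2F ∷ [])
      d-nbhd = fits-nbhd F 3F (2F ∷ []) (toWitness {a? = fin5? (P 4) 3F (2F ∷ [])} tt)

      Q : Subset n
      Q = S ⊖ f 1F

      d∈Q : f 3F ∈ Q
      d∈Q = ∈-⊖⁺ (inside-S 3F) (distinct λ ()) λ e → distinct (λ ()) (nbhd₁ d-nbhd (inside-S 1F) (~-sym e))

      d-isolated : Nbhd⊆ Q (f 3F) []
      d-isolated u u∈ e with nbhd₁ d-nbhd (proj₁ (∈-⊖⁻ u∈)) e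
      ... | refl = ⊥-elim (proj₂ (proj₂ (∈-⊖⁻ u∈)) b~c)

    path₄-rate : HasRate (drop 2 0 general ⊞ drop 4 0 general) S
    path₄-rate = bounded-≤ _ (mis-leaf (inside-S 0F) a-nbhd) (bounded-+ _ _
      (bounded-lose general (loses-⊖ {us = f 1F ∷ []} (inside-S 0F) (([] ∷ []) , (inside-S 1F , a~b) ∷ []) no-pairs)
        (general-rate (S ⊖ f 0F)))
      (drop-isolated general d∈Q d-isolated
        (loses-list (f 0F ∷ f 1F ∷ f 2F ∷ f 3F ∷ []) (inside-S 1F) (⊖⊆remove ∘ ∈-remove⁻) no-pairs
          ((distinct (λ ()) ∷ distinct (λ ()) ∷ distinct (λ ()) ∷ []) ∷ (distinct (λ ()) ∷ distinct (λ ()) ∷ []) ∷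
            (distinct (λ ()) ∷ []) ∷ [] ∷ [])
          ((inside-S 0F , (∉-⊖ (~-sym a~b) ∘ ∈-remove⁻)) ∷ (inside-S 1F , λ p → proj₁ (proj₂ (∈-⊖⁻ (∈-remove⁻ p))) refl) ∷
            (inside-S 2F , (∉-⊖ b~c ∘ ∈-remove⁻)) ∷ (inside-S 3F , ∉-remove {S = Q}) ∷ []))
        (general-rate (Q - f 3F))))

    -- In the even case branching gives 3/4 of the unit, more than the leading coefficient 2/3. On
    -- four vertices the unit is at most 4 times 2^r, so 1/12 of it can be moved into the correction
    -- term.
    path₄-connected-rate : ConnectedRate S
    path₄-connected-rate δ od r h B = Bound-weaken _ (connected δ od)
      (everyᵇ-elim (λ δ _ → (drop 2 0 general ⊞ drop 4 0 general) od ≼ᵇ connected δ od) tt δ od) (at-budget path₄-rate B)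
    path₄-connected-rate δ ev r h B = Bound-weaken (rate 8 4 12) (connected δ ev)
      (everyᵇ-elim (λ δ _ → rate 8 4 12 ≼ᵇ connected δ ev) tt δ ev)
      (Bound-trade 8 1 0 12 4 (small-unit 0 2 4 r h
          (halved 2 r (trans (cong (_+ r) (sym (fits-size F))) (Budget.size≡ B))) tt)
        (Bound-weaken _ (rate 9 0 12) tt (at-budget path₄-rate B)))

  module _ {S : Subset n} {f : Fin 5 → Fin n} (F : Fits S (C 5) f) where
    open Fits F

    private
      distinct : ∀ {i j} → i ≢ j → f i ≢ f j
      distinct i≢j eq = i≢j (injective _ _ eq)

      v~a : f 0F ~ f 1F
      v~a = preserves 0F 1F ((λ ()) , inj₁ (inj₁ refl))
      a~b : f 1F ~ f 2F
      a~b = preserves 1F 2F ((λ ()) , inj₁ (inj₁ refl))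
      b~c : f 2F ~ f 3F
      b~c = preserves 2F 3F ((λ ()) , inj₁ (inj₁ refl))
      c~d : f 3F ~ f 4F
      c~d = preserves 3F 4F ((λ ()) , inj₁ (inj₁ refl))
      v~d : f 0F ~ f 4F
      v~d = preserves 0F 4F ((λ ()) , inj₂ (inj₂ (refl , refl)))

      R Q : Subset n
      R = S - f 0F
      Q = R ⊖ f 2F

      in-R : ∀ i → i ≢ 0F → f i ∈ R
      in-R i i≢0 = ∈-remove⁺ (inside-S i) (distinct i≢0)

      a-nbhd : Nbhd⊆ R (f 1F) (f 2F ∷ [])
      a-nbhd = nbhd-remove (fits-nbhd F 1F (0F ∷ 2F ∷ []) (toWitness {a? = fin5? (C 5) 1F (0F ∷ 2F ∷ [])} tt))

      d-nbhd : Nbhd⊆ S (f 4F) (f 0F ∷ f 3F ∷ [])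
      d-nbhd = fits-nbhd F 4F (0F ∷ 3F ∷ []) (toWitness {a? = fin5? (C 5) 4F (0F ∷ 3F ∷ [])} tt)

      closes : Connects S (f 0F) ((f 1F , f 4F) ∷ [])
      closes = one-pair (distinct (λ ()) , v~a , v~d ,
        step (in-R 1F λ ()) a~b (step (in-R 2F λ ()) b~c (reach-edge (in-R 3F λ ()) (in-R 4F λ ()) c~d)))

      d∈Q : f 4F ∈ Q
      d∈Q = ∈-⊖⁺ (in-R 4F λ ()) (distinct λ ()) λ e → [ distinct (λ ()) , distinct (λ ()) ]′ (nbhd₂ d-nbhd (inside-S 2F) (~-sym e))

      d-isolated : Nbhd⊆ Q (f 4F) []
      d-isolated u u∈ e with nbhd₂ d-nbhd (∈-remove⁻ (proj₁ (∈-⊖⁻ u∈))) e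
      ... | inj₁ refl = contradiction refl (remove-≢ (proj₁ (∈-⊖⁻ u∈)))
      ... | inj₂ refl = ⊥-elim (proj₂ (proj₂ (∈-⊖⁻ u∈)) b~c)

    cycle₅-rate : HasRate (drop 3 1 general ⊞ drop 5 1 general ⊞ drop 3 1 general) S
    cycle₅-rate = bounded-≤ _ (≤-trans (mis-branch S (f 0F)) (ℕ.+-monoˡ-≤ _ (mis-leaf (in-R 1F λ ()) a-nbhd)))
      (bounded-+ _ _ (bounded-+ _ _
        (bounded-lose general (loses-list (f 0F ∷ f 1F ∷ f 2F ∷ []) (inside-S 0F) (proj₁ ∘ ∈-⊖⁻) closes
          ((distinct (λ ()) ∷ distinct (λ ()) ∷ []) ∷ (distinct (λ ()) ∷ []) ∷ [] ∷ [])
          ((inside-S 0F , (∉-remove {S = S} ∘ proj₁ ∘ ∈-⊖⁻)) ∷ (inside-S 1F , λ p → proj₁ (proj₂ (∈-⊖⁻ p)) refl) ∷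
            (inside-S 2F , ∉-⊖ a~b) ∷ [])) (general-rate (R ⊖ f 1F)))
        (drop-isolated general d∈Q d-isolated
          (loses-list (f 0F ∷ f 1F ∷ f 2F ∷ f 3F ∷ f 4F ∷ []) (inside-S 0F) (proj₁ ∘ ∈-⊖⁻ ∘ ∈-remove⁻) closes
            ((distinct (λ ()) ∷ distinct (λ ()) ∷ distinct (λ ()) ∷ distinct (λ ()) ∷ []) ∷
              (distinct (λ ()) ∷ distinct (λ ()) ∷ distinct (λ ()) ∷ []) ∷ (distinct (λ ()) ∷ distinct (λ ()) ∷ []) ∷
              (distinct (λ ()) ∷ []) ∷ [] ∷ [])
            ((inside-S 0F , (∉-remove {S = S} ∘ proj₁ ∘ ∈-⊖⁻ ∘ ∈-remove⁻)) ∷ (inside-S 1F , (∉-⊖ (~-sym a~b) ∘ ∈-remove⁻)) ∷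
              (inside-S 2F , λ p → proj₁ (proj₂ (∈-⊖⁻ (∈-remove⁻ p))) refl) ∷
              (inside-S 3F , (∉-⊖ b~c ∘ ∈-remove⁻)) ∷ (inside-S 4F , ∉-remove {S = Q}) ∷ []))
          (general-rate (Q - f 4F))))
        (bounded-lose general (loses-⊖ {us = f 1F ∷ f 4F ∷ []} (inside-S 0F)
          ((distinct (λ ()) ∷ []) ∷ [] ∷ [] , (inside-S 1F , v~a) ∷ (inside-S 4F , v~d) ∷ []) closes) (general-rate (S ⊖ f 0F))))

    -- Branching gives 5/6 and 10/9 of the unit. On five vertices with r ≥ 1 the unit is at most 3
    -- times 2^r in the even and 4 times 2^r in the odd case, and the surplus of 1/6 or 1/9 is moved
    -- into the correction term. Without the flag the odd case is void: r is even, so r ≥ 2 and 3r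
    -- exceeds 5.
    cycle₅-connected-rate : ConnectedRate S
    cycle₅-connected-rate δ p r h B = go δ p r B
      where
      1≤r : ∀ {δ p r} → Budget δ p r h S → 1 ≤ r
      1≤r B = ≤-trans (s≤s z≤n) (≤-trans (Loses.fewer-cycles (loses-remove (inside-S 0F) closes)) (Budget.cyc≤ B))
      size : ∀ {δ p r} → Budget δ p r h S → 5 + r ≡ val p + 2 * h
      size B = trans (cong (_+ _) (sym (fits-size F))) (Budget.size≡ B)
      go : ∀ δ p r → Budget δ p r h S → Bound (connected δ p) (mis S) r h
      go δ p zero B = contradiction (1≤r B) λ ()
      go δ ev (suc r) B = Bound-weaken (rate 4 3 6) (connected δ ev)
        (everyᵇ-elim (λ δ _ → rate 4 3 6 ≼ᵇ connected δ ev) tt δ ev)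
        (Bound-trade 4 1 0 6 3 (small-unit 1 3 3 r h (halved 3 r (trans (sym (ℕ.+-suc 5 r)) (size B))) tt)
          (Bound-weaken _ (rate 5 0 6) tt (at-budget cycle₅-rate B)))
      go true od (suc r) B = Bound-weaken (rate 9 4 9) (connected true od) tt
        (Bound-trade 9 1 0 9 4 (small-unit 0 2 4 (suc r) h (halved 2 (suc r) (ℕ.suc-injective (size B))) tt)
          (Bound-weaken _ (rate 10 0 9) tt (at-budget cycle₅-rate B)))
      go false od (suc zero) B = ⊥-elim (odd h (size B))
        where
        odd : ∀ h → 6 ≡ 1 + 2 * h → ⊥
        odd 1 ()
        odd 2 ()
        odd (suc (suc (suc h))) eq = contradiction (trans eq (cong suc (ℕ.*-distribˡ-+ 2 3 h))) λ ()
      go false od (suc (suc r)) B with Budget.regime B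
      ... | inj₂ le = contradiction (≤-trans (ℕ.*-monoʳ-≤ 3 (s≤s (s≤s (z≤n {r})))) (≤-trans le (≤-reflexive (fits-size F))))
        λ { (s≤s (s≤s (s≤s (s≤s (s≤s ()))))) }

  special-rate : ∀ {S} → ConnectedIn S → Special S → ConnectedRate S
  special-rate conn (hub h∈ (_ , _ , cl)) = Hub.hub-rate conn h∈ cl
  special-rate conn (path₄ F)  = path₄-connected-rate F
  special-rate conn (cycle₅ F) = cycle₅-connected-rate F

  claim-rate : ∀ {S} → Claim S → ConnectedIn S → 1 ≤ ∣ S ∣ → ∣ S ∣ ≢ 2 → ConnectedRate S
  claim-rate claim conn ne ≢2 δ p r h B with claim conn ne ≢2 B
  ... | strict b  = Bound<⇒Bound (connected δ p) b
  ... | special s = special-rate conn s δ p r h B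

  -- For configurations in which rates that ignore connectivity already fall below c, whatever the
  -- flag and the parity.
  crude : ∀ {S δ p r h} x → T (everyᵇ λ δ p → x p ≺ᵇ connected δ p) → HasRate x S →
    Budget δ p r h S → Outcome δ p r h S
  crude {δ = δ} {p} x lt b B = strict (Bound-strict (x p) (connected δ p)
    (everyᵇ-elim (λ δ p → x p ≺ᵇ connected δ p) lt δ p) (at-budget b B))

  crude-od : ∀ {S δ r h} x → T (everyᵇ λ δ _ → x od ≺ᵇ connected δ od) → HasRate x S →
    Budget δ od r h S → Outcome δ od r h S
  crude-od {δ = δ} x lt b B = strict (Bound-strict (x od) (connected δ od)
    (everyᵇ-elim (λ δ _ → x od ≺ᵇ connected δ od) lt δ od) (at-budget b B))

  remove-connected : ∀ {S v} → ConnectedIn S → Noncut S v → ConnectedIn (S - v)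
  remove-connected {S} {v} conn nc a b a∈ b∈
    with reach-exit (S - v) (conn a b (∈-remove⁻ a∈) (∈-remove⁻ b∈)) a∈
       | reach-exit (S - v) (conn b a (∈-remove⁻ b∈) (∈-remove⁻ a∈)) b∈
  ... | inj₁ r | _ = r
  ... | inj₂ _ | inj₁ r = reach-sym r
  ... | inj₂ (c , d , r , c~d , d∈ , d∉) | inj₂ (c′ , d′ , r′ , c′~d′ , d′∈ , d′∉) =
    reach-trans r (reach-trans (nc c c′ (∈-remove⁻ (reach-target r)) (∈-remove⁻ (reach-target r′))
      (exit c~d d∈ d∉) (exit c′~d′ d′∈ d′∉)) (reach-sym r′))
    where
    exit : ∀ {c d} → c ~ d → d ∈ S → d ∉ S - v → v ~ c
    exit {c} {d} e d∈ d∉ = subst (_~ c) (decidable-stable (d Fin.≟ v) λ ≢v → d∉ (∈-remove⁺ d∈ ≢v)) (~-sym e)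

  -- A walk towards x can leave `T` only into w, say from c. Then `link` leads from c to x without
  -- w, and since w is the only exit this second walk stays in `T`.
  rest-connected : ∀ {S T w x} → ConnectedIn S → T ⊆ S → w ∉ T → x ∈ T →
    (∀ c d → c ∈ T → d ∈ S → d ∉ T → c ~ d → d ≡ w) →
    (∀ c → c ∈ T → w ~ c → Reach (S - w) c x) → ConnectedIn T
  rest-connected {S} {T} {w} {x} conn sub w∉ x∈ boundary link a b a∈ b∈ = reach-trans (to-x a a∈) (reach-sym (to-x b b∈))
    where
    to-x : ∀ a → a ∈ T → Reach T a x
    to-x a a∈ with reach-exit T (conn a x (sub a∈) (sub x∈)) a∈
    ... | inj₁ r = r
    ... | inj₂ (c , d , r , e , d∈ , d∉) with boundary c d (reach-target r) d∈ d∉ e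
    ... | refl with reach-exit T (link c (reach-target r) (~-sym e)) (reach-target r)
    ... | inj₁ r′ = reach-trans r r′
    ... | inj₂ (c′ , d′ , r′ , e′ , d′∈ , d′∉) =
      contradiction (boundary c′ d′ (reach-target r′) (∈-remove⁻ d′∈) d′∉ e′) (remove-≢ d′∈)

  members : ∀ {S : Subset n} (xs : List (Fin n)) → Unique xs → All (_∈ S) xs → length xs ≤ ∣ S ∣
  members {S} xs u all = ≤-trans (ℕ.m≤m+n _ _) (size-drop {T = ∅} xs (λ x∈ → contradiction x∈ ∉⊥) u
    (All.map (_, ∉⊥) all))

  3≤⇒≢2 : ∀ {k} → 3 ≤ k → k ≢ 2
  3≤⇒≢2 (s≤s (s≤s ())) refl

  clustered-≡ : ∀ {S T} → S ⊆ T → T ⊆ S → IsClustered S → IsClustered T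
  clustered-≡ p q = subst IsClustered (⊆-antisym p q)

  hub-edge : ∀ {S w x v} → w ∈ S → EdgeComponent (S - w) x v → IsClustered (S - w - x - v) → Special S
  hub-edge w∈ c (_ , _ , cl) = hub w∈ (_ , _ , edge c tt cl)

  size-two : ∀ {S} → ConnectedIn S → ∣ S ∣ ≡ 2 → IsClustered S
  size-two {S} conn eq with any? (_∈? S)
  ... | no none = 0 , 0 , empty λ v v∈ → none (v , v∈)
  ... | yes (u , u∈) with any? (_∈? S - u)
  ...   | no none = contradiction (trans (size-remove u∈) eq) λ e → small (ℕ.suc-injective e)
    where
    small : ∣ S - u ∣ ≢ 1
    small e = case trans (sym e) (clusters-size (empty {Q₃ = λ _ _ _ → ⊤} {Q₂ = λ _ _ → ⊤} λ v v∈ → none (v , v∈))) of λ ()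
  ...   | yes (v , v∈) = 0 , 1 , edge comp tt (empty λ z z∈ → third z (∈-remove⁻ (∈-remove⁻ z∈)) (remove-≢ (∈-remove⁻ z∈)) (remove-≢ z∈))
    where
    v∈S = ∈-remove⁻ v∈
    third : ∀ z → z ∈ S → z ≢ u → z ≢ v → ⊥
    third z z∈ z≢u z≢v = contradiction eq (3≤⇒≢2 (members (z ∷ v ∷ u ∷ [])
      ((z≢v ∷ z≢u ∷ []) ∷ (remove-≢ v∈ ∷ []) ∷ [] ∷ []) (z∈ ∷ v∈S ∷ u∈ ∷ [])))
    only : ∀ x y → (∀ z → z ∈ S → z ≢ x → z ≢ y → ⊥) → Nbhd⊆ S x (y ∷ [])
    only x y no-third z z∈ e with z Fin.≟ y
    ... | yes eq = here eq
    ... | no ≢y = ⊥-elim (no-third z z∈ (~⇒≢ e ∘ sym) ≢y)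
    adjacent : ∀ {a} → Reach S u a → a ≡ v → u ~ v
    adjacent (stop _) eq = contradiction (sym eq) (remove-≢ v∈)
    adjacent (step {c = c} _ e r) _ with only u v third c (reach-source r) e
    ... | here refl = e
    comp : EdgeComponent S u v
    comp = record { x∈ = u∈ ; y∈ = v∈S ; x~y = adjacent (conn u v u∈ v∈S) refl ; x-nbhd = only u v third
      ; y-nbhd = only v u λ z z∈ a b → third z z∈ b a }

  three-in-two : ∀ {k l a b c : Fin n} → a ∈ₗ k ∷ l ∷ [] → b ∈ₗ k ∷ l ∷ [] → c ∈ₗ k ∷ l ∷ [] → a ≢ b → a ≢ c → b ≢ c → ⊥
  three-in-two (here refl) (here refl) _ ab _ _ = ab refl
  three-in-two (here refl) (there (here refl)) (here refl) _ ac _ = ac refl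
  three-in-two (here refl) (there (here refl)) (there (here refl)) _ _ bc = bc refl
  three-in-two (there (here refl)) (there (here refl)) _ ab _ _ = ab refl
  three-in-two (there (here refl)) (here refl) (there (here refl)) _ ac _ = ac refl
  three-in-two (there (here refl)) (here refl) (here refl) _ _ bc = bc refl

  -- Configurations in the induction step

  module Local {S} (conn : ConnectedIn S) (IH : ∀ {T v} → v ∈ S → T ⊆ S - v → Claim T) where

    Goal : Set
    Goal = ∀ {δ p r h} → Budget δ p r h S → Outcome δ p r h S

    Goal-at : Parity → Set
    Goal-at p = ∀ {δ r h} → Budget δ p r h S → Outcome δ p r h S

    by-parity : Goal-at ev → Goal-at od → Goal
    by-parity e o {p = ev} B = e B
    by-parity e o {p = od} B = o B

    conclude : ∀ {δ p r h} (x : Bool → Parity → Rate) → T (everyᵇ λ δ p → x δ p ≺ᵇ connected δ p) → Bound (x δ p) (mis S) r h → Outcome δ p r h S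
    conclude {δ} {p} x lt b = strict (Bound-strict (x δ p) (connected δ p)
      (everyᵇ-elim (λ δ p → x δ p ≺ᵇ connected δ p) lt δ p) b)

    -- Three neighbours form three pairs, and as v separates none of them three cycles run through
    -- v. Moreover S - v stays connected, so the induction hypothesis applies with three cycles
    -- less.
    crowded-noncut : ∀ {v us} → v ∈ S → Noncut S v → Nbrs S v us → length us ≡ 3 → Goal
    crowded-noncut {v} {a ∷ b ∷ c ∷ []} v∈ nc nb@((ab ∷ ac ∷ []) ∷ (bc ∷ []) ∷ [] ∷ [] , (a∈ , e) ∷ (b∈ , f) ∷ (c∈ , g) ∷ []) refl {δ} B =
      conclude (λ δ p → drop 1 3 (connected δ) p ⊕ drop 4 3 general p) tt
        (Bound-≤ _ (mis-branch S v) (Bound-+ _ _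
          (connected-lose δ (claim-rate (IH v∈ id) (remove-connected conn nc) (≤-trans (s≤s z≤n) size₃) (3≤⇒≢2 size₃))
            (loses! (size-remove v∈) (Loses.fewer-cycles (loses-remove v∈ cn))) (inj₂ (refl , s≤s z≤n)) B)
          (at-budget (bounded-lose general (loses-⊖ v∈ nb cn) (general-rate (S ⊖ v))) B)))
      where
      size₃ : 3 ≤ ∣ S - v ∣
      size₃ = members (a ∷ b ∷ c ∷ []) ((ab ∷ ac ∷ []) ∷ (bc ∷ []) ∷ [] ∷ [])
        (∈-remove⁺ a∈ (~⇒≢ e ∘ sym) ∷ ∈-remove⁺ b∈ (~⇒≢ f ∘ sym) ∷ ∈-remove⁺ c∈ (~⇒≢ g ∘ sym) ∷ [])
      cn : Connects S v ((a , b) ∷ (a , c) ∷ (b , c) ∷ [])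
      cn = (ab , e , f , nc a b a∈ b∈ e f) ∷ (ac , e , g , nc a c a∈ c∈ e g) ∷ (bc , f , g , nc b c b∈ c∈ f g) ∷ [] ,
        (inj₂ (ab ∘ sym , bc) ∷ inj₁ (ab , ac) ∷ []) ∷ (inj₁ (ab , ac) ∷ []) ∷ [] ∷ []

    leaf-four : ∀ {x w us} → x ∈ S → w ∈ S → x ~ w → Nbhd⊆ S x (w ∷ []) → Nbrs S w us → length us ≡ 4 → Goal
    leaf-four {x} {w} {us@(_ ∷ _ ∷ _ ∷ _ ∷ [])} x∈ w∈ e nx nb refl = crude (drop 2 0 general ⊞ drop 5 0 general) tt
      (bounded-≤ _ (mis-leaf x∈ nx) (bounded-+ _ _
        (bounded-lose general (loses-⊖ {us = w ∷ []} x∈ ([] ∷ [] , (w∈ , e) ∷ []) no-pairs) (general-rate (S ⊖ x)))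
        (bounded-lose general (loses-⊖ w∈ nb no-pairs) (general-rate (S ⊖ w)))))

    -- Choosing x removes w and leaves x′ isolated, so this branch loses a third vertex for free.
    leaf-leaf : ∀ {x x′ w u} → x ∈ S → x′ ∈ S → w ∈ S → u ∈ S → w ~ x → w ~ x′ → w ~ u → x′ ≢ x → x ≢ u → x′ ≢ u →
      Nbhd⊆ S x (w ∷ []) → Nbhd⊆ S x′ (w ∷ []) → Goal
    leaf-leaf {x} {x′} {w} {u} x∈ x′∈ w∈ u∈ e e′ f x′≢x x≢u x′≢u nx nx′ = crude (drop 3 0 general ⊞ drop 4 0 general) tt
      (bounded-≤ _ (mis-leaf x∈ nx) (bounded-+ _ _
        (drop-isolated general x′∈Q iso (loses-list (x′ ∷ x ∷ w ∷ []) x∈ (⊖⊆remove ∘ ∈-remove⁻) no-pairs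
            ((x′≢x ∷ (~⇒≢ e′ ∘ sym) ∷ []) ∷ ((~⇒≢ e ∘ sym) ∷ []) ∷ [] ∷ [])
            ((x′∈ , ∉-remove {S = S ⊖ x}) ∷ (x∈ , (λ q → proj₁ (proj₂ (∈-⊖⁻ (∈-remove⁻ q))) refl)) ∷
              (w∈ , (∉-⊖ (~-sym e) ∘ ∈-remove⁻)) ∷ []))
          (general-rate _))
        (bounded-lose general (loses-⊖ {us = x ∷ x′ ∷ u ∷ []} w∈
          (((x′≢x ∘ sym) ∷ x≢u ∷ []) ∷ (x′≢u ∷ []) ∷ [] ∷ [] , (x∈ , e) ∷ (x′∈ , e′) ∷ (u∈ , f) ∷ []) no-pairs)
          (general-rate (S ⊖ w)))))
      where
      x′∈Q : x′ ∈ S ⊖ x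
      x′∈Q = ∈-⊖⁺ x′∈ x′≢x λ q → ~⇒≢ e′ (sym (nbhd₁ nx x′∈ q))
      iso : Nbhd⊆ (S ⊖ x) x′ []
      iso z z∈ q with nbhd₁ nx′ (proj₁ (∈-⊖⁻ z∈)) q
      ... | refl = ⊥-elim (∉-⊖ (~-sym e) z∈)

    -- Choosing w removes v′ and isolates x′, so the branch loses five vertices as if w had a fourth
    -- neighbour.
    leaf-pendant : ∀ {x w v′ x′ u} → x ∈ S → w ∈ S → v′ ∈ S → x′ ∈ S → u ∈ S → w ~ x → w ~ v′ → w ~ u → v′ ~ x′ →
      x ≢ v′ → x ≢ u → v′ ≢ u → x′ ≢ w → Nbhd⊆ S x (w ∷ []) → Nbhd⊆ S x′ (v′ ∷ []) → Goal
    leaf-pendant {x} {w} {v′} {x′} {u} x∈ w∈ v′∈ x′∈ u∈ e f g k x≢v′ x≢u v′≢u x′≢w nx nx′ =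
      crude (drop 2 0 general ⊞ drop 5 0 general) tt
      (bounded-≤ _ (mis-leaf x∈ nx) (bounded-+ _ _
        (bounded-lose general (loses-⊖ {us = w ∷ []} x∈ ([] ∷ [] , (w∈ , ~-sym e) ∷ []) no-pairs) (general-rate (S ⊖ x)))
        (drop-isolated general x′∈Q iso (loses-list (x′ ∷ w ∷ x ∷ v′ ∷ u ∷ []) w∈ (⊖⊆remove ∘ ∈-remove⁻) no-pairs
          ((x′≢w ∷ apart e ∷ (~⇒≢ k ∘ sym) ∷ apart g ∷ []) ∷ (~⇒≢ e ∷ ~⇒≢ f ∷ ~⇒≢ g ∷ []) ∷ (x≢v′ ∷ x≢u ∷ []) ∷ (v′≢u ∷ []) ∷ [] ∷ [])
          ((x′∈ , ∉-remove {S = S ⊖ w}) ∷ (w∈ , λ q → proj₁ (proj₂ (∈-⊖⁻ (∈-remove⁻ q))) refl) ∷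
            (x∈ , (∉-⊖ e ∘ ∈-remove⁻)) ∷ (v′∈ , (∉-⊖ f ∘ ∈-remove⁻)) ∷ (u∈ , (∉-⊖ g ∘ ∈-remove⁻)) ∷ [])) (general-rate _))))
      where
      w≁x′ : ¬ w ~ x′
      w≁x′ q with nbhd₁ nx′ w∈ (~-sym q)
      ... | refl = ~-irrefl refl f
      apart : ∀ {z} → w ~ z → x′ ≢ z
      apart q refl = w≁x′ q
      x′∈Q : x′ ∈ S ⊖ w
      x′∈Q = ∈-⊖⁺ x′∈ x′≢w w≁x′
      iso : Nbhd⊆ (S ⊖ w) x′ []
      iso z z∈ q with nbhd₁ nx′ (proj₁ (∈-⊖⁻ z∈)) q
      ... | refl = ⊥-elim (∉-⊖ f z∈)

    -- The general bounds add up to 2/3 of the unit in the even case, which is strict thanks to the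
    -- term 2^(r-1), but to exactly 1 in the odd case. There `Q` is examined. If it is not
    -- clustered, `bad` yields the gap. If it is, u and u′ share a component: a triangle, whose
    -- third vertex becomes isolated when w is chosen, or an edge, and then S is a triangle with one
    -- leaf.
    leaf-cyclic : ∀ {x w u u′} → x ∈ S → w ∈ S → u ∈ S → u′ ∈ S → w ~ x → w ~ u → w ~ u′ → x ≢ u → x ≢ u′ → u ≢ u′ →
      Nbhd⊆ S x (w ∷ []) → Nbhd⊆ S w (x ∷ u ∷ u′ ∷ []) → Reach (S - w) u u′ → Goal
    leaf-cyclic {x} {w} {u} {u′} x∈ w∈ u∈ u′∈ e f g x≢u x≢u′ u≢u′ nx nw link = by-parity even odd
      where
      Q = S ⊖ x
      closes : Connects S w ((u , u′) ∷ [])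
      closes = one-pair (u≢u′ , f , g , link)
      Q⊆ : Q ⊆ S - w
      Q⊆ z∈ = let (a , b , c) = ∈-⊖⁻ z∈ in ∈-remove⁺ a λ { refl → c (~-sym e) }
      loses-Q : Loses 2 1 Q S
      loses-Q = loses-list (x ∷ w ∷ []) w∈ Q⊆ closes (((~⇒≢ e ∘ sym) ∷ []) ∷ [] ∷ [])
        ((x∈ , λ q → proj₁ (proj₂ (∈-⊖⁻ q)) refl) ∷ (w∈ , ∉-⊖ (~-sym e)) ∷ [])
      nbrs : Nbrs S w (x ∷ u ∷ u′ ∷ [])
      nbrs = (x≢u ∷ x≢u′ ∷ []) ∷ (u≢u′ ∷ []) ∷ [] ∷ [] , (x∈ , e) ∷ (u∈ , f) ∷ (u′∈ , g) ∷ []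
      rate-by : ∀ x → HasRate x Q → HasRate (drop 2 1 x ⊞ drop 4 1 general) S
      rate-by x b = bounded-≤ _ (mis-leaf x∈ nx) (bounded-+ _ _ (bounded-lose x loses-Q b)
        (bounded-lose general (loses-⊖ w∈ nbrs closes) (general-rate (S ⊖ w))))
      in-Q : ∀ {z} → z ∈ S → w ~ z → z ≢ x → z ∈ Q
      in-Q z∈ q z≢x = ∈-⊖⁺ z∈ z≢x λ s → ~⇒≢ q (sym (nbhd₁ nx z∈ s))
      in-Q′ : ∀ {z} → z ∈ S → z ≢ w → z ≢ x → z ∈ Q
      in-Q′ z∈ z≢w z≢x = ∈-⊖⁺ z∈ z≢x λ s → z≢w (nbhd₁ nx z∈ s)
      u∈Q = in-Q u∈ f (x≢u ∘ sym)
      u′∈Q = in-Q u′∈ g (x≢u′ ∘ sym)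
      stay : ∀ {a b} → Reach (S - w) a b → a ∈ Q → b ∈ Q → Reach Q a b
      stay r a∈ b∈ with reach-exit Q r a∈
      ... | inj₁ r′ = r′
      ... | inj₂ (c , d , r′ , q , d∈ , d∉) = case nx c (proj₁ (∈-⊖⁻ (reach-target r′))) (subst (_~ c) (d≡x d d∈ d∉) (~-sym q)) of
          λ { (here eq) → contradiction eq (remove-≢ (Q⊆ (reach-target r′))) }
        where
        d≡x : ∀ d → d ∈ S - w → d ∉ Q → d ≡ x
        d≡x d d∈ d∉ = decidable-stable (d Fin.≟ x) λ ≢x → d∉ (in-Q′ (∈-remove⁻ d∈) (remove-≢ d∈) ≢x)
      clustered-case : IsClustered Q → Goal
      clustered-case (_ , _ , cl) with clusters-reach cl (stay link u∈Q u′∈Q)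
      ... | inj₁ eq = contradiction eq u≢u′
      ... | inj₂ u~u′ with neighbour? Q u (u′ ∷ [])
      ...   | inj₁ (z , z∈ , u~z , z∉) = crude (drop 2 1 general ⊞ drop 5 1 general) tt
        (bounded-≤ _ (mis-leaf x∈ nx) (bounded-+ _ _ (bounded-lose general loses-Q (general-rate Q))
          (drop-isolated general z∈W iso (loses-list (z ∷ w ∷ x ∷ u ∷ u′ ∷ []) w∈ (⊖⊆remove ∘ ∈-remove⁻) closes
            (((remove-≢ (Q⊆ z∈)) ∷ proj₁ (proj₂ (∈-⊖⁻ z∈)) ∷ (~⇒≢ u~z ∘ sym) ∷ (z∉ ∘ here) ∷ []) ∷
              (~⇒≢ e ∷ ~⇒≢ f ∷ ~⇒≢ g ∷ []) ∷ proj₁ nbrs)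
            ((proj₁ (∈-⊖⁻ z∈) , ∉-remove {S = S ⊖ w}) ∷ (w∈ , λ q → proj₁ (proj₂ (∈-⊖⁻ (∈-remove⁻ q))) refl) ∷
              (x∈ , (∉-⊖ e ∘ ∈-remove⁻)) ∷ (u∈ , (∉-⊖ f ∘ ∈-remove⁻)) ∷ (u′∈ , (∉-⊖ g ∘ ∈-remove⁻)) ∷ []))
            (general-rate _))))
        where
        z≢x = proj₁ (proj₂ (∈-⊖⁻ z∈))
        w≁z : ¬ w ~ z
        w≁z q = All¬⇒¬Any (z≢x ∷ ~⇒≢ u~z ∘ sym ∷ z∉ ∘ here ∷ []) (nw z (proj₁ (∈-⊖⁻ z∈)) q)
        z∈W : z ∈ S ⊖ w
        z∈W = ∈-⊖⁺ (proj₁ (∈-⊖⁻ z∈)) (remove-≢ (Q⊆ z∈)) w≁z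
        -- A further neighbour of z would make u, u′, z and it mutually adjacent.
        iso : Nbhd⊆ (S ⊖ w) z []
        iso t t∈ z~t = ⊥-elim (no-K₄ (clusters-clique cl z∈ u∈Q t∈Q (~-sym u~z) z~t))
          where
          t∈S = proj₁ (∈-⊖⁻ t∈)
          t≢x : t ≢ x
          t≢x refl = ∉-⊖ e t∈
          t∈Q = in-Q′ t∈S (proj₁ (proj₂ (∈-⊖⁻ t∈))) t≢x
          no-K₄ : u ≡ t ⊎ u ~ t → ⊥
          no-K₄ (inj₁ refl) = ∉-⊖ f t∈
          no-K₄ (inj₂ u~t) with clusters-nbhd cl u u∈Q
          ... | k , l , nb = three-in-two (nb u′ u′∈Q u~u′) (nb z z∈ u~z) (nb t t∈Q u~t)
                (z∉ ∘ here ∘ sym) (λ { refl → ∉-⊖ g t∈ }) (~⇒≢ z~t)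
      ...   | inj₂ nu = λ _ → special (hub x∈ (1 , 0 , triangle comp tt (empty none)))
        where
        nu′ : Nbhd⊆ Q u′ (u ∷ [])
        nu′ t t∈ q with clusters-clique cl u′∈Q u∈Q t∈ (~-sym u~u′) q
        ... | inj₁ eq = here (sym eq)
        ... | inj₂ u~t with nbhd₁ nu t∈ u~t
        ...   | refl = ⊥-elim (~-irrefl refl q)
        w∈′ = ∈-remove⁺ w∈ (~⇒≢ e)
        u∈′ = ∈-remove⁺ u∈ (x≢u ∘ sym)
        u′∈′ = ∈-remove⁺ u′∈ (x≢u′ ∘ sym)
        around : ∀ {a b} → Nbhd⊆ Q a (b ∷ []) → Nbhd⊆ (S - x) a (w ∷ b ∷ [])
        around nb t t∈ q with t Fin.≟ w
        ... | yes eq = here eq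
        ... | no t≢w = there (nb t (in-Q′ (∈-remove⁻ t∈) t≢w (remove-≢ t∈)) q)
        comp : TriangleComponent (S - x) w u u′
        comp = record { x∈ = w∈′ ; y∈ = u∈′ ; z∈ = u′∈′ ; x~y = f ; x~z = g ; y~z = u~u′
          ; x-nbhd = nbhd-remove nw
          ; y-nbhd = around nu ; z-nbhd = around nu′ }
        none : ∀ z → z ∉ S - x - w - u - u′
        none z z∈ = excluded (clusters-reach cl z⇝)
          where
          z∈₂ = ∈-remove⁻ z∈
          z∈₁ = ∈-remove⁻ z∈₂
          z∈Q = in-Q′ (∈-remove⁻ (∈-remove⁻ z∈₁)) (remove-≢ z∈₁) (remove-≢ (∈-remove⁻ z∈₁))
          from : ∀ {c} → c ∈ₗ x ∷ u ∷ u′ ∷ [] → c ∈ Q → Reach Q c u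
          from (here refl) c∈ = contradiction refl (proj₁ (proj₂ (∈-⊖⁻ c∈)))
          from (there (here refl)) c∈ = stop c∈
          from (there (there (here refl))) c∈ = reach-edge u′∈Q u∈Q (~-sym u~u′)
          z⇝ : Reach Q z u
          z⇝ with reach-exit Q (conn z w (proj₁ (∈-⊖⁻ z∈Q)) w∈) z∈Q
          ... | inj₁ r = contradiction (Q⊆ (reach-target r)) (∉-remove {S = S})
          ... | inj₂ (c , d , r , q , d∈ , d∉) with d Fin.≟ w
          ...   | yes refl = reach-trans r (from (nw c (proj₁ (∈-⊖⁻ (reach-target r))) (~-sym q)) (reach-target r))
          ...   | no d≢w with d Fin.≟ x
          ...     | no d≢x = contradiction (in-Q′ d∈ d≢w d≢x) d∉
          ...     | yes refl = case nx c (proj₁ (∈-⊖⁻ (reach-target r))) (~-sym q) of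
                      λ { (here eq) → contradiction eq (remove-≢ (Q⊆ (reach-target r))) }
          excluded : z ≡ u ⊎ z ~ u → ⊥
          excluded (inj₁ eq) = remove-≢ z∈₂ eq
          excluded (inj₂ q) = remove-≢ z∈ (nbhd₁ nu z∈Q (~-sym q))
      even : Goal-at ev
      even {δ} B = strict (Bound-strict _ (connected δ ev)
        (everyᵇ-elim (λ δ _ → (drop 2 1 general ⊞ drop 4 1 general) ev ≺ᵇ connected δ ev) tt δ ev)
        (at-budget (rate-by general (general-rate Q)) B))
      odd : Goal-at od
      odd with proj₂ (classify Q)
      ... | inj₁ cl = clustered-case cl
      ... | inj₂ b = crude-od (drop 2 1 bad ⊞ drop 4 1 general) tt (rate-by bad b)

    leaf-noncut : ∀ {T x y} → Nbhd⊆ T x (y ∷ []) → Noncut T x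
    leaf-noncut nb a b a∈ b∈ e f with nb a a∈ e | nb b b∈ f
    ... | here refl | here refl = stop (∈-remove⁺ a∈ (~⇒≢ e ∘ sym))

    record Pendant (x v w : Fin n) : Set where
      field
        x∈ : x ∈ S
        v∈ : v ∈ S
        w∈ : w ∈ S
        x~v : x ~ v
        v~w : v ~ w
        x≢w : x ≢ w
        x-nbhd : Nbhd⊆ S x (v ∷ [])
        v-nbhd : Nbhd⊆ S v (x ∷ w ∷ [])

      w≁x : ¬ w ~ x
      w≁x e = ~⇒≢ v~w (sym (nbhd₁ x-nbhd w∈ (~-sym e)))

      component : EdgeComponent (S - w) x v
      component = record { x∈ = ∈-remove⁺ x∈ x≢w ; y∈ = ∈-remove⁺ v∈ (~⇒≢ v~w) ; x~y = x~v
        ; x-nbhd = nbhd-mono ∈-remove⁻ x-nbhd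
        ; y-nbhd = nbhd-remove (nbhd-reverse v-nbhd) }

      v∉⊖x : v ∉ S ⊖ x
      v∉⊖x = ∉-⊖ x~v

      ⊖x⊆ : S ⊖ x ⊆ S - x - v
      ⊖x⊆ z∈ = ∈-remove⁺ (⊖⊆remove z∈) λ { refl → v∉⊖x z∈ }

      ⊖v⊆ : S ⊖ v ⊆ S - w - x - v
      ⊖v⊆ z∈ = let (k , l , m) = ∈-⊖⁻ z∈ in
        ∈-remove⁺ (∈-remove⁺ (∈-remove⁺ k λ { refl → m v~w }) λ { refl → m (~-sym x~v) }) l

      loses-three : Loses 3 0 (S - w - x - v) S
      loses-three = loses (≤-reflexive (trans (cong suc (trans (cong suc
        (size-remove (∈-remove⁺ (∈-remove⁺ v∈ (~⇒≢ v~w)) (~⇒≢ x~v ∘ sym)))) (size-remove (∈-remove⁺ x∈ x≢w)))) (size-remove w∈)))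
        (cyc-mono (∈-remove⁻ ∘ ∈-remove⁻ ∘ ∈-remove⁻))

      x∈⊖w : x ∈ S ⊖ w
      x∈⊖w = ∈-⊖⁺ x∈ x≢w w≁x

      x-isolated : Nbhd⊆ (S ⊖ w) x []
      x-isolated z z∈ e with nbhd₁ x-nbhd (proj₁ (∈-⊖⁻ z∈)) e
      ... | refl = ⊥-elim (∉-⊖ (~-sym v~w) z∈)

    path₄-special : ∀ {x v w u} → Pendant x v w → u ∈ S → w ~ u → u ≢ v → Nbhd⊆ S w (v ∷ u ∷ []) → Nbhd⊆ S u (w ∷ []) → Special S
    path₄-special {x} {v} {w} {u} pd u∈ w~u u≢v nw nu = path₄ (fits (P 4) (lookup vs) ins sur
      ((x~v , (x≢w , w≁x ∘ ~-sym) , (x≢u , x≁u) , tt) , (v~w , (u≢v ∘ sym , v≁u) , tt) , (w~u , tt) , tt , tt))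
      where
      open Pendant pd
      x≢u : x ≢ u
      x≢u refl = w≁x w~u
      x≁u : ¬ x ~ u
      x≁u e = u≢v (nbhd₁ x-nbhd u∈ e)
      v≁u : ¬ v ~ u
      v≁u e = [ x≢u ∘ sym , ~⇒≢ w~u ∘ sym ]′ (nbhd₂ v-nbhd u∈ e)
      vs = x ∷ v ∷ w ∷ u ∷ []
      ins : ∀ i → lookup vs i ∈ S
      ins = all-lookup vs (x∈ ∷ v∈ ∷ w∈ ∷ u∈ ∷ [])
      closed : All (λ z → Nbhd⊆ S z (Vec.toList vs)) (Vec.toList vs)
      closed = nbhd-within (∈-lookup 1F ∷ []) x-nbhd ∷ nbhd-within (∈-lookup 0F ∷ ∈-lookup 2F ∷ []) v-nbhd ∷
        nbhd-within (∈-lookup 1F ∷ ∈-lookup 3F ∷ []) nw ∷ nbhd-within (∈-lookup 2F ∷ []) nu ∷ []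
      sur : ∀ z → z ∈ S → ∃ λ i → lookup vs i ≡ z
      sur z z∈ = ∈-toList⁻ vs (closed-reach closed (here refl) (conn x z x∈ z∈))

    -- As u and v have the same neighbours, a maximal independent set contains both or neither, and
    -- u can be deleted without loss. In S - u the path p, v, q is induced, so S - u is not
    -- clustered and `bad` applies.
    twins : ∀ {u v p q} → u ∈ S → v ∈ S → p ∈ S → q ∈ S → u ≢ v → p ≢ q → u ~ p → u ~ q → v ~ p → v ~ q → ¬ p ~ q →
      Nbhd⊆ S u (p ∷ q ∷ []) → Nbhd⊆ S v (p ∷ q ∷ []) → Goal
    twins {u} {v} {p} {q} u∈ v∈ p∈ q∈ u≢v p≢q u~p u~q v~p v~q p≁q nu nv with proj₂ (classify (S - u))
    ... | inj₁ (_ , _ , cl) = ⊥-elim ([ p≢q , p≁q ]′ (clusters-clique cl v∈′ p∈′ q∈′ v~p v~q))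
      where
      v∈′ = ∈-remove⁺ v∈ (u≢v ∘ sym)
      p∈′ = ∈-remove⁺ p∈ (~⇒≢ u~p ∘ sym)
      q∈′ = ∈-remove⁺ q∈ (~⇒≢ u~q ∘ sym)
    ... | inj₂ b = crude (drop 1 1 bad) tt (bounded-≤ _ (mis-delete S u twin)
      (bounded-lose bad (loses-remove u∈ (one-pair (p≢q , u~p , u~q ,
        step (∈-remove⁺ p∈ (~⇒≢ u~p ∘ sym)) (~-sym v~p) (reach-edge (∈-remove⁺ v∈ (u≢v ∘ sym)) (∈-remove⁺ q∈ (~⇒≢ u~q ∘ sym)) v~q)))) b))
      where
      adjacent-to : ∀ {w t} → w ~ p → w ~ q → t ∈ₗ p ∷ q ∷ [] → w ~ t
      adjacent-to e f (here refl) = e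
      adjacent-to e f (there (here refl)) = f
      twin : ∀ I → MIS S I → u ∈ I → ∀ y → y ∈ S → u ~ y → ∃ λ z → z ∈ I × z ≢ u × z ~ y
      twin I (I⊆ , ind , dom) u∈I y y∈ u~y with v ∈? I
      ... | yes v∈I = v , v∈I , u≢v ∘ sym , adjacent-to v~p v~q (nu y y∈ u~y)
      ... | no v∉I = let (z , z∈I , z~v) = dom v v∈ v∉I in
        ⊥-elim (ind u z u∈I z∈I (adjacent-to u~p u~q (nv z (I⊆ z∈I) (~-sym z~v))))

    -- S - x - v is connected, but two vertices and no cycle are lost, so 3r ≤ n may fail there. The
    -- even bound does not depend on the flag and tolerates this; in the odd case pendant paths need
    -- the separate arguments that follow.
    pendant-even : ∀ {x v w} → Pendant x v w → Goal-at ev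
    pendant-even {x} {v} {w} pd {δ} B with ∣ S - x - v ∣ ℕ.≟ 2
      where open Pendant pd
    ... | yes eq = special (small (size-two conn-T eq))
      where
      open Pendant pd
      conn-T : ConnectedIn (S - x - v)
      conn-T = remove-connected (remove-connected conn (leaf-noncut x-nbhd))
        (leaf-noncut (nbhd-remove v-nbhd))
      w∈T : w ∈ S - x - v
      w∈T = ∈-remove⁺ (∈-remove⁺ w∈ (x≢w ∘ sym)) (~⇒≢ v~w ∘ sym)
      small : IsClustered (S - x - v) → Special S
      small (_ , _ , cl) with clusters-neighbour cl w w∈T
      ... | u , u∈ , w~u = path₄-special pd (∈-remove⁻ (∈-remove⁻ u∈)) w~u (remove-≢ u∈) nw nu
        where
        third : ∀ z → z ∈ S - x - v → z ≢ w → z ≢ u → ⊥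
        third z z∈ z≢w z≢u = 3≤⇒≢2 (members (z ∷ w ∷ u ∷ []) ((z≢w ∷ z≢u ∷ []) ∷ (~⇒≢ w~u ∷ []) ∷ [] ∷ [])
          (z∈ ∷ w∈T ∷ u∈ ∷ [])) eq
        nw : Nbhd⊆ S w (v ∷ u ∷ [])
        nw z z∈ e with z Fin.≟ v | z Fin.≟ u
        ... | yes eq | _ = here eq
        ... | no _ | yes eq = there (here eq)
        ... | no z≢v | no z≢u = ⊥-elim (third z (∈-remove⁺ (∈-remove⁺ z∈ λ { refl → w≁x e }) z≢v) (~⇒≢ e ∘ sym) z≢u)
        nu : Nbhd⊆ S u (w ∷ [])
        nu z z∈ e with z Fin.≟ w
        ... | yes eq = here eq
        ... | no z≢w = ⊥-elim (third z (∈-remove⁺ (∈-remove⁺ z∈ z≢x) z≢v) z≢w (~⇒≢ e ∘ sym))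
          where
          z≢x : z ≢ x
          z≢x refl = remove-≢ u∈ (nbhd₁ x-nbhd (∈-remove⁻ (∈-remove⁻ u∈)) (~-sym e))
          z≢v : z ≢ v
          z≢v refl = [ remove-≢ (∈-remove⁻ u∈) , ~⇒≢ w~u ∘ sym ]′ (nbhd₂ v-nbhd (∈-remove⁻ (∈-remove⁻ u∈)) (~-sym e))
    ... | no ≢2 with proj₂ (classify (S - w - x - v))
    ...   | inj₁ cl = special (hub-edge w∈ component cl)
      where open Pendant pd
    ...   | inj₂ b = strict (Bound-strict (drop 2 0 (connected true) ev ⊕ drop 3 0 bad ev) (connected δ ev)
      (everyᵇ-elim (λ δ _ → (drop 2 0 (connected true) ev ⊕ drop 3 0 bad ev) ≺ᵇ connected δ ev) tt δ ev)
      (Bound-≤ _ (≤-trans (mis-leaf x∈ x-nbhd) (+-mono-≤ (mis-mono ⊖x⊆) (mis-mono ⊖v⊆)))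
        (Bound-+ (drop 2 0 (connected true) ev) (drop 3 0 bad ev)
          (connected-lose true (claim-rate (IH x∈ ∈-remove⁻) conn-T nonempty ≢2)
            (loses! (trans (cong suc (size-remove (∈-remove⁺ v∈ (~⇒≢ x~v ∘ sym)))) (size-remove x∈))
              (cyc-mono (∈-remove⁻ ∘ ∈-remove⁻))) (inj₁ refl) B)
          (at-budget (bounded-lose bad loses-three b) B))))
      where
      open Pendant pd
      conn-T : ConnectedIn (S - x - v)
      conn-T = remove-connected (remove-connected conn (leaf-noncut x-nbhd))
        (leaf-noncut (nbhd-remove v-nbhd))
      nonempty : 1 ≤ ∣ S - x - v ∣
      nonempty = members (w ∷ []) ([] ∷ []) (∈-remove⁺ (∈-remove⁺ w∈ (x≢w ∘ sym)) (~⇒≢ v~w ∘ sym) ∷ [])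

    -- In the even case the branches sum to 44/81 + 9/81 of the unit, just below the 54/81 allowed.
    two-cycles : ∀ {w us ps} → w ∈ S → HasRate bad (S - w) → Nbrs S w us → length us ≡ 5 → Connects S w ps → length ps ≡ 2 → Goal
    two-cycles {us = _ ∷ _ ∷ _ ∷ _ ∷ _ ∷ []} {_ ∷ _ ∷ []} w∈ b nb refl cn refl =
      crude (drop 1 2 bad ⊞ drop 6 2 general) tt (branch-rate bad general w∈ nb cn b (general-rate _))

    three-cycles : ∀ {w us ps} → w ∈ S → HasRate bad (S - w) → Nbrs S w us → length us ≡ 4 → Connects S w ps → length ps ≡ 3 → Goal-at od
    three-cycles {us = _ ∷ _ ∷ _ ∷ _ ∷ []} {_ ∷ _ ∷ _ ∷ []} w∈ b nb refl cn refl =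
      crude-od (drop 1 3 bad ⊞ drop 5 3 general) tt (branch-rate bad general w∈ nb cn b (general-rate _))

    -- Choosing w isolates the end x of the pendant path, so the four neighbours count as five.
    pendant-cycle : ∀ {x v w us q} → Pendant x v w → HasRate bad (S - w) → Nbrs S w us → length us ≡ 4 → Closes S w q → Goal-at od
    pendant-cycle {x} {v} {w} {us@(_ ∷ _ ∷ _ ∷ _ ∷ [])} pd b (u , all) refl cl = crude-od (drop 1 1 bad ⊞ drop 6 1 general) tt
      (bounded-≤ _ (mis-branch S w) (bounded-+ _ _ (bounded-lose bad (loses-remove w∈ (one-pair cl)) b)
        (drop-isolated general x∈⊖w x-isolated
          (loses-list (x ∷ w ∷ us) w∈ (⊖⊆remove ∘ ∈-remove⁻) (one-pair cl)
            ((x≢w ∷ All.map (λ (_ , e) eq → w≁x (subst (w ~_) (sym eq) e)) all) ∷ All.map (λ (_ , e) → ~⇒≢ e) all ∷ u)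
            ((x∈ , ∉-remove {S = S ⊖ w}) ∷ (w∈ , λ z → proj₁ (proj₂ (∈-⊖⁻ (∈-remove⁻ z))) refl) ∷
              All.map (λ (z∈ , e) → z∈ , (∉-⊖ e ∘ ∈-remove⁻)) all))
          (general-rate _))))
      where open Pendant pd

    -- Branching at the leaves x and x′ produces rests with 3, 4 and 5 vertices less, and a gap in
    -- each is used: 4/9 + 11/36 + 2/9 = 35/36. If the rest with 5 less is clustered, w is a hub; if
    -- not, neither is the rest with 3 less. If the rest with 4 less is clustered, w, u, t form a
    -- triangle and `pendant-cycle` applies.
    two-pendants : ∀ {x v x′ v′ w u t} → Pendant x v w → Pendant x′ v′ w → v ≢ v′ → u ∈ S → w ~ u → u ≢ v → u ≢ v′ →
      t ∈ S → u ~ t → t ≢ w → Goal-at od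
    two-pendants {x} {v} {x′} {v′} {w} {u} {t} pd pd′ v≢v′ u∈ w~u u≢v u≢v′ t∈ u~t t≢w =
      start (proj₂ (classify (S - w - x - v - x′ - v′)))
      where
      open Pendant pd
      module ′ = Pendant pd′
      x≢x′ : x ≢ x′
      x≢x′ refl = v≢v′ (nbhd₁ ′.x-nbhd v∈ x~v)
      x≢v′ : x ≢ v′
      x≢v′ refl = w≁x (~-sym ′.v~w)
      x′≢v : x′ ≢ v
      x′≢v refl = ′.w≁x (~-sym v~w)
      comp′ : EdgeComponent (S - w - x - v) x′ v′
      comp′ = record { x∈ = ∈-remove⁺ (∈-remove⁺ (EdgeComponent.x∈ ′.component) (x≢x′ ∘ sym)) x′≢v
        ; y∈ = ∈-remove⁺ (∈-remove⁺ (EdgeComponent.y∈ ′.component) (x≢v′ ∘ sym)) (v≢v′ ∘ sym) ; x~y = ′.x~v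
        ; x-nbhd = λ z z∈ → EdgeComponent.x-nbhd ′.component z (∈-remove⁻ (∈-remove⁻ z∈))
        ; y-nbhd = λ z z∈ → EdgeComponent.y-nbhd ′.component z (∈-remove⁻ (∈-remove⁻ z∈)) }
      bad-edge : ∀ {T a c} → EdgeComponent T a c → HasRate bad (T - a - c) → HasRate bad T
      bad-edge = edge-rate bad (λ { ev → tt ; od → tt })
      main : HasRate bad (S - w - x - v - x′ - v′) → HasRate bad (S - w - x - v) →
        IsClustered (S - x - v - x′ - v′) ⊎ HasRate bad (S - x - v - x′ - v′) → Goal-at od
      main b₅ b₃ (inj₁ (_ , _ , cl)) = pendant-cycle pd (bad-edge component b₃)
        ((v≢v′ ∷ (u≢v ∘ sym) ∷ apart v-nbhd u≢x ∷ []) ∷ ((u≢v′ ∘ sym) ∷ apart ′.v-nbhd u≢x′ ∷ []) ∷ (~⇒≢ u~t ∷ []) ∷ [] ∷ [] ,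
          (v∈ , ~-sym v~w) ∷ (′.v∈ , ~-sym ′.v~w) ∷ (u∈ , w~u) ∷ (t∈ , w~t) ∷ [])
        refl (~⇒≢ u~t , w~u , w~t , reach-edge (∈-remove⁺ u∈ (~⇒≢ w~u ∘ sym)) (∈-remove⁺ t∈ t≢w) u~t)
        where
        in-T : ∀ {z} → z ∈ S → z ≢ x → z ≢ v → z ≢ x′ → z ≢ v′ → z ∈ S - x - v - x′ - v′
        in-T z∈ a b c d = ∈-remove⁺ (∈-remove⁺ (∈-remove⁺ (∈-remove⁺ z∈ a) b) c) d
        u≢x : u ≢ x
        u≢x refl = w≁x w~u
        u≢x′ : u ≢ x′
        u≢x′ refl = ′.w≁x w~u
        apart : ∀ {a c} → Nbhd⊆ S a (c ∷ w ∷ []) → u ≢ c → a ≢ t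
        apart nb c≢ refl = [ c≢ , ~⇒≢ w~u ∘ sym ]′ (nbhd₂ nb u∈ (~-sym u~t))
        t≢x : t ≢ x
        t≢x refl = u≢v (nbhd₁ x-nbhd u∈ (~-sym u~t))
        t≢x′ : t ≢ x′
        t≢x′ refl = u≢v′ (nbhd₁ ′.x-nbhd u∈ (~-sym u~t))
        w~t : w ~ t
        w~t with clusters-clique cl (in-T u∈ u≢x u≢v u≢x′ u≢v′)
          (in-T w∈ (x≢w ∘ sym) (~⇒≢ v~w ∘ sym) (′.x≢w ∘ sym) (~⇒≢ ′.v~w ∘ sym))
          (in-T t∈ t≢x (apart v-nbhd u≢x ∘ sym) t≢x′ (apart ′.v-nbhd u≢x′ ∘ sym)) (~-sym w~u) u~t
        ... | inj₁ eq = contradiction (sym eq) t≢w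
        ... | inj₂ e = e
      main b₅ b₃ (inj₂ b₄) = crude-od (drop 3 0 bad ⊞ (drop 4 0 bad ⊞ drop 5 0 bad)) tt
        (bounded-≤ _ (≤-trans (mis-leaf x∈ x-nbhd) (≤-trans (≤-reflexive (ℕ.+-comm (mis (S ⊖ x)) _))
            (+-mono-≤ (mis-mono ⊖v⊆) (≤-trans (mis-leaf x′∈Y λ z z∈ → ′.x-nbhd z (proj₁ (∈-⊖⁻ z∈)))
              (+-mono-≤ (mis-mono Y⊖x′) (mis-mono Y⊖v′))))))
          (bounded-+ _ _ (bounded-lose bad loses-three b₃) (bounded-+ _ _
            (bounded-lose bad (loses-list (v′ ∷ x′ ∷ v ∷ x ∷ []) x∈ into no-pairs
              ((~⇒≢ ′.x~v ∘ sym ∷ (v≢v′ ∘ sym) ∷ (x≢v′ ∘ sym) ∷ []) ∷ (x′≢v ∷ (x≢x′ ∘ sym) ∷ []) ∷ ((~⇒≢ x~v ∘ sym) ∷ []) ∷ [] ∷ [])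
              ((′.v∈ , ∉-remove {S = S - x - v - x′}) ∷ (′.x∈ , ∉-remove {S = S - x - v} ∘ ∈-remove⁻) ∷
                (v∈ , ∉-remove {S = S - x} ∘ ∈-remove⁻ ∘ ∈-remove⁻) ∷
                (x∈ , ∉-remove {S = S} ∘ ∈-remove⁻ ∘ ∈-remove⁻ ∘ ∈-remove⁻) ∷ [])) b₄)
            (bounded-lose bad (loses-trans loses-three (loses-edge comp′)) b₅))))
        where
        into : S - x - v - x′ - v′ ⊆ S - x
        into = ∈-remove⁻ ∘ ∈-remove⁻ ∘ ∈-remove⁻
        x′∈Y : x′ ∈ S ⊖ x
        x′∈Y = ∈-⊖⁺ ′.x∈ (x≢x′ ∘ sym) λ e → x′≢v (nbhd₁ x-nbhd ′.x∈ e)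
        Y⊖x′ : S ⊖ x ⊖ x′ ⊆ S - x - v - x′ - v′
        Y⊖x′ z∈ = let (k , l , m) = ∈-⊖⁻ z∈ in ∈-remove⁺ (∈-remove⁺ (⊖x⊆ k) l) λ { refl → m ′.x~v }
        Y⊖v′ : S ⊖ x ⊖ v′ ⊆ S - w - x - v - x′ - v′
        Y⊖v′ z∈ = let (k , l , m) = ∈-⊖⁻ z∈ ; k′ = ⊖x⊆ k in
          ∈-remove⁺ (∈-remove⁺ (∈-remove⁺ (∈-remove⁺ (∈-remove⁺ (∈-remove⁻ (∈-remove⁻ k′)) λ { refl → m ′.v~w })
            (remove-≢ (∈-remove⁻ k′))) (remove-≢ k′)) λ { refl → m (~-sym ′.x~v) }) l
      start : IsClustered (S - w - x - v - x′ - v′) ⊎ HasRate bad (S - w - x - v - x′ - v′) → Goal-at od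
      start (inj₁ (_ , _ , cl)) _ = special (hub-edge w∈ component (_ , _ , edge comp′ tt cl))
      start (inj₂ b₅) = main b₅ (bad-edge comp′ b₅) (proj₂ (classify (S - x - v - x′ - v′)))

    edge-rest-connected : ∀ {w a b x} → EdgeComponent (S - w) a b → x ∈ S - w - a - b →
      (∀ c → c ∈ S - w - a - b → w ~ c → Reach (S - w) c x) → ConnectedIn (S - w - a - b)
    edge-rest-connected {w} {a} {b} {x} comp x∈ link = rest-connected conn (∈-remove⁻ ∘ ∈-remove⁻ ∘ ∈-remove⁻)
      (∉-remove {S = S} ∘ ∈-remove⁻ ∘ ∈-remove⁻) x∈ boundary link
      where
      open EdgeComponent comp using (x-nbhd; y-nbhd)
      boundary : ∀ c d → c ∈ S - w - a - b → d ∈ S → d ∉ S - w - a - b → c ~ d → d ≡ w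
      boundary c d c∈ d∈ d∉ e with d Fin.≟ w | d Fin.≟ a | d Fin.≟ b
      ... | yes eq | _ | _ = eq
      ... | no _ | yes refl | _ with nbhd₁ x-nbhd (∈-remove⁻ (∈-remove⁻ c∈)) (~-sym e)
      ...   | eq = contradiction eq (remove-≢ c∈)
      boundary c d c∈ d∈ d∉ e | no _ | no _ | yes refl = contradiction (nbhd₁ y-nbhd (∈-remove⁻ (∈-remove⁻ c∈)) (~-sym e)) (remove-≢ (∈-remove⁻ c∈))
      boundary c d c∈ d∈ d∉ e | no p | no q | no r = contradiction (∈-remove⁺ (∈-remove⁺ (∈-remove⁺ d∈ p) q) r) d∉

    size-edge-rest : ∀ {w a b} → w ∈ S → EdgeComponent (S - w) a b → 3 + ∣ S - w - a - b ∣ ≡ ∣ S ∣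
    size-edge-rest w∈ comp = trans (cong suc (trans (cong suc (size-remove (∈-remove⁺ y∈ (~⇒≢ x~y ∘ sym)))) (size-remove x∈)))
      (size-remove w∈)
      where open EdgeComponent comp

    record Ear (a b w : Fin n) : Set where
      field
        a∈ : a ∈ S
        b∈ : b ∈ S
        w∈ : w ∈ S
        a~b : a ~ b
        w~a : w ~ a
        w~b : w ~ b
        a-nbhd : Nbhd⊆ S a (b ∷ w ∷ [])
        b-nbhd : Nbhd⊆ S b (a ∷ w ∷ [])

      component : EdgeComponent (S - w) a b
      component = record { x∈ = ∈-remove⁺ a∈ (~⇒≢ w~a ∘ sym) ; y∈ = ∈-remove⁺ b∈ (~⇒≢ w~b ∘ sym) ; x~y = a~b
        ; x-nbhd = nbhd-remove (nbhd-reverse a-nbhd) ; y-nbhd = nbhd-remove (nbhd-reverse b-nbhd) }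

      ⊖a⊆ : S ⊖ a ⊆ S - w - a - b
      ⊖a⊆ z∈ = let (k , l , m) = ∈-⊖⁻ z∈ in ∈-remove⁺ (∈-remove⁺ (∈-remove⁺ k λ { refl → m (~-sym w~a) }) l) λ { refl → m a~b }

      ⊖b⊆ : S ⊖ b ⊆ S - w - a - b
      ⊖b⊆ z∈ = let (k , l , m) = ∈-⊖⁻ z∈ in ∈-remove⁺ (∈-remove⁺ (∈-remove⁺ k λ { refl → m (~-sym w~b) }) λ { refl → m (~-sym a~b) }) l

      closes : Closes S w (a , b)
      closes = ~⇒≢ a~b , w~a , w~b , reach-edge (EdgeComponent.x∈ component) (EdgeComponent.y∈ component) a~b

      ear-mis : mis S ≤ mis (S - w - a - b) + (mis (S - w - a - b) + mis (S ⊖ w))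
      ear-mis = ≤-trans (mis-triangle a∈ a-nbhd) (+-mono-≤ (mis-mono ⊖a⊆) (ℕ.+-monoˡ-≤ (mis (S ⊖ w)) (mis-mono ⊖b⊆)))

    -- Choosing a or b leaves the connected set beyond w, choosing w also removes u. The first two
    -- branches use the induction hypothesis, the third a gap. If the last rest is clustered, u is a
    -- hub, because w, a, b become a triangle component of S - u.
    ear-bridge : ∀ {a b w u} → Ear a b w → u ∈ S → w ~ u → u ≢ a → u ≢ b → Nbhd⊆ S w (a ∷ b ∷ u ∷ []) → Goal
    ear-bridge {a} {b} {w} {u} ear u∈ w~u u≢a u≢b nw {δ} {p} B with ∣ S - w - a - b ∣ ℕ.≟ 2 | proj₂ (classify (S - w - a - b - u))
    ... | yes eq | _ = special (hub-edge w∈ component (size-two conn-T eq))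
      where
      open Ear ear
      conn-T : ConnectedIn (S - w - a - b)
      conn-T = edge-rest-connected component (∈-remove⁺ (∈-remove⁺ (∈-remove⁺ u∈ (~⇒≢ w~u ∘ sym)) u≢a) u≢b) λ c c∈ e →
        case nbhd₁ (nbhd-remove (nbhd-remove (nbhd-mono ∈-remove⁻ nw))) c∈ e of λ { refl → stop (∈-remove⁻ (∈-remove⁻ c∈)) }
    ... | no _ | inj₁ cl = special (hub u∈ (pack (clustered-≡ into out cl)))
      where
      open Ear ear
      into : S - w - a - b - u ⊆ S - u - w - a - b
      into z∈ = let z₁ = ∈-remove⁻ z∈ ; z₂ = ∈-remove⁻ z₁ ; z₃ = ∈-remove⁻ z₂ in
        ∈-remove⁺ (∈-remove⁺ (∈-remove⁺ (∈-remove⁺ (∈-remove⁻ z₃) (remove-≢ z∈)) (remove-≢ z₃)) (remove-≢ z₂)) (remove-≢ z₁)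
      out : S - u - w - a - b ⊆ S - w - a - b - u
      out z∈ = let z₁ = ∈-remove⁻ z∈ ; z₂ = ∈-remove⁻ z₁ ; z₃ = ∈-remove⁻ z₂ in
        ∈-remove⁺ (∈-remove⁺ (∈-remove⁺ (∈-remove⁺ (∈-remove⁻ z₃) (remove-≢ z₂)) (remove-≢ z₁)) (remove-≢ z∈)) (remove-≢ z₃)
      comp : TriangleComponent (S - u) w a b
      comp = record { x∈ = ∈-remove⁺ w∈ (~⇒≢ w~u) ; y∈ = ∈-remove⁺ a∈ (u≢a ∘ sym) ; z∈ = ∈-remove⁺ b∈ (u≢b ∘ sym)
        ; x~y = w~a ; x~z = w~b ; y~z = a~b
        ; x-nbhd = nbhd-reverse (nbhd-remove (nbhd-reverse nw))
        ; y-nbhd = nbhd-mono ∈-remove⁻ (nbhd-reverse a-nbhd) ; z-nbhd = nbhd-mono ∈-remove⁻ (nbhd-reverse b-nbhd) }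
      pack : IsClustered (S - u - w - a - b) → IsClustered (S - u)
      pack (_ , _ , cs) = _ , _ , triangle comp tt cs
    ... | no ≢2 | inj₂ bd = conclude (λ δ p → drop 3 1 (connected δ) p ⊕ (drop 3 1 (connected δ) p ⊕ drop 4 1 bad p)) tt
      (Bound-≤ _ (≤-trans ear-mis (ℕ.+-monoʳ-≤ (mis T₀) (ℕ.+-monoʳ-≤ (mis T₀) (mis-mono ⊖w⊆))))
        (Bound-+ _ _ T-rate (Bound-+ _ _ T-rate (at-budget (bounded-lose bad
          (loses (≤-reflexive (trans (cong (3 +_) (size-remove u∈T)) (size-edge-rest w∈ component)))
            (cyc-pairs ((a , b) ∷ []) (∈-remove⁻ ∘ ∈-remove⁻ ∘ ∈-remove⁻) w∈ (closes ∷ []) ([] ∷ []))) bd) B))))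
      where
      open Ear ear
      T₀ = S - w - a - b
      u∈T : u ∈ S - w - a - b
      u∈T = ∈-remove⁺ (∈-remove⁺ (∈-remove⁺ u∈ (~⇒≢ w~u ∘ sym)) u≢a) u≢b
      conn-T : ConnectedIn (S - w - a - b)
      conn-T = edge-rest-connected component u∈T λ c c∈ e →
        case nbhd₁ (nbhd-remove (nbhd-remove (nbhd-mono ∈-remove⁻ nw))) c∈ e of λ { refl → stop (∈-remove⁻ (∈-remove⁻ c∈)) }
      T-rate = connected-lose δ (claim-rate (IH w∈ (∈-remove⁻ ∘ ∈-remove⁻)) conn-T (members (u ∷ []) ([] ∷ []) (u∈T ∷ [])) ≢2)
        (loses! (size-edge-rest w∈ component) (cyc-pairs ((a , b) ∷ []) (∈-remove⁻ ∘ ∈-remove⁻) w∈ (closes ∷ []) ([] ∷ [])))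
        (inj₂ (refl , s≤s (s≤s (s≤s z≤n)))) B
      ⊖w⊆ : S ⊖ w ⊆ S - w - a - b - u
      ⊖w⊆ z∈ = let (k , l , m) = ∈-⊖⁻ z∈ in ∈-remove⁺ (∈-remove⁺ (∈-remove⁺ (∈-remove⁺ k l)
        λ { refl → m w~a }) λ { refl → m w~b }) λ { refl → m w~u }

    -- The triangle and the cycle through u and u′ are both lost with w, which is enough in three of
    -- the four cases. In the odd case without the flag a correction term remains and has to be
    -- absorbed by the leading one.
    ear-cycle : ∀ {a b w u u′} → Ear a b w → u ∈ S → u′ ∈ S → w ~ u → w ~ u′ → a ≢ u → b ≢ u → a ≢ u′ → b ≢ u′ → u ≢ u′ →
      Nbhd⊆ S w (a ∷ b ∷ u ∷ u′ ∷ []) → Reach (S - w) u u′ → Goal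
    ear-cycle {a} {b} {w} {u} {u′} ear u∈ u′∈ w~u w~u′ a≢u b≢u a≢u′ b≢u′ u≢u′ nw link {δ} {p} {r} {h} B = main (∣ S - w - a - b ∣ ℕ.≟ 2)
      where
      open Ear ear
      u∈T : u ∈ S - w - a - b
      u∈T = ∈-remove⁺ (∈-remove⁺ (∈-remove⁺ u∈ (~⇒≢ w~u ∘ sym)) (a≢u ∘ sym)) (b≢u ∘ sym)
      conn-T : ConnectedIn (S - w - a - b)
      conn-T = edge-rest-connected component u∈T λ c c∈ e →
        case nbhd₂ (nbhd-remove (nbhd-remove (nbhd-mono ∈-remove⁻ nw))) c∈ e of λ
          { (inj₁ refl) → stop (∈-remove⁻ (∈-remove⁻ c∈)) ; (inj₂ refl) → reach-sym link }
      cn : Connects S w ((a , b) ∷ (u , u′) ∷ [])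
      cn = closes ∷ (u≢u′ , w~u , w~u′ , link) ∷ [] , (inj₁ (a≢u , a≢u′) ∷ []) ∷ [] ∷ []
      T-rate : ∣ S - w - a - b ∣ ≢ 2 → ∀ {δ p} → Budget δ p r h S → Bound (drop 3 2 (connected δ) p) (mis (S - w - a - b)) r h
      T-rate ≢2 {δ} = connected-lose δ (claim-rate (IH w∈ (∈-remove⁻ ∘ ∈-remove⁻)) conn-T (members (u ∷ []) ([] ∷ []) (u∈T ∷ [])) ≢2)
        (loses! (size-edge-rest w∈ component) (cyc-pairs _ (∈-remove⁻ ∘ ∈-remove⁻) w∈ (proj₁ cn) (proj₂ cn)))
        (inj₂ (refl , s≤s (s≤s (s≤s z≤n))))
      nbrs : Nbrs S w (a ∷ b ∷ u ∷ u′ ∷ [])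
      nbrs = (~⇒≢ a~b ∷ a≢u ∷ a≢u′ ∷ []) ∷ (b≢u ∷ b≢u′ ∷ []) ∷ (u≢u′ ∷ []) ∷ [] ∷ [] ,
        (a∈ , w~a) ∷ (b∈ , w~b) ∷ (u∈ , w~u) ∷ (u′∈ , w~u′) ∷ []
      total : Bool → Parity → Rate
      total δ p = drop 3 2 (connected δ) p ⊕ (drop 3 2 (connected δ) p ⊕ drop 5 2 general p)
      sum-bound : ∣ S - w - a - b ∣ ≢ 2 → ∀ {δ p} → Budget δ p r h S → Bound (total δ p) (mis S) r h
      sum-bound ≢2 B = Bound-≤ _ ear-mis (Bound-+ _ _ (T-rate ≢2 B) (Bound-+ _ _ (T-rate ≢2 B)
        (at-budget (bounded-lose general (loses-⊖ w∈ nbrs cn) (general-rate (S ⊖ w))) B)))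
      2≤r : ∀ {δ p} → Budget δ p r h S → 2 ≤ r
      2≤r B = ≤-trans (≤-trans (ℕ.m≤m+n 2 _) (Loses.fewer-cycles (loses-remove w∈ cn))) (Budget.cyc≤ B)
      dominated : 2 ≤ r → 4 ^ r ≤ 2 ^ h → 9 * 8 ^ r ≤ 4 * (3 ^ r * 2 ^ h)
      dominated 2≤r 4≤2 = begin
        9 * 8 ^ r                ≡⟨ cong (9 *_) (sym (2^*4^ r)) ⟩
        9 * (2 ^ r * 4 ^ r)      ≡⟨ sym (ℕ.*-assoc 9 (2 ^ r) _) ⟩
        9 * 2 ^ r * 4 ^ r        ≤⟨ ℕ.*-mono-≤ (9·2^≤4·3^ r 2≤r) 4≤2 ⟩
        4 * 3 ^ r * 2 ^ h        ≡⟨ ℕ.*-assoc 4 (3 ^ r) _ ⟩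
        4 * (3 ^ r * 2 ^ h)      ∎
        where
        open ≤-Reasoning
        open +-*-Solver
        9·2^≤4·3^ : ∀ r → 2 ≤ r → 9 * 2 ^ r ≤ 4 * 3 ^ r
        9·2^≤4·3^ 1 (s≤s ())
        9·2^≤4·3^ (suc (suc r)) _ = begin
          9 * (2 * (2 * 2 ^ r))  ≡⟨ solve 1 (λ a → con 9 :* (con 2 :* (con 2 :* a)) := con 36 :* a) refl (2 ^ r) ⟩
          36 * 2 ^ r             ≤⟨ ℕ.*-monoʳ-≤ 36 (ℕ.^-monoˡ-≤ r (ℕ.n≤1+n 2)) ⟩
          36 * 3 ^ r             ≡⟨ sym (solve 1 (λ a → con 4 :* (con 3 :* (con 3 :* a)) := con 36 :* a) refl (3 ^ r)) ⟩
          4 * (3 * (3 * 3 ^ r))  ∎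
      go : ∣ S - w - a - b ∣ ≢ 2 → ∀ δ p → Budget δ p r h S → Outcome δ p r h S
      go ≢2 false ev B = strict (Bound-strict _ (connected false ev) tt (sum-bound ≢2 B))
      go ≢2 true  ev B = strict (Bound-strict _ (connected true ev) tt (sum-bound ≢2 B))
      go ≢2 true  od B = strict (Bound-strict _ (connected true od) tt (sum-bound ≢2 B))
      -- The branches sum to 22/27 of the unit plus 1/4 of 2^r. Two cycles force r ≥ 2, so 2^r is at
      -- most 4/9 of the unit, and 22/27 + 1/9 is less than 1.
      go ≢2 false od B = strict (Bound-strict _ (connected false od) tt (Bound-trade′ 88 27 108 9 4 (dominated (2≤r B) (regime-od B))
        (Bound-weaken _ (rate 88 27 108) tt (sum-bound ≢2 B))))
      main : Dec (∣ S - w - a - b ∣ ≡ 2) → Outcome δ p r h S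
      main (yes eq) = special (hub-edge w∈ component (size-two conn-T eq))
      main (no ≢2)  = go ≢2 δ p B

    -- Deleting w, x and v loses three vertices and one cycle. This just preserves 3r ≤ n, so the
    -- induction hypothesis is available even in the odd case.
    pendant-on-cycle : ∀ {x v w u u′} → Pendant x v w → u ∈ S → u′ ∈ S → w ~ u → w ~ u′ → v ≢ u → v ≢ u′ → u ≢ u′ →
      Nbhd⊆ S w (v ∷ u ∷ u′ ∷ []) → Reach (S - w) u u′ → Goal-at od
    pendant-on-cycle {x} {v} {w} {u} {u′} pd u∈ u′∈ w~u w~u′ v≢u v≢u′ u≢u′ nw link {δ} {r} {h} B = main (∣ S - w - x - v ∣ ℕ.≟ 2)
      where
      open Pendant pd
      x≢ : ∀ {z} → w ~ z → x ≢ z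
      x≢ e refl = w≁x e
      u∈T : u ∈ S - w - x - v
      u∈T = ∈-remove⁺ (∈-remove⁺ (∈-remove⁺ u∈ (~⇒≢ w~u ∘ sym)) (x≢ w~u ∘ sym)) (v≢u ∘ sym)
      conn-T : ConnectedIn (S - w - x - v)
      conn-T = edge-rest-connected component u∈T λ c c∈ e →
        case nbhd₂ (nbhd-remove (nbhd-mono (∈-remove⁻ ∘ ∈-remove⁻) nw)) c∈ e of λ
          { (inj₁ refl) → stop (∈-remove⁻ (∈-remove⁻ c∈)) ; (inj₂ refl) → reach-sym link }
      cn : Connects S w ((u , u′) ∷ [])
      cn = one-pair (u≢u′ , w~u , w~u′ , link)
      main : Dec (∣ S - w - x - v ∣ ≡ 2) → Outcome δ od r h S
      main (yes eq) = special (hub-edge w∈ component (size-two conn-T eq))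
      main (no ≢2) = strict (Bound-strict total (connected δ od) (everyᵇ-elim (λ δ _ →
          (drop 3 1 (connected δ) od ⊕ drop 3 1 (connected δ) od ⊕ drop 5 1 general od) ≺ᵇ connected δ od) tt δ od)
        (Bound-≤ _ (≤-trans (mis-branch S w) (ℕ.+-monoˡ-≤ (mis (S ⊖ w)) (edge-mis component)))
          (Bound-+ _ _ (Bound-+ _ _ T-rate T-rate) (at-budget (drop-isolated general x∈⊖w x-isolated
            (loses-list (x ∷ w ∷ v ∷ u ∷ u′ ∷ []) w∈ (⊖⊆remove ∘ ∈-remove⁻) cn
              ((x≢w ∷ ~⇒≢ x~v ∷ x≢ w~u ∷ x≢ w~u′ ∷ []) ∷ ((~⇒≢ v~w ∘ sym) ∷ ~⇒≢ w~u ∷ ~⇒≢ w~u′ ∷ []) ∷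
                (v≢u ∷ v≢u′ ∷ []) ∷ (u≢u′ ∷ []) ∷ [] ∷ [])
              ((x∈ , ∉-remove {S = S ⊖ w}) ∷ (w∈ , λ z → proj₁ (proj₂ (∈-⊖⁻ (∈-remove⁻ z))) refl) ∷
                (v∈ , (∉-⊖ (~-sym v~w) ∘ ∈-remove⁻)) ∷ (u∈ , (∉-⊖ w~u ∘ ∈-remove⁻)) ∷ (u′∈ , (∉-⊖ w~u′ ∘ ∈-remove⁻)) ∷ []))
            (general-rate _)) B))))
        where
        total = drop 3 1 (connected δ) od ⊕ drop 3 1 (connected δ) od ⊕ drop 5 1 general od
        T-rate = connected-lose δ (claim-rate (IH w∈ (∈-remove⁻ ∘ ∈-remove⁻)) conn-T (members (u ∷ []) ([] ∷ []) (u∈T ∷ [])) ≢2)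
          (loses! (size-edge-rest w∈ component) (cyc-pairs _ (∈-remove⁻ ∘ ∈-remove⁻) w∈ (proj₁ cn) (proj₂ cn)))
          (inj₂ (refl , s≤s (s≤s (s≤s z≤n)))) B

    pendant-end : ∀ {x v w} → Pendant x v w → Nbhd⊆ S w (v ∷ []) → Special S
    pendant-end {x} {v} {w} pd nw = hub-edge w∈ component (0 , 0 , empty λ z z∈ →
        All¬⇒¬Any (remove-≢ (∈-remove⁻ z∈) ∷ remove-≢ z∈ ∷ remove-≢ (∈-remove⁻ (∈-remove⁻ z∈)) ∷ [])
          (closed-reach closed (here refl) (conn x z x∈ (∈-remove⁻ (∈-remove⁻ (∈-remove⁻ z∈))))))
      where
      open Pendant pd
      closed : All (λ z → Nbhd⊆ S z (x ∷ v ∷ w ∷ [])) (x ∷ v ∷ w ∷ [])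
      closed = nbhd-within (∈-lookup 1F ∷ []) x-nbhd ∷ nbhd-within (∈-lookup 0F ∷ ∈-lookup 2F ∷ []) v-nbhd ∷
        nbhd-within (∈-lookup 1F ∷ []) nw ∷ []

    -- No cycle is lost here, so only rates for arbitrary graphs are used. Leaf branchings at x and
    -- then at w leave three rests. Even with `bad` for `R` they may sum to 4/9 + 1/3 + 1/4 = 37/36,
    -- slightly too much; each configuration around u and its neighbour y has to save a little more.
    pendant-path : ∀ {x v w u} → Pendant x v w → u ∈ S → w ~ u → u ≢ v → Nbhd⊆ S w (v ∷ u ∷ []) → Goal-at od
    pendant-path {x} {v} {w} {u} pd u∈ w~u u≢v nw = main (proj₂ (classify R))
      where
      open Pendant pd
      R = S - w - x - v
      Y = S ⊖ x
      u≢x : u ≢ x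
      u≢x refl = w≁x w~u
      u∈R : u ∈ R
      u∈R = ∈-remove⁺ (∈-remove⁺ (∈-remove⁺ u∈ (~⇒≢ w~u ∘ sym)) u≢x) u≢v
      R⊆S : R ⊆ S
      R⊆S = ∈-remove⁻ ∘ ∈-remove⁻ ∘ ∈-remove⁻
      removed : ∀ z → z ∈ S → z ∉ R → z ≢ w → z ≢ x → z ≡ v
      removed z z∈ z∉ z≢w z≢x = decidable-stable (z Fin.≟ v) λ z≢v → z∉ (∈-remove⁺ (∈-remove⁺ (∈-remove⁺ z∈ z≢w) z≢x) z≢v)
      w∈Y : w ∈ Y
      w∈Y = ∈-⊖⁺ w∈ (x≢w ∘ sym) (w≁x ∘ ~-sym)
      Y-nbhd : Nbhd⊆ Y w (u ∷ [])
      Y-nbhd z z∈ e with nw z (proj₁ (∈-⊖⁻ z∈)) e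
      ... | here refl = contradiction z∈ v∉⊖x
      ... | there m = m
      Y⊖w⊆ : Y ⊖ w ⊆ R - u
      Y⊖w⊆ z∈ = let (k , l , m) = ∈-⊖⁻ z∈ ; k′ = ⊖x⊆ k in
        ∈-remove⁺ (∈-remove⁺ (∈-remove⁺ (∈-remove⁺ (∈-remove⁻ (∈-remove⁻ k′)) l) (remove-≢ (∈-remove⁻ k′))) (remove-≢ k′)) λ { refl → m w~u }
      split : mis S ≤ mis R + (mis (R - u) + mis (Y ⊖ u))
      split = ≤-trans (mis-leaf x∈ x-nbhd) (≤-trans (≤-reflexive (ℕ.+-comm (mis Y) _))
        (+-mono-≤ (mis-mono ⊖v⊆) (≤-trans (mis-leaf w∈Y Y-nbhd) (ℕ.+-monoˡ-≤ (mis (Y ⊖ u)) (mis-mono Y⊖w⊆)))))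
      base : List (Fin n)
      base = w ∷ x ∷ v ∷ []
      base-unique : Unique base
      base-unique = ((x≢w ∘ sym) ∷ (~⇒≢ v~w ∘ sym) ∷ []) ∷ (~⇒≢ x~v ∷ []) ∷ [] ∷ []
      apart : ∀ {z} → z ∈ R → All (z ≢_) base
      apart z∈ = remove-≢ (∈-remove⁻ (∈-remove⁻ z∈)) ∷ remove-≢ (∈-remove⁻ z∈) ∷ remove-≢ z∈ ∷ []
      base-gone : ∀ {T} → T ⊆ R → All (λ z → z ∈ S × z ∉ T) base
      base-gone sub = (w∈ , ∉-remove {S = S} ∘ ∈-remove⁻ ∘ ∈-remove⁻ ∘ sub) ∷
        (x∈ , ∉-remove {S = S - w} ∘ ∈-remove⁻ ∘ sub) ∷ (v∈ , ∉-remove {S = S - w - x} ∘ sub) ∷ []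
      loses-base : ∀ {T} xs → T ⊆ R → Unique (xs ++ base) → All (λ z → z ∈ S × z ∉ T) xs → Loses (length (xs ++ base)) 0 T S
      loses-base {T} xs sub un all = loses-list (xs ++ base) w∈ (∈-remove⁻ ∘ ∈-remove⁻ ∘ sub) no-pairs un (All-++ xs all (base-gone sub))
        where
        All-++ : ∀ {Q : Fin n → Set} xs {ys} → All Q xs → All Q ys → All Q (xs ++ ys)
        All-++ [] [] b = b
        All-++ (_ ∷ xs) (a ∷ as) b = a ∷ All-++ xs as b
      Y⊖u⊆ : Y ⊖ u ⊆ R
      Y⊖u⊆ z∈ = let (k , l , m) = ∈-⊖⁻ z∈ ; k′ = ⊖x⊆ k in
        ∈-remove⁺ (∈-remove⁺ (∈-remove⁺ (∈-remove⁻ (∈-remove⁻ k′)) λ { refl → m (~-sym w~u) }) (remove-≢ (∈-remove⁻ k′))) (remove-≢ k′)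
      u∉Y⊖u : u ∉ Y ⊖ u
      u∉Y⊖u z∈ = proj₁ (proj₂ (∈-⊖⁻ z∈)) refl
      loses-4 : Loses 4 0 (R - u) S
      loses-4 = loses-base (u ∷ []) ∈-remove⁻ (apart u∈R ∷ base-unique) ((u∈ , ∉-remove {S = R}) ∷ [])
      third : Bounded (drop 4 0 general) S (mis (R - u))
      third = bounded-lose general loses-4 (general-rate _)
      module _ {y} (y∈ : y ∈ R) (u~y : u ~ y) where
        private
          ≢y : All (u ≢_) (y ∷ base)
          ≢y = ~⇒≢ u~y ∷ apart u∈R
          quarter : Bounded (drop 5 0 general) S (mis (Y ⊖ u))
          quarter = bounded-lose general (loses-base (u ∷ y ∷ []) Y⊖u⊆ (≢y ∷ apart y∈ ∷ base-unique)
            ((u∈ , u∉Y⊖u) ∷ (R⊆S y∈ , ∉-⊖ u~y) ∷ [])) (general-rate _)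
        two-more : ∀ {z} → z ∈ R → u ~ z → z ≢ y → HasRate bad R → Goal-at od
        two-more {z} z∈ u~z z≢y b = crude-od (drop 3 0 bad ⊞ (drop 4 0 general ⊞ drop 6 0 general)) tt
          (bounded-≤ _ split (bounded-+ _ _ (bounded-lose bad loses-three b) (bounded-+ _ _ third
            (bounded-lose general (loses-base (u ∷ z ∷ y ∷ []) Y⊖u⊆ ((~⇒≢ u~z ∷ ≢y) ∷ (z≢y ∷ apart z∈) ∷ apart y∈ ∷ base-unique)
              ((u∈ , u∉Y⊖u) ∷ (R⊆S z∈ , ∉-⊖ u~z) ∷ (R⊆S y∈ , ∉-⊖ u~y) ∷ [])) (general-rate _)))))
        end : Nbhd⊆ R y (u ∷ []) → HasRate bad R → Goal-at od
        end ny b = crude-od (drop 3 0 bad ⊞ (drop 5 0 general ⊞ drop 5 0 general)) tt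
          (bounded-≤ _ split (bounded-+ _ _ (bounded-lose bad loses-three b) (bounded-+ _ _
            (drop-isolated general y∈′ (λ z z∈ e → contradiction (nbhd₁ ny (∈-remove⁻ z∈) e) (remove-≢ z∈))
              (loses-base (u ∷ y ∷ []) (∈-remove⁻ ∘ ∈-remove⁻) (≢y ∷ apart y∈ ∷ base-unique)
                ((u∈ , (∉-remove {S = R} ∘ ∈-remove⁻)) ∷ (R⊆S y∈ , ∉-remove {S = R - u}) ∷ [])) (general-rate _)) quarter)))
          where
          y∈′ : y ∈ R - u
          y∈′ = ∈-remove⁺ y∈ (~⇒≢ u~y ∘ sym)
        module _ (nu : Nbhd⊆ R u (y ∷ [])) {z} (z∈ : z ∈ R) (y~z : y ~ z) (z≢u : z ≢ u) where
          extend-bad : HasRate bad (R - u) → Goal-at od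
          extend-bad b = crude-od (drop 3 0 leafy ⊞ (drop 4 0 bad ⊞ drop 5 0 general)) tt
            (bounded-≤ _ split (bounded-+ _ _ (bounded-lose leafy loses-three
                (leaf-rate u∈R y∈ z∈ u~y y~z z≢u nu (general-rate _) (general-rate _)))
              (bounded-+ _ _ (bounded-lose bad loses-4 b) quarter)))
          R⊖⊆ : ∀ {q} → R ⊖ q ⊆ R
          R⊖⊆ = proj₁ ∘ ∈-⊖⁻
          split′ : mis S ≤ (mis (R ⊖ u) + mis (R ⊖ y)) + (mis (R - u) + mis (Y ⊖ u))
          split′ = ≤-trans split (ℕ.+-monoˡ-≤ (mis (R - u) + mis (Y ⊖ u)) (mis-leaf u∈R nu))
          y-removed : y ∉ R ⊖ y
          y-removed m = proj₁ (proj₂ (∈-⊖⁻ m)) refl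
          fork : ∀ {t} → t ∈ R → y ~ t → t ≢ z → t ≢ u → Goal-at od
          fork {t} t∈ y~t t≢z t≢u = crude-od ((drop 5 0 general ⊞ drop 7 0 general) ⊞ (drop 4 0 general ⊞ drop 5 0 general)) tt
            (bounded-≤ _ split′ (bounded-+ _ _ (bounded-+ _ _
              (bounded-lose general (loses-base (u ∷ y ∷ []) R⊖⊆ (≢y ∷ apart y∈ ∷ base-unique)
                ((u∈ , λ m → proj₁ (proj₂ (∈-⊖⁻ m)) refl) ∷ (R⊆S y∈ , ∉-⊖ u~y) ∷ [])) (general-rate _))
              (bounded-lose general (loses-base (t ∷ z ∷ u ∷ y ∷ []) R⊖⊆
                ((t≢z ∷ t≢u ∷ (~⇒≢ y~t ∘ sym) ∷ apart t∈) ∷ (z≢u ∷ (~⇒≢ y~z ∘ sym) ∷ apart z∈) ∷ ≢y ∷ apart y∈ ∷ base-unique)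
                ((R⊆S t∈ , ∉-⊖ y~t) ∷ (R⊆S z∈ , ∉-⊖ y~z) ∷ (u∈ , ∉-⊖ (~-sym u~y)) ∷ (R⊆S y∈ , y-removed) ∷ [])) (general-rate _)))
              (bounded-+ _ _ third quarter)))
          stem : ∀ {a b} → Clustered (R - u) a b → Nbhd⊆ R y (z ∷ u ∷ []) → Goal-at od
          stem cl ny = crude-od ((drop 6 0 general ⊞ drop 6 0 general) ⊞ (drop 4 0 general ⊞ drop 5 0 general)) tt
            (bounded-≤ _ split′ (bounded-+ _ _ (bounded-+ _ _
              (drop-isolated general z∈′ iso (loses-base (z ∷ u ∷ y ∷ []) (R⊖⊆ ∘ ∈-remove⁻)
                ((z≢u ∷ (~⇒≢ y~z ∘ sym) ∷ apart z∈) ∷ ≢y ∷ apart y∈ ∷ base-unique)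
                ((R⊆S z∈ , ∉-remove {S = R ⊖ u}) ∷ (u∈ , λ m → proj₁ (proj₂ (∈-⊖⁻ (∈-remove⁻ m))) refl) ∷
                  (R⊆S y∈ , (∉-⊖ u~y ∘ ∈-remove⁻)) ∷ [])) (general-rate _))
              (bounded-lose general (loses-base (z ∷ u ∷ y ∷ []) R⊖⊆ ((z≢u ∷ (~⇒≢ y~z ∘ sym) ∷ apart z∈) ∷ ≢y ∷ apart y∈ ∷ base-unique)
                ((R⊆S z∈ , ∉-⊖ y~z) ∷ (u∈ , ∉-⊖ (~-sym u~y)) ∷ (R⊆S y∈ , y-removed) ∷ [])) (general-rate _)))
              (bounded-+ _ _ third quarter)))
            where
            z∈′ : z ∈ R ⊖ u
            z∈′ = ∈-⊖⁺ z∈ z≢u λ e → ~⇒≢ y~z (sym (nbhd₁ nu z∈ e))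
            iso : Nbhd⊆ (R ⊖ u) z []
            iso t t∈ z~t with clusters-clique cl (∈-remove⁺ z∈ z≢u) (∈-remove⁺ y∈ (~⇒≢ u~y ∘ sym))
              (∈-remove⁺ (R⊖⊆ t∈) (proj₁ (proj₂ (∈-⊖⁻ t∈)))) (~-sym y~z) z~t
            ... | inj₁ refl = ⊥-elim (∉-⊖ u~y t∈)
            ... | inj₂ y~t with nbhd₂ ny (R⊖⊆ t∈) y~t
            ...   | inj₁ refl = ⊥-elim (~-irrefl refl z~t)
            ...   | inj₂ refl = contradiction refl (proj₁ (proj₂ (∈-⊖⁻ t∈)))
      main : IsClustered R ⊎ HasRate bad R → Goal-at od
      main (inj₁ cl) _ = special (hub-edge w∈ component cl)
      main (inj₂ b) with neighbour? R u []
      ... | inj₂ nu = λ _ → special (path₄-special pd u∈ w~u u≢v nw alone)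
        where
        alone : Nbhd⊆ S u (w ∷ [])
        alone z z∈ e with z Fin.≟ w
        ... | yes eq = here eq
        ... | no z≢w with removed z z∈ (λ z∈R → case nu z z∈R e of λ ()) z≢w (λ { refl → u≢v (nbhd₁ x-nbhd u∈ (~-sym e)) })
        ...   | refl with nbhd₂ v-nbhd u∈ (~-sym e)
        ...     | inj₁ eq = contradiction eq u≢x
        ...     | inj₂ eq = contradiction (sym eq) (~⇒≢ w~u)
      ... | inj₁ (y , y∈ , u~y , _) with neighbour? R u (y ∷ [])
      ...   | inj₁ (z , z∈ , u~z , z∉) = two-more y∈ u~y z∈ u~z (z∉ ∘ here) b
      ...   | inj₂ nu with neighbour? R y (u ∷ [])
      ...     | inj₂ ny = end y∈ u~y ny b
      ...     | inj₁ (z , z∈ , y~z , z∉) with proj₂ (classify (R - u))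
      ...       | inj₂ b′ = extend-bad y∈ u~y nu z∈ y~z (z∉ ∘ here) b′
      ...       | inj₁ (_ , _ , cl) with neighbour? R y (z ∷ u ∷ [])
      ...         | inj₁ (t , t∈ , y~t , t∉) = fork y∈ u~y nu z∈ y~z (z∉ ∘ here) t∈ y~t (t∉ ∘ here) (t∉ ∘ there ∘ here)
      ...         | inj₂ ny = stem y∈ u~y nu z∈ y~z (z∉ ∘ here) cl ny

    path₄-thin : ∀ {T f} → Fits T (P 4) f → ∀ v → v ∈ T → ∃₂ λ k l → Nbhd⊆ T v (k ∷ l ∷ [])
    path₄-thin {f = f} F v v∈ with Fits.onto F v v∈
    ... | 0F , refl = _ , _ , fits-nbhd F 0F (1F ∷ 1F ∷ []) (toWitness {a? = fin5? (P 4) 0F (1F ∷ 1F ∷ [])} tt)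
    ... | 1F , refl = _ , _ , fits-nbhd F 1F (0F ∷ 2F ∷ []) (toWitness {a? = fin5? (P 4) 1F (0F ∷ 2F ∷ [])} tt)
    ... | 2F , refl = _ , _ , fits-nbhd F 2F (1F ∷ 3F ∷ []) (toWitness {a? = fin5? (P 4) 2F (1F ∷ 3F ∷ [])} tt)
    ... | 3F , refl = _ , _ , fits-nbhd F 3F (2F ∷ 2F ∷ []) (toWitness {a? = fin5? (P 4) 3F (2F ∷ 2F ∷ [])} tt)

    cycle₅-thin : ∀ {T f} → Fits T (C 5) f → ∀ v → v ∈ T → ∃₂ λ k l → Nbhd⊆ T v (k ∷ l ∷ [])
    cycle₅-thin {f = f} F v v∈ with Fits.onto F v v∈
    ... | 0F , refl = _ , _ , fits-nbhd F 0F (1F ∷ 4F ∷ []) (toWitness {a? = fin5? (C 5) 0F (1F ∷ 4F ∷ [])} tt)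
    ... | 1F , refl = _ , _ , fits-nbhd F 1F (0F ∷ 2F ∷ []) (toWitness {a? = fin5? (C 5) 1F (0F ∷ 2F ∷ [])} tt)
    ... | 2F , refl = _ , _ , fits-nbhd F 2F (1F ∷ 3F ∷ []) (toWitness {a? = fin5? (C 5) 2F (1F ∷ 3F ∷ [])} tt)
    ... | 3F , refl = _ , _ , fits-nbhd F 3F (2F ∷ 4F ∷ []) (toWitness {a? = fin5? (C 5) 3F (2F ∷ 4F ∷ [])} tt)
    ... | 4F , refl = _ , _ , fits-nbhd F 4F (0F ∷ 3F ∷ []) (toWitness {a? = fin5? (C 5) 4F (0F ∷ 3F ∷ [])} tt)

    -- c(n-1,r-1) + c(n-3,r-1) = c(n,r), so strictness is inherited from S - v.
    subdivide : ∀ {v a b} → v ∈ S → a ∈ S → b ∈ S → v ~ a → v ~ b → a ≢ b → ConnectedIn (S - v) → ConnectedIn (S - v - a - b) →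
      3 ≤ ∣ S - v ∣ → 1 ≤ ∣ S - v - a - b ∣ → ∣ S - v - a - b ∣ ≢ 2 → ¬ Special (S - v) → Goal
    subdivide {v} {a} {b} v∈ a∈ b∈ v~a v~b a≢b conn₁ conn₃ 3≤ nonempty ≢2 ordinary {δ} {p} {r} {h} B =
      finish (inherit δ (loses! (size-remove v∈) cycles₁) (inj₂ (refl , s≤s z≤n)) B)
      where
      a∈′ : a ∈ S - v
      a∈′ = ∈-remove⁺ a∈ (~⇒≢ v~a ∘ sym)
      b∈′ : b ∈ S - v
      b∈′ = ∈-remove⁺ b∈ (~⇒≢ v~b ∘ sym)
      closes : Closes S v (a , b)
      closes = a≢b , v~a , v~b , conn₁ a b a∈′ b∈′
      cycles₁ : 1 + cyc (S - v) ≤ cyc S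
      cycles₁ = cyc-pairs _ id v∈ (closes ∷ []) ([] ∷ [])
      ⊖v⊆ : S ⊖ v ⊆ S - v - a - b
      ⊖v⊆ z∈ = let (k , l , m) = ∈-⊖⁻ z∈ in ∈-remove⁺ (∈-remove⁺ (∈-remove⁺ k l) λ { refl → m v~a }) λ { refl → m v~b }
      total : Bool → Parity → Rate
      total δ p = drop 1 1 (connected δ) p ⊕ drop 3 1 (connected δ) p
      rate₃ : Bound (drop 3 1 (connected δ) p) (mis (S - v - a - b)) r h
      rate₃ = connected-lose δ (claim-rate (IH v∈ (∈-remove⁻ ∘ ∈-remove⁻)) conn₃ nonempty ≢2)
        (loses! (trans (cong (2 +_) (size-remove (∈-remove⁺ b∈′ (a≢b ∘ sym)))) (trans (cong suc (size-remove a∈′)) (size-remove v∈)))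
          (cyc-pairs _ (∈-remove⁻ ∘ ∈-remove⁻) v∈ (closes ∷ []) ([] ∷ [])))
        (inj₂ (refl , s≤s (s≤s (s≤s z≤n)))) B
      finish : (∃₂ λ r′ h′ → 1 + r′ ≡ r × halves p 2 + h′ ≡ h × Budget δ (shift p 2) r′ h′ (S - v)) → Outcome δ p r h S
      finish (r′ , h′ , r-eq , h-eq , B′) with IH v∈ id conn₁ (≤-trans (s≤s z≤n) 3≤) (3≤⇒≢2 3≤) B′
      ... | special s = contradiction s ordinary
      ... | strict lt = strict (Bound<-weaken (total δ p) (connected δ p)
        (everyᵇ-elim (λ δ p → 0 <ᵇ den (connected δ p)) tt δ p) (everyᵇ-elim (λ δ p → total δ p ≼ᵇ connected δ p) tt δ p)
        (Bound<-≤ (total δ p) (≤-trans (mis-branch S v) (ℕ.+-monoʳ-≤ (mis (S - v)) (mis-mono ⊖v⊆)))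
          (Bound<-+ (drop 1 1 (connected δ) p) (drop 3 1 (connected δ) p)
            (everyᵇ-elim (λ δ p → 0 <ᵇ den (drop 3 1 (connected δ) p)) tt δ p)
            (subst₂ (Bound< (drop 1 1 (connected δ) p) (mis (S - v))) r-eq h-eq
              (Bound<-scale (connected δ (shift p 2)) 1 (halves p 2) lt)) rate₃)))

    -- A component of S - w attached to w only through a cycle or path w y y′ y″ ... of vertices of degree two.
    long-ear : ∀ {w y y′ y″ u} → w ∈ S → y ∈ S → y′ ∈ S → y″ ∈ S → u ∈ S → w ~ y → y ~ y′ → y′ ~ y″ → w ~ u → y″ ≢ w → y″ ≢ y → y′ ≢ w →
      Nbhd⊆ S y (y′ ∷ w ∷ []) → Nbhd⊆ S y′ (y″ ∷ y ∷ []) → (∀ us → Nbrs S y″ us → length us ≢ 3) → Noncut S y →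
      ¬ Reach (S - w) y u → Goal
    long-ear {w} {y} {y′} {y″} {u} w∈ y∈ y′∈ y″∈ u∈ w~y y~y′ y′~y″ w~u y″≢w y″≢y y′≢w ny ny′ thin nc far with y″ ~? w
    ... | yes y″~w = twins y∈ y″∈ w∈ y′∈ (y″≢y ∘ sym) (y′≢w ∘ sym) (~-sym w~y) y~y′ y″~w (~-sym y′~y″) w≁y′
        (nbhd-reverse ny) ny″
      where
      w≁y′ : ¬ w ~ y′
      w≁y′ e = [ y″≢w ∘ sym , ~⇒≢ w~y ]′ (nbhd₂ ny′ w∈ (~-sym e))
      ny″ : Nbhd⊆ S y″ (w ∷ y′ ∷ [])
      ny″ with neighbour? S y″ (w ∷ y′ ∷ [])
      ... | inj₂ nb = nb
      ... | inj₁ (t , t∈ , e , t∉) = ⊥-elim (thin (t ∷ w ∷ y′ ∷ []) (fresh-∷ t∉ (((y′≢w ∘ sym) ∷ []) ∷ [] ∷ []) ,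
              (t∈ , e) ∷ (w∈ , y″~w) ∷ (y′∈ , ~-sym y′~y″) ∷ []) refl)
    -- As y does not separate S, some path joins y′ to w without y. By the degrees of y′ and y″ it
    -- starts with y′, y″ and leaves y″ through its only other neighbour t.
    ... | no y″≁w = along (reach⇒path (nc y′ w y′∈ w∈ y~y′ (~-sym w~y)))
      where
      along : Path (S - y) y′ w → Goal
      along (stop _) = contradiction refl y′≢w
      along (step {c = c} _ e q) with ny′ c (∈-remove⁻ (∈-remove⁻ (reach-source (path⇒reach q)))) e
      ... | there (here refl) = contradiction refl (remove-≢ (∈-remove⁻ (reach-source (path⇒reach q))))
      along (step _ e (stop _)) | here refl = contradiction refl y″≢w
      along (step _ e (step {c = t} _ y″~t q)) | here refl = subdivide y′∈ y∈ y″∈ (~-sym y~y′) y′~y″ (y″≢y ∘ sym)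
        (remove-connected conn nc′) conn-T₂′ size₁ (≤-trans (s≤s z≤n) size₂) (3≤⇒≢2 size₂) ordinary
        where
        T₂ = S - y′ - y - y″
        T₂ᵒ = S - y - y′ - y″
        reorder : T₂ᵒ ⊆ T₂
        reorder z∈ = let z₁ = ∈-remove⁻ z∈ ; z₂ = ∈-remove⁻ z₁ in
          ∈-remove⁺ (∈-remove⁺ (∈-remove⁺ (∈-remove⁻ z₂) (remove-≢ z₁)) (remove-≢ z₂)) (remove-≢ z∈)
        t⇝w : Reach T₂ t w
        t⇝w = reach-mono reorder (path⇒reach q)
        in-T₂ : ∀ {z} → z ∈ S → z ≢ y → z ≢ y′ → z ≢ y″ → z ∈ T₂
        in-T₂ z∈ a b c = ∈-remove⁺ (∈-remove⁺ (∈-remove⁺ z∈ b) a) c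
        T₂⊆S : T₂ ⊆ S
        T₂⊆S = ∈-remove⁻ ∘ ∈-remove⁻ ∘ ∈-remove⁻
        t∈ : t ∈ T₂
        t∈ = reach-source t⇝w
        w∈T₂ : w ∈ T₂
        w∈T₂ = reach-target t⇝w
        t≢w : t ≢ w
        t≢w refl = y″≁w y″~t
        ny″ : Nbhd⊆ S y″ (t ∷ y′ ∷ [])
        ny″ with neighbour? S y″ (t ∷ y′ ∷ [])
        ... | inj₂ nb = nb
        ... | inj₁ (z , z∈ , e , z∉) = ⊥-elim (thin (z ∷ t ∷ y′ ∷ []) (fresh-∷ z∉ ((remove-≢ (∈-remove⁻ (∈-remove⁻ t∈)) ∷ []) ∷ [] ∷ []) ,
                (z∈ , e) ∷ (T₂⊆S t∈ , y″~t) ∷ (y′∈ , ~-sym y′~y″) ∷ []) refl)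
        to-w : ∀ z → z ∈ T₂ → Reach T₂ z w
        to-w z z∈ with reach-exit T₂ (conn z w (T₂⊆S z∈) w∈) z∈
        ... | inj₁ s = s
        ... | inj₂ (c , d , s , e , d∈ , d∉) with d Fin.≟ y | d Fin.≟ y′ | d Fin.≟ y″
        ...   | no a | no b | no c = contradiction (in-T₂ d∈ a b c) d∉
        ...   | yes refl | _ | _ with nbhd₂ ny (T₂⊆S (reach-target s)) (~-sym e)
        ...     | inj₁ refl = contradiction refl (remove-≢ (∈-remove⁻ (∈-remove⁻ (reach-target s))))
        ...     | inj₂ refl = s
        to-w z z∈ | inj₂ (c , d , s , e , d∈ , d∉) | no _ | yes refl | _ with nbhd₂ ny′ (T₂⊆S (reach-target s)) (~-sym e)
        ...     | inj₁ refl = contradiction refl (remove-≢ (reach-target s))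
        ...     | inj₂ refl = contradiction refl (remove-≢ (∈-remove⁻ (reach-target s)))
        to-w z z∈ | inj₂ (c , d , s , e , d∈ , d∉) | no _ | no _ | yes refl with nbhd₂ ny″ (T₂⊆S (reach-target s)) (~-sym e)
        ...     | inj₁ refl = reach-trans s t⇝w
        ...     | inj₂ refl = contradiction refl (remove-≢ (∈-remove⁻ (∈-remove⁻ (reach-target s))))
        conn-T₂′ : ConnectedIn T₂
        conn-T₂′ a b a∈ b∈ = reach-trans (to-w a a∈) (reach-sym (to-w b b∈))
        T₂⊆y′ : T₂ ⊆ S - y′
        T₂⊆y′ = ∈-remove⁻ ∘ ∈-remove⁻
        y∈′ : y ∈ S - y′
        y∈′ = ∈-remove⁺ y∈ (~⇒≢ y~y′)
        y″∈′ : y″ ∈ S - y′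
        y″∈′ = ∈-remove⁺ y″∈ (~⇒≢ y′~y″ ∘ sym)
        around : Reach (S - y′) y y″
        around = reach-trans (reach-edge y∈′ (T₂⊆y′ w∈T₂) (~-sym w~y)) (reach-trans (reach-sym (reach-mono T₂⊆y′ t⇝w))
          (reach-edge (T₂⊆y′ t∈) y″∈′ (~-sym y″~t)))
        nc′ : Noncut S y′
        nc′ a b a∈ b∈ e f with ny′ a a∈ e | ny′ b b∈ f
        ... | here refl | here refl = stop y″∈′
        ... | here refl | there (here refl) = reach-sym around
        ... | there (here refl) | here refl = around
        ... | there (here refl) | there (here refl) = stop y∈′
        y⇝t : Reach (S - w) y t
        y⇝t = step (∈-remove⁺ y∈ (~⇒≢ w~y ∘ sym)) y~y′ (step (∈-remove⁺ y′∈ y′≢w) y′~y″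
          (reach-edge (∈-remove⁺ y″∈ y″≢w) (∈-remove⁺ (T₂⊆S t∈) t≢w) y″~t))
        -- The last vertex z before w on the way back from y″.
        last-step : ∃ λ z → z ∈ T₂ × w ~ z × Reach (S - w) y z
        last-step with reach-exit (T₂ - w) t⇝w (∈-remove⁺ t∈ t≢w)
        ... | inj₁ s = contradiction (reach-target s) (∉-remove {S = T₂})
        ... | inj₂ (c , d , s , e , d∈ , d∉) with d Fin.≟ w
        ...   | yes refl = c , ∈-remove⁻ (reach-target s) , ~-sym e , reach-trans y⇝t (reach-mono (remove-mono T₂⊆S) s)
        ...   | no d≢w = contradiction (∈-remove⁺ d∈ d≢w) d∉
        z = proj₁ last-step
        z∈ = proj₁ (proj₂ last-step)
        w~z = proj₁ (proj₂ (proj₂ last-step))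
        y⇝z = proj₂ (proj₂ (proj₂ last-step))
        far-from : ∀ {x} → Reach (S - w) y x → ¬ x ~ u
        far-from s e = far (reach-trans s (reach-edge (reach-target s) (∈-remove⁺ u∈ (~⇒≢ w~u ∘ sym)) e))
        u≢ : ∀ {x} → Reach (S - w) y x → x ≢ u
        u≢ s refl = far s
        y≢u : y ≢ u
        y≢u = u≢ (stop (∈-remove⁺ y∈ (~⇒≢ w~y ∘ sym)))
        y′≢u : y′ ≢ u
        y′≢u = u≢ (reach-edge (∈-remove⁺ y∈ (~⇒≢ w~y ∘ sym)) (∈-remove⁺ y′∈ y′≢w) y~y′)
        y″≢u : y″ ≢ u
        y″≢u refl = y″≁w (~-sym w~u)
        y≢z : y ≢ z
        y≢z eq = remove-≢ (∈-remove⁻ z∈) (sym eq)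
        u∈T₂ : u ∈ T₂
        u∈T₂ = in-T₂ u∈ (y≢u ∘ sym) (y′≢u ∘ sym) (y″≢u ∘ sym)
        size₂ : 3 ≤ ∣ T₂ ∣
        size₂ = members (w ∷ u ∷ z ∷ []) ((~⇒≢ w~u ∷ ~⇒≢ w~z ∷ []) ∷ ((u≢ y⇝z ∘ sym) ∷ []) ∷ [] ∷ []) (w∈T₂ ∷ u∈T₂ ∷ z∈ ∷ [])
        size₁ : 3 ≤ ∣ S - y′ ∣
        size₁ = ≤-trans size₂ (p⊆q⇒∣p∣≤∣q∣ T₂⊆y′)
        y-alone : ∀ {x} → x ∈ S - y′ → y ~ x → x ≡ w
        y-alone x∈ e = [ (λ eq → contradiction eq (remove-≢ x∈)) , id ]′ (nbhd₂ ny (∈-remove⁻ x∈) e)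
        crowded : ∀ {T} → T ⊆ S → w ∈ T → y ∈ T → z ∈ T → u ∈ T → ¬ ∃₂ λ k l → Nbhd⊆ T w (k ∷ l ∷ [])
        crowded _ w∈ y∈ z∈ u∈ (k , l , nb) = three-in-two (nb y y∈ w~y) (nb z z∈ w~z) (nb u u∈ w~u) y≢z y≢u (u≢ y⇝z)
        -- In S - y′ the vertex w has the three neighbours y, z, u, where y is a leaf and u is not
        -- adjacent to z. Three neighbours exclude P₄ and C₅. For a hub other than w, two of the
        -- three remain and would have to be adjacent; the hub w would isolate y.
        ordinary : ¬ Special (S - y′)
        ordinary (path₄ F)  = crowded ∈-remove⁻ (T₂⊆y′ w∈T₂) y∈′ (T₂⊆y′ z∈) (T₂⊆y′ u∈T₂) (path₄-thin F w (T₂⊆y′ w∈T₂))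
        ordinary (cycle₅ F) = crowded ∈-remove⁻ (T₂⊆y′ w∈T₂) y∈′ (T₂⊆y′ z∈) (T₂⊆y′ u∈T₂) (cycle₅-thin F w (T₂⊆y′ w∈T₂))
        ordinary (hub {h} h∈ (_ , _ , cl)) with h Fin.≟ w | h Fin.≟ y
        ... | yes refl | _ = let (x , x∈ , e) = clusters-neighbour cl y (∈-remove⁺ y∈′ (~⇒≢ w~y ∘ sym))
                             in remove-≢ x∈ (y-alone (∈-remove⁻ x∈) e)
        ... | no h≢w | yes refl = [ u≢ y⇝z , far-from y⇝z ]′
          (clusters-clique cl (∈-remove⁺ (T₂⊆y′ w∈T₂) (h≢w ∘ sym)) (∈-remove⁺ (T₂⊆y′ z∈) (y≢z ∘ sym)) (∈-remove⁺ (T₂⊆y′ u∈T₂) (y≢u ∘ sym)) w~z w~u)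
        ... | no h≢w | no h≢y with h Fin.≟ z
        ...   | no h≢z = [ y≢z , (λ e → ~⇒≢ w~z (sym (y-alone (T₂⊆y′ z∈) e))) ]′
          (clusters-clique cl (∈-remove⁺ (T₂⊆y′ w∈T₂) (h≢w ∘ sym)) (∈-remove⁺ y∈′ (h≢y ∘ sym)) (∈-remove⁺ (T₂⊆y′ z∈) (h≢z ∘ sym)) w~y w~z)
        ...   | yes h≡z = [ y≢u , (λ e → ~⇒≢ w~u (sym (y-alone (T₂⊆y′ u∈T₂) e))) ]′
          (clusters-clique cl (∈-remove⁺ (T₂⊆y′ w∈T₂) (h≢w ∘ sym)) (∈-remove⁺ y∈′ (h≢y ∘ sym))
            (∈-remove⁺ (T₂⊆y′ u∈T₂) λ u≡h → u≢ y⇝z (sym (trans u≡h h≡z))) w~y w~u)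

    -- Cycles, by their length

    module Cyclic (noncut : ∀ v → v ∈ S → Noncut S v)
      (other : ∀ x y → x ∈ S → x ~ y → ∃ λ z → z ∈ S × x ~ z × z ≢ y)
      (nbhd : ∀ {x y z} → x ∈ S → y ∈ S → z ∈ S → x ~ y → x ~ z → y ≢ z → Nbhd⊆ S x (y ∷ z ∷ [])) where

      private
        avoid : ∀ {x s t z : Fin n} → Nbhd⊆ S x (s ∷ t ∷ []) → z ∈ S → z ≢ s → z ≢ t → ¬ x ~ z
        avoid nb z∈ p q e = [ p , q ]′ (nbhd₂ nb z∈ e)

      -- The vertices v, a, a′, b′, b are consecutive up to the pair a′, b′.
      module Around {v a b a′ b′} (v∈ : v ∈ S) (a∈ : a ∈ S) (b∈ : b ∈ S) (a′∈ : a′ ∈ S) (b′∈ : b′ ∈ S)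
        (v~a : v ~ a) (v~b : v ~ b) (a~a′ : a ~ a′) (b~b′ : b ~ b′)
        (a≢b : a ≢ b) (a′≢v : a′ ≢ v) (b′≢v : b′ ≢ v) (a′≢b : a′ ≢ b) (a′≢b′ : a′ ≢ b′) where

        nv : Nbhd⊆ S v (a ∷ b ∷ [])
        nv = nbhd v∈ a∈ b∈ v~a v~b a≢b
        na : Nbhd⊆ S a (v ∷ a′ ∷ [])
        na = nbhd a∈ v∈ a′∈ (~-sym v~a) a~a′ (a′≢v ∘ sym)
        nb : Nbhd⊆ S b (v ∷ b′ ∷ [])
        nb = nbhd b∈ v∈ b′∈ (~-sym v~b) b~b′ (b′≢v ∘ sym)

        a≁b : ¬ a ~ b
        a≁b = avoid na b∈ (~⇒≢ v~b ∘ sym) (a′≢b ∘ sym)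
        b′≢a : b′ ≢ a
        b′≢a refl = a≁b (~-sym b~b′)
        a≁b′ : ¬ a ~ b′
        a≁b′ = avoid na b′∈ b′≢v (a′≢b′ ∘ sym)
        b≁a′ : ¬ b ~ a′
        b≁a′ = avoid nb a′∈ a′≢v a′≢b′
        v≁a′ : ¬ v ~ a′
        v≁a′ = avoid nv a′∈ (~⇒≢ a~a′ ∘ sym) a′≢b
        v≁b′ : ¬ v ~ b′
        v≁b′ = avoid nv b′∈ b′≢a (~⇒≢ b~b′ ∘ sym)

        conn₁ : ConnectedIn (S - v)
        conn₁ = remove-connected conn (noncut v v∈)

        a-leaf : Nbhd⊆ (S - v) a (a′ ∷ [])
        a-leaf = nbhd-remove na
        b-leaf : Nbhd⊆ (S - v) b (b′ ∷ [])
        b-leaf = nbhd-remove nb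

        a∈′ : a ∈ S - v
        a∈′ = ∈-remove⁺ a∈ (~⇒≢ v~a ∘ sym)
        b∈′ : b ∈ S - v
        b∈′ = ∈-remove⁺ b∈ (~⇒≢ v~b ∘ sym)
        a′∈′ : a′ ∈ S - v
        a′∈′ = ∈-remove⁺ a′∈ a′≢v
        b′∈′ : b′ ∈ S - v
        b′∈′ = ∈-remove⁺ b′∈ b′≢v

        five : a′ ~ b′ → Special S
        five a′~b′ = cycle₅ (fits (C 5) (lookup vs) ins sur
          ((v~a , (a′≢v ∘ sym , v≁a′) , (b′≢v ∘ sym , v≁b′) , v~b , tt) , (a~a′ , (b′≢a ∘ sym , a≁b′) , (a≢b , a≁b) , tt) ,
            (a′~b′ , (a′≢b , b≁a′ ∘ ~-sym) , tt) , (~-sym b~b′ , tt) , tt , tt))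
          where
          vs = v ∷ a ∷ a′ ∷ b′ ∷ b ∷ []
          ins : ∀ i → lookup vs i ∈ S
          ins = all-lookup vs (v∈ ∷ a∈ ∷ a′∈ ∷ b′∈ ∷ b∈ ∷ [])
          na′ = nbhd a′∈ a∈ b′∈ (~-sym a~a′) a′~b′ (b′≢a ∘ sym)
          nb′ = nbhd b′∈ b∈ a′∈ (~-sym b~b′) (~-sym a′~b′) (a′≢b ∘ sym)
          closed : All (λ z → Nbhd⊆ S z (Vec.toList vs)) (Vec.toList vs)
          closed = nbhd-within (∈-lookup 1F ∷ ∈-lookup 4F ∷ []) nv ∷ nbhd-within (∈-lookup 0F ∷ ∈-lookup 2F ∷ []) na ∷
            nbhd-within (∈-lookup 1F ∷ ∈-lookup 3F ∷ []) na′ ∷ nbhd-within (∈-lookup 4F ∷ ∈-lookup 2F ∷ []) nb′ ∷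
            nbhd-within (∈-lookup 0F ∷ ∈-lookup 3F ∷ []) nb ∷ []
          sur : ∀ z → z ∈ S → ∃ λ i → lookup vs i ≡ z
          sur z z∈ = ∈-toList⁻ vs (closed-reach closed (here refl) (conn v z v∈ z∈))

        module _ {c} (c∈ : c ∈ S) (a′~c : a′ ~ c) (c≢a : c ≢ a) (a′≁b′ : ¬ a′ ~ b′) where
          private
            na′ : Nbhd⊆ S a′ (a ∷ c ∷ [])
            na′ = nbhd a′∈ a∈ c∈ (~-sym a~a′) a′~c (c≢a ∘ sym)
            c≢v : c ≢ v
            c≢v refl = v≁a′ (~-sym a′~c)
            c≢b : c ≢ b
            c≢b refl = b≁a′ (~-sym a′~c)
            c≢b′ : c ≢ b′
            c≢b′ refl = a′≁b′ a′~c
            a≁c : ¬ a ~ c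
            a≁c = avoid na c∈ c≢v (~⇒≢ a′~c ∘ sym)
            b≁c : ¬ b ~ c
            b≁c = avoid nb c∈ c≢v c≢b′
            c∈′ : c ∈ S - v
            c∈′ = ∈-remove⁺ c∈ c≢v

          -- Here S - v is a path on five vertices, whose middle is a hub, so `subdivide` cannot be
          -- used. Counting directly gives 2/3 and exactly 1 of the unit. In the even case the
          -- correction term makes this strict, in the odd case one independent set lost by the
          -- branching does.
          six : b′ ~ c → Goal
          six b′~c = by-parity even odd
            where
            nb′ = nbhd b′∈ b∈ c∈ (~-sym b~b′) b′~c (c≢b ∘ sym)
            nc = nbhd c∈ a′∈ b′∈ (~-sym a′~c) (~-sym b′~c) a′≢b′
            Q = S - v
            closes : Connects S v ((a , b) ∷ [])
            closes = one-pair (a≢b , v~a , v~b , conn₁ a b a∈′ b∈′)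
            six-distinct : Unique (c ∷ b′ ∷ a′ ∷ b ∷ a ∷ v ∷ [])
            six-distinct = (c≢b′ ∷ (~⇒≢ a′~c ∘ sym) ∷ c≢b ∷ c≢a ∷ c≢v ∷ []) ∷ ((a′≢b′ ∘ sym) ∷ (~⇒≢ b~b′ ∘ sym) ∷ b′≢a ∷ b′≢v ∷ []) ∷
              (a′≢b ∷ (~⇒≢ a~a′ ∘ sym) ∷ a′≢v ∷ []) ∷ ((a≢b ∘ sym) ∷ (~⇒≢ v~b ∘ sym) ∷ []) ∷ ((~⇒≢ v~a ∘ sym) ∷ []) ∷ [] ∷ []
            loses-six : ∀ {T} → T ⊆ Q → c ∉ T → b′ ∉ T → a′ ∉ T → b ∉ T → a ∉ T → Loses 6 1 T S
            loses-six sub p q r s t = loses-list (c ∷ b′ ∷ a′ ∷ b ∷ a ∷ v ∷ []) v∈ sub closes six-distinct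
              ((c∈ , p) ∷ (b′∈ , q) ∷ (a′∈ , r) ∷ (b∈ , s) ∷ (a∈ , t) ∷ (v∈ , ∉-remove {S = S} ∘ sub) ∷ [])
            self : ∀ {T z} → z ∉ T ⊖ z
            self z∈ = proj₁ (proj₂ (∈-⊖⁻ z∈)) refl
            gone : ∀ {T z t} → z ∉ T → z ∉ T ⊖ t
            gone z∉ z∈ = z∉ (proj₁ (∈-⊖⁻ z∈))
            X = Q ⊖ a
            W = S ⊖ v
            b∈X : b ∈ X
            b∈X = ∈-⊖⁺ b∈′ (a≢b ∘ sym) a≁b
            a′∈W : a′ ∈ W
            a′∈W = ∈-⊖⁺ a′∈ a′≢v v≁a′
            W-leaf : Nbhd⊆ W a′ (c ∷ [])
            W-leaf z z∈ e with na′ z (proj₁ (∈-⊖⁻ z∈)) e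
            ... | here refl = contradiction z∈ (∉-⊖ v~a)
            ... | there m = m
            total-rate : Bounded ((drop 6 1 general ⊞ drop 6 1 general) ⊞ drop 4 1 general ⊞ (drop 6 1 general ⊞ drop 6 1 general)) S (mis Q + mis W)
            total-rate = bounded-≤ _ (+-mono-≤ (≤-trans (mis-leaf a∈′ a-leaf) (ℕ.+-monoˡ-≤ (mis (Q ⊖ a′))
                (mis-leaf b∈X λ z z∈ → b-leaf z (proj₁ (∈-⊖⁻ z∈))))) (mis-leaf a′∈W W-leaf))
              (bounded-+ _ _ (bounded-+ _ _ (bounded-+ _ _
                (drop-isolated general (∈-⊖⁺ (∈-⊖⁺ c∈′ c≢a a≁c) c≢b b≁c)
                  (λ z z∈ e → ⊥-elim ([ (λ eq → ∉-⊖ a~a′ (subst (_∈ X) eq (proj₁ (∈-⊖⁻ z∈)))) , (λ eq → ∉-⊖ b~b′ (subst (_∈ X ⊖ b) eq z∈)) ]′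
                    (nbhd₂ nc (∈-remove⁻ (proj₁ (∈-⊖⁻ (proj₁ (∈-⊖⁻ z∈))))) e)))
                  (loses-six (proj₁ ∘ ∈-⊖⁻ ∘ proj₁ ∘ ∈-⊖⁻ ∘ ∈-remove⁻) (∉-remove {S = X ⊖ b}) (∉-⊖ b~b′ ∘ ∈-remove⁻)
                    (gone (∉-⊖ a~a′) ∘ ∈-remove⁻) (self ∘ ∈-remove⁻) (gone self ∘ ∈-remove⁻)) (general-rate _))
                (bounded-lose general (loses-six (proj₁ ∘ ∈-⊖⁻ ∘ proj₁ ∘ ∈-⊖⁻) (∉-⊖ b′~c) self (gone (∉-⊖ a~a′)) (∉-⊖ (~-sym b~b′)) (gone self)) (general-rate _)))
                (bounded-lose general (loses-list (c ∷ a′ ∷ a ∷ v ∷ []) v∈ (proj₁ ∘ ∈-⊖⁻) closes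
                  (((~⇒≢ a′~c ∘ sym) ∷ c≢a ∷ c≢v ∷ []) ∷ ((~⇒≢ a~a′ ∘ sym) ∷ a′≢v ∷ []) ∷ ((~⇒≢ v~a ∘ sym) ∷ []) ∷ [] ∷ [])
                  ((c∈ , ∉-⊖ a′~c) ∷ (a′∈ , self) ∷ (a∈ , ∉-⊖ (~-sym a~a′)) ∷ (v∈ , ∉-remove {S = S} ∘ proj₁ ∘ ∈-⊖⁻) ∷ [])) (general-rate _)))
                (bounded-+ _ _
                  (drop-isolated general (∈-⊖⁺ (∈-⊖⁺ b′∈ b′≢v v≁b′) (a′≢b′ ∘ sym) a′≁b′)
                    (λ z z∈ e → ⊥-elim ([ (λ eq → ∉-⊖ v~b (subst (_∈ W) eq (proj₁ (∈-⊖⁻ z∈)))) , (λ eq → ∉-⊖ a′~c (subst (_∈ W ⊖ a′) eq z∈)) ]′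
                      (nbhd₂ nb′ (proj₁ (∈-⊖⁻ (proj₁ (∈-⊖⁻ z∈)))) e)))
                    (loses-six (⊖⊆remove ∘ proj₁ ∘ ∈-⊖⁻ ∘ ∈-remove⁻) (∉-⊖ a′~c ∘ ∈-remove⁻) (∉-remove {S = W ⊖ a′})
                      (self ∘ ∈-remove⁻) (gone (∉-⊖ v~b) ∘ ∈-remove⁻) (gone (∉-⊖ v~a) ∘ ∈-remove⁻)) (general-rate _))
                  (bounded-lose general (loses-six (⊖⊆remove ∘ proj₁ ∘ ∈-⊖⁻) self (∉-⊖ (~-sym b′~c)) (∉-⊖ (~-sym a′~c))
                    (gone (∉-⊖ v~b)) (gone (∉-⊖ v~a))) (general-rate _))))
            total : Parity → Rate
            total = (drop 6 1 general ⊞ drop 6 1 general) ⊞ drop 4 1 general ⊞ (drop 6 1 general ⊞ drop 6 1 general)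
            even : Goal-at ev
            even {δ} B = strict (Bound-strict (total ev) (connected δ ev) (everyᵇ-elim (λ δ _ → total ev ≺ᵇ connected δ ev) tt δ ev)
              (Bound-≤ (total ev) (mis-branch S v) (at-budget total-rate B)))
            -- {a′, b′} is a maximal independent set of S - v without neighbours of v.
            J = ⁅ a′ ⁆ ∪ ⁅ b′ ⁆
            in-J : ∀ {z} → z ∈ J → z ≡ a′ ⊎ z ≡ b′
            in-J z∈ = [ inj₁ ∘ x∈⁅y⁆⇒x≡y a′ , inj₂ ∘ x∈⁅y⁆⇒x≡y b′ ]′ (x∈p∪q⁻ ⁅ a′ ⁆ ⁅ b′ ⁆ z∈)
            a′∈J : a′ ∈ J
            a′∈J = x∈p∪q⁺ (inj₁ (x∈⁅x⁆ a′))
            b′∈J : b′ ∈ J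
            b′∈J = x∈p∪q⁺ (inj₂ (x∈⁅x⁆ b′))
            cover : ∀ z → z ∈ S → z ∈ₗ c ∷ b′ ∷ a′ ∷ b ∷ a ∷ v ∷ []
            cover z z∈ = closed-reach closed (∈-lookup 5F) (conn v z v∈ z∈)
              where
              closed : All (λ z → Nbhd⊆ S z (c ∷ b′ ∷ a′ ∷ b ∷ a ∷ v ∷ [])) (c ∷ b′ ∷ a′ ∷ b ∷ a ∷ v ∷ [])
              closed = nbhd-within (∈-lookup 2F ∷ ∈-lookup 1F ∷ []) nc ∷ nbhd-within (∈-lookup 3F ∷ ∈-lookup 0F ∷ []) nb′ ∷
                nbhd-within (∈-lookup 4F ∷ ∈-lookup 0F ∷ []) na′ ∷ nbhd-within (∈-lookup 5F ∷ ∈-lookup 1F ∷ []) nb ∷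
                nbhd-within (∈-lookup 5F ∷ ∈-lookup 2F ∷ []) na ∷ nbhd-within (∈-lookup 4F ∷ ∈-lookup 3F ∷ []) nv ∷ []
            J-MIS : MIS Q J
            J-MIS = (λ {z} z∈ → [ (λ { refl → a′∈′ }) , (λ { refl → b′∈′ }) ]′ (in-J z∈)) , ind , dom
              where
              ind : Independent G J
              ind x y x∈ y∈ e with in-J x∈ | in-J y∈
              ... | inj₁ refl | inj₁ refl = ~-irrefl refl e
              ... | inj₁ refl | inj₂ refl = a′≁b′ e
              ... | inj₂ refl | inj₁ refl = a′≁b′ (~-sym e)
              ... | inj₂ refl | inj₂ refl = ~-irrefl refl e
              dom : Dominating Q J
              dom z z∈ z∉ with cover z (∈-remove⁻ z∈)
              ... | here refl = a′ , a′∈J , a′~c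
              ... | there (here refl) = contradiction b′∈J z∉
              ... | there (there (here refl)) = contradiction a′∈J z∉
              ... | there (there (there (here refl))) = b′ , b′∈J , ~-sym b~b′
              ... | there (there (there (there (here refl)))) = a′ , a′∈J , ~-sym a~a′
              ... | there (there (there (there (there (here refl))))) = contradiction refl (remove-≢ z∈)
            odd : Goal-at od
            odd {δ} B = strict (Bound-suc (connected δ od) (everyᵇ-elim (λ δ p → 0 <ᵇ den (connected δ p)) tt δ od)
              (Bound-weaken (total od) (connected δ od) (everyᵇ-elim (λ δ _ → total od ≼ᵇ connected δ od) tt δ od)
                (Bound-≤ (total od) (mis-branch-strict S v v∈ J-MIS λ u u∈ e →
                  [ (λ { refl → v≁a′ (~-sym e) }) , (λ { refl → v≁b′ (~-sym e) }) ]′ (in-J u∈)) (at-budget total-rate B))))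

          seven : ∀ {d} → d ∈ S → b′ ~ d → d ≢ b → c ≢ d → Goal
          seven {d} d∈ b′~d d≢b c≢d = subdivide v∈ a∈ b∈ v~a v~b a≢b conn₁ conn₃ (≤-trans (s≤s (s≤s (s≤s z≤n))) size₁)
            (≤-trans (s≤s z≤n) size₃) (3≤⇒≢2 size₃) ordinary
            where
            Q = S - v
            d≢v : d ≢ v
            d≢v refl = v≁b′ (~-sym b′~d)
            d≢a : d ≢ a
            d≢a refl = a≁b′ (~-sym b′~d)
            d≢a′ : d ≢ a′
            d≢a′ refl = a′≁b′ (~-sym b′~d)
            d∈′ : d ∈ Q
            d∈′ = ∈-remove⁺ d∈ d≢v
            conn₃ : ConnectedIn (Q - a - b)
            conn₃ = remove-connected (remove-connected conn₁ (leaf-noncut a-leaf)) (leaf-noncut λ z z∈ → b-leaf z (∈-remove⁻ z∈))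
            size₁ : 6 ≤ ∣ Q ∣
            size₁ = members (a ∷ b ∷ a′ ∷ b′ ∷ c ∷ d ∷ [])
              ((a≢b ∷ ~⇒≢ a~a′ ∷ (b′≢a ∘ sym) ∷ (c≢a ∘ sym) ∷ (d≢a ∘ sym) ∷ []) ∷ ((a′≢b ∘ sym) ∷ ~⇒≢ b~b′ ∷ (c≢b ∘ sym) ∷ (d≢b ∘ sym) ∷ []) ∷
                (a′≢b′ ∷ ~⇒≢ a′~c ∷ (d≢a′ ∘ sym) ∷ []) ∷ ((c≢b′ ∘ sym) ∷ ~⇒≢ b′~d ∷ []) ∷ (c≢d ∷ []) ∷ [] ∷ [])
              (a∈′ ∷ b∈′ ∷ a′∈′ ∷ b′∈′ ∷ c∈′ ∷ d∈′ ∷ [])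
            size₃ : 3 ≤ ∣ Q - a - b ∣
            size₃ = members (a′ ∷ b′ ∷ c ∷ []) ((a′≢b′ ∷ ~⇒≢ a′~c ∷ []) ∷ ((c≢b′ ∘ sym) ∷ []) ∷ [] ∷ [])
              (∈-remove⁺ (∈-remove⁺ a′∈′ (~⇒≢ a~a′ ∘ sym)) a′≢b ∷ ∈-remove⁺ (∈-remove⁺ b′∈′ b′≢a) (~⇒≢ b~b′ ∘ sym) ∷
                ∈-remove⁺ (∈-remove⁺ c∈′ c≢a) c≢b ∷ [])
            -- Deleting a hub must break the path p, q, r, as p and r are not adjacent. Deleting q
            -- would isolate p, so only p and r remain. Applied at both ends of S - v this leaves no
            -- common candidate.
            near : ∀ {h p q r k l} → Clustered (Q - h) k l → p ∈ Q → q ∈ Q → r ∈ Q → Nbhd⊆ Q p (q ∷ []) → q ~ r → p ~ q → p ≢ r → h ≡ p ⊎ h ≡ r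
            near {h} {p} {q} {r} cl p∈ q∈ r∈ np q~r p~q p≢r with h Fin.≟ p | h Fin.≟ r
            ... | yes eq | _ = inj₁ eq
            ... | no _ | yes eq = inj₂ eq
            ... | no h≢p | no h≢r with h Fin.≟ q
            ...   | yes refl = let (x , x∈ , e) = clusters-neighbour cl p (∈-remove⁺ p∈ (h≢p ∘ sym)) in
                contradiction (nbhd₁ np (∈-remove⁻ x∈) e) (remove-≢ x∈)
            ...   | no h≢q with clusters-clique cl (∈-remove⁺ q∈ (h≢q ∘ sym)) (∈-remove⁺ p∈ (h≢p ∘ sym)) (∈-remove⁺ r∈ (h≢r ∘ sym)) (~-sym p~q) q~r
            ...     | inj₁ eq = contradiction eq p≢r
            ...     | inj₂ p~r with nbhd₁ np r∈ p~r
            ...       | refl = ⊥-elim (~-irrefl refl q~r)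
            ordinary : ¬ Special Q
            ordinary (path₄ F) = contradiction (≤-trans size₁ (≤-reflexive (fits-size F))) λ { (s≤s (s≤s (s≤s (s≤s ())))) }
            ordinary (cycle₅ F) = contradiction (≤-trans size₁ (≤-reflexive (fits-size F))) λ { (s≤s (s≤s (s≤s (s≤s (s≤s ()))))) }
            ordinary (hub _ (_ , _ , cl)) with near cl a∈′ a′∈′ c∈′ a-leaf a′~c a~a′ (c≢a ∘ sym) | near cl b∈′ b′∈′ d∈′ b-leaf b′~d b~b′ (d≢b ∘ sym)
            ... | inj₁ p | inj₁ q = a≢b (trans (sym p) q)
            ... | inj₁ p | inj₂ q = d≢a (trans (sym q) p)
            ... | inj₂ p | inj₁ q = c≢b (trans (sym p) q)
            ... | inj₂ p | inj₂ q = c≢d (trans (sym p) q)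

      three : ∀ {v a b} → v ∈ S → a ∈ S → b ∈ S → v ~ a → v ~ b → a ~ b → Special S
      three {v} {a} {b} v∈ a∈ b∈ v~a v~b a~b = hub v∈ (0 , 1 , edge comp tt (empty λ z z∈ →
          All¬⇒¬Any (remove-≢ (∈-remove⁻ (∈-remove⁻ z∈)) ∷ remove-≢ (∈-remove⁻ z∈) ∷ remove-≢ z∈ ∷ [])
            (closed-reach closed (here refl) (conn v z v∈ (∈-remove⁻ (∈-remove⁻ (∈-remove⁻ z∈)))))))
        where
        nv = nbhd v∈ a∈ b∈ v~a v~b (~⇒≢ a~b)
        na = nbhd a∈ v∈ b∈ (~-sym v~a) a~b (~⇒≢ v~b)
        nb = nbhd b∈ v∈ a∈ (~-sym v~b) (~-sym a~b) (~⇒≢ v~a)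
        comp : EdgeComponent (S - v) a b
        comp = record { x∈ = ∈-remove⁺ a∈ (~⇒≢ v~a ∘ sym) ; y∈ = ∈-remove⁺ b∈ (~⇒≢ v~b ∘ sym) ; x~y = a~b
          ; x-nbhd = nbhd-remove na ; y-nbhd = nbhd-remove nb }
        closed : All (λ z → Nbhd⊆ S z (v ∷ a ∷ b ∷ [])) (v ∷ a ∷ b ∷ [])
        closed = nbhd-within (∈-lookup 1F ∷ ∈-lookup 2F ∷ []) nv ∷ nbhd-within (∈-lookup 0F ∷ ∈-lookup 2F ∷ []) na ∷
          nbhd-within (∈-lookup 0F ∷ ∈-lookup 1F ∷ []) nb ∷ []

      -- With all degrees equal to two S is a cycle. Lengths 3 and 5 are special, length 4 consists
      -- of twins, length 6 needs a count of its own, and longer cycles follow from `subdivide`.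
      cyclic : ∀ {v a} → v ∈ S → a ∈ S → v ~ a → Goal
      cyclic {v} {a} v∈ a∈ v~a with other v a v∈ v~a | other a v a∈ (~-sym v~a)
      ... | b , b∈ , v~b , b≢a | a′ , a′∈ , a~a′ , a′≢v with a′ Fin.≟ b
      ...   | yes refl = λ _ → special (three v∈ a∈ b∈ v~a v~b a~a′)
      ...   | no a′≢b with other b v b∈ (~-sym v~b)
      ...     | b′ , b′∈ , b~b′ , b′≢v with a′ Fin.≟ b′
      ...       | yes refl = twins v∈ a′∈ a∈ b∈ (a′≢v ∘ sym) (b≢a ∘ sym) v~a v~b (~-sym a~a′) (~-sym b~b′)
                    (λ e → [ ~⇒≢ v~b ∘ sym , a′≢b ∘ sym ]′ (nbhd₂ (nbhd a∈ v∈ a′∈ (~-sym v~a) a~a′ (a′≢v ∘ sym)) b∈ e))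
                    (nbhd v∈ a∈ b∈ v~a v~b (b≢a ∘ sym)) (nbhd a′∈ a∈ b∈ (~-sym a~a′) (~-sym b~b′) (b≢a ∘ sym))
      ...       | no a′≢b′ with a′ ~? b′
      ...         | yes e = λ _ → special (Around.five v∈ a∈ b∈ a′∈ b′∈ v~a v~b a~a′ b~b′ (b≢a ∘ sym) a′≢v b′≢v a′≢b a′≢b′ e)
      ...         | no a′≁b′ with other a′ a a′∈ (~-sym a~a′) | other b′ b b′∈ (~-sym b~b′)
      ...           | c , c∈ , a′~c , c≢a | d , d∈ , b′~d , d≢b with c Fin.≟ d
      ...             | yes refl = Around.six v∈ a∈ b∈ a′∈ b′∈ v~a v~b a~a′ b~b′ (b≢a ∘ sym) a′≢v b′≢v a′≢b a′≢b′ c∈ a′~c c≢a a′≁b′ b′~d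
      ...             | no c≢d = Around.seven v∈ a∈ b∈ a′∈ b′∈ v~a v~b a~a′ b~b′ (b≢a ∘ sym) a′≢v b′≢v a′≢b a′≢b′ c∈ a′~c c≢a a′≁b′ d∈ b′~d d≢b c≢d

    -- Choosing a lowest essential cut vertex

    Thin : Fin n → Set
    Thin v = ∃₂ λ k l → Nbhd⊆ S v (k ∷ l ∷ [])

    thin-no-three : ∀ {v} → Thin v → ∀ us → Nbrs S v us → length us ≢ 3
    thin-no-three (k , l , nb) (a ∷ b ∷ c ∷ []) ((ab ∷ ac ∷ []) ∷ (bc ∷ []) ∷ [] ∷ [] , (a∈ , e) ∷ (b∈ , f) ∷ (c∈ , g) ∷ []) _ =
      three-in-two (nb a a∈ e) (nb b b∈ f) (nb c c∈ g) ab ac bc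

    thin-nbhd : ∀ {v p q} → Thin v → p ∈ S → q ∈ S → v ~ p → v ~ q → p ≢ q → Nbhd⊆ S v (p ∷ q ∷ [])
    thin-nbhd {v} {p} {q} (k , l , nb) p∈ q∈ e f p≢q with neighbour? S v (p ∷ q ∷ [])
    ... | inj₂ nb′ = nb′
    ... | inj₁ (t , t∈ , g , t∉) = ⊥-elim (three-in-two (nb p p∈ e) (nb q q∈ f) (nb t t∈ g) p≢q
            (t∉ ∘ here ∘ sym) (t∉ ∘ there ∘ here ∘ sym))

    thin? : ∀ v → (∃ λ us → Nbrs S v us × length us ≡ 3) ⊎ Thin v
    thin? v with neighbour? S v []
    ... | inj₂ nb = inj₂ (v , v , λ u u∈ e → case nb u u∈ e of λ ())
    ... | inj₁ (a , a∈ , v~a , _) with neighbour? S v (a ∷ [])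
    ...   | inj₂ nb = inj₂ (a , a , λ u u∈ e → there (nb u u∈ e))
    ...   | inj₁ (b , b∈ , v~b , b∉) with neighbour? S v (b ∷ a ∷ [])
    ...     | inj₂ nb = inj₂ (b , a , nb)
    ...     | inj₁ (c , c∈ , v~c , c∉) = inj₁ (c ∷ b ∷ a ∷ [] , (fresh-∷ c∉ (fresh-∷ b∉ ([] ∷ [])) ,
                (c∈ , v~c) ∷ (b∈ , v~b) ∷ (a∈ , v~a) ∷ []) , refl)

    noncut? : ∀ v → Dec (Noncut S v)
    noncut? v = all? λ a → all? λ b → (a ∈? S) →-dec ((b ∈? S) →-dec ((v ~? a) →-dec ((v ~? b) →-dec reach? (S - v) a b)))

    nbhd? : ∀ v xs → Dec (Nbhd⊆ S v xs)
    nbhd? v xs = all? λ u → (u ∈? S) →-dec ((v ~? u) →-dec (u ∈ₗ? xs))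

    pendant? : ∀ x v w → Dec (Pendant x v w)
    pendant? x v w = map′
      (λ (a , b , c , d , e , f , g , h) → record { x∈ = a ; v∈ = b ; w∈ = c ; x~v = d ; v~w = e ; x≢w = f ; x-nbhd = g ; v-nbhd = h })
      (λ pd → let open Pendant pd in x∈ , v∈ , w∈ , x~v , v~w , x≢w , x-nbhd , v-nbhd)
      ((x ∈? S) ×-dec (v ∈? S) ×-dec (w ∈? S) ×-dec (x ~? v) ×-dec (v ~? w) ×-dec ¬? (x Fin.≟ w) ×-dec
        nbhd? x (v ∷ []) ×-dec nbhd? v (x ∷ w ∷ []))

    -- The middle of a pendant path is a cut vertex, but separates only a leaf. Tolerating it makes
    -- the lowest remaining cut vertex sit above all short hanging pieces.
    Good : Fin n → Set
    Good v = Noncut S v ⊎ ∃₂ λ x w → Pendant x v w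

    good? : ∀ v → Dec (Good v)
    good? v = noncut? v ⊎-dec (any? λ x → any? λ w → pendant? x v w)

    -- The induction step once vertices that do not disconnect S have at most two neighbours.
    module Sparse (thin-noncut : ∀ v → v ∈ S → Noncut S v → Thin v) where

      thin-good : ∀ v → v ∈ S → Good v → Thin v
      thin-good v v∈ (inj₁ nc) = thin-noncut v v∈ nc
      thin-good v v∈ (inj₂ (x , w , pd)) = x , w , Pendant.v-nbhd pd

      -- If a pendant path exists, the vertex w that carries it has at most one further neighbour,
      -- which the pendant lemmas cover. Otherwise no vertex is a cut vertex, and S is a single
      -- vertex or has no leaf and is a cycle.
      all-good : (∀ v → v ∈ S → Good v) → ∀ {v₀} → v₀ ∈ S → ∣ S ∣ ≢ 2 → Goal
      all-good good {v₀} v₀∈ ≢2 with any? (λ x → any? λ v → any? λ w → pendant? x v w)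
      ... | yes (x , v , w , pd) = by-parity (pendant-even pd) tail
        where
        open Pendant pd
        tail : Goal-at od
        tail with neighbour? S w (v ∷ [])
        ... | inj₂ nw = λ _ → special (pendant-end pd nw)
        ... | inj₁ (u , u∈ , w~u , u∉) = pendant-path pd u∈ w~u (u∉ ∘ here)
                (thin-nbhd (thin-good w w∈ (good w w∈)) v∈ u∈ (~-sym v~w) w~u (u∉ ∘ here ∘ sym))
      ... | no ¬pd with neighbour? S v₀ []
      ...   | inj₂ nb = λ _ → special (hub v₀∈ (0 , 0 , empty λ z z∈ →
                All¬⇒¬Any (remove-≢ z∈ ∷ []) (closed-reach (nbhd-within [] nb ∷ []) (here refl) (conn v₀ z v₀∈ (∈-remove⁻ z∈)))))
      ...   | inj₁ (a , a∈ , v~a , _) = Cyclic.cyclic noncut other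
                (λ x∈ y∈ z∈ → thin-nbhd (thin-noncut _ x∈ (noncut _ x∈)) y∈ z∈) v₀∈ a∈ v~a
        where
        noncut : ∀ v → v ∈ S → Noncut S v
        noncut v v∈ with good v v∈
        ... | inj₁ nc = nc
        ... | inj₂ (x , w , pd) = contradiction (x , v , w , pd) ¬pd
        other : ∀ x y → x ∈ S → x ~ y → ∃ λ z → z ∈ S × x ~ z × z ≢ y
        other x y x∈ x~y with neighbour? S x (y ∷ [])
        ... | inj₁ (z , z∈ , e , z∉) = z , z∈ , e , z∉ ∘ here
        ... | inj₂ nx with y ∈? S
        ...   | no y∉ = ⊥-elim (isolated (neighbour? S x []))
          where
          isolated : (∃ λ u → u ∈ S × x ~ u × u ∉ₗ []) ⊎ Nbhd⊆ S x [] → ⊥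
          isolated (inj₁ (u , u∈ , e , _)) = y∉ (subst (_∈ S) (nbhd₁ nx u∈ e) u∈)
          isolated (inj₂ nb) with closed-reach (nbhd-within [] nb ∷ []) (here refl) (conn x v₀ x∈ v₀∈)
          ... | here refl = case nb a a∈ v~a of λ ()
        ...   | yes y∈ with neighbour? S y (x ∷ [])
        ...     | inj₂ ny = ⊥-elim (≢2 (clusters-size (edge {Q₃ = λ _ _ _ → ⊤} {Q₂ = λ _ _ → ⊤} comp tt (empty λ z z∈ →
                    All¬⇒¬Any (remove-≢ (∈-remove⁻ z∈) ∷ remove-≢ z∈ ∷ [])
                      (closed-reach (nbhd-within (∈-lookup 1F ∷ []) nx ∷ nbhd-within (∈-lookup 0F ∷ []) ny ∷ []) (here refl)
                        (conn x z x∈ (∈-remove⁻ (∈-remove⁻ z∈))))))))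
          where
          comp : EdgeComponent S x y
          comp = record { x∈ = x∈ ; y∈ = y∈ ; x~y = x~y ; x-nbhd = nx ; y-nbhd = ny }
        -- The vertex y does not separate its neighbours x and z, although x has no neighbour other
        -- than y.
        ...     | inj₁ (z , z∈ , y~z , z∉) with noncut y y∈ x z x∈ z∈ (~-sym x~y) y~z
        ...       | stop _ = contradiction (here refl) z∉
        ...       | step {c = c} _ e r with nbhd₁ nx (∈-remove⁻ (reach-source r)) e
        ...         | eq = contradiction eq (remove-≢ (reach-source r))

      module Rooted {x} (x∈ : x ∈ S) (x-noncut : Noncut S x) where

        separated? : ∀ u → U.Decidable (λ z → z ∈ S - u × ¬ Reach (S - u) x z)
        separated? u z = (z ∈? S - u) ×-dec ¬? (reach? (S - u) x z)

        -- The part cut off from the root x by u. It is empty or not according to whether u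
        -- separates anything from x, and shrinks strictly when u is replaced by a vertex below it.
        below : Fin n → Subset n
        below u = comprehension (separated? u)

        below⁻ : ∀ {u z} → z ∈ below u → z ∈ S - u × ¬ Reach (S - u) x z
        below⁻ {u} = ∈-comprehension⁻ (separated? u)

        below⁺ : ∀ {u z} → z ∈ S - u → ¬ Reach (S - u) x z → z ∈ below u
        below⁺ {u} a b = ∈-comprehension⁺ (separated? u) (a , b)

        module At {w} (w∈ : w ∈ S) (w-bad : ¬ Good w) where

          x≢w : x ≢ w
          x≢w refl = w-bad (inj₁ x-noncut)

          x∈′ : x ∈ S - w
          x∈′ = ∈-remove⁺ x∈ x≢w

          above : ∃ λ u → u ∈ S × w ~ u × Reach (S - w) x u
          above with reach-exit (S - w) (conn x w x∈ w∈) x∈′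
          ... | inj₁ r = contradiction (reach-target r) (∉-remove {S = S})
          ... | inj₂ (c , d , r , e , d∈ , d∉) with d Fin.≟ w
          ...   | yes refl = c , ∈-remove⁻ (reach-target r) , ~-sym e , r
          ...   | no d≢w = contradiction (∈-remove⁺ d∈ d≢w) d∉

          below-closed : ∀ {z t} → z ∈ below w → z ~ t → t ∈ S → t ≢ w → t ∈ below w
          below-closed z∈ e t∈ t≢w = let (z∈′ , ¬r) = below⁻ z∈ ; t∈′ = ∈-remove⁺ t∈ t≢w in
            below⁺ t∈′ λ r → ¬r (reach-trans r (reach-edge t∈′ z∈′ (~-sym e)))

          below-S : ∀ {z} → z ∈ below w → z ∈ S
          below-S z∈ = ∈-remove⁻ (proj₁ (below⁻ z∈))

          joined : ∀ {z} → z ∈ S → z ≢ w → z ∉ below w → Reach (S - w) x z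
          joined {z} z∈ z≢w z∉ = decidable-stable (reach? (S - w) x z) λ ¬r → z∉ (below⁺ (∈-remove⁺ z∈ z≢w) ¬r)

          below-neighbour : ∃ λ y → w ~ y × y ∈ below w
          below-neighbour with any? (λ y → (w ~? y) ×-dec (y ∈? below w))
          ... | yes p = p
          ... | no ¬p = contradiction (inj₁ λ a b a∈ b∈ e f → reach-trans (reach-sym (joined a∈ (~⇒≢ e ∘ sym) λ m → ¬p (a , e , m)))
                  (joined b∈ (~⇒≢ f ∘ sym) λ m → ¬p (b , f , m))) w-bad

          -- A walk from the root that avoids w cannot reach u, which lies below w, so it also
          -- avoids u. Hence whatever u cuts off is cut off by w too; w itself is not cut off by u,
          -- being adjacent to the root side.
          below-shrinks : ∀ {u} → u ∈ below w → below u ⊆ below w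
          below-shrinks {u} u∈ {z} z∈ = below⁺ (∈-remove⁺ (∈-remove⁻ (proj₁ (below⁻ z∈))) z≢w) λ r → proj₂ (below⁻ z∈) (avoid-u r)
            where
            avoid-u : ∀ {z} → Reach (S - w) x z → Reach (S - u) x z
            avoid-u r = reach-mono (remove-mono ∈-remove⁻) (reach-avoid r λ c s eq → proj₂ (below⁻ u∈) (subst (Reach (S - w) x) eq s))
            z≢w : z ≢ w
            z≢w refl = let (t , t∈ , w~t , r) = above in
              proj₂ (below⁻ z∈) (reach-trans (avoid-u r) (reach-edge (reach-target (avoid-u r)) (proj₁ (below⁻ z∈)) (~-sym w~t)))

        minimal : ∀ k {w} → w ∈ S → ¬ Good w → ∣ below w ∣ ≤ k →
          ∃ λ w → w ∈ S × ¬ Good w × (∀ u → u ∈ below w → Good u)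
        minimal k {w} w∈ w-bad size with any? (λ u → (u ∈? below w) ×-dec ¬? (good? u))
        ... | no ¬u = w , w∈ , w-bad , λ u u∈ → decidable-stable (good? u) λ ¬g → ¬u (u , u∈ , ¬g)
        minimal zero w∈ w-bad size | yes (u , u∈ , _) = contradiction (≤-trans (≤-reflexive (size-remove u∈)) size) λ ()
        minimal (suc k) {w} w∈ w-bad size | yes (u , u∈ , u-bad) = minimal k (At.below-S w∈ w-bad u∈) u-bad
          (ℕ.≤-pred (≤-trans (size-drop (u ∷ []) (At.below-shrinks w∈ w-bad u∈) ([] ∷ [])
            ((u∈ , λ m → remove-≢ (proj₁ (below⁻ m)) refl) ∷ [])) size))

        module Lowest {w} (w∈ : w ∈ S) (w-bad : ¬ Good w) (below-good : ∀ u → u ∈ below w → Good u) where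
          open At w∈ w-bad

          private
            u = proj₁ above
            u∈ = proj₁ (proj₂ above)
            w~u = proj₁ (proj₂ (proj₂ above))
            x⇝u = proj₂ (proj₂ (proj₂ above))

          below-thin : ∀ {z} → z ∈ below w → Thin z
          below-thin z∈ = thin-good _ (below-S z∈) (below-good _ z∈)

          not-below : ∀ {z t} → z ∈ below w → Reach (S - w) x t → z ≢ t
          not-below z∈ r refl = proj₂ (below⁻ z∈) r

          far : ∀ {z t} → z ∈ below w → Reach (S - w) x t → ¬ Reach (S - w) z t
          far z∈ r s = proj₂ (below⁻ z∈) (reach-trans r (reach-sym s))

          -- What hangs at w through its neighbour y.
          data Kind (y : Fin n) : Set where
            leaf    : Nbhd⊆ S y (w ∷ []) → Kind y
            pendant : ∀ {x′} → Pendant x′ y w → Kind y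
            ear     : ∀ {y′} → Ear y y′ w → Kind y
            long    : Goal → Kind y

          kind : ∀ {y} → y ∈ below w → w ~ y → Kind y
          kind {y} y∈ w~y with neighbour? S y (w ∷ [])
          ... | inj₂ ny = leaf ny
          ... | inj₁ (y′ , y′∈S , y~y′ , y′∉) with neighbour? S y′ (y ∷ [])
          ...   | inj₂ ny′ = pendant (record { x∈ = y′∈S ; v∈ = below-S y∈ ; w∈ = w∈ ; x~v = ~-sym y~y′ ; v~w = ~-sym w~y
                    ; x≢w = y′∉ ∘ here ; x-nbhd = ny′ ; v-nbhd = thin-nbhd (below-thin y∈) y′∈S w∈ y~y′ (~-sym w~y) (y′∉ ∘ here) })
          ...   | inj₁ (y″ , y″∈S , y′~y″ , y″∉) = split (y″ Fin.≟ w)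
            where
            y′≢w : y′ ≢ w
            y′≢w = y′∉ ∘ here
            y∈S = below-S y∈
            y′∈ = below-closed y∈ y~y′ y′∈S y′≢w
            ny : Nbhd⊆ S y (y′ ∷ w ∷ [])
            ny = thin-nbhd (below-thin y∈) y′∈S w∈ y~y′ (~-sym w~y) y′≢w
            ny′ : Nbhd⊆ S y′ (y″ ∷ y ∷ [])
            ny′ = thin-nbhd (below-thin y′∈) y″∈S y∈S y′~y″ (~-sym y~y′) (y″∉ ∘ here)
            -- Were y the middle of a pendant path, its outer end would be y′ or w. But y′ has the
            -- neighbour y″, and w has the neighbour u on the root side.
            noncut : Good y → Noncut S y
            noncut (inj₁ nc) = nc
            noncut (inj₂ (l , t , pd)) with nbhd₂ ny (Pendant.x∈ pd) (~-sym (Pendant.x~v pd))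
            ... | inj₁ refl = contradiction (here (nbhd₁ (Pendant.x-nbhd pd) y″∈S y′~y″)) y″∉
            ... | inj₂ refl = contradiction (sym (nbhd₁ (Pendant.x-nbhd pd) u∈ w~u)) (not-below y∈ x⇝u)
            split : Dec (y″ ≡ w) → Kind y
            split (yes refl) = ear (record { a∈ = y∈S ; b∈ = y′∈S ; w∈ = w∈ ; a~b = y~y′ ; w~a = w~y ; w~b = ~-sym y′~y″ ; a-nbhd = ny
              ; b-nbhd = thin-nbhd (below-thin y′∈) y∈S w∈ (~-sym y~y′) y′~y″ (~⇒≢ w~y ∘ sym) })
            split (no y″≢w) = long (long-ear w∈ y∈S y′∈S y″∈S u∈ w~y y~y′ y′~y″ w~u y″≢w (y″∉ ∘ here) y′≢w ny ny′
              (thin-no-three (below-thin (below-closed y′∈ y′~y″ y″∈S y″≢w))) (noncut (below-good y y∈)) (far y∈ x⇝u))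

          -- With at most two neighbours, one of them a leaf, w would be good; with four,
          -- `leaf-four` applies. So the neighbours are ℓ, p, q. Either p and q are linked beyond w,
          -- or one of them lies below w and its kind decides.
          with-leaf : ∀ {ℓ} → ℓ ∈ S → w ~ ℓ → Nbhd⊆ S ℓ (w ∷ []) → Goal
          with-leaf {ℓ} ℓ∈ w~ℓ nℓ with neighbour? S w (ℓ ∷ [])
          ... | inj₂ nw = contradiction (inj₁ (leaf-noncut nw)) w-bad
          ... | inj₁ (p , p∈ , w~p , p∉) with neighbour? S w (p ∷ ℓ ∷ [])
          ...   | inj₂ nw = contradiction (inj₂ (ℓ , p , record { x∈ = ℓ∈ ; v∈ = w∈ ; w∈ = p∈ ; x~v = ~-sym w~ℓ ; v~w = w~p
                    ; x≢w = p∉ ∘ here ∘ sym ; x-nbhd = nℓ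
                    ; v-nbhd = nbhd-reverse nw })) w-bad
          ...   | inj₁ (q , q∈ , w~q , q∉) with neighbour? S w (q ∷ p ∷ ℓ ∷ [])
          ...     | inj₁ (t , t∈ , w~t , t∉) = leaf-four ℓ∈ w∈ (~-sym w~ℓ) nℓ
                      (fresh-∷ t∉ (fresh-∷ q∉ (fresh-∷ p∉ ([] ∷ []))) , (t∈ , w~t) ∷ (q∈ , w~q) ∷ (p∈ , w~p) ∷ (ℓ∈ , w~ℓ) ∷ []) refl
          ...     | inj₂ nw = decide (reach? (S - w) p q)
            where
            p≢ℓ : p ≢ ℓ
            p≢ℓ = p∉ ∘ here
            q≢p : q ≢ p
            q≢p = q∉ ∘ here
            q≢ℓ : q ≢ ℓ
            q≢ℓ = q∉ ∘ there ∘ here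
            via : ∀ {p q} → p ∈ below w → p ∈ S → q ∈ S → w ~ p → w ~ q → p ≢ ℓ → q ≢ ℓ → p ≢ q → ¬ Reach (S - w) p q →
              (∀ z → z ∈ S → w ~ z → z ≡ q ⊎ z ≡ p ⊎ z ≡ ℓ) → Goal
            via {p} {q} p∈′ p∈ q∈ w~p w~q p≢ℓ q≢ℓ p≢q apart nw′ with kind p∈′ w~p
            ... | leaf np = leaf-leaf ℓ∈ p∈ w∈ q∈ w~ℓ w~p w~q p≢ℓ (q≢ℓ ∘ sym) p≢q nℓ np
            ... | pendant pd = leaf-pendant ℓ∈ w∈ p∈ (Pendant.x∈ pd) q∈ w~ℓ w~p w~q (~-sym (Pendant.x~v pd)) (p≢ℓ ∘ sym) (q≢ℓ ∘ sym) p≢q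
                    (Pendant.x≢w pd) nℓ (Pendant.x-nbhd pd)
            ... | long goal = goal
            ... | ear {p′} er with nw′ p′ (Ear.b∈ er) (Ear.w~b er)
            ...   | inj₁ refl = contradiction (reach-edge (∈-remove⁺ p∈ (~⇒≢ w~p ∘ sym)) (∈-remove⁺ q∈ (~⇒≢ w~q ∘ sym)) (Ear.a~b er)) apart
            ...   | inj₂ (inj₁ refl) = ⊥-elim (~-irrefl refl (Ear.a~b er))
            ...   | inj₂ (inj₂ refl) = contradiction (sym (nbhd₁ nℓ p∈ (~-sym (Ear.a~b er)))) (~⇒≢ w~p)
            decide : Dec (Reach (S - w) p q) → Goal
            decide (yes r) = leaf-cyclic ℓ∈ w∈ p∈ q∈ w~ℓ w~p w~q (p≢ℓ ∘ sym) (q≢ℓ ∘ sym) (q≢p ∘ sym) nℓ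
              (nbhd-reverse nw) r
            decide (no ¬r) with p ∈? below w | q ∈? below w
            ... | yes p∈′ | _ = via p∈′ p∈ q∈ w~p w~q p≢ℓ q≢ℓ (q≢p ∘ sym) ¬r λ z z∈ e → nbhd₃ nw z∈ e
            ... | no _ | yes q∈′ = via q∈′ q∈ p∈ w~q w~p q≢ℓ p≢ℓ q≢p (¬r ∘ reach-sym) λ z z∈ e →
                    nbhd₃ (nbhd-within (∈-lookup 1F ∷ ∈-lookup 0F ∷ ∈-lookup 2F ∷ []) nw) z∈ e
            ... | no p∉′ | no q∉′ = contradiction (reach-trans (reach-sym (joined p∈ (~⇒≢ w~p ∘ sym) p∉′)) (joined q∈ (~⇒≢ w~q ∘ sym) q∉′)) ¬r

          module Leafless (leafless : ∀ ℓ → ℓ ∈ S → w ~ ℓ → ¬ Nbhd⊆ S ℓ (w ∷ [])) (bad-w : HasRate bad (S - w)) where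

            further? : ∀ xs → (∃ λ z → z ∈ below w × w ~ z × z ∉ₗ xs) ⊎ (∀ z → z ∈ S → w ~ z → z ∉ₗ xs → Reach (S - w) x z)
            further? xs with any? (λ z → (z ∈? below w) ×-dec (w ~? z) ×-dec ¬? (z ∈ₗ? xs))
            ... | yes p = inj₁ p
            ... | no ¬p = inj₂ λ z z∈ e z∉ → joined z∈ (~⇒≢ e ∘ sym) λ m → ¬p (z , m , e , z∉)

            u-further : ∃ λ t → t ∈ S × u ~ t × t ≢ w
            u-further with neighbour? S u (w ∷ [])
            ... | inj₁ (t , t∈ , e , t∉) = t , t∈ , e , t∉ ∘ here
            ... | inj₂ nu = contradiction nu (leafless u u∈ w~u)

            link : ∀ {s t} → Reach (S - w) x s → Reach (S - w) x t → Reach (S - w) s t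
            link r s = reach-trans (reach-sym r) s

            -- In the odd case the other pieces at w decide. Another pendant path or a triangle
            -- below w is settled directly. Otherwise all further neighbours of w belong to the root
            -- side and are linked there: one of them continues a path, two lie on a cycle, three
            -- give three cycles.
            with-pendant : ∀ {x′ y} → y ∈ below w → w ~ y → Pendant x′ y w → Goal
            with-pendant {x′} {y} y∈ w~y pd = by-parity (pendant-even pd) odd
              where
              y∈S = below-S y∈
              y≢u = not-below y∈ x⇝u
              rooted : (∀ z → z ∈ S → w ~ z → z ∉ₗ y ∷ [] → Reach (S - w) x z) → Goal-at od
              rooted up with neighbour? S w (u ∷ y ∷ [])
              ... | inj₂ nw = pendant-path pd u∈ w~u (y≢u ∘ sym)
                      (nbhd-reverse nw)
              ... | inj₁ (s , s∈ , w~s , s∉) with neighbour? S w (s ∷ u ∷ y ∷ [])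
              ...   | inj₂ nw = pendant-on-cycle pd u∈ s∈ w~u w~s y≢u (s∉ ∘ there ∘ here ∘ sym) (s∉ ∘ here ∘ sym)
                      (nbhd-reverse nw)
                      (link x⇝u (up s s∈ w~s (s∉ ∘ there)))
              ...   | inj₁ (t , t∈ , w~t , t∉) = three-cycles w∈ bad-w
                      (fresh-∷ t∉ (fresh-∷ s∉ (((y≢u ∘ sym) ∷ []) ∷ [] ∷ [])) , (t∈ , w~t) ∷ (s∈ , w~s) ∷ (u∈ , w~u) ∷ (y∈S , w~y) ∷ []) refl
                      ((u≢s , w~u , w~s , link x⇝u x⇝s) ∷ (u≢t , w~u , w~t , link x⇝u x⇝t) ∷ (s≢t , w~s , w~t , link x⇝s x⇝t) ∷ [] ,
                        (inj₂ (u≢s ∘ sym , s≢t) ∷ inj₁ (u≢s , u≢t) ∷ []) ∷ (inj₁ (u≢s , u≢t) ∷ []) ∷ [] ∷ []) refl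
                where
                x⇝s = up s s∈ w~s (s∉ ∘ there)
                x⇝t = up t t∈ w~t (t∉ ∘ there ∘ there)
                u≢s : u ≢ s
                u≢s = s∉ ∘ here ∘ sym
                u≢t : u ≢ t
                u≢t = t∉ ∘ there ∘ here ∘ sym
                s≢t : s ≢ t
                s≢t = t∉ ∘ here ∘ sym
              odd : Goal-at od
              odd with further? (y ∷ [])
              ... | inj₂ up = rooted up
              ... | inj₁ (z , z∈ , w~z , z∉) with kind z∈ w~z
              ...   | leaf nz = contradiction nz (leafless z (below-S z∈) w~z)
              ...   | long goal = goal
              ...   | pendant pd′ = let (t , t∈ , u~t , t≢w) = u-further in
                      two-pendants pd pd′ (z∉ ∘ here ∘ sym) u∈ w~u (y≢u ∘ sym) (not-below z∈ x⇝u ∘ sym) t∈ u~t t≢w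
              ...   | ear {z′} er = pendant-cycle pd bad-w
                      (((z∉ ∘ here ∘ sym) ∷ y≢z′ ∷ y≢u ∷ []) ∷ (~⇒≢ (Ear.a~b er) ∷ not-below z∈ x⇝u ∷ []) ∷ (not-below z′∈ x⇝u ∷ []) ∷ [] ∷ [] ,
                        (y∈S , w~y) ∷ (below-S z∈ , w~z) ∷ (Ear.b∈ er , Ear.w~b er) ∷ (u∈ , w~u) ∷ []) refl (Ear.closes er)
                where
                z′∈ : z′ ∈ below w
                z′∈ = below-closed z∈ (Ear.a~b er) (Ear.b∈ er) (~⇒≢ (Ear.w~b er) ∘ sym)
                y≢z′ : y ≢ z′
                y≢z′ refl = [ (λ eq → Pendant.w≁x pd (subst (w ~_) eq w~z)) , ~⇒≢ w~z ∘ sym ]′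
                  (nbhd₂ (Pendant.v-nbhd pd) (below-S z∈) (~-sym (Ear.a~b er)))

            -- If a second piece hangs at w, it supplies the missing neighbour or cycle. Otherwise w
            -- has one, two or more neighbours on the root side: a bridge, a cycle, or five
            -- neighbours with two cycles.
            with-ear : ∀ {y y′} → y ∈ below w → w ~ y → Ear y y′ w → Goal
            with-ear {y} {y′} y∈ w~y er with further? (y ∷ y′ ∷ [])
            ... | inj₁ (z , z∈ , w~z , z∉) = another (kind z∈ w~z)
              where
              open Ear er hiding (w∈)
              y′∈ : y′ ∈ below w
              y′∈ = below-closed y∈ a~b b∈ (~⇒≢ w~b ∘ sym)
              y≢u = not-below y∈ x⇝u
              y′≢u = not-below y′∈ x⇝u
              y≢z : y ≢ z
              y≢z = z∉ ∘ here ∘ sym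
              y′≢z : y′ ≢ z
              y′≢z = z∉ ∘ there ∘ here ∘ sym
              another : Kind z → Goal
              another (leaf nz) = contradiction nz (leafless z (below-S z∈) w~z)
              another (long goal) = goal
              another (pendant pd) = by-parity (pendant-even pd) (pendant-cycle pd bad-w
                ((~⇒≢ a~b ∷ y≢z ∷ y≢u ∷ []) ∷ (y′≢z ∷ y′≢u ∷ []) ∷ (not-below z∈ x⇝u ∷ []) ∷ [] ∷ [] ,
                  (a∈ , w~a) ∷ (b∈ , w~b) ∷ (below-S z∈ , w~z) ∷ (u∈ , w~u) ∷ []) refl closes)
              another (ear {z′} er′) = two-cycles w∈ bad-w
                ((~⇒≢ a~b ∷ y≢z ∷ y≢z′ ∷ y≢u ∷ []) ∷ (y′≢z ∷ y′≢z′ ∷ y′≢u ∷ []) ∷ (~⇒≢ ′.a~b ∷ not-below z∈ x⇝u ∷ []) ∷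
                    (not-below z′∈ x⇝u ∷ []) ∷ [] ∷ [] ,
                  (a∈ , w~a) ∷ (b∈ , w~b) ∷ (′.a∈ , ′.w~a) ∷ (′.b∈ , ′.w~b) ∷ (u∈ , w~u) ∷ []) refl
                (closes ∷ ′.closes ∷ [] , (inj₁ (y≢z , y≢z′) ∷ []) ∷ [] ∷ []) refl
                where
                module ′ = Ear er′
                z′∈ : z′ ∈ below w
                z′∈ = below-closed z∈ ′.a~b ′.b∈ (~⇒≢ ′.w~b ∘ sym)
                y≢z′ : y ≢ z′
                y≢z′ refl = [ y′≢z ∘ sym , ~⇒≢ w~z ∘ sym ]′ (nbhd₂ a-nbhd (below-S z∈) (~-sym ′.a~b))
                y′≢z′ : y′ ≢ z′
                y′≢z′ refl = [ y≢z ∘ sym , ~⇒≢ w~z ∘ sym ]′ (nbhd₂ b-nbhd (below-S z∈) (~-sym ′.a~b))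
            ... | inj₂ up with neighbour? S w (u ∷ y′ ∷ y ∷ [])
            ...   | inj₂ nw = ear-bridge er u∈ w~u (not-below y∈ x⇝u ∘ sym) (not-below y′∈ x⇝u ∘ sym)
                    (nbhd-reverse nw)
              where
              open Ear er hiding (w∈)
              y′∈ : y′ ∈ below w
              y′∈ = below-closed y∈ a~b b∈ (~⇒≢ w~b ∘ sym)
            ...   | inj₁ (s , s∈ , w~s , s∉) = cycles (neighbour? S w (s ∷ u ∷ y′ ∷ y ∷ []))
              where
              open Ear er hiding (w∈)
              y′∈ : y′ ∈ below w
              y′∈ = below-closed y∈ a~b b∈ (~⇒≢ w~b ∘ sym)
              y≢u = not-below y∈ x⇝u
              y′≢u = not-below y′∈ x⇝u
              s≢u : s ≢ u
              s≢u = s∉ ∘ here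
              s≢y′ : s ≢ y′
              s≢y′ = s∉ ∘ there ∘ here
              s≢y : s ≢ y
              s≢y = s∉ ∘ there ∘ there ∘ here
              x⇝s : Reach (S - w) x s
              x⇝s = up s s∈ w~s (All¬⇒¬Any (s≢y ∷ s≢y′ ∷ []))
              cycles : (∃ λ t → t ∈ S × w ~ t × t ∉ₗ s ∷ u ∷ y′ ∷ y ∷ []) ⊎ Nbhd⊆ S w (s ∷ u ∷ y′ ∷ y ∷ []) → Goal
              cycles (inj₁ (t , t∈ , w~t , t∉)) = two-cycles w∈ bad-w
                (fresh-∷ t∉ (fresh-∷ s∉ (((y′≢u ∘ sym) ∷ (y≢u ∘ sym) ∷ []) ∷ ((~⇒≢ a~b ∘ sym) ∷ []) ∷ [] ∷ [])) ,
                  (t∈ , w~t) ∷ (s∈ , w~s) ∷ (u∈ , w~u) ∷ (b∈ , w~b) ∷ (a∈ , w~a) ∷ []) refl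
                (closes ∷ (s≢u ∘ sym , w~u , w~s , link x⇝u x⇝s) ∷ [] , (inj₁ (y≢u , s≢y ∘ sym) ∷ []) ∷ [] ∷ []) refl
              cycles (inj₂ nw) = ear-cycle er u∈ s∈ w~u w~s y≢u y′≢u (s≢y ∘ sym) (s≢y′ ∘ sym) (s≢u ∘ sym)
                (nbhd-reverse nw) (link x⇝u x⇝s)

            finish : Goal
            finish with below-neighbour
            ... | y , w~y , y∈ with kind y∈ w~y
            ...   | leaf ny    = contradiction ny (leafless y (below-S y∈) w~y)
            ...   | long goal  = goal
            ...   | pendant pd = with-pendant y∈ w~y pd
            ...   | ear er     = with-ear y∈ w~y er

          -- Leaves at w are treated first. After that, either S - w is clustered and w is a hub, or
          -- the gap of `bad` for S - w is available in all remaining configurations.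
          lowest : Goal
          lowest with any? (λ ℓ → (ℓ ∈? S) ×-dec (w ~? ℓ) ×-dec nbhd? ℓ (w ∷ []))
          ... | yes (ℓ , ℓ∈ , e , nℓ) = with-leaf ℓ∈ e nℓ
          ... | no none with proj₂ (classify (S - w))
          ...   | inj₁ cl = λ _ → special (hub w∈ cl)
          ...   | inj₂ b  = Leafless.finish (λ ℓ ℓ∈ e nℓ → none (ℓ , ℓ∈ , e , nℓ)) b

    step-claim : ∀ {v₀} → v₀ ∈ S → ∣ S ∣ ≢ 2 → Goal
    step-claim {v₀} v₀∈ ≢2 with search crowded?
      where
      crowded? : ∀ v → (v ∈ S × Noncut S v × ∃ λ us → Nbrs S v us × length us ≡ 3) ⊎ (v ∈ S → Noncut S v → Thin v)
      crowded? v with v ∈? S | noncut? v | thin? v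
      ... | no v∉ | _ | _ = inj₂ λ v∈ → contradiction v∈ v∉
      ... | yes _ | no cut | _ = inj₂ λ _ nc → contradiction nc cut
      ... | yes v∈ | yes nc | inj₁ us = inj₁ (v∈ , nc , us)
      ... | yes _ | yes _ | inj₂ th = inj₂ λ _ _ → th
    ... | inj₁ (v , v∈ , nc , us , nb , eq) = crowded-noncut v∈ nc nb eq
    ... | inj₂ thin with any? (λ w → (w ∈? S) ×-dec ¬? (good? w))
    ...   | no none = all-good (λ v v∈ → decidable-stable (good? v) λ ¬g → none (v , v∈ , ¬g)) v₀∈ ≢2
      where open Sparse thin
    ...   | yes (w , w∈ , w-bad) with noncut-exists v₀∈
    ...     | x , x∈ , nc with minimal ∣ below w ∣ w∈ w-bad ≤-refl
      where
      open Sparse thin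
      open Rooted x∈ nc
    ...       | w′ , w′∈ , w′-bad , good = Lowest.lowest w′∈ w′-bad good
      where
      open Sparse thin
      open Rooted x∈ nc

  -- Extremal graphs

  claim : ∀ S → Claim S
  claim S = go ∣ S ∣ S ≤-refl
    where
    go : ∀ k S → ∣ S ∣ ≤ k → Claim S
    go k S bound conn nonempty ≢2 with any? (_∈? S)
    ... | no none = contradiction (≤-trans nonempty (≤-reflexive
            (clusters-size (empty {Q₃ = λ _ _ _ → ⊤} {Q₂ = λ _ _ → ⊤} λ v v∈ → none (v , v∈))))) λ ()
    go zero S bound conn nonempty ≢2 | yes _ = contradiction (≤-trans nonempty bound) λ ()
    go (suc k) S bound conn nonempty ≢2 | yes (v₀ , v₀∈) = Local.step-claim conn (λ v∈ sub → go k _ (ℕ.≤-pred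
      (≤-trans (s≤s (p⊆q⇒∣p∣≤∣q∣ sub)) (≤-trans (≤-reflexive (size-remove v∈)) bound)))) v₀∈ ≢2

  clusters-mis-≥ : ∀ {Q₃ Q₂ S a b} → Clusters Q₃ Q₂ S a b → 3 ^ a * 2 ^ b ≤ mis S
  clusters-mis-≥ (empty none) = ≤-reflexive (sym (mis-empty none))
  clusters-mis-≥ (triangle {S} {x} {y} {z} {a} {b} c _ cs) = begin
    3 * 3 ^ a * 2 ^ b              ≡⟨ solve 2 (λ p q → con 3 :* p :* q := p :* q :+ (p :* q :+ (p :* q :+ con 0))) refl (3 ^ a) (2 ^ b) ⟩
    3 ^ a * 2 ^ b + (3 ^ a * 2 ^ b + (3 ^ a * 2 ^ b + 0))
      ≤⟨ +-mono-≤ (at x-nbhd (λ p → remove-≢ (∈-remove⁻ (∈-remove⁻ p))) λ p → All¬⇒¬Any (remove-≢ (∈-remove⁻ p) ∷ remove-≢ p ∷ []))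
          (+-mono-≤ (at y-nbhd (λ p → remove-≢ (∈-remove⁻ p)) λ p → All¬⇒¬Any (remove-≢ (∈-remove⁻ (∈-remove⁻ p)) ∷ remove-≢ p ∷ []))
          (+-mono-≤ (at z-nbhd remove-≢ λ p → All¬⇒¬Any (remove-≢ (∈-remove⁻ (∈-remove⁻ p)) ∷ remove-≢ (∈-remove⁻ p) ∷ [])) z≤n)) ⟩
    mis (S ⊖ x) + (mis (S ⊖ y) + (mis (S ⊖ z) + 0))
      ≤⟨ mis-clique-≥ (x ∷ y ∷ z ∷ []) (x∈ ∷ y∈ ∷ z∈ ∷ []) ((x~y ∷ x~z ∷ []) ∷ (y~z ∷ []) ∷ [] ∷ []) ⟩
    mis S ∎
    where
    open TriangleComponent c
    open ≤-Reasoning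
    open +-*-Solver
    at : ∀ {v xs} → Nbhd⊆ S v xs → (∀ {u} → u ∈ S - x - y - z → u ≢ v) → (∀ {u} → u ∈ S - x - y - z → u ∉ₗ xs) → 3 ^ a * 2 ^ b ≤ mis (S ⊖ v)
    at nb ≢v out = ≤-trans (clusters-mis-≥ cs) (mis-mono λ p → let p′ = ∈-remove⁻ (∈-remove⁻ (∈-remove⁻ p)) in
      ∈-⊖⁺ p′ (≢v p) λ e → out p (nb _ p′ e))
  clusters-mis-≥ (edge {S} {x} {y} {a} {b} c _ cs) = begin
    3 ^ a * (2 * 2 ^ b)              ≡⟨ solve 2 (λ p q → p :* (con 2 :* q) := p :* q :+ (p :* q :+ con 0)) refl (3 ^ a) (2 ^ b) ⟩
    3 ^ a * 2 ^ b + (3 ^ a * 2 ^ b + 0)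
      ≤⟨ +-mono-≤ (at x-nbhd (λ p → remove-≢ (∈-remove⁻ p)) remove-≢) (+-mono-≤ (at y-nbhd remove-≢ λ p → remove-≢ (∈-remove⁻ p)) z≤n) ⟩
    mis (S ⊖ x) + (mis (S ⊖ y) + 0)  ≤⟨ mis-clique-≥ (x ∷ y ∷ []) (x∈ ∷ y∈ ∷ []) ((x~y ∷ []) ∷ [] ∷ []) ⟩
    mis S ∎
    where
    open EdgeComponent c
    open ≤-Reasoning
    open +-*-Solver
    at : ∀ {v t} → Nbhd⊆ S v (t ∷ []) → (∀ {u} → u ∈ S - x - y → u ≢ v) → (∀ {u} → u ∈ S - x - y → u ≢ t) → 3 ^ a * 2 ^ b ≤ mis (S ⊖ v)
    at nb ≢v ≢t = ≤-trans (clusters-mis-≥ cs) (mis-mono λ p → let p′ = ∈-remove⁻ (∈-remove⁻ p) in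
      ∈-⊖⁺ p′ (≢v p) λ e → ≢t p (nbhd₁ nb p′ e))

  -- Hubs joined to each component by a single edge

  Single₃ : Fin n → Fin n → Fin n → Fin n → Set
  Single₃ h x y z = h ~ x × ¬ h ~ y × ¬ h ~ z

  Single₂ : Fin n → Fin n → Fin n → Set
  Single₂ h x y = h ~ x × ¬ h ~ y

  Spokes : Fin n → Subset n → ℕ → ℕ → Set
  Spokes h = Clusters (Single₃ h) (Single₂ h)

  -- Away from h every triangle retains two adjacent vertices, a choice of two; an edge retains one
  -- vertex and contributes no factor.
  spokes-mis-≥ : ∀ {h T a b} → Spokes h T a b → ∀ {U} → (∀ v → v ∈ T → ¬ h ~ v → v ∈ U) → 2 ^ a ≤ mis U
  spokes-mis-≥ (empty _) {U} _ = ≤-trans (≤-reflexive (sym (mis-empty {∅} λ _ → ∉⊥))) (mis-mono λ x∈ → contradiction x∈ ∉⊥)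
  spokes-mis-≥ {h} (triangle {T} {x} {y} {z} {a} c (_ , h≁y , h≁z) cs) {U} sub = begin
    2 ^ a + (2 ^ a + 0)               ≤⟨ +-mono-≤ (spokes-mis-≥ cs λ v v∈ h≁v → keep v∈ h≁v (remove-≢ (∈-remove⁻ v∈)) λ e →
                                            All¬⇒¬Any (remove-≢ (∈-remove⁻ (∈-remove⁻ v∈)) ∷ remove-≢ v∈ ∷ []) (y-nbhd v (in-T v∈) e))
                                          (+-mono-≤ (spokes-mis-≥ cs λ v v∈ h≁v → keep v∈ h≁v (remove-≢ v∈) λ e →
                                            All¬⇒¬Any (remove-≢ (∈-remove⁻ (∈-remove⁻ v∈)) ∷ remove-≢ (∈-remove⁻ v∈) ∷ []) (z-nbhd v (in-T v∈) e)) z≤n) ⟩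
    mis (U ⊖ y) + (mis (U ⊖ z) + 0)   ≤⟨ mis-clique-≥ (y ∷ z ∷ []) (sub y y∈ h≁y ∷ sub z z∈ h≁z ∷ []) ((y~z ∷ []) ∷ [] ∷ []) ⟩
    mis U                             ∎
    where
    open TriangleComponent c
    open ≤-Reasoning
    in-T : ∀ {v} → v ∈ T - x - y - z → v ∈ T
    in-T = ∈-remove⁻ ∘ ∈-remove⁻ ∘ ∈-remove⁻
    keep : ∀ {v t} → v ∈ T - x - y - z → ¬ h ~ v → v ≢ t → ¬ t ~ v → v ∈ U ⊖ t
    keep v∈ h≁v v≢t t≁v = ∈-⊖⁺ (sub _ (in-T v∈) h≁v) v≢t t≁v
  spokes-mis-≥ (edge _ _ cs) sub = spokes-mis-≥ cs λ v v∈ → sub v (∈-remove⁻ (∈-remove⁻ v∈))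

  private
    shuffle₂₂ : ∀ {S : Subset n} {p q x y} → S - p - q - x - y ⊆ S - x - y - p - q
    shuffle₂₂ m = let m₁ = ∈-remove⁻ m ; m₂ = ∈-remove⁻ m₁ ; m₃ = ∈-remove⁻ m₂ in
      ∈-remove⁺ (∈-remove⁺ (∈-remove⁺ (∈-remove⁺ (∈-remove⁻ m₃) (remove-≢ m₁)) (remove-≢ m)) (remove-≢ m₃)) (remove-≢ m₂)
    shuffle₂₃ : ∀ {S : Subset n} {p q x y z} → S - p - q - x - y - z ⊆ S - x - y - z - p - q
    shuffle₂₃ m = let m₁ = ∈-remove⁻ m ; m₂ = ∈-remove⁻ m₁ ; m₃ = ∈-remove⁻ m₂ ; m₄ = ∈-remove⁻ m₃ in
      ∈-remove⁺ (∈-remove⁺ (∈-remove⁺ (∈-remove⁺ (∈-remove⁺ (∈-remove⁻ m₄) (remove-≢ m₂)) (remove-≢ m₁)) (remove-≢ m)) (remove-≢ m₄)) (remove-≢ m₃)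
    shuffle₃₂ : ∀ {S : Subset n} {p q x y z} → S - x - y - z - p - q ⊆ S - p - q - x - y - z
    shuffle₃₂ m = let m₁ = ∈-remove⁻ m ; m₂ = ∈-remove⁻ m₁ ; m₃ = ∈-remove⁻ m₂ ; m₄ = ∈-remove⁻ m₃ in
      ∈-remove⁺ (∈-remove⁺ (∈-remove⁺ (∈-remove⁺ (∈-remove⁺ (∈-remove⁻ m₄) (remove-≢ m₁)) (remove-≢ m)) (remove-≢ m₄)) (remove-≢ m₃)) (remove-≢ m₂)

  -- A derivation fixes an order in which components are peeled off. This moves a given component K₂
  -- to the front.
  clusters-remove-edge : ∀ {T a b p q} → Clustered T a b → EdgeComponent T p q → ∃ λ b′ → b ≡ suc b′ × Clustered (T - p - q) a b′
  clusters-remove-edge (empty none) e = contradiction (EdgeComponent.x∈ e) (none _)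
  clusters-remove-edge {T} {p = p} {q} (triangle {x = x} {y} {z} c _ cs) e = pack (clusters-remove-edge cs e′)
    where
    open TriangleComponent c
    module e = EdgeComponent e
    distinct : ∀ {v s t} → v ∈ T → s ∈ T → t ∈ T → v ~ s → v ~ t → s ~ t → p ≢ v × q ≢ v
    distinct {v} {s} {t} v∈ s∈ t∈ f g k = (λ { refl → clash (e.x-nbhd s s∈ f) (e.x-nbhd t t∈ g) }) , (λ { refl → clash (e.y-nbhd s s∈ f) (e.y-nbhd t t∈ g) })
      where
      clash : ∀ {o} → s ∈ₗ o ∷ [] → t ∈ₗ o ∷ [] → ⊥
      clash (here refl) (here refl) = ~-irrefl refl k
    px = distinct x∈ y∈ z∈ x~y x~z y~z
    py = distinct y∈ x∈ z∈ (~-sym x~y) y~z x~z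
    pz = distinct z∈ x∈ y∈ (~-sym x~z) (~-sym y~z) x~y
    e′ : EdgeComponent (T - x - y - z) p q
    e′ = record { x∈ = ∈-remove⁺ (∈-remove⁺ (∈-remove⁺ e.x∈ (proj₁ px)) (proj₁ py)) (proj₁ pz)
      ; y∈ = ∈-remove⁺ (∈-remove⁺ (∈-remove⁺ e.y∈ (proj₂ px)) (proj₂ py)) (proj₂ pz) ; x~y = e.x~y
      ; x-nbhd = nbhd-mono (∈-remove⁻ ∘ ∈-remove⁻ ∘ ∈-remove⁻) e.x-nbhd
      ; y-nbhd = nbhd-mono (∈-remove⁻ ∘ ∈-remove⁻ ∘ ∈-remove⁻) e.y-nbhd }
    c′ : TriangleComponent (T - p - q) x y z
    c′ = record { x∈ = ∈-remove⁺ (∈-remove⁺ x∈ (proj₁ px ∘ sym)) (proj₂ px ∘ sym) ; y∈ = ∈-remove⁺ (∈-remove⁺ y∈ (proj₁ py ∘ sym)) (proj₂ py ∘ sym)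
      ; z∈ = ∈-remove⁺ (∈-remove⁺ z∈ (proj₁ pz ∘ sym)) (proj₂ pz ∘ sym) ; x~y = x~y ; x~z = x~z ; y~z = y~z
      ; x-nbhd = nbhd-mono (∈-remove⁻ ∘ ∈-remove⁻) x-nbhd ; y-nbhd = nbhd-mono (∈-remove⁻ ∘ ∈-remove⁻) y-nbhd
      ; z-nbhd = nbhd-mono (∈-remove⁻ ∘ ∈-remove⁻) z-nbhd }
    pack : ∀ {a b} → (∃ λ b′ → b ≡ suc b′ × Clustered (T - x - y - z - p - q) a b′) → ∃ λ b′ → b ≡ suc b′ × Clustered (T - p - q) (suc a) b′
    pack {a} (b′ , eq , cs′) = b′ , eq , triangle c′ tt (subst (λ U → Clustered U a b′) (⊆-antisym shuffle₃₂ shuffle₂₃) cs′)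
  clusters-remove-edge {T} {p = p} {q} (edge {x = x} {y} {a} {b} c _ cs) e with p Fin.≟ x | p Fin.≟ y
  ... | yes refl | _ = b , refl , subst (λ v → Clustered (T - x - v) a b) (sym q≡y) cs
    where
    q≡y : q ≡ y
    q≡y = nbhd₁ (EdgeComponent.x-nbhd c) (EdgeComponent.y∈ e) (EdgeComponent.x~y e)
  ... | no _ | yes refl = b , refl , subst (λ U → Clustered U a b) (⊆-antisym remove-comm remove-comm)
      (subst (λ v → Clustered (T - v - y) a b) (sym q≡x) cs)
    where
    q≡x : q ≡ x
    q≡x = nbhd₁ (EdgeComponent.y-nbhd c) (EdgeComponent.y∈ e) (EdgeComponent.x~y e)
  ... | no p≢x | no p≢y = pack (clusters-remove-edge cs e′)
    where
    open EdgeComponent c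
    module e = EdgeComponent e
    q∈ : q ∈ T - x - y
    q∈ = edge-away c e.x∈ p≢x p≢y e.y∈ e.x~y
    e′ : EdgeComponent (T - x - y) p q
    e′ = record { x∈ = ∈-remove⁺ (∈-remove⁺ e.x∈ p≢x) p≢y ; y∈ = q∈ ; x~y = e.x~y
      ; x-nbhd = nbhd-mono (∈-remove⁻ ∘ ∈-remove⁻) e.x-nbhd ; y-nbhd = nbhd-mono (∈-remove⁻ ∘ ∈-remove⁻) e.y-nbhd }
    c′ : EdgeComponent (T - p - q) x y
    c′ = record { x∈ = ∈-remove⁺ (∈-remove⁺ x∈ (p≢x ∘ sym)) (remove-≢ (∈-remove⁻ q∈) ∘ sym) ; y∈ = ∈-remove⁺ (∈-remove⁺ y∈ (p≢y ∘ sym)) (remove-≢ q∈ ∘ sym)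
      ; x~y = x~y ; x-nbhd = nbhd-mono (∈-remove⁻ ∘ ∈-remove⁻) x-nbhd ; y-nbhd = nbhd-mono (∈-remove⁻ ∘ ∈-remove⁻) y-nbhd }
    pack : (∃ λ b′ → b ≡ suc b′ × Clustered (T - x - y - p - q) a b′) → ∃ λ b′ → suc b ≡ suc b′ × Clustered (T - p - q) a b′
    pack (b′ , eq , cs′) = suc b′ , cong suc eq , edge c′ tt (subst (λ U → Clustered U a b′) (⊆-antisym shuffle₂₂ shuffle₂₂) cs′)

  -- Each component has a vertex joined to h. If it is the only one, the component is relabelled so
  -- that it comes first; if there are two, they are adjacent and close a triangle with h.
  spokes? : ∀ {h T a b} → Clustered T a b → (∀ v → v ∈ T → ∃ λ w → w ∈ T × h ~ w × (v ≡ w ⊎ v ~ w)) →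
    Spokes h T a b ⊎ (∃₂ λ p q → p ∈ T × q ∈ T × p ~ q × h ~ p × h ~ q)
  spokes? (empty none) _ = inj₁ (empty none)
  spokes? {h} {T} (triangle {x = x} {y} {z} c _ cs) att with spokes? cs att′
    where
    att′ : ∀ v → v ∈ T - x - y - z → ∃ λ w → w ∈ T - x - y - z × h ~ w × (v ≡ w ⊎ v ~ w)
    att′ v v∈ with att v (∈-remove⁻ (∈-remove⁻ (∈-remove⁻ v∈)))
    ... | w , w∈ , e , inj₁ refl = w , v∈ , e , inj₁ refl
    ... | w , w∈ , e , inj₂ f = w , triangle-away c (∈-remove⁻ (∈-remove⁻ (∈-remove⁻ v∈)))
            (remove-≢ (∈-remove⁻ (∈-remove⁻ v∈))) (remove-≢ (∈-remove⁻ v∈)) (remove-≢ v∈) w∈ f , e , inj₂ f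
  ... | inj₂ (p , q , p∈ , q∈ , rest) = inj₂ (p , q , ∈-remove⁻ (∈-remove⁻ (∈-remove⁻ p∈)) , ∈-remove⁻ (∈-remove⁻ (∈-remove⁻ q∈)) , rest)
  ... | inj₁ sp = cases (h ~? x) (h ~? y) (h ~? z)
    where
    open TriangleComponent c
    c-y : TriangleComponent T y x z
    c-y = record { x∈ = y∈ ; y∈ = x∈ ; z∈ = z∈ ; x~y = ~-sym x~y ; x~z = y~z ; y~z = x~z
      ; x-nbhd = y-nbhd ; y-nbhd = x-nbhd ; z-nbhd = nbhd-reverse z-nbhd }
    c-z : TriangleComponent T z x y
    c-z = record { x∈ = z∈ ; y∈ = x∈ ; z∈ = y∈ ; x~y = ~-sym x~z ; x~z = ~-sym y~z ; y~z = x~y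
      ; x-nbhd = z-nbhd ; y-nbhd = nbhd-reverse x-nbhd ; z-nbhd = nbhd-reverse y-nbhd }
    perm-y : T - x - y - z ≡ T - y - x - z
    perm-y = cong (_- z) (⊆-antisym remove-comm remove-comm)
    perm-z : T - x - y - z ≡ T - z - x - y
    perm-z = ⊆-antisym
      (λ m → let m₁ = ∈-remove⁻ m ; m₂ = ∈-remove⁻ m₁ in ∈-remove⁺ (∈-remove⁺ (∈-remove⁺ (∈-remove⁻ m₂) (remove-≢ m)) (remove-≢ m₂)) (remove-≢ m₁))
      (λ m → let m₁ = ∈-remove⁻ m ; m₂ = ∈-remove⁻ m₁ in ∈-remove⁺ (∈-remove⁺ (∈-remove⁺ (∈-remove⁻ m₂) (remove-≢ m₁)) (remove-≢ m)) (remove-≢ m₂))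
    cases : Dec (h ~ x) → Dec (h ~ y) → Dec (h ~ z) → Spokes h T _ _ ⊎ (∃₂ λ p q → p ∈ T × q ∈ T × p ~ q × h ~ p × h ~ q)
    cases (yes e) (yes f) _ = inj₂ (x , y , x∈ , y∈ , x~y , e , f)
    cases (yes e) (no _) (yes g) = inj₂ (x , z , x∈ , z∈ , x~z , e , g)
    cases (no _) (yes f) (yes g) = inj₂ (y , z , y∈ , z∈ , y~z , f , g)
    cases (yes e) (no ¬f) (no ¬g) = inj₁ (triangle c (e , ¬f , ¬g) sp)
    cases (no ¬e) (yes f) (no ¬g) = inj₁ (triangle c-y (f , ¬e , ¬g) (subst (λ U → Spokes h U _ _) perm-y sp))
    cases (no ¬e) (no ¬f) (yes g) = inj₁ (triangle c-z (g , ¬e , ¬f) (subst (λ U → Spokes h U _ _) perm-z sp))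
    cases (no ¬e) (no ¬f) (no ¬g) with att x x∈
    ... | w , w∈ , k , inj₁ refl = contradiction k ¬e
    ... | w , w∈ , k , inj₂ f with nbhd₂ x-nbhd w∈ f
    ...   | inj₁ refl = contradiction k ¬f
    ...   | inj₂ refl = contradiction k ¬g
  spokes? {h} {T} (edge {x = x} {y} c _ cs) att with spokes? cs att′
    where
    att′ : ∀ v → v ∈ T - x - y → ∃ λ w → w ∈ T - x - y × h ~ w × (v ≡ w ⊎ v ~ w)
    att′ v v∈ with att v (∈-remove⁻ (∈-remove⁻ v∈))
    ... | w , w∈ , e , inj₁ refl = w , v∈ , e , inj₁ refl
    ... | w , w∈ , e , inj₂ f = w , edge-away c (∈-remove⁻ (∈-remove⁻ v∈))
            (remove-≢ (∈-remove⁻ v∈)) (remove-≢ v∈) w∈ f , e , inj₂ f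
  ... | inj₂ (p , q , p∈ , q∈ , rest) = inj₂ (p , q , ∈-remove⁻ (∈-remove⁻ p∈) , ∈-remove⁻ (∈-remove⁻ q∈) , rest)
  ... | inj₁ sp = cases (h ~? x) (h ~? y)
    where
    open EdgeComponent c
    c′ : EdgeComponent T y x
    c′ = record { x∈ = y∈ ; y∈ = x∈ ; x~y = ~-sym x~y ; x-nbhd = y-nbhd ; y-nbhd = x-nbhd }
    cases : Dec (h ~ x) → Dec (h ~ y) → Spokes h T _ _ ⊎ (∃₂ λ p q → p ∈ T × q ∈ T × p ~ q × h ~ p × h ~ q)
    cases (yes e) (yes f) = inj₂ (x , y , x∈ , y∈ , x~y , e , f)
    cases (yes e) (no ¬f) = inj₁ (edge c (e , ¬f) sp)
    cases (no ¬e) (yes f) = inj₁ (edge c′ (f , ¬e) (subst (λ U → Spokes h U _ _) (⊆-antisym remove-comm remove-comm) sp))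
    cases (no ¬e) (no ¬f) with att x x∈
    ... | w , w∈ , k , inj₁ refl = contradiction k ¬e
    ... | w , w∈ , k , inj₂ f with nbhd₁ x-nbhd w∈ f
    ...   | refl = contradiction k ¬f

  -- Isomorphisms with the model graphs

  fits⇒≅ : {V : Set} {H : Graph V} {f : V → Fin n} → Fits full H f → G ≅ H
  fits⇒≅ {H = H} {f} F = mk↔ₛ′ to f (λ i → injective _ _ (at (f i))) at , λ u v → mk⇔
    (λ e → reflects _ _ (subst₂ _~_ (sym (at u)) (sym (at v)) e))
    (λ e → subst₂ _~_ (at u) (at v) (preserves _ _ e))
    where
    open Fits F
    to = λ v → proj₁ (onto v ∈⊤)
    at : ∀ v → f (to v) ≡ v
    at v = proj₂ (onto v ∈⊤)

  ≅⇒fits : {V : Set} {H : Graph V} → G ≅ H → ∃ λ f → Fits full H f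
  ≅⇒fits {H = H} (φ , adj) = from , record
    { inside-S  = λ _ → ∈⊤
    ; onto      = λ v _ → to v , strictlyInverseʳ v
    ; injective = λ i j eq → trans (sym (strictlyInverseˡ i)) (trans (cong to eq) (strictlyInverseˡ j))
    ; preserves = λ i j e → Equivalence.from (adj _ _) (subst₂ (Graph._~_ H) (sym (strictlyInverseˡ i)) (sym (strictlyInverseˡ j)) e)
    ; reflects  = λ i j e → subst₂ (Graph._~_ H) (strictlyInverseˡ i) (strictlyInverseˡ j) (Equivalence.to (adj _ _) e) }
    where open Inverse φ using (to; from; strictlyInverseˡ; strictlyInverseʳ)

  triangle-∈ : ∀ {S x y z} → TriangleComponent S x y z → ∀ i → lookup (x ∷ y ∷ z ∷ []) i ∈ S
  triangle-∈ c 0F = TriangleComponent.x∈ c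
  triangle-∈ c 1F = TriangleComponent.y∈ c
  triangle-∈ c 2F = TriangleComponent.z∈ c

  triangle-~ : ∀ {S x y z} → TriangleComponent S x y z → ∀ i j → i ≢ j → lookup (x ∷ y ∷ z ∷ []) i ~ lookup (x ∷ y ∷ z ∷ []) j
  triangle-~ c 0F 0F i≢j = contradiction refl i≢j
  triangle-~ c 0F 1F _   = TriangleComponent.x~y c
  triangle-~ c 0F 2F _   = TriangleComponent.x~z c
  triangle-~ c 1F 0F _   = ~-sym (TriangleComponent.x~y c)
  triangle-~ c 1F 1F i≢j = contradiction refl i≢j
  triangle-~ c 1F 2F _   = TriangleComponent.y~z c
  triangle-~ c 2F 0F _   = ~-sym (TriangleComponent.x~z c)
  triangle-~ c 2F 1F _   = ~-sym (TriangleComponent.y~z c)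
  triangle-~ c 2F 2F i≢j = contradiction refl i≢j

  triangle-rest-≢ : ∀ {S : Subset n} {x y z v} → v ∈ S - x - y - z → ∀ i → v ≢ lookup (x ∷ y ∷ z ∷ []) i
  triangle-rest-≢ v∈ 0F = remove-≢ (∈-remove⁻ (∈-remove⁻ v∈))
  triangle-rest-≢ v∈ 1F = remove-≢ (∈-remove⁻ v∈)
  triangle-rest-≢ v∈ 2F = remove-≢ v∈

  edge-∈ : ∀ {S x y} → EdgeComponent S x y → ∀ i → lookup (x ∷ y ∷ []) i ∈ S
  edge-∈ c 0F = EdgeComponent.x∈ c
  edge-∈ c 1F = EdgeComponent.y∈ c

  edge-~ : ∀ {S x y} → EdgeComponent S x y → ∀ i j → i ≢ j → lookup (x ∷ y ∷ []) i ~ lookup (x ∷ y ∷ []) j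
  edge-~ c 0F 0F i≢j = contradiction refl i≢j
  edge-~ c 0F 1F _   = EdgeComponent.x~y c
  edge-~ c 1F 0F _   = ~-sym (EdgeComponent.x~y c)
  edge-~ c 1F 1F i≢j = contradiction refl i≢j

  edge-rest-≢ : ∀ {S : Subset n} {x y v} → v ∈ S - x - y → ∀ i → v ≢ lookup (x ∷ y ∷ []) i
  edge-rest-≢ v∈ 0F = remove-≢ (∈-remove⁻ v∈)
  edge-rest-≢ v∈ 1F = remove-≢ v∈

  private
    triangle-apart : ∀ {S x y z v} → TriangleComponent S x y z → v ∈ S - x - y - z → ∀ i → ¬ v ~ lookup (x ∷ y ∷ z ∷ []) i
    triangle-apart c v∈ i e = triangle-rest-≢ (triangle-away c (∈-remove⁻ (∈-remove⁻ (∈-remove⁻ v∈)))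
      (remove-≢ (∈-remove⁻ (∈-remove⁻ v∈))) (remove-≢ (∈-remove⁻ v∈)) (remove-≢ v∈) (triangle-∈ c i) e) i refl

    edge-apart : ∀ {S x y v} → EdgeComponent S x y → v ∈ S - x - y → ∀ i → ¬ v ~ lookup (x ∷ y ∷ []) i
    edge-apart c v∈ i e = edge-rest-≢ (edge-away c (∈-remove⁻ (∈-remove⁻ v∈))
      (remove-≢ (∈-remove⁻ v∈)) (remove-≢ v∈) (edge-∈ c i) e) i refl

    lookup-injective : ∀ {k} (vs : Vec (Fin n) k) → (∀ i j → i ≢ j → lookup vs i ~ lookup vs j) →
      ∀ i j → lookup vs i ≡ lookup vs j → i ≡ j
    lookup-injective vs clique i j eq with i Fin.≟ j
    ... | yes i≡j = i≡j
    ... | no i≢j  = contradiction eq (~⇒≢ (clique i j i≢j))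

    suc₁ : ∀ {a b k l i j} → _≡_ {A = Cells a b} (inj₁ (k , i)) (inj₁ (l , j)) → _≡_ {A = Cells (suc a) b} (inj₁ (suc k , i)) (inj₁ (suc l , j))
    suc₁ refl = refl

    up₁ : ∀ {a b k i} {w : Fin b × Fin 2} → _≡_ {A = Cells a b} (inj₁ (k , i)) (inj₂ w) → ⊥
    up₁ ()

    keep₂ : ∀ {a b} {v w : Fin b × Fin 2} → _≡_ {A = Cells a b} (inj₂ v) (inj₂ w) → _≡_ {A = Cells (suc a) b} (inj₂ v) (inj₂ w)
    keep₂ refl = refl

    keep₁ : ∀ {a b} {v w : Fin a × Fin 3} → _≡_ {A = Cells a b} (inj₁ v) (inj₁ w) → _≡_ {A = Cells a (suc b)} (inj₁ v) (inj₁ w)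
    keep₁ refl = refl

    suc₂ : ∀ {a b k l i j} → _≡_ {A = Cells a b} (inj₂ (k , i)) (inj₂ (l , j)) → _≡_ {A = Cells a (suc b)} (inj₂ (suc k , i)) (inj₂ (suc l , j))
    suc₂ refl = refl

  module _ {Q₃ : Fin n → Fin n → Fin n → Set} {Q₂ : Fin n → Fin n → Set} where

    place : ∀ {S a b} → Clusters Q₃ Q₂ S a b → Cells a b → Fin n
    place (triangle {x = x} {y} {z} _ _ cs) (inj₁ (0F , i))    = lookup (x ∷ y ∷ z ∷ []) i
    place (triangle _ _ cs)                 (inj₁ (suc k , i)) = place cs (inj₁ (k , i))
    place (triangle _ _ cs)                 (inj₂ w)           = place cs (inj₂ w)
    place (edge _ _ cs)                     (inj₁ w)           = place cs (inj₁ w)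
    place (edge {x = x} {y} _ _ cs)         (inj₂ (0F , i))    = lookup (x ∷ y ∷ []) i
    place (edge _ _ cs)                     (inj₂ (suc k , i)) = place cs (inj₂ (k , i))

    place-Q₃ : ∀ {S a b} (cs : Clusters Q₃ Q₂ S a b) k →
      Q₃ (place cs (inj₁ (k , 0F))) (place cs (inj₁ (k , 1F))) (place cs (inj₁ (k , 2F)))
    place-Q₃ (triangle _ q _)  0F      = q
    place-Q₃ (triangle _ _ cs) (suc k) = place-Q₃ cs k
    place-Q₃ (edge _ _ cs)     k       = place-Q₃ cs k

    place-Q₂ : ∀ {S a b} (cs : Clusters Q₃ Q₂ S a b) k → Q₂ (place cs (inj₂ (k , 0F))) (place cs (inj₂ (k , 1F)))
    place-Q₂ (triangle _ _ cs) k       = place-Q₂ cs k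
    place-Q₂ (edge _ q _)      0F      = q
    place-Q₂ (edge _ _ cs)     (suc k) = place-Q₂ cs k

    place-∈ : ∀ {S a b} (cs : Clusters Q₃ Q₂ S a b) w → place cs w ∈ S
    place-∈ (triangle c _ cs) (inj₁ (0F , i))    = triangle-∈ c i
    place-∈ (triangle _ _ cs) (inj₁ (suc k , i)) = ∈-remove⁻ (∈-remove⁻ (∈-remove⁻ (place-∈ cs (inj₁ (k , i)))))
    place-∈ (triangle _ _ cs) (inj₂ w)           = ∈-remove⁻ (∈-remove⁻ (∈-remove⁻ (place-∈ cs (inj₂ w))))
    place-∈ (edge _ _ cs)     (inj₁ w)           = ∈-remove⁻ (∈-remove⁻ (place-∈ cs (inj₁ w)))
    place-∈ (edge c _ cs)     (inj₂ (0F , i))    = edge-∈ c i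
    place-∈ (edge _ _ cs)     (inj₂ (suc k , i)) = ∈-remove⁻ (∈-remove⁻ (place-∈ cs (inj₂ (k , i))))

    place-onto : ∀ {S a b} (cs : Clusters Q₃ Q₂ S a b) v → v ∈ S → ∃ λ w → place cs w ≡ v
    place-onto (empty none) v v∈ = contradiction v∈ (none v)
    place-onto (triangle {x = x} {y} {z} _ _ cs) v v∈ with v Fin.≟ x | v Fin.≟ y | v Fin.≟ z
    ... | yes eq | _ | _ = inj₁ (0F , 0F) , sym eq
    ... | no _ | yes eq | _ = inj₁ (0F , 1F) , sym eq
    ... | no _ | no _ | yes eq = inj₁ (0F , 2F) , sym eq
    ... | no p | no q | no r with place-onto cs v (∈-remove⁺ (∈-remove⁺ (∈-remove⁺ v∈ p) q) r)
    ...   | inj₁ (k , i) , eq = inj₁ (suc k , i) , eq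
    ...   | inj₂ w , eq = inj₂ w , eq
    place-onto (edge {x = x} {y} _ _ cs) v v∈ with v Fin.≟ x | v Fin.≟ y
    ... | yes eq | _ = inj₂ (0F , 0F) , sym eq
    ... | no _ | yes eq = inj₂ (0F , 1F) , sym eq
    ... | no p | no q with place-onto cs v (∈-remove⁺ (∈-remove⁺ v∈ p) q)
    ...   | inj₁ w , eq = inj₁ w , eq
    ...   | inj₂ (k , i) , eq = inj₂ (suc k , i) , eq

    place-injective : ∀ {S a b} (cs : Clusters Q₃ Q₂ S a b) v w → place cs v ≡ place cs w → v ≡ w
    place-injective (triangle c _ cs) (inj₁ (0F , i)) (inj₁ (0F , j)) eq =
      cong (λ k → inj₁ (0F , k)) (lookup-injective (_ ∷ _ ∷ _ ∷ []) (triangle-~ c) i j eq)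
    place-injective (triangle c _ cs) (inj₁ (0F , i)) (inj₁ (suc l , j)) eq = contradiction (sym eq) (triangle-rest-≢ (place-∈ cs (inj₁ (l , j))) i)
    place-injective (triangle c _ cs) (inj₁ (0F , i)) (inj₂ w) eq = contradiction (sym eq) (triangle-rest-≢ (place-∈ cs (inj₂ w)) i)
    place-injective (triangle c _ cs) (inj₁ (suc k , i)) (inj₁ (0F , j)) eq = contradiction eq (triangle-rest-≢ (place-∈ cs (inj₁ (k , i))) j)
    place-injective (triangle c _ cs) (inj₂ w) (inj₁ (0F , j)) eq = contradiction eq (triangle-rest-≢ (place-∈ cs (inj₂ w)) j)
    place-injective (triangle c _ cs) (inj₁ (suc k , i)) (inj₁ (suc l , j)) eq = suc₁ (place-injective cs (inj₁ (k , i)) (inj₁ (l , j)) eq)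
    place-injective (triangle c _ cs) (inj₁ (suc k , i)) (inj₂ w) eq = ⊥-elim (up₁ (place-injective cs (inj₁ (k , i)) (inj₂ w) eq))
    place-injective (triangle c _ cs) (inj₂ w) (inj₁ (suc k , i)) eq = ⊥-elim (up₁ (sym (place-injective cs (inj₂ w) (inj₁ (k , i)) eq)))
    place-injective (triangle c _ cs) (inj₂ v) (inj₂ w) eq = keep₂ (place-injective cs (inj₂ v) (inj₂ w) eq)
    place-injective (edge c _ cs) (inj₂ (0F , i)) (inj₂ (0F , j)) eq =
      cong (λ k → inj₂ (0F , k)) (lookup-injective (_ ∷ _ ∷ []) (edge-~ c) i j eq)
    place-injective (edge c _ cs) (inj₂ (0F , i)) (inj₂ (suc l , j)) eq = contradiction (sym eq) (edge-rest-≢ (place-∈ cs (inj₂ (l , j))) i)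
    place-injective (edge c _ cs) (inj₂ (0F , i)) (inj₁ w) eq = contradiction (sym eq) (edge-rest-≢ (place-∈ cs (inj₁ w)) i)
    place-injective (edge c _ cs) (inj₂ (suc k , i)) (inj₂ (0F , j)) eq = contradiction eq (edge-rest-≢ (place-∈ cs (inj₂ (k , i))) j)
    place-injective (edge c _ cs) (inj₁ w) (inj₂ (0F , j)) eq = contradiction eq (edge-rest-≢ (place-∈ cs (inj₁ w)) j)
    place-injective (edge c _ cs) (inj₂ (suc k , i)) (inj₂ (suc l , j)) eq = suc₂ (place-injective cs (inj₂ (k , i)) (inj₂ (l , j)) eq)
    place-injective (edge c _ cs) (inj₂ (suc k , i)) (inj₁ w) eq = ⊥-elim (up₁ (sym (place-injective cs (inj₂ (k , i)) (inj₁ w) eq)))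
    place-injective (edge c _ cs) (inj₁ w) (inj₂ (suc k , i)) eq = ⊥-elim (up₁ (place-injective cs (inj₁ w) (inj₂ (k , i)) eq))
    place-injective (edge c _ cs) (inj₁ v) (inj₁ w) eq = keep₁ (place-injective cs (inj₁ v) (inj₁ w) eq)

    place-preserves : ∀ {S a b} (cs : Clusters Q₃ Q₂ S a b) v w → Graph._~_ (cells a b) v w → place cs v ~ place cs w
    place-preserves (triangle c _ cs) (inj₁ (0F , i)) (inj₁ (0F , j)) (_ , i≢j , _) = triangle-~ c i j i≢j
    place-preserves (triangle c _ cs) (inj₁ (suc k , i)) (inj₁ (suc .k , j)) (refl , e) = place-preserves cs (inj₁ (k , i)) (inj₁ (k , j)) (refl , e)
    place-preserves (triangle c _ cs) (inj₂ v) (inj₂ w) e = place-preserves cs (inj₂ v) (inj₂ w) e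
    place-preserves (edge c _ cs) (inj₁ v) (inj₁ w) e = place-preserves cs (inj₁ v) (inj₁ w) e
    place-preserves (edge c _ cs) (inj₂ (0F , i)) (inj₂ (0F , j)) (_ , i≢j , _) = edge-~ c i j i≢j
    place-preserves (edge c _ cs) (inj₂ (suc k , i)) (inj₂ (suc .k , j)) (refl , e) = place-preserves cs (inj₂ (k , i)) (inj₂ (k , j)) (refl , e)

    place-reflects : ∀ {S a b} (cs : Clusters Q₃ Q₂ S a b) v w → place cs v ~ place cs w → Graph._~_ (cells a b) v w
    place-reflects (triangle c _ cs) (inj₁ (0F , i)) (inj₁ (0F , j)) e = refl , (λ { refl → ~-irrefl refl e }) , inj₁ tt
    place-reflects (triangle c _ cs) (inj₁ (0F , i)) (inj₁ (suc l , j)) e = ⊥-elim (triangle-apart c (place-∈ cs (inj₁ (l , j))) i (~-sym e))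
    place-reflects (triangle c _ cs) (inj₁ (0F , i)) (inj₂ w) e = triangle-apart c (place-∈ cs (inj₂ w)) i (~-sym e)
    place-reflects (triangle c _ cs) (inj₁ (suc k , i)) (inj₁ (0F , j)) e = ⊥-elim (triangle-apart c (place-∈ cs (inj₁ (k , i))) j e)
    place-reflects (triangle c _ cs) (inj₂ w) (inj₁ (0F , j)) e = triangle-apart c (place-∈ cs (inj₂ w)) j e
    place-reflects (triangle c _ cs) (inj₁ (suc k , i)) (inj₁ (suc l , j)) e =
      let (p , q) = place-reflects cs (inj₁ (k , i)) (inj₁ (l , j)) e in cong suc p , q
    place-reflects (triangle c _ cs) (inj₁ (suc k , i)) (inj₂ w) e = place-reflects cs (inj₁ (k , i)) (inj₂ w) e
    place-reflects (triangle c _ cs) (inj₂ w) (inj₁ (suc k , i)) e = place-reflects cs (inj₂ w) (inj₁ (k , i)) e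
    place-reflects (triangle c _ cs) (inj₂ v) (inj₂ w) e = place-reflects cs (inj₂ v) (inj₂ w) e
    place-reflects (edge c _ cs) (inj₂ (0F , i)) (inj₂ (0F , j)) e = refl , (λ { refl → ~-irrefl refl e }) , inj₁ tt
    place-reflects (edge c _ cs) (inj₂ (0F , i)) (inj₂ (suc l , j)) e = ⊥-elim (edge-apart c (place-∈ cs (inj₂ (l , j))) i (~-sym e))
    place-reflects (edge c _ cs) (inj₂ (0F , i)) (inj₁ w) e = edge-apart c (place-∈ cs (inj₁ w)) i (~-sym e)
    place-reflects (edge c _ cs) (inj₂ (suc k , i)) (inj₂ (0F , j)) e = ⊥-elim (edge-apart c (place-∈ cs (inj₂ (k , i))) j e)
    place-reflects (edge c _ cs) (inj₁ w) (inj₂ (0F , j)) e = edge-apart c (place-∈ cs (inj₁ w)) j e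
    place-reflects (edge c _ cs) (inj₂ (suc k , i)) (inj₂ (suc l , j)) e =
      let (p , q) = place-reflects cs (inj₂ (k , i)) (inj₂ (l , j)) e in cong suc p , q
    place-reflects (edge c _ cs) (inj₂ (suc k , i)) (inj₁ w) e = place-reflects cs (inj₂ (k , i)) (inj₁ w) e
    place-reflects (edge c _ cs) (inj₁ w) (inj₂ (suc k , i)) e = place-reflects cs (inj₁ w) (inj₂ (k , i)) e
    place-reflects (edge c _ cs) (inj₁ v) (inj₁ w) e = place-reflects cs (inj₁ v) (inj₁ w) e

    clusters⇒fits : ∀ {S a b} (cs : Clusters Q₃ Q₂ S a b) → Fits S (cells a b) (place cs)
    clusters⇒fits cs = record { inside-S = place-∈ cs ; onto = place-onto cs ; injective = place-injective cs
      ; preserves = place-preserves cs ; reflects = place-reflects cs }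

    fits⇒clusters : ∀ {S} a b {f} → Fits S (cells a b) f →
      (∀ k → Q₃ (f (inj₁ (k , 0F))) (f (inj₁ (k , 1F))) (f (inj₁ (k , 2F)))) →
      (∀ k → Q₂ (f (inj₂ (k , 0F))) (f (inj₂ (k , 1F)))) → Clusters Q₃ Q₂ S a b
    fits⇒clusters zero zero F _ _ = empty λ v v∈ → case proj₁ (Fits.onto F v v∈) of λ { (inj₁ (() , _)) ; (inj₂ (() , _)) }
    fits⇒clusters {S} zero (suc b) {f} F q₃ q₂ = edge comp (q₂ 0F) (fits⇒clusters zero b F′ (λ ()) (q₂ ∘ suc))
      where
      open Fits F
      v : Fin 2 → Fin n
      v i = f (inj₂ (0F , i))
      nbhd : ∀ i j → (∀ k → i ≢ k → k ≡ j) → Nbhd⊆ S (v i) (v j ∷ [])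
      nbhd i j other u u∈ e with onto u u∈
      ... | inj₂ (k , l) , refl with reflects (inj₂ (0F , i)) (inj₂ (k , l)) e
      ...   | refl , i≢l , _ = here (cong v (other l i≢l))
      comp : EdgeComponent S (v 0F) (v 1F)
      comp = record { x∈ = inside-S _ ; y∈ = inside-S _ ; x~y = preserves _ _ (refl , (λ ()) , inj₁ tt)
        ; x-nbhd = nbhd 0F 1F λ { 0F p → contradiction refl p ; 1F _ → refl }
        ; y-nbhd = nbhd 1F 0F λ { 0F _ → refl ; 1F p → contradiction refl p } }
      f′ : Cells zero b → Fin n
      f′ (inj₂ (k , i)) = f (inj₂ (suc k , i))
      away : ∀ k i j → f (inj₂ (suc k , i)) ≢ v j
      away k i j eq = case injective _ _ eq of λ ()
      F′ : Fits (S - v 0F - v 1F) (cells zero b) f′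
      F′ = record
        { inside-S = λ { (inj₂ (k , i)) → ∈-remove⁺ (∈-remove⁺ (inside-S _) (away k i 0F)) (away k i 1F) }
        ; onto = λ u u∈ → back u u∈ (onto u (∈-remove⁻ (∈-remove⁻ u∈)))
        ; injective = λ { (inj₂ _) (inj₂ _) eq → case injective _ _ eq of λ { refl → refl } }
        ; preserves = λ { (inj₂ _) (inj₂ _) (p , e) → preserves _ _ (cong suc p , e) }
        ; reflects = λ { (inj₂ (k , i)) (inj₂ (l , j)) e → let (p , q) = reflects (inj₂ (suc k , i)) (inj₂ (suc l , j)) e in Fin.suc-injective p , q } }
        where
        back : ∀ u → u ∈ S - v 0F - v 1F → (∃ λ w → f w ≡ u) → ∃ λ w → f′ w ≡ u
        back u u∈ (inj₂ (0F , 0F) , eq) = contradiction (sym eq) (remove-≢ (∈-remove⁻ u∈))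
        back u u∈ (inj₂ (0F , 1F) , eq) = contradiction (sym eq) (remove-≢ u∈)
        back u u∈ (inj₂ (suc k , i) , eq) = inj₂ (k , i) , eq
    fits⇒clusters {S} (suc a) b {f} F q₃ q₂ = triangle comp (q₃ 0F) (fits⇒clusters a b F′ (q₃ ∘ suc) q₂)
      where
      open Fits F
      v : Fin 3 → Fin n
      v i = f (inj₁ (0F , i))
      nbhd : ∀ i j k → (∀ l → i ≢ l → l ≡ j ⊎ l ≡ k) → Nbhd⊆ S (v i) (v j ∷ v k ∷ [])
      nbhd i j k other u u∈ e with onto u u∈
      ... | inj₂ w , refl = ⊥-elim (reflects (inj₁ (0F , i)) (inj₂ w) e)
      ... | inj₁ (t , l) , refl with reflects (inj₁ (0F , i)) (inj₁ (t , l)) e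
      ...   | refl , i≢l , _ = [ (λ eq → here (cong v eq)) , (λ eq → there (here (cong v eq))) ]′ (other l i≢l)
      comp : TriangleComponent S (v 0F) (v 1F) (v 2F)
      comp = record { x∈ = inside-S _ ; y∈ = inside-S _ ; z∈ = inside-S _
        ; x~y = preserves _ _ (refl , (λ ()) , inj₁ tt) ; x~z = preserves _ _ (refl , (λ ()) , inj₁ tt) ; y~z = preserves _ _ (refl , (λ ()) , inj₁ tt)
        ; x-nbhd = nbhd 0F 1F 2F λ { 0F p → contradiction refl p ; 1F _ → inj₁ refl ; 2F _ → inj₂ refl }
        ; y-nbhd = nbhd 1F 0F 2F λ { 0F _ → inj₁ refl ; 1F p → contradiction refl p ; 2F _ → inj₂ refl }
        ; z-nbhd = nbhd 2F 0F 1F λ { 0F _ → inj₁ refl ; 1F _ → inj₂ refl ; 2F p → contradiction refl p } }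
      lift : Cells a b → Cells (suc a) b
      lift (inj₁ (k , i)) = inj₁ (suc k , i)
      lift (inj₂ w)       = inj₂ w
      away : ∀ w j → f (lift w) ≢ v j
      away (inj₁ _) j eq = case injective _ _ eq of λ ()
      away (inj₂ _) j eq = case injective _ _ eq of λ ()
      lift-injective : ∀ w w′ → lift w ≡ lift w′ → w ≡ w′
      lift-injective (inj₁ _) (inj₁ _) refl = refl
      lift-injective (inj₂ _) (inj₂ _) refl = refl
      lift-preserves : ∀ w w′ → Graph._~_ (cells a b) w w′ → Graph._~_ (cells (suc a) b) (lift w) (lift w′)
      lift-preserves (inj₁ _) (inj₁ _) (p , e) = cong suc p , e
      lift-preserves (inj₂ _) (inj₂ _) e = e
      lift-reflects : ∀ w w′ → Graph._~_ (cells (suc a) b) (lift w) (lift w′) → Graph._~_ (cells a b) w w′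
      lift-reflects (inj₁ _) (inj₁ _) (p , e) = Fin.suc-injective p , e
      lift-reflects (inj₂ _) (inj₂ _) e = e
      F′ : Fits (S - v 0F - v 1F - v 2F) (cells a b) (f ∘ lift)
      F′ = record
        { inside-S = λ w → ∈-remove⁺ (∈-remove⁺ (∈-remove⁺ (inside-S _) (away w 0F)) (away w 1F)) (away w 2F)
        ; onto = λ u u∈ → back u u∈ (onto u (∈-remove⁻ (∈-remove⁻ (∈-remove⁻ u∈))))
        ; injective = λ w w′ eq → lift-injective w w′ (injective _ _ eq)
        ; preserves = λ w w′ e → preserves _ _ (lift-preserves w w′ e)
        ; reflects = λ w w′ e → lift-reflects w w′ (reflects _ _ e) }
        where
        back : ∀ u → u ∈ S - v 0F - v 1F - v 2F → (∃ λ w → f w ≡ u) → ∃ λ w → f (lift w) ≡ u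
        back u u∈ (inj₁ (0F , 0F) , eq) = contradiction (sym eq) (remove-≢ (∈-remove⁻ (∈-remove⁻ u∈)))
        back u u∈ (inj₁ (0F , 1F) , eq) = contradiction (sym eq) (remove-≢ (∈-remove⁻ u∈))
        back u u∈ (inj₁ (0F , 2F) , eq) = contradiction (sym eq) (remove-≢ u∈)
        back u u∈ (inj₁ (suc k , i) , eq) = inj₁ (k , i) , eq
        back u u∈ (inj₂ w , eq) = inj₂ w , eq

  -- The cell vertices joined to the hub in K[1+_]*⟨_∙K₃⊎_∙K₂⟩.
  Joined : ∀ {a b} → Cells a b → Set
  Joined (inj₁ (_ , i)) = i ≡ 0F
  Joined (inj₂ (_ , i)) = i ≡ 0F

  spokes-joined : ∀ {h T a b} (cs : Spokes h T a b) w → (Joined w → h ~ place cs w) × (h ~ place cs w → Joined w)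
  spokes-joined cs (inj₁ (k , 0F)) = (λ _ → proj₁ (place-Q₃ cs k)) , λ _ → refl
  spokes-joined cs (inj₁ (k , 1F)) = (λ ()) , λ e → contradiction e (proj₁ (proj₂ (place-Q₃ cs k)))
  spokes-joined cs (inj₁ (k , 2F)) = (λ ()) , λ e → contradiction e (proj₂ (proj₂ (place-Q₃ cs k)))
  spokes-joined cs (inj₂ (k , 0F)) = (λ _ → proj₁ (place-Q₂ cs k)) , λ _ → refl
  spokes-joined cs (inj₂ (k , 1F)) = (λ ()) , λ e → contradiction e (proj₂ (place-Q₂ cs k))

  module _ {S : Subset n} {a b : ℕ} where

    place₁ : ∀ {h} → Spokes h (S - h) a b → Fin 1 ⊎ Cells a b → Fin n
    place₁ {h} cs (inj₁ _) = h
    place₁     cs (inj₂ w) = place cs w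

    spokes⇒fits₁ : ∀ {h} → h ∈ S → (cs : Spokes h (S - h) a b) → Fits S K[1+ 0 ]*⟨ a ∙K₃⊎ b ∙K₂⟩ (place₁ cs)
    spokes⇒fits₁ {h} h∈ cs = record
      { inside-S = λ { (inj₁ 0F) → h∈ ; (inj₂ w) → ∈-remove⁻ (place-∈ cs w) }
      ; onto = λ v v∈ → from v v∈ (v Fin.≟ h)
      ; injective = λ
          { (inj₁ 0F) (inj₁ 0F) _ → refl ; (inj₁ 0F) (inj₂ w) eq → contradiction (sym eq) (remove-≢ (place-∈ cs w))
          ; (inj₂ w) (inj₁ 0F) eq → contradiction eq (remove-≢ (place-∈ cs w)) ; (inj₂ v) (inj₂ w) eq → cong inj₂ (place-injective cs v w eq) }
      ; preserves = pres
      ; reflects = refl′ }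
      where
      module K = Graph K[1+ 0 ]*⟨ a ∙K₃⊎ b ∙K₂⟩
      from : ∀ v → v ∈ S → Dec (v ≡ h) → ∃ λ w → place₁ cs w ≡ v
      from v v∈ (yes eq) = inj₁ 0F , sym eq
      from v v∈ (no v≢h) = let (w , eq) = place-onto cs v (∈-remove⁺ v∈ v≢h) in inj₂ w , eq
      pres : ∀ v w → v K.~ w → place₁ cs v ~ place₁ cs w
      pres (inj₁ 0F) (inj₁ 0F) (p , _) = contradiction refl p
      pres (inj₁ 0F) (inj₂ w@(inj₁ _)) (_ , j) = proj₁ (spokes-joined cs w) j
      pres (inj₁ 0F) (inj₂ w@(inj₂ _)) (_ , j) = proj₁ (spokes-joined cs w) j
      pres (inj₂ w@(inj₁ _)) (inj₁ 0F) (_ , j) = ~-sym (proj₁ (spokes-joined cs w) j)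
      pres (inj₂ w@(inj₂ _)) (inj₁ 0F) (_ , j) = ~-sym (proj₁ (spokes-joined cs w) j)
      pres (inj₂ v) (inj₂ w) e = place-preserves cs v w e
      refl′ : ∀ v w → place₁ cs v ~ place₁ cs w → v K.~ w
      refl′ (inj₁ 0F) (inj₁ 0F) e = contradiction e (~-irrefl refl)
      refl′ (inj₁ 0F) (inj₂ w@(inj₁ _)) e = refl , proj₂ (spokes-joined cs w) e
      refl′ (inj₁ 0F) (inj₂ w@(inj₂ _)) e = refl , proj₂ (spokes-joined cs w) e
      refl′ (inj₂ w@(inj₁ _)) (inj₁ 0F) e = refl , proj₂ (spokes-joined cs w) (~-sym e)
      refl′ (inj₂ w@(inj₂ _)) (inj₁ 0F) e = refl , proj₂ (spokes-joined cs w) (~-sym e)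
      refl′ (inj₂ v) (inj₂ w) e = place-reflects cs v w e

    place₃ : ∀ {h p q} → Spokes h (S - h - p - q) a b → Fin 3 ⊎ Cells a b → Fin n
    place₃ {h} {p} {q} cs (inj₁ i) = lookup (h ∷ p ∷ q ∷ []) i
    place₃             cs (inj₂ w) = place cs w

    spokes⇒fits₃ : ∀ {h p q} → h ∈ S → EdgeComponent (S - h) p q → h ~ p → h ~ q → (cs : Spokes h (S - h - p - q) a b) →
      Fits S K[1+ 2 ]*⟨ a ∙K₃⊎ b ∙K₂⟩ (place₃ cs)
    spokes⇒fits₃ {h} {p} {q} h∈ comp h~p h~q cs = record
      { inside-S = λ { (inj₁ i) → root-∈ i ; (inj₂ w) → ∈-remove⁻ (∈-remove⁻ (∈-remove⁻ (place-∈ cs w))) }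
      ; onto = λ v v∈ → from v v∈ (v Fin.≟ h) (v Fin.≟ p) (v Fin.≟ q)
      ; injective = λ
          { (inj₁ i) (inj₁ j) eq → cong inj₁ (root-injective i j eq)
          ; (inj₁ i) (inj₂ w) eq → contradiction (sym eq) (triangle-rest-≢′ (place-∈ cs w) i)
          ; (inj₂ w) (inj₁ i) eq → contradiction eq (triangle-rest-≢′ (place-∈ cs w) i)
          ; (inj₂ v) (inj₂ w) eq → cong inj₂ (place-injective cs v w eq) }
      ; preserves = pres
      ; reflects = refl′ }
      where
      open EdgeComponent comp
      module K = Graph K[1+ 2 ]*⟨ a ∙K₃⊎ b ∙K₂⟩
      vs = h ∷ p ∷ q ∷ []
      root-∈ : ∀ i → lookup vs i ∈ S
      root-∈ 0F = h∈
      root-∈ 1F = ∈-remove⁻ x∈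
      root-∈ 2F = ∈-remove⁻ y∈
      root-~ : ∀ i j → i ≢ j → lookup vs i ~ lookup vs j
      root-~ 0F 0F i≢j = contradiction refl i≢j
      root-~ 0F 1F _ = h~p
      root-~ 0F 2F _ = h~q
      root-~ 1F 0F _ = ~-sym h~p
      root-~ 1F 1F i≢j = contradiction refl i≢j
      root-~ 1F 2F _ = x~y
      root-~ 2F 0F _ = ~-sym h~q
      root-~ 2F 1F _ = ~-sym x~y
      root-~ 2F 2F i≢j = contradiction refl i≢j
      root-injective : ∀ i j → lookup vs i ≡ lookup vs j → i ≡ j
      root-injective i j eq with i Fin.≟ j
      ... | yes i≡j = i≡j
      ... | no i≢j  = contradiction eq (~⇒≢ (root-~ i j i≢j))
      triangle-rest-≢′ : ∀ {v} → v ∈ S - h - p - q → ∀ i → v ≢ lookup vs i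
      triangle-rest-≢′ v∈ 0F = remove-≢ (∈-remove⁻ (∈-remove⁻ v∈))
      triangle-rest-≢′ v∈ 1F = remove-≢ (∈-remove⁻ v∈)
      triangle-rest-≢′ v∈ 2F = remove-≢ v∈
      from : ∀ v → v ∈ S → Dec (v ≡ h) → Dec (v ≡ p) → Dec (v ≡ q) → ∃ λ w → place₃ cs w ≡ v
      from v v∈ (yes eq) _ _ = inj₁ 0F , sym eq
      from v v∈ _ (yes eq) _ = inj₁ 1F , sym eq
      from v v∈ _ _ (yes eq) = inj₁ 2F , sym eq
      from v v∈ (no ≢h) (no ≢p) (no ≢q) = let (w , eq) = place-onto cs v (∈-remove⁺ (∈-remove⁺ (∈-remove⁺ v∈ ≢h) ≢p) ≢q) in inj₂ w , eq
      detached : ∀ i w → i ≢ 0F → ¬ lookup vs i ~ place cs w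
      detached 0F w i≢0 _ = i≢0 refl
      detached 1F w _ e = remove-≢ (place-∈ cs w) (nbhd₁ x-nbhd (∈-remove⁻ (∈-remove⁻ (place-∈ cs w))) e)
      detached 2F w _ e = remove-≢ (∈-remove⁻ (place-∈ cs w)) (nbhd₁ y-nbhd (∈-remove⁻ (∈-remove⁻ (place-∈ cs w))) e)
      hub-edge⁺ : ∀ i w → i ≡ 0F → Joined w → lookup vs i ~ place cs w
      hub-edge⁺ _ w refl j = proj₁ (spokes-joined cs w) j
      hub-edge⁻ : ∀ i w → lookup vs i ~ place cs w → i ≡ 0F × Joined w
      hub-edge⁻ 0F w e = refl , proj₂ (spokes-joined cs w) e
      hub-edge⁻ 1F w e = contradiction e (detached 1F w λ ())
      hub-edge⁻ 2F w e = contradiction e (detached 2F w λ ())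
      pres : ∀ v w → v K.~ w → place₃ cs v ~ place₃ cs w
      pres (inj₁ i) (inj₁ j) (i≢j , _) = root-~ i j i≢j
      pres (inj₁ i) (inj₂ w@(inj₁ _)) (e , j) = hub-edge⁺ i w e j
      pres (inj₁ i) (inj₂ w@(inj₂ _)) (e , j) = hub-edge⁺ i w e j
      pres (inj₂ w@(inj₁ _)) (inj₁ i) (e , j) = ~-sym (hub-edge⁺ i w e j)
      pres (inj₂ w@(inj₂ _)) (inj₁ i) (e , j) = ~-sym (hub-edge⁺ i w e j)
      pres (inj₂ v) (inj₂ w) e = place-preserves cs v w e
      refl′ : ∀ v w → place₃ cs v ~ place₃ cs w → v K.~ w
      refl′ (inj₁ i) (inj₁ j) e = (λ { refl → ~-irrefl refl e }) , inj₁ tt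
      refl′ (inj₁ i) (inj₂ w@(inj₁ _)) e = hub-edge⁻ i w e
      refl′ (inj₁ i) (inj₂ w@(inj₂ _)) e = hub-edge⁻ i w e
      refl′ (inj₂ w@(inj₁ _)) (inj₁ i) e = hub-edge⁻ i w (~-sym e)
      refl′ (inj₂ w@(inj₂ _)) (inj₁ i) e = hub-edge⁻ i w (~-sym e)
      refl′ (inj₂ v) (inj₂ w) e = place-reflects cs v w e

  module _ {S : Subset n} {a b k : ℕ} {f : Fin (suc k) ⊎ Cells a b → Fin n} (F : Fits S K[1+ k ]*⟨ a ∙K₃⊎ b ∙K₂⟩ f) where
    open Fits F
    private
      h : Fin n
      h = f (inj₁ 0F)

    fits⇒spokes : ∀ {T} → T ⊆ S → (∀ w → f (inj₂ w) ∈ T) → (∀ i → f (inj₁ i) ∉ T) → Spokes h T a b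
    fits⇒spokes {T} sub ins out = fits⇒clusters a b F′ (λ k → joined (inj₁ (k , 0F)) refl , unjoined (inj₁ (k , 1F)) (λ ()) , unjoined (inj₁ (k , 2F)) λ ())
      λ k → joined (inj₂ (k , 0F)) refl , unjoined (inj₂ (k , 1F)) λ ()
      where
      joined : ∀ w → Joined w → h ~ f (inj₂ w)
      joined (inj₁ _) j = preserves (inj₁ 0F) _ (refl , j)
      joined (inj₂ _) j = preserves (inj₁ 0F) _ (refl , j)
      unjoined : ∀ w → ¬ Joined w → ¬ h ~ f (inj₂ w)
      unjoined w@(inj₁ _) ¬j e = ¬j (proj₂ (reflects (inj₁ 0F) (inj₂ w) e))
      unjoined w@(inj₂ _) ¬j e = ¬j (proj₂ (reflects (inj₁ 0F) (inj₂ w) e))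
      F′ : Fits T (cells a b) (f ∘ inj₂)
      F′ = record { inside-S = ins
        ; onto = λ v v∈ → back v v∈ (onto v (sub v∈))
        ; injective = λ v w eq → case injective _ _ eq of λ { refl → refl }
        ; preserves = λ v w → preserves (inj₂ v) (inj₂ w) ; reflects = λ v w → reflects (inj₂ v) (inj₂ w) }
        where
        back : ∀ v → v ∈ T → (∃ λ w → f w ≡ v) → ∃ λ w → f (inj₂ w) ≡ v
        back v v∈ (inj₁ i , refl) = contradiction v∈ (out i)
        back v v∈ (inj₂ w , eq)   = w , eq

  size-full : ∣ full {n} ∣ ≡ n
  size-full = ∣⊤∣≡n n

  -- Images of maximal independent sets are maximal independent sets. This supplies the lower bound
  -- for the sporadic graphs; the matching upper bound comes from the induction.
  fits-mis-≤ : ∀ {k} {H : Graph (Fin k)} {f} → Fits full H f → m H ≤ m G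
  fits-mis-≤ {k} {H} {f} F = subst (m H ≤_) mis≡m (count-injection (maximalIndependent? H) (MIS? full) (subsets k) (subsets n)
    (subsets-unique k) (subsets-complete n) image ok inj)
    where
    open Fits F
    module H = Graph H
    image? : ∀ J → U.Decidable (λ v → ∃ λ i → i ∈ J × f i ≡ v)
    image? J v = any? λ i → (i ∈? J) ×-dec (f i Fin.≟ v)
    image : Subset k → Subset n
    image J = comprehension (image? J)
    image⁻ : ∀ {J v} → v ∈ image J → ∃ λ i → i ∈ J × f i ≡ v
    image⁻ {J} = ∈-comprehension⁻ (image? J)
    image⁺ : ∀ {J i} → i ∈ J → f i ∈ image J
    image⁺ {J} {i} i∈ = ∈-comprehension⁺ (image? J) (i , i∈ , refl)
    pull : ∀ {J i} → f i ∈ image J → i ∈ J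
    pull {J} m = let (j , j∈ , eq) = image⁻ m in subst (_∈ J) (injective _ _ eq) j∈
    inj : ∀ {I J} → MaximalIndependent H I → MaximalIndependent H J → image I ≡ image J → I ≡ J
    inj _ _ eq = ⊆-antisym (λ {i} i∈ → pull (subst (f i ∈_) eq (image⁺ i∈))) (λ {i} i∈ → pull (subst (f i ∈_) (sym eq) (image⁺ i∈)))
    ok : ∀ {J} → MaximalIndependent H J → MIS full (image J)
    ok {J} (ind , maximal) = (λ _ → ∈⊤) , ind′ , dom
      where
      ind′ : Independent G (image J)
      ind′ u v u∈ v∈ e with image⁻ u∈ | image⁻ v∈
      ... | i , i∈ , refl | j , j∈ , refl = ind i j i∈ j∈ (reflects i j e)
      dom : Dominating full (image J)
      dom v _ v∉ with onto v ∈⊤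
      ... | i , refl with any? (λ j → (j ∈? J) ×-dec (j H.~? i))
      ...   | yes (j , j∈ , e) = f j , image⁺ j∈ , preserves j i e
      ...   | no ¬j = ⊥-elim (maximal (J ∪ ⁅ i ⁆ , (x∈p∪q⁺ ∘ inj₁ , i , v∈I∪⁅v⁆ , λ i∈ → v∉ (image⁺ i∈)) ,
                        independent-insert H ind (λ j j∈ e → ¬j (j , j∈ , e))))

  iso-mis-≤ : ∀ {k} {H : Graph (Fin k)} → G ≅ H → m H ≤ m G
  iso-mis-≤ {H = H} iso = fits-mis-≤ {H = H} (proj₂ (≅⇒fits iso))

  cells-mis-≥ : ∀ {a b} → G ≅ cells a b → 3 ^ a * 2 ^ b ≤ m G
  cells-mis-≥ {a} {b} iso = subst (3 ^ a * 2 ^ b ≤_) mis≡m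
    (clusters-mis-≥ (fits⇒clusters {Q₃ = λ _ _ _ → ⊤} {Q₂ = λ _ _ → ⊤} a b (proj₂ (≅⇒fits iso)) (λ _ → tt) (λ _ → tt)))

  clustered⇒≅ : ∀ {a b} → Clustered full a b → G ≅ cells a b
  clustered⇒≅ cl = fits⇒≅ (clusters⇒fits cl)

  forget : ∀ {Q₃ Q₂ S a b} → Clusters Q₃ Q₂ S a b → Clustered S a b
  forget (empty e)         = empty e
  forget (triangle c _ cs) = triangle c tt (forget cs)
  forget (edge c _ cs)     = edge c tt (forget cs)

  -- Deleting the hub leaves a copies of K₃ and b of K₂, and deleting a vertex never increases the
  -- count.
  hub₁-mis-≥ : ∀ {a b} → G ≅ K[1+ 0 ]*⟨ a ∙K₃⊎ b ∙K₂⟩ → 3 ^ a * 2 ^ b ≤ m G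
  hub₁-mis-≥ iso with ≅⇒fits iso
  ... | f , F = ≤-trans (clusters-mis-≥ (fits⇒spokes F {T = full - h} ∈-remove⁻
      (λ w → ∈-remove⁺ ∈⊤ λ eq → case injective _ _ eq of λ ()) λ { 0F → ∉-remove {S = full} }))
      (≤-trans (mis-remove-≤ full h ∈⊤) (≤-reflexive mis≡m))
    where
    open Fits F
    h = f (inj₁ 0F)

  -- The root triangle leaves the component p, q in G - h, and every maximal independent set of G -
  -- h contains p or q, hence a neighbour of h. So it stays maximal in G, and both terms of the
  -- branching at h are attained.
  hub₃-mis-≥ : ∀ {a b} → G ≅ K[1+ 2 ]*⟨ a ∙K₃⊎ b ∙K₂⟩ → 3 ^ a * 2 ^ suc b + 2 ^ a ≤ m G
  hub₃-mis-≥ {a} {b} iso with ≅⇒fits iso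
  ... | f , F = ≤-trans (+-mono-≤ (clusters-mis-≥ (edge comp tt (forget cs)))
      (spokes-mis-≥ cs λ v v∈ h≁v → ∈-⊖⁺ ∈⊤ (remove-≢ (∈-remove⁻ (∈-remove⁻ v∈))) h≁v))
      (≤-trans (mis-branch-≥ full h ∈⊤ hit) (≤-reflexive mis≡m))
    where
    open Fits F
    h = f (inj₁ 0F)
    p = f (inj₁ 1F)
    q = f (inj₁ 2F)
    root-~ : ∀ i j → i ≢ j → f (inj₁ i) ~ f (inj₁ j)
    root-~ i j i≢j = preserves (inj₁ i) (inj₁ j) (i≢j , inj₁ tt)
    root-≢ : ∀ i j → i ≢ j → f (inj₁ i) ≢ f (inj₁ j)
    root-≢ i j i≢j = ~⇒≢ (root-~ i j i≢j)
    cell-≢ : ∀ w i → f (inj₂ w) ≢ f (inj₁ i)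
    cell-≢ w i eq = case injective _ _ eq of λ ()
    nbhd : ∀ i j → i ≢ 0F → (∀ k → i ≢ k → k ≡ 0F ⊎ k ≡ j) → Nbhd⊆ (full - h) (f (inj₁ i)) (f (inj₁ j) ∷ [])
    nbhd i j i≢0 other u u∈ e with onto u ∈⊤
    ... | inj₂ w@(inj₁ _) , refl = contradiction (proj₁ (reflects (inj₁ i) (inj₂ w) e)) i≢0
    ... | inj₂ w@(inj₂ _) , refl = contradiction (proj₁ (reflects (inj₁ i) (inj₂ w) e)) i≢0
    ... | inj₁ k , refl with other k (λ { refl → ~-irrefl refl e })
    ...   | inj₁ refl = contradiction refl (remove-≢ u∈)
    ...   | inj₂ refl = here refl
    comp : EdgeComponent (full - h) p q
    comp = record { x∈ = ∈-remove⁺ ∈⊤ (root-≢ 1F 0F λ ()) ; y∈ = ∈-remove⁺ ∈⊤ (root-≢ 2F 0F λ ()) ; x~y = root-~ 1F 2F λ ()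
      ; x-nbhd = nbhd 1F 2F (λ ()) λ { 0F _ → inj₁ refl ; 1F ne → contradiction refl ne ; 2F _ → inj₂ refl }
      ; y-nbhd = nbhd 2F 1F (λ ()) λ { 0F _ → inj₁ refl ; 1F _ → inj₂ refl ; 2F ne → contradiction refl ne } }
    cs : Spokes h (full - h - p - q) a b
    cs = fits⇒spokes F (λ _ → ∈⊤) (λ w → ∈-remove⁺ (∈-remove⁺ (∈-remove⁺ ∈⊤ (cell-≢ w 0F)) (cell-≢ w 1F)) (cell-≢ w 2F)) λ
      { 0F m → remove-≢ (∈-remove⁻ (∈-remove⁻ m)) refl ; 1F m → remove-≢ (∈-remove⁻ m) refl ; 2F m → remove-≢ m refl }
    hit : ∀ I → MIS (full - h) I → ∃ λ u → u ∈ I × u ~ h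
    hit I (I⊆ , _ , dom) with p ∈? I
    ... | yes p∈ = p , p∈ , root-~ 1F 0F λ ()
    ... | no p∉ with dom p (EdgeComponent.x∈ comp) p∉
    ...   | u , u∈ , u~p with EdgeComponent.x-nbhd comp u (I⊆ u∈) (~-sym u~p)
    ...     | here refl = q , u∈ , root-~ 2F 0F λ ()

  -- Cases of equality

  Equality : ℕ → Set → Set
  Equality M Q = m G ≤ M × (m G ≡ M ⇔ Q)

  equality : ∀ {M Q} → m G ≤ M → (m G ≡ M → Q) → (Q → M ≤ m G) → Equality M Q
  equality le to from = le , mk⇔ to (λ q → ℕ.≤-antisym le (from q))

  private
    clustered-case : ∀ {a b} r i → Clustered full a b → a ≤ r → n ≡ 3 * r + 2 * i → m G ≤ 3 ^ r * 2 ^ i × (m G ≡ 3 ^ r * 2 ^ i → G ≅ cells r i)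
    clustered-case {a} {b} r i cl a≤r n≡ = ≤-trans upper (proj₁ cmp) , λ eq →
      let (p , q) = proj₂ cmp (subst (_≤ 3 ^ a * 2 ^ b) eq upper) in subst₂ (λ a b → G ≅ cells a b) p q (clustered⇒≅ cl)
      where
      upper : m G ≤ 3 ^ a * 2 ^ b
      upper = subst (_≤ 3 ^ a * 2 ^ b) mis≡m (clusters-mis cl)
      cmp = exchange-≤ {a} {b} {r} {i} a≤r (trans (sym (clusters-size cl)) (trans size-full n≡))

    below⇒ : ∀ {M} {Q : Set} → m G < M → m G ≤ M × (m G ≡ M → Q)
    below⇒ lt = ℕ.<⇒≤ lt , λ eq → ⊥-elim (ℕ.<⇒≢ lt eq)

  all-even : ∀ r i → n ≡ 3 * r + 2 * i → cyc full ≤ r → Equality (3 ^ r * 2 ^ i) (G ≅ cells r i)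
  all-even r i n≡ cyc≤ = let (le , to) = main (proj₂ (classify full)) in equality le to cells-mis-≥
    where
    open +-*-Solver
    X = 3 ^ r * 2 ^ i
    main : IsClustered full ⊎ HasRate bad full → m G ≤ X × (m G ≡ X → G ≅ cells r i)
    main (inj₁ (_ , _ , cl)) = clustered-case r i cl (≤-trans (clusters-cyc cl) cyc≤) n≡
    main (inj₂ b) = below⇒ (ℕ.*-cancelˡ-< 9 _ _ (begin-strict
      9 * m G             ≡⟨ cong (9 *_) (sym mis≡m) ⟩
      9 * mis full        ≤⟨ unscale (bad ev) r i (Bounded.at b ev r (2 * r + i) cyc≤ (≤-reflexive (trans (cong (_+ r) (trans size-full n≡))
                               (solve 2 (λ r i → con 3 :* r :+ con 2 :* i :+ r := con 2 :* (con 2 :* r :+ i)) refl r i)))) ⟩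
      8 * X + 0           ≡⟨ ℕ.+-identityʳ _ ⟩
      8 * X               <⟨ ℕ.*-monoˡ-< X {{>-nonZero (ℕ.*-mono-≤ (1≤^ 2 r) (1≤^ 1 i))}} (ℕ.n<1+n 8) ⟩
      9 * X               ∎))
      where open ≤-Reasoning

  all-odd : ∀ r i → suc n ≡ 3 * suc r + 2 * i → cyc full ≤ suc r → Equality (3 ^ r * 2 ^ suc i) (G ≅ cells r (suc i))
  all-odd r i n≡ cyc≤ = let (le , to) = main (proj₂ (classify full)) in equality le to cells-mis-≥
    where
    open +-*-Solver
    X = 3 ^ r * 2 ^ suc i
    n≡′ : n ≡ 3 * r + 2 * suc i
    n≡′ = ℕ.suc-injective (trans n≡ (solve 2 (λ r i → con 3 :* (con 1 :+ r) :+ con 2 :* i := con 1 :+ (con 3 :* r :+ con 2 :* (con 1 :+ i))) refl r i))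
    main : IsClustered full ⊎ HasRate bad full → m G ≤ X × (m G ≡ X → G ≅ cells r (suc i))
    main (inj₁ (a , b , cl)) = clustered-case r (suc i) cl (ℕ.≤-pred (ℕ.≤∧≢⇒< (≤-trans (clusters-cyc cl) cyc≤) a≢)) n≡′
      where
      -- With r + 1 triangles an odd number of vertices would be left for the components K₂.
      a≢ : a ≢ suc r
      a≢ refl = even≢odd i b (ℕ.+-cancelˡ-≡ (3 * suc r) _ _ (trans (sym n≡)
        (trans (cong suc (trans (sym size-full) (clusters-size cl))) (solve 2 (λ x b → con 1 :+ (x :+ con 2 :* b) := x :+ (con 1 :+ con 2 :* b)) refl (3 * suc r) b))))
    main (inj₂ b) = below⇒ (ℕ.*-cancelˡ-< 18 _ _ (begin-strict
      18 * m G                              ≡⟨ trans (cong (18 *_) (sym mis≡m)) (solve 1 (λ x → con 18 :* x := con 9 :* (con 2 :* x)) refl (mis full)) ⟩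
      9 * (2 * mis full)                    ≤⟨ unscale (bad od) (suc r) i doubled ⟩
      11 * (3 ^ suc r * 2 ^ i) + 0          ≡⟨ solve 2 (λ x y → con 11 :* (con 3 :* x :* y) :+ con 0 := con 33 :* (x :* y)) refl (3 ^ r) (2 ^ i) ⟩
      33 * (3 ^ r * 2 ^ i)                  <⟨ ℕ.*-monoˡ-< (3 ^ r * 2 ^ i) {{>-nonZero (ℕ.*-mono-≤ (1≤^ 2 r) (1≤^ 1 i))}} (ℕ.m≤m+n 34 2) ⟩
      36 * (3 ^ r * 2 ^ i)                  ≡⟨ solve 2 (λ x y → con 36 :* (x :* y) := con 18 :* (x :* (con 2 :* y))) refl (3 ^ r) (2 ^ i) ⟩
      18 * X                                ∎))
      where
      open ≤-Reasoning
      half : ℕ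
      half = 2 * r + 1 + i
      size≤ : ∣ full {n} ∣ + suc r ≡ 1 + 2 * half
      size≤ = trans (cong (_+ suc r) (trans size-full n≡′))
        (solve 2 (λ r i → con 3 :* r :+ con 2 :* (con 1 :+ i) :+ (con 1 :+ r) := con 1 :+ con 2 :* (con 2 :* r :+ con 1 :+ i)) refl r i)
      -- The exponent `half` is 2(r+1) + i - 1, one less than the form required by `unscale`; this
      -- includes n = 3(r+1) - 1, where i = 0. Doubling the count raises the exponent by one.
      doubled : Bound (bad od) (2 * mis full) (suc r) (2 * suc r + i)
      doubled with Bounded.at b od (suc r) half cyc≤ (≤-reflexive size≤)
      ... | isBound le = isBound (begin
        9 * (4 ^ suc r * (2 * mis full))       ≡⟨ solve 2 (λ f M → con 9 :* (f :* (con 2 :* M)) := con 2 :* (con 9 :* (f :* M))) refl (4 ^ suc r) (mis full) ⟩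
        2 * (9 * (4 ^ suc r * mis full))       ≤⟨ ℕ.*-monoʳ-≤ 2 le ⟩
        2 * (11 * (3 ^ suc r * 2 ^ half) + 0)  ≡⟨ solve 2 (λ t p → con 2 :* (con 11 :* (t :* p) :+ con 0) := con 11 :* (t :* (con 2 :* p)) :+ con 0) refl (3 ^ suc r) (2 ^ half) ⟩
        11 * (3 ^ suc r * 2 ^ suc half) + 0    ≡⟨ cong (λ k → 11 * (3 ^ suc r * 2 ^ k) + 0)
                                                    (solve 2 (λ r i → con 1 :+ (con 2 :* r :+ con 1 :+ i) := con 2 :* (con 1 :+ r) :+ i) refl r i) ⟩
        11 * (3 ^ suc r * 2 ^ (2 * suc r + i)) + 0 ∎)

  Exceptional : ℕ → Set
  Exceptional r = (n ≡ 4 × r ≡ 1 × (G ≅ P 4)) ⊎ (n ≡ 5 × r ≡ 1 × (G ≅ C 5)) ⊎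
    (n ≡ 7 × r ≡ 2 × ((G ≅ K[1+ 2 ]*⟨ 0 ∙K₃⊎ 2 ∙K₂⟩) ⊎ (G ≅ E)))

  private
    r≡1 : ∀ {r k} → 1 ≤ r → 3 * r ≤ k → k < 6 → r ≡ 1
    r≡1 {suc zero} _ _ _ = refl
    r≡1 {suc (suc r)} _ 3r≤ k<6 = contradiction (≤-trans (ℕ.*-monoʳ-≤ 3 (s≤s (s≤s (z≤n {r})))) 3r≤) (ℕ.<⇒≱ k<6)

  module Extremal (conn : ConnectedIn full) where

    module Classify {h a b} (cl : Clustered (full - h) a b) where
      open Hub conn ∈⊤ cl

      pair-closes : ∀ {p q} → p ∈ full - h → q ∈ full - h → p ~ q → h ~ p → h ~ q → Closes full h (p , q)
      pair-closes p∈ q∈ e f g = ~⇒≢ e , f , g , reach-edge p∈ q∈ e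

      cyc-by-pairs : ∀ {ps} → All (Closes full h) ps → AllPairs Apart ps → length ps + a ≤ cyc full
      cyc-by-pairs {ps} cls ap = ≤-trans (ℕ.+-monoʳ-≤ (length ps) (clusters-cyc cl)) (cyc-pairs ps id ∈⊤ cls ap)

      -- An edge of G - h with both ends joined to h would close one more cycle in addition to the a
      -- triangles.
      spokes-only : cyc full ≤ a → Spokes h (full - h) a b
      spokes-only cyc≤ with spokes? cl attached
      ... | inj₁ sp = sp
      ... | inj₂ (p , q , p∈ , q∈ , e , f , g) =
        contradiction (≤-trans (cyc-by-pairs (pair-closes p∈ q∈ e f g ∷ []) ([] ∷ [])) cyc≤) (ℕ.n≮n a)

      attached-rest : ∀ {p q} → EdgeComponent (full - h) p q → ∀ v → v ∈ full - h - p - q → ∃ λ w → w ∈ full - h - p - q × h ~ w × (v ≡ w ⊎ v ~ w)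
      attached-rest comp v v∈ with attached v (∈-remove⁻ (∈-remove⁻ v∈))
      ... | w , w∈ , e , inj₁ refl = w , v∈ , e , inj₁ refl
      ... | w , w∈ , e , inj₂ f = w , edge-away comp (∈-remove⁻ (∈-remove⁻ v∈)) (remove-≢ (∈-remove⁻ v∈)) (remove-≢ v∈) w∈ f , e , inj₂ f

      disjoint-pair : ∀ {p q s t} → s ∈ full - h - p - q → t ∈ full - h - p - q → Apart (p , q) (s , t)
      disjoint-pair s∈ t∈ = inj₁ (remove-≢ (∈-remove⁻ s∈) ∘ sym , remove-≢ (∈-remove⁻ t∈) ∘ sym)

      -- Besides the a triangles of G - h there is room for one cycle only, and the saturated
      -- component uses it up. So that component is an edge, since a fully joined K₃ closes three
      -- cycles with h, and every other component is attached by a single vertex.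
      one-double : cyc full ≤ suc a → ∃ (Saturated full h) →
        ∃₂ λ p q → ∃ λ b′ → b ≡ suc b′ × EdgeComponent (full - h) p q × h ~ p × h ~ q × Spokes h (full - h - p - q) a b′
      one-double cyc≤ (y , y∈ , h~y , sat) with clusters-neighbour cl y y∈
      ... | z , z∈ , y~z = build (clusters-remove-edge cl comp)
        where
        closes-yz = pair-closes y∈ z∈ y~z h~y (sat z z∈ y~z)
        too-many : ∀ {s t} → Closes full h (s , t) → Apart (y , z) (s , t) → ⊥
        too-many c ap = ℕ.n≮n _ (≤-trans (cyc-by-pairs (closes-yz ∷ c ∷ []) ((ap ∷ []) ∷ [] ∷ [])) cyc≤)
        y-nbhd : Nbhd⊆ (full - h) y (z ∷ [])
        y-nbhd t t∈ e with t Fin.≟ z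
        ... | yes eq = here eq
        ... | no t≢z = ⊥-elim (too-many (pair-closes y∈ t∈ e h~y (sat t t∈ e)) (inj₂ (~⇒≢ y~z ∘ sym , t≢z ∘ sym)))
        z-nbhd : Nbhd⊆ (full - h) z (y ∷ [])
        z-nbhd t t∈ e with clusters-clique cl z∈ y∈ t∈ (~-sym y~z) e
        ... | inj₁ eq = here (sym eq)
        ... | inj₂ y~t with nbhd₁ y-nbhd t∈ y~t
        ...   | refl = ⊥-elim (~-irrefl refl e)
        comp : EdgeComponent (full - h) y z
        comp = record { x∈ = y∈ ; y∈ = z∈ ; x~y = y~z ; x-nbhd = y-nbhd ; y-nbhd = z-nbhd }
        build : (∃ λ b′ → b ≡ suc b′ × Clustered (full - h - y - z) a b′) → _
        build (b′ , eq , cl′) with spokes? cl′ (attached-rest comp)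
        ... | inj₁ sp = y , z , b′ , eq , comp , h~y , sat z z∈ y~z , sp
        ... | inj₂ (p , q , p∈ , q∈ , e , f , g) =
          ⊥-elim (too-many (pair-closes (∈-remove⁻ (∈-remove⁻ p∈)) (∈-remove⁻ (∈-remove⁻ q∈)) e f g) (disjoint-pair p∈ q∈))

    clustered-edges : ∀ {T b} → Clustered T 0 b → ∀ {p q} → p ∈ T → p ~ q → q ∈ T → Nbhd⊆ T p (q ∷ [])
    clustered-edges (empty none) p∈ _ _ = contradiction p∈ (none _)
    clustered-edges (edge {x = x} {y} c _ cs) {p} {q} p∈ e q∈ with p Fin.≟ x | p Fin.≟ y
    ... | no ≢x | no ≢y = λ u u∈ f → clustered-edges cs (∈-remove⁺ (∈-remove⁺ p∈ ≢x) ≢y) e (edge-away c p∈ ≢x ≢y q∈ e) u (edge-away c p∈ ≢x ≢y u∈ f) f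
    ... | yes refl | _ with EdgeComponent.x-nbhd c q q∈ e
    ...   | here refl = EdgeComponent.x-nbhd c
    clustered-edges (edge {x = x} {y} c _ cs) {p} {q} p∈ e q∈ | no _ | yes refl with EdgeComponent.y-nbhd c q q∈ e
    ...   | here refl = EdgeComponent.y-nbhd c

    clustered-edge : ∀ {T b} → Clustered T 0 b → ∀ {p q} → p ∈ T → p ~ q → q ∈ T → EdgeComponent T p q
    clustered-edge cl p∈ e q∈ = record { x∈ = p∈ ; y∈ = q∈ ; x~y = e ; x-nbhd = clustered-edges cl p∈ e q∈ ; y-nbhd = clustered-edges cl q∈ (~-sym e) p∈ }

    fits-E : ∀ {h p q p′ q′} → EdgeComponent (full - h) p q → EdgeComponent (full - h - p - q) p′ q′ → h ~ p → h ~ q → h ~ p′ → h ~ q′ →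
      Spokes h (full - h - p - q - p′ - q′) 0 1 → G ≅ E
    fits-E {h} {p} {q} {p′} {q′} c c′ h~p h~q h~p′ h~q′ (edge {x = x} {y} d (h~x , h≁y) (empty none)) =
      fits⇒≅ (fits E (lookup vs) (λ _ → ∈⊤) (λ v _ → sur v)
        ((h~p , h~q , h~p′ , h~q′ , h~x , (h≢ (in-h y∈) , h≁y) , tt) ,
         (x~y , from-p p′∈ , from-p q′∈ , from-p x∈₂ , from-p y∈₂ , tt) ,
         (from-q p′∈ , from-q q′∈ , from-q x∈₂ , from-q y∈₂ , tt) ,
         (C′.x~y , from-p′ x∈ , from-p′ y∈ , tt) , (from-q′ x∈ , from-q′ y∈ , tt) , (D.x~y , tt) , tt , tt))
      where
      open EdgeComponent c using (x~y)
      module C′ = EdgeComponent c′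
      module D = EdgeComponent d
      p′∈ = C′.x∈
      q′∈ = C′.y∈
      x∈ = D.x∈
      y∈ = D.y∈
      x∈₂ = ∈-remove⁻ (∈-remove⁻ x∈)
      y∈₂ = ∈-remove⁻ (∈-remove⁻ y∈)
      in-h : ∀ {v} → v ∈ full - h - p - q - p′ - q′ → v ∈ full - h
      in-h = ∈-remove⁻ ∘ ∈-remove⁻ ∘ ∈-remove⁻ ∘ ∈-remove⁻
      h≢ : ∀ {v} → v ∈ full - h → h ≢ v
      h≢ v∈ eq = remove-≢ v∈ (sym eq)
      apart : ∀ {T : Subset n} {s t v} → EdgeComponent T s t → v ∈ T - s - t → Related s v false × Related t v false
      apart e v∈ =
        ((λ { refl → remove-≢ (∈-remove⁻ v∈) refl }) , λ f → remove-≢ v∈ (nbhd₁ (EdgeComponent.x-nbhd e) (∈-remove⁻ (∈-remove⁻ v∈)) f)) ,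
        ((λ { refl → remove-≢ v∈ refl }) , λ f → remove-≢ (∈-remove⁻ v∈) (nbhd₁ (EdgeComponent.y-nbhd e) (∈-remove⁻ (∈-remove⁻ v∈)) f))
      from-p : ∀ {v} → v ∈ full - h - p - q → Related p v false
      from-p v∈ = proj₁ (apart c v∈)
      from-q : ∀ {v} → v ∈ full - h - p - q → Related q v false
      from-q v∈ = proj₂ (apart c v∈)
      from-p′ : ∀ {v} → v ∈ full - h - p - q - p′ - q′ → Related p′ v false
      from-p′ v∈ = proj₁ (apart c′ v∈)
      from-q′ : ∀ {v} → v ∈ full - h - p - q - p′ - q′ → Related q′ v false
      from-q′ v∈ = proj₂ (apart c′ v∈)
      vs = h ∷ p ∷ q ∷ p′ ∷ q′ ∷ x ∷ y ∷ []
      sur : ∀ v → ∃ λ i → lookup vs i ≡ v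
      sur v = ∈-toList⁻ vs (decidable-stable (v ∈ₗ? Vec.toList vs) λ v∉ →
        let off : ∀ {z} → z ∈ₗ Vec.toList vs → v ≢ z
            off z∈ eq = v∉ (subst (_∈ₗ Vec.toList vs) (sym eq) z∈)
        in none v (∈-remove⁺ (∈-remove⁺ (∈-remove⁺ (∈-remove⁺ (∈-remove⁺ (∈-remove⁺ (∈-remove⁺ ∈⊤ (off (∈-lookup 0F)))
          (off (∈-lookup 1F))) (off (∈-lookup 2F))) (off (∈-lookup 3F))) (off (∈-lookup 4F))) (off (∈-lookup 5F))) (off (∈-lookup 6F))))

    -- Three edges at h, of which at most two are attached by both ends.
    three-edges : ∀ {h} → Clustered (full - h) 0 3 → cyc full ≤ 2 → ∃ (Saturated full h) → (G ≅ K[1+ 2 ]*⟨ 0 ∙K₃⊎ 2 ∙K₂⟩) ⊎ (G ≅ E)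
    three-edges {h} cl cyc≤ (y , y∈ , h~y , sat) with clusters-neighbour cl y y∈
    ... | z , z∈ , y~z = first (clusters-remove-edge cl comp)
      where
      open Classify cl
      comp = clustered-edge cl y∈ y~z z∈
      h~z = sat z z∈ y~z
      first : (∃ λ b′ → 3 ≡ suc b′ × Clustered (full - h - y - z) 0 b′) → (G ≅ K[1+ 2 ]*⟨ 0 ∙K₃⊎ 2 ∙K₂⟩) ⊎ (G ≅ E)
      first (_ , refl , cl′) with spokes? cl′ (attached-rest comp)
      ... | inj₁ sp = inj₁ (fits⇒≅ (spokes⇒fits₃ ∈⊤ comp h~y h~z sp))
      ... | inj₂ (p , q , p∈ , q∈ , e , f , g) = inj₂ (second (clusters-remove-edge cl′ comp′))
        where
        comp′ = clustered-edge cl′ p∈ e q∈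
        att : ∀ v → v ∈ full - h - y - z - p - q → ∃ λ w → w ∈ full - h - y - z - p - q × h ~ w × (v ≡ w ⊎ v ~ w)
        att v v∈ with attached-rest comp v (∈-remove⁻ (∈-remove⁻ v∈))
        ... | w , w∈ , k , inj₁ refl = w , v∈ , k , inj₁ refl
        ... | w , w∈ , k , inj₂ l = w , edge-away comp′ (∈-remove⁻ (∈-remove⁻ v∈)) (remove-≢ (∈-remove⁻ v∈)) (remove-≢ v∈) w∈ l , k , inj₂ l
        second : (∃ λ b′ → 2 ≡ suc b′ × Clustered (full - h - y - z - p - q) 0 b′) → G ≅ E
        second (_ , refl , cl″) with spokes? cl″ att
        ... | inj₁ sp = fits-E comp comp′ h~y h~z f g sp
        ... | inj₂ (s , t , s∈ , t∈ , k , l , o) = contradiction (≤-trans (cyc-by-pairs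
                (pair-closes y∈ z∈ y~z h~y h~z ∷ pair-closes (down p∈) (down q∈) e f g ∷ pair-closes (down (down′ s∈)) (down (down′ t∈)) k l o ∷ [])
                ((disjoint-pair p∈ q∈ ∷ disjoint-pair (down′ s∈) (down′ t∈) ∷ []) ∷
                  (inj₁ (remove-≢ (∈-remove⁻ s∈) ∘ sym , remove-≢ (∈-remove⁻ t∈) ∘ sym) ∷ []) ∷ [] ∷ [])) cyc≤) λ { (s≤s (s≤s ())) }
          where
          down : ∀ {v} → v ∈ full - h - y - z → v ∈ full - h
          down = ∈-remove⁻ ∘ ∈-remove⁻
          down′ : ∀ {v} → v ∈ full - h - y - z - p - q → v ∈ full - h - y - z
          down′ = ∈-remove⁻ ∘ ∈-remove⁻

    module Main {r} (1≤r : 1 ≤ r) (3r≤n : 3 * r ≤ n) (cyc≤ : cyc full ≤ r) where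

      private
        3≤n : 3 ≤ n
        3≤n = ≤-trans (ℕ.*-monoʳ-≤ 3 1≤r) 3r≤n
        nonempty : 1 ≤ ∣ full {n} ∣
        nonempty = ≤-trans (s≤s z≤n) (≤-trans 3≤n (≤-reflexive (sym size-full)))
        not-two : ∣ full {n} ∣ ≢ 2
        not-two = 3≤⇒≢2 (≤-trans 3≤n (≤-reflexive (sym size-full)))

        budget : ∀ {p h} → n + r ≡ val p + 2 * h → Budget false p r h full
        budget eq = record { cyc≤ = cyc≤ ; size≡ = trans (cong (_+ r) size-full) eq ; regime = inj₂ (≤-trans 3r≤n (≤-reflexive (sym size-full))) }

        path-case : ∀ {f} → Fits full (P 4) f → Exceptional r
        path-case F = inj₁ (n≡4 , r≡1 1≤r 3r≤n (≤-trans (s≤s (≤-reflexive n≡4)) (ℕ.n≤1+n 5)) , fits⇒≅ F)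
          where n≡4 = trans (sym size-full) (fits-size F)

        cycle-case : ∀ {f} → Fits full (C 5) f → Exceptional r
        cycle-case F = inj₂ (inj₁ (n≡5 , r≡1 1≤r 3r≤n (s≤s (≤-reflexive n≡5)) , fits⇒≅ F))
          where n≡5 = trans (sym size-full) (fits-size F)

      -- An unsaturated hub misses the term 2^r′. For a saturated one m is at most 3^a 2^b + 2^a;
      -- two triangles less cost a factor 8/9, so equality forces a = r′. Then one cycle is left for
      -- the hub, and `one-double` determines the graph.
      connected-even : ∀ r′ i → r ≡ suc r′ → n ≡ 3 * r + 2 * i →
        m G ≤ 3 ^ r′ * 2 ^ suc i + 2 ^ r′ × (m G ≡ 3 ^ r′ * 2 ^ suc i + 2 ^ r′ → (G ≅ K[1+ 2 ]*⟨ r′ ∙K₃⊎ i ∙K₂⟩) ⊎ Exceptional r)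
      connected-even r′ i refl n≡ = main (claim full conn nonempty not-two initial)
        where
        open +-*-Solver
        M = 3 ^ r′ * 2 ^ suc i + 2 ^ r′
        initial : Budget false ev r (2 * r + i) full
        initial = budget (trans (cong (_+ r) n≡) (solve 2 (λ r i → con 3 :* r :+ con 2 :* i :+ r := con 2 :* (con 2 :* r :+ i)) refl r i))
        target : 4 * (3 ^ r * 2 ^ i) + 3 * 2 ^ r ≡ 6 * M
        target = solve 3 (λ t p q → con 4 :* (con 3 :* t :* p) :+ con 3 :* (con 2 :* q) := con 6 :* (t :* (con 2 :* p) :+ q)) refl (3 ^ r′) (2 ^ i) (2 ^ r′)
        bound-M : Special full → m G ≤ M
        bound-M s = ℕ.*-cancelˡ-≤ 6 (≤-trans (≤-reflexive (cong (6 *_) (sym mis≡m)))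
          (≤-trans (unscale (connected false ev) r i (special-rate conn s false ev r (2 * r + i) initial)) (≤-reflexive target)))
        hub-case : ∀ {h a b} → Clustered (full - h) a b → m G ≡ M → (G ≅ K[1+ 2 ]*⟨ r′ ∙K₃⊎ i ∙K₂⟩) ⊎ Exceptional r
        hub-case {h} {a} {b} cl eq = go (saturated? full h)
          where
          open Hub conn ∈⊤ cl
          open Classify cl
          sizes : 1 + (3 * a + 2 * b) ≡ 3 * r + 2 * i
          sizes = trans (sym size) (trans size-full n≡)
          a≢r : a ≢ r
          a≢r refl = even≢odd i b (sym (ℕ.+-cancelˡ-≡ (3 * r) _ _ (trans (solve 2 (λ x b → x :+ (con 1 :+ con 2 :* b) := con 1 :+ (x :+ con 2 :* b)) refl (3 * r) b) sizes)))
          a≤r′ : a ≤ r′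
          a≤r′ = ℕ.≤-pred (ℕ.≤∧≢⇒< (≤-trans (≤-trans (clusters-cyc cl) (cyc-mono ∈-remove⁻)) cyc≤) a≢r)
          cmp = exchange-≤ {a} {b} {r′} {suc i} a≤r′ (ℕ.suc-injective (trans sizes
            (solve 2 (λ r i → con 3 :* (con 1 :+ r) :+ con 2 :* i := con 1 :+ (con 3 :* r :+ con 2 :* (con 1 :+ i))) refl r′ i)))
          go : Dec (∃ (Saturated full h)) → (G ≅ K[1+ 2 ]*⟨ r′ ∙K₃⊎ i ∙K₂⟩) ⊎ Exceptional r
          go (no ¬sat) = contradiction eq (ℕ.<⇒≢ (begin-strict
            m G                      ≡⟨ sym mis≡m ⟩
            mis full                 ≤⟨ unsaturated ¬sat ⟩
            mis (full - h)           ≤⟨ clusters-mis cl ⟩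
            3 ^ a * 2 ^ b            ≤⟨ proj₁ cmp ⟩
            3 ^ r′ * 2 ^ suc i       ≡⟨ sym (ℕ.+-identityʳ _) ⟩
            3 ^ r′ * 2 ^ suc i + 0   <⟨ ℕ.+-monoʳ-< (3 ^ r′ * 2 ^ suc i) (1≤^ 1 r′) ⟩
            M                        ∎))
            where open ≤-Reasoning
          go (yes sat) = inj₁ (build (one-double (subst (λ k → cyc full ≤ suc k) (sym a≡r′) cyc≤) sat))
            where
            upper : M ≤ 3 ^ a * 2 ^ b + 2 ^ a
            upper = ≤-trans (≤-reflexive (trans (sym eq) (sym mis≡m))) (≤-trans (mis-branch full h) (+-mono-≤ (clusters-mis cl) mis-⊖))
            lead-≤ : 3 ^ r′ * 2 ^ suc i ≤ 3 ^ a * 2 ^ b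
            lead-≤ = ℕ.+-cancelʳ-≤ (2 ^ r′) _ _ (≤-trans upper (ℕ.+-monoʳ-≤ (3 ^ a * 2 ^ b) (ℕ.^-monoʳ-≤ 2 a≤r′)))
            a≡r′ = proj₁ (proj₂ cmp lead-≤)
            b≡ = proj₂ (proj₂ cmp lead-≤)
            build : (∃₂ λ p q → ∃ λ b′ → b ≡ suc b′ × EdgeComponent (full - h) p q × h ~ p × h ~ q × Spokes h (full - h - p - q) a b′) →
              G ≅ K[1+ 2 ]*⟨ r′ ∙K₃⊎ i ∙K₂⟩
            build (p , q , b′ , b≡′ , comp , f , g , sp) = fits⇒≅ (spokes⇒fits₃ ∈⊤ comp f g
              (subst₂ (Spokes h (full - h - p - q)) a≡r′ (ℕ.suc-injective (trans (sym b≡′) b≡)) sp))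
        main : Outcome false ev r (2 * r + i) full → m G ≤ M × (m G ≡ M → (G ≅ K[1+ 2 ]*⟨ r′ ∙K₃⊎ i ∙K₂⟩) ⊎ Exceptional r)
        main (strict lt) = below⇒ (ℕ.*-cancelˡ-< 6 _ _ (ℕ.≤-<-trans (≤-reflexive (cong (6 *_) (sym mis≡m)))
          (ℕ.<-≤-trans (unscale< (connected false ev) r i lt) (≤-reflexive target))))
        main (special s@(path₄ F))  = bound-M s , λ _ → inj₂ (path-case F)
        main (special s@(cycle₅ F)) = bound-M s , λ _ → inj₂ (cycle-case F)
        main (special s@(hub _ (_ , _ , cl))) = bound-M s , hub-case cl

      -- An unsaturated hub attains the bound only with a = r, and then no cycle is left for it. A
      -- saturated hub costs a cycle, so r = a + 2d with d ≥ 1. Then the single extra term 2^a must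
      -- make up for the factor (8/9)^d, which happens only for 9 = 8 + 1: no triangle, three edges,
      -- n = 7 and r = 2.
      connected-odd : ∀ i → n ≡ 1 + (3 * r + 2 * i) →
        m G ≤ 3 ^ r * 2 ^ i × (m G ≡ 3 ^ r * 2 ^ i → (G ≅ K[1+ 0 ]*⟨ r ∙K₃⊎ i ∙K₂⟩) ⊎ Exceptional r)
      connected-odd i n≡ = main (claim full conn nonempty not-two initial)
        where
        open +-*-Solver
        M = 3 ^ r * 2 ^ i
        initial : Budget false od r (2 * r + i) full
        initial = budget (trans (cong (_+ r) n≡) (solve 2 (λ r i → con 1 :+ (con 3 :* r :+ con 2 :* i) :+ r := con 1 :+ con 2 :* (con 2 :* r :+ i)) refl r i))
        target : 1 * M + 0 ≡ 1 * M
        target = ℕ.+-identityʳ _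
        bound-M : Special full → m G ≤ M
        bound-M s = ℕ.*-cancelˡ-≤ 1 (≤-trans (≤-reflexive (cong (1 *_) (sym mis≡m)))
          (≤-trans (unscale (connected false od) r i (special-rate conn s false od r (2 * r + i) initial)) (≤-reflexive target)))
        hub-case : ∀ {h a b} → Clustered (full - h) a b → m G ≡ M → (G ≅ K[1+ 0 ]*⟨ r ∙K₃⊎ i ∙K₂⟩) ⊎ Exceptional r
        hub-case {h} {a} {b} cl eq = go (saturated? full h)
          where
          open Hub conn ∈⊤ cl
          open Classify cl
          sizes : 3 * a + 2 * b ≡ 3 * r + 2 * i
          sizes = ℕ.suc-injective (trans (sym size) (trans size-full n≡))
          a≤r : a ≤ r
          a≤r = ≤-trans (≤-trans (clusters-cyc cl) (cyc-mono ∈-remove⁻)) cyc≤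
          cmp = exchange-≤ {a} {b} {r} {i} a≤r sizes
          go : Dec (∃ (Saturated full h)) → (G ≅ K[1+ 0 ]*⟨ r ∙K₃⊎ i ∙K₂⟩) ⊎ Exceptional r
          go (no ¬sat) = inj₁ (fits⇒≅ (spokes⇒fits₁ ∈⊤ (subst₂ (Spokes h (full - h)) a≡r b≡i (spokes-only (subst (cyc full ≤_) (sym a≡r) cyc≤)))))
            where
            lead-≤ : M ≤ 3 ^ a * 2 ^ b
            lead-≤ = ≤-trans (≤-reflexive (trans (sym eq) (sym mis≡m))) (≤-trans (unsaturated ¬sat) (clusters-mis cl))
            a≡r = proj₁ (proj₂ cmp lead-≤)
            b≡i = proj₂ (proj₂ cmp lead-≤)
          go (yes sat) = inj₂ (inj₂ (inj₂ (small (exchange {a} {b} {r} {i} a≤r sizes) upper)))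
            where
            upper : 3 ^ r * 2 ^ i ≤ 3 ^ a * 2 ^ b + 2 ^ a
            upper = ≤-trans (≤-reflexive (trans (sym eq) (sym mis≡m))) (≤-trans (mis-branch full h) (+-mono-≤ (clusters-mis cl) mis-⊖))
            small : (∃ λ d → r ≡ a + 2 * d × b ≡ i + 3 * d) → 3 ^ r * 2 ^ i ≤ 3 ^ a * 2 ^ b + 2 ^ a →
              n ≡ 7 × r ≡ 2 × ((G ≅ K[1+ 2 ]*⟨ 0 ∙K₃⊎ 2 ∙K₂⟩) ⊎ (G ≅ E))
            small (zero , r≡ , _) _ = contradiction (≤-trans (saturated-cyc sat) cyc≤) (ℕ.<⇒≱ (s≤s (≤-reflexive (trans r≡ (ℕ.+-identityʳ a)))))
            small (suc d , r≡ , b≡) le =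
              let (a≡0 , i≡0 , d≡0) = tight-exchange a i d (subst₂ (λ r b → 3 ^ r * 2 ^ i ≤ 3 ^ a * 2 ^ b + 2 ^ a) r≡ b≡ le)
                  r≡2 = trans r≡ (cong₂ (λ a d → a + 2 * suc d) a≡0 d≡0)
                  b≡3 = trans b≡ (cong₂ (λ i d → i + 3 * suc d) i≡0 d≡0)
              in trans n≡ (cong₂ (λ r i → 1 + (3 * r + 2 * i)) r≡2 i≡0) , r≡2 ,
                 three-edges (subst₂ (Clustered (full - h)) a≡0 b≡3 cl) (subst (cyc full ≤_) r≡2 cyc≤) sat
        main : Outcome false od r (2 * r + i) full → m G ≤ M × (m G ≡ M → (G ≅ K[1+ 0 ]*⟨ r ∙K₃⊎ i ∙K₂⟩) ⊎ Exceptional r)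
        main (strict lt) = below⇒ (ℕ.*-cancelˡ-< 1 _ _ (ℕ.≤-<-trans (≤-reflexive (cong (1 *_) (sym mis≡m)))
          (ℕ.<-≤-trans (unscale< (connected false od) r i lt) (≤-reflexive target))))
        main (special s@(path₄ F))  = bound-M s , λ _ → inj₂ (path-case F)
        main (special s@(cycle₅ F)) = bound-M s , λ _ → inj₂ (cycle-case F)
        main (special s@(hub _ (_ , _ , cl))) = bound-M s , hub-case cl

-- The two cases of the parity of n - r

connected-in : ∀ {n} (G : Graph (Fin n)) → Connected G → ConnectedIn G full
connected-in G conn a b _ _ = from-star (conn a b)
  where
  from-star : ∀ {a b} → Star (Graph._~_ G) a b → Reach G full a b
  from-star ε        = stop ∈⊤
  from-star (e ◅ es) = step ∈⊤ e (from-star es)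

halved : ∀ x i {n} → n ≡ x + 2 * i → (n ∸ x) / 2 ≡ i
halved x i refl = trans (cong (_/ 2) (trans (ℕ.m+n∸m≡n x (2 * i)) (ℕ.*-comm 2 i))) (m*n/n≡m i 2)

same-parity : ∀ n r → n % 2 ≡ r % 2 → ∃ λ k → n + r ≡ 2 * k
same-parity n r eq = r % 2 + n / 2 + r / 2 , (begin
  n + r                                          ≡⟨ cong₂ _+_ (m≡m%n+[m/n]*n n 2) (m≡m%n+[m/n]*n r 2) ⟩
  n % 2 + n / 2 * 2 + (r % 2 + r / 2 * 2)        ≡⟨ cong (λ x → x + n / 2 * 2 + (r % 2 + r / 2 * 2)) eq ⟩
  r % 2 + n / 2 * 2 + (r % 2 + r / 2 * 2)        ≡⟨ solve 3 (λ x y z → x :+ y :* con 2 :+ (x :+ z :* con 2) := con 2 :* (x :+ y :+ z)) refl (r % 2) (n / 2) (r / 2) ⟩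
  2 * (r % 2 + n / 2 + r / 2)                    ∎)
  where
  open ≡-Reasoning
  open +-*-Solver

even-% : ∀ {n} r i → n ≡ 3 * r + 2 * i → n % 2 ≡ r % 2
even-% r i refl = trans
  (cong (_% 2) (solve 2 (λ r i → con 3 :* r :+ con 2 :* i := r :+ (r :+ i) :* con 2) refl r i)) ([m+kn]%n≡m%n r (r + i) 2)
  where open +-*-Solver

odd-% : ∀ {n} r i → suc n ≡ 3 * r + 2 * i → n % 2 ≢ r % 2
odd-% {n} r i eq same = let (k , sum) = same-parity n r same in
  even≢odd (2 * r + i) k (trans (solve 2 (λ r i → con 2 :* (con 2 :* r :+ i) := con 3 :* r :+ con 2 :* i :+ r) refl r i)
    (trans (cong (_+ r) (sym eq)) (cong suc sum)))
  where open +-*-Solver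

module _ {n : ℕ} (r i : ℕ) (n≡ : n ≡ 3 * r + 2 * i) where

  private
    n+2≡ : n + 2 ≡ 3 * r + 2 * suc i
    n+2≡ = trans (cong (_+ 2) n≡) (solve 2 (λ x i → x :+ con 2 :* i :+ con 2 := x :+ con 2 :* (con 1 :+ i)) refl (3 * r) i)
      where open +-*-Solver

  g-even : g n r ≡ 3 ^ r * 2 ^ i
  g-even with n % 2 ℕ.≟ r % 2
  ... | yes _ = cong (λ j → 3 ^ r * 2 ^ j) (halved (3 * r) i n≡)
  ... | no ≢ = contradiction (even-% r i n≡) ≢

  G-even : G⟨ n , r ⟩ ≡ (_ , cells r i)
  G-even with n % 2 ℕ.≟ r % 2
  ... | yes _ = cong (λ j → _ , cells r j) (halved (3 * r) i n≡)
  ... | no ≢ = contradiction (even-% r i n≡) ≢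

  c-even : c n r ≡ 3 ^ (r ∸ 1) * 2 ^ suc i + 2 ^ (r ∸ 1)
  c-even with n % 2 ℕ.≟ r % 2
  ... | yes _ = cong (λ j → 3 ^ (r ∸ 1) * 2 ^ j + 2 ^ (r ∸ 1)) (halved (3 * r) (suc i) n+2≡)
  ... | no ≢ = contradiction (even-% r i n≡) ≢

  C-even : C⟨ n , r ⟩ ≡ (_ , K[1+ 2 ]*⟨ r ∸ 1 ∙K₃⊎ i ∙K₂⟩)
  C-even with n % 2 ℕ.≟ r % 2
  ... | yes _ = cong (λ j → _ , K[1+ 2 ]*⟨ r ∸ 1 ∙K₃⊎ j ∙K₂⟩) (halved (3 * r) i n≡)
  ... | no ≢ = contradiction (even-% r i n≡) ≢

module _ {n : ℕ} (r i : ℕ) (n≡ : suc n ≡ 3 * r + 2 * i) where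

  private
    n+3≡ : n + 3 ≡ 3 * r + 2 * suc i
    n+3≡ = trans (ℕ.+-suc n 2) (trans (cong (_+ 2) n≡) (solve 2 (λ x i → x :+ con 2 :* i :+ con 2 := x :+ con 2 :* (con 1 :+ i)) refl (3 * r) i))
      where open +-*-Solver

  g-odd : g n r ≡ 3 ^ (r ∸ 1) * 2 ^ suc i
  g-odd with n % 2 ℕ.≟ r % 2
  ... | yes eq = contradiction eq (odd-% r i n≡)
  ... | no _ = cong (λ j → 3 ^ (r ∸ 1) * 2 ^ j) (halved (3 * r) (suc i) n+3≡)

  G-odd : G⟨ n , r ⟩ ≡ (_ , cells (r ∸ 1) (suc i))
  G-odd with n % 2 ℕ.≟ r % 2
  ... | yes eq = contradiction eq (odd-% r i n≡)
  ... | no _ = cong (λ j → _ , cells (r ∸ 1) j) (halved (3 * r) (suc i) n+3≡)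

module _ {n : ℕ} (r i : ℕ) (n≡ : n ≡ 1 + (3 * r + 2 * i)) where

  private
    half : (n ∸ 3 * r ∸ 1) / 2 ≡ i
    half = trans (cong (_/ 2) (ℕ.∸-+-assoc n (3 * r) 1))
      (halved (3 * r + 1) i (trans n≡ (solve 2 (λ x i → con 1 :+ (x :+ con 2 :* i) := x :+ con 1 :+ con 2 :* i) refl (3 * r) i)))
      where open +-*-Solver
    suc-n≡ : suc n ≡ 3 * r + 2 * suc i
    suc-n≡ = trans (cong suc n≡) (solve 2 (λ x i → con 1 :+ (con 1 :+ (x :+ con 2 :* i)) := x :+ con 2 :* (con 1 :+ i)) refl (3 * r) i)
      where open +-*-Solver

  c-odd : c n r ≡ 3 ^ r * 2 ^ i
  c-odd with n % 2 ℕ.≟ r % 2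
  ... | yes eq = contradiction eq (odd-% r (suc i) suc-n≡)
  ... | no _ = cong (λ j → 3 ^ r * 2 ^ j) half

  C-odd : C⟨ n , r ⟩ ≡ (_ , K[1+ 0 ]*⟨ r ∙K₃⊎ i ∙K₂⟩)
  C-odd with n % 2 ℕ.≟ r % 2
  ... | yes eq = contradiction eq (odd-% r (suc i) suc-n≡)
  ... | no _ = cong (λ j → _ , K[1+ 0 ]*⟨ r ∙K₃⊎ j ∙K₂⟩) half

-- Obtained by evaluating `mis`, whose test is domination; evaluating `m` would search all subsets
-- for a larger independent one.
m-E : m E ≡ 9
m-E = sym (mis≡m E)

-- By evaluation the values c(4,1) = 3, c(5,1) = 5 and c(7,2) = 9 agree with the counts for the
-- sporadic graphs.
exceptional-mis-≥ : ∀ {n r} (G : Graph (Fin n)) → Exceptional G r → c n r ≤ m G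
exceptional-mis-≥ G (inj₁ (refl , refl , iso))               = iso-mis-≤ G {H = P 4} iso
exceptional-mis-≥ G (inj₂ (inj₁ (refl , refl , iso)))        = iso-mis-≤ G {H = C 5} iso
exceptional-mis-≥ G (inj₂ (inj₂ (refl , refl , inj₁ iso)))   = hub₃-mis-≥ G iso
exceptional-mis-≥ G (inj₂ (inj₂ (refl , refl , inj₂ iso)))   = subst (_≤ m G) m-E (iso-mis-≤ G {H = E} iso)

theorem3p1 : (n r : ℕ) → r ≥ 1 → (G : Graph (Fin n)) → numCycles G ≤ r →
    (n ≥ 3 * r ∸ 1 →
    m G ≤ g n r × ((m G ≡ g n r) ⇔ (G ≅ proj₂ G⟨ n , r ⟩)))
    ×
    (n ≥ 3 * r → Connected G →
    m G ≤ c n r ×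
    ((m G ≡ c n r) ⇔
    ( (G ≅ proj₂ C⟨ n , r ⟩)
    ⊎ (n ≡ 4 × r ≡ 1 × (G ≅ P 4))
    ⊎ (n ≡ 5 × r ≡ 1 × (G ≅ C 5))
    ⊎ (n ≡ 7 × r ≡ 2 × ((G ≅ proj₂ C⟨ 7 , 1 ⟩) ⊎ (G ≅ E))))))
theorem3p1 n r@(suc r′) r≥1 G cycles≤r =
  (λ n≥ → all (suc n ∸ 3 * r) (sym (ℕ.m+[n∸m]≡n (3r≤1+n n≥)))) ,
  λ n≥ conn → connected-case conn n≥ (n ∸ 3 * r) (sym (ℕ.m+[n∸m]≡n n≥))
  where
  cyc≤ : cyc G full ≤ r
  cyc≤ = ≤-trans (cyc-full G) cycles≤r

  3r≤1+n : 3 * r ∸ 1 ≤ n → 3 * r ≤ suc n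
  3r≤1+n le = s≤s le

  -- Here k counts from n = 3r - 1, so even k is the case in which n and r have different parity.
  all : ∀ k → suc n ≡ 3 * r + k → Equality G (g n r) (G ≅ proj₂ G⟨ n , r ⟩)
  all k eq with halve k
  ... | inj₁ (i , refl) = subst₂ (λ M X → Equality G M (G ≅ proj₂ X)) (sym (g-odd r i eq)) (sym (G-odd r i eq)) (all-odd G r′ i eq cyc≤)
  ... | inj₂ (i , refl) = subst₂ (λ M X → Equality G M (G ≅ proj₂ X)) (sym (g-even r i eq′)) (sym (G-even r i eq′)) (all-even G r i eq′ cyc≤)
    where
    eq′ : n ≡ 3 * r + 2 * i
    eq′ = ℕ.suc-injective (trans eq (ℕ.+-suc (3 * r) (2 * i)))

  connected-case : Connected G → 3 * r ≤ n → ∀ k → n ≡ 3 * r + k → Equality G (c n r) (G ≅ proj₂ C⟨ n , r ⟩ ⊎ Exceptional G r)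
  connected-case conn 3r≤n k eq with halve k
  ... | inj₁ (i , refl) = subst (λ X → Equality G (c n r) (G ≅ proj₂ X ⊎ Exceptional G r)) (sym (C-even r i eq))
    (equality G (subst (m G ≤_) (sym (c-even r i eq)) (proj₁ bound)) (λ e → proj₂ bound (trans e (c-even r i eq)))
      [ (λ iso → subst (_≤ m G) (sym (c-even r i eq)) (hub₃-mis-≥ G iso)) , exceptional-mis-≥ G ]′)
    where bound = Extremal.Main.connected-even G (connected-in G conn) r≥1 3r≤n cyc≤ r′ i refl eq
  ... | inj₂ (i , refl) = subst (λ X → Equality G (c n r) (G ≅ proj₂ X ⊎ Exceptional G r)) (sym (C-odd r i eq′))
    (equality G (subst (m G ≤_) (sym (c-odd r i eq′)) (proj₁ bound)) (λ e → proj₂ bound (trans e (c-odd r i eq′)))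
      [ (λ iso → subst (_≤ m G) (sym (c-odd r i eq′)) (hub₁-mis-≥ G iso)) , exceptional-mis-≥ G ]′)
    where
    eq′ : n ≡ 1 + (3 * r + 2 * i)
    eq′ = trans eq (ℕ.+-suc (3 * r) (2 * i))
    bound = Extremal.Main.connected-odd G (connected-in G conn) r≥1 3r≤n cyc≤ i eq′
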